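{- For each $*\in\{0,\square,\ell\}$, let $\mathcal R_*(H):=\{\mathcal E\in\mathcal S_*(H)\mid r_{\mathcal E}\ge 1\}$. Then $$\lim_{H\to\infty}\frac{\sharp\mathcal R_*(H)}{\sharp\mathcal S_*(H)}=0.$$
   Context: For polynomials $A,B,C\in\mathbb Z[X]$ with $\deg(A),\deg(B),\deg(C-X^3)\le 2$, let $\mathcal E_{A,B,C}$ denote the curve over $\mathbb Q(T)$ given by $$\mathcal E_{A,B,C}:\quad Y^2=A(X)T^2+B(X)T+C(X).$$ Collecting powers of $X$, the right-hand side is $X^3+\alpha_2(T)X^2+\alpha_4(T)X+\alpha_6(T)$ with $\alpha_i\in\mathbb Z[T]$ of degree $\le 2$. The curve is called non-singular if the discriminant of this Weierstrass equation is not the zero polynomial in $T$; then it is an elliptic curve over $\mathbb Q(T)$, its group of $\mathbb Q(T)$-rational points is finitely generated, and $r_{\mathcal E_{A,B,C}}$ denotes the rank of $\mathcal E_{A,B,C}(\mathbb Q(T))$. For $P\in\mathbb Z[X]$, $\|P\|$ is the maximum of the absolute values of the coefficients of $P$, and $\|P_1,\dots,P_n\|:=\max(\|P_1\|,\dots,\|P_n\|)$. Conditions of the form $\deg(P)\le d$ allow $P=0$. With $A,B,C\in\mathbb Z[X]$, define - $\mathcal S_0(H)$: the set of non-singular $\mathcal E_{A,B,C}$ with $A=0$, $\deg(B)\le 2$, $\deg(C-X^3)\le 2$, $\|B,C\|\le H$; - $\mathcal S_\square(H)$: the set of non-singular $\mathcal E_{A^2,B,C}$ with $\deg(A)=0$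 (so $A$ is a nonzero integer constant), $\deg(B)\le 2$, $\deg(C-X^3)\le 2$, $\|A,B,C\|\le H$; - $\mathcal S_\ell(H)$: the set of non-singular $\mathcal E_{A,B,C}$ with $\deg(A)\le1$, $\deg(B)\le1$, $\deg(C-X^3)\le 1$, $\|A,B,C\|\le H$. -}

module Defs where

open import Algebra.Bundles using (CommutativeRing; RawGroup)
open import Algebra.Apartness.Bundles using (HeytingField; HeytingCommutativeRing)
import Algebra.Definitions.RawMonoid as RawMonoidDefinitions
import Algebra.Properties.Group as GroupProperties
import Algebra.Properties.Ring as RingProperties
import Algebra.Solver.Ring.NaturalCoefficients.Default as SemiringSolver
open import Data.Empty using (⊥-elim)
open import Data.Integer.Base as ℤ using (ℤ; +_; -[1+_]; 0ℤ; 1ℤ)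
import Data.Integer.Properties as ℤ
open import Data.List.Base using (List; []; _∷_; _++_; length; map; foldr)
open import Data.List.Membership.Propositional using (_∈_)
open import Data.List.Relation.Unary.Unique.Propositional using (Unique)
open import Data.Nat.Base as ℕ using (ℕ; zero; suc; _⊔_)
open import Data.Product using (Σ-syntax; _×_; _,_; proj₁; proj₂)
open import Data.Rational.Base as ℚ using (ℚ; 0ℚ)
import Data.Rational.Properties as ℚ
open import Data.Sum.Base using (_⊎_; inj₁; inj₂)
open import Data.Vec.Base using (Vec; []; _∷_; toList)
open import Data.Vec.Functional using (Vector)
open import Function.Bundles using (_⇔_)
import Level
open import Level using (0ℓ)
open import Relation.Binary.Bundles using (Setoid)
open import Relation.Binary.Definitions using (Decidable)
import Relation.Binary.Reasoning.Setoid as SetoidReasoning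
open import Relation.Binary.PropositionalEquality as ≡ using (_≡_; _≢_)
open import Relation.Nullary using (¬_; Dec; yes; no)
open import Relation.Unary using (Pred)

-- A polynomial is its list of coefficients, constant term first; trailing
-- zeros are allowed and are ignored by the equality _≋_.

module Polynomials {c ℓ} (R : CommutativeRing c ℓ) where

  open CommutativeRing R
  open RingProperties ring using (-0#≈0#)
  open SemiringSolver commutativeSemiring using (solve; _:+_; _:=_)

  Poly : Set c
  Poly = List Carrier

  coeff : Poly → ℕ → Carrier
  coeff []      _       = 0#
  coeff (a ∷ _) zero    = a
  coeff (_ ∷ p) (suc n) = coeff p n

  infix 4 _≋_

  record _≋_ (p q : Poly) : Set ℓ where
    constructor mk≋
    field at : ∀ n → coeff p n ≈ coeff q n

  open _≋_ public

  infixl 6 _⊹_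
  infixl 7 _✶_ _·_
  infix  8 ⊟_

  _⊹_ : Poly → Poly → Poly
  []      ⊹ q       = q
  (a ∷ p) ⊹ []      = a ∷ p
  (a ∷ p) ⊹ (b ∷ q) = (a + b) ∷ (p ⊹ q)

  ⊟_ : Poly → Poly
  ⊟_ = map (λ a → - a)

  _·_ : Carrier → Poly → Poly
  a · p = map (a *_) p

  shift : Poly → Poly
  shift p = 0# ∷ p

  _✶_ : Poly → Poly → Poly
  []      ✶ q = []
  (a ∷ p) ✶ q = a · q ⊹ shift (p ✶ q)

  coeff-⊹ : ∀ p q n → coeff (p ⊹ q) n ≈ coeff p n + coeff q n
  coeff-⊹ []      q       n       = sym (+-identityˡ _)
  coeff-⊹ (a ∷ p) []      n       = sym (+-identityʳ _)
  coeff-⊹ (a ∷ p) (b ∷ q) zero    = refl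
  coeff-⊹ (a ∷ p) (b ∷ q) (suc n) = coeff-⊹ p q n

  coeff-⊟ : ∀ p n → coeff (⊟ p) n ≈ - coeff p n
  coeff-⊟ []      n       = sym -0#≈0#
  coeff-⊟ (a ∷ p) zero    = refl
  coeff-⊟ (a ∷ p) (suc n) = coeff-⊟ p n

  coeff-· : ∀ a p n → coeff (a · p) n ≈ a * coeff p n
  coeff-· a []      n       = sym (zeroʳ a)
  coeff-· a (b ∷ p) zero    = refl
  coeff-· a (b ∷ p) (suc n) = coeff-· a p n

  ≋-refl : ∀ {p} → p ≋ p
  ≋-refl = mk≋ λ _ → refl

  ≋-sym : ∀ {p q} → p ≋ q → q ≋ p
  ≋-sym e = mk≋ λ n → sym (at e n)

  ≋-trans : ∀ {p q r} → p ≋ q → q ≋ r → p ≋ r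
  ≋-trans e f = mk≋ λ n → trans (at e n) (at f n)

  ≋-setoid : Setoid c ℓ
  ≋-setoid = record
    { _≈_ = _≋_
    ; isEquivalence = record { refl = ≋-refl ; sym = ≋-sym ; trans = ≋-trans }
    }

  open SetoidReasoning ≋-setoid

  ∷-cong : ∀ {a b p q} → a ≈ b → p ≋ q → a ∷ p ≋ b ∷ q
  ∷-cong a≈b p≋q = mk≋ λ { zero → a≈b ; (suc n) → at p≋q n }

  ≋-tail : ∀ {a b p q} → a ∷ p ≋ b ∷ q → p ≋ q
  ≋-tail e = mk≋ λ n → at e (suc n)

  shift-0 : shift [] ≋ []
  shift-0 = mk≋ λ { zero → refl ; (suc n) → refl }

  ⊹-cong : ∀ {p p′ q q′} → p ≋ p′ → q ≋ q′ → p ⊹ q ≋ p′ ⊹ q′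
  ⊹-cong {p} {p′} {q} {q′} e f = mk≋ λ n →
    trans (coeff-⊹ p q n) (trans (+-cong (at e n) (at f n)) (sym (coeff-⊹ p′ q′ n)))

  ⊹-assoc : ∀ p q r → (p ⊹ q) ⊹ r ≋ p ⊹ (q ⊹ r)
  ⊹-assoc p q r = mk≋ λ n →
    trans (coeff-⊹ (p ⊹ q) r n) (trans (+-congʳ (coeff-⊹ p q n))
    (trans (+-assoc _ _ _)
    (sym (trans (coeff-⊹ p (q ⊹ r) n) (+-congˡ (coeff-⊹ q r n))))))

  ⊹-comm : ∀ p q → p ⊹ q ≋ q ⊹ p
  ⊹-comm p q = mk≋ λ n →
    trans (coeff-⊹ p q n) (trans (+-comm _ _) (sym (coeff-⊹ q p n)))

  ⊹-identityʳ : ∀ p → p ⊹ [] ≋ p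
  ⊹-identityʳ p = ⊹-comm p []

  ⊟-cong : ∀ {p q} → p ≋ q → ⊟ p ≋ ⊟ q
  ⊟-cong {p} {q} e = mk≋ λ n →
    trans (coeff-⊟ p n) (trans (-‿cong (at e n)) (sym (coeff-⊟ q n)))

  ⊟-inverseˡ : ∀ p → ⊟ p ⊹ p ≋ []
  ⊟-inverseˡ p = mk≋ λ n →
    trans (coeff-⊹ (⊟ p) p n) (trans (+-congʳ (coeff-⊟ p n)) (-‿inverseˡ _))

  ⊟-inverseʳ : ∀ p → p ⊹ ⊟ p ≋ []
  ⊟-inverseʳ p = ≋-trans (⊹-comm p (⊟ p)) (⊟-inverseˡ p)

  ⊹-swap : ∀ p q r s → (p ⊹ q) ⊹ (r ⊹ s) ≋ (p ⊹ r) ⊹ (q ⊹ s)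
  ⊹-swap p q r s = mk≋ λ n →
    trans (expand p q r s n)
    (trans (solve 4 (λ w x y z → (w :+ x) :+ (y :+ z) := (w :+ y) :+ (x :+ z)) refl _ _ _ _)
    (sym (expand p r q s n)))
    where
    expand : ∀ p q r s n →
             coeff ((p ⊹ q) ⊹ (r ⊹ s)) n ≈ (coeff p n + coeff q n) + (coeff r n + coeff s n)
    expand p q r s n = trans (coeff-⊹ (p ⊹ q) (r ⊹ s) n) (+-cong (coeff-⊹ p q n) (coeff-⊹ r s n))

  ·-cong : ∀ {a b p q} → a ≈ b → p ≋ q → a · p ≋ b · q
  ·-cong {a} {b} {p} {q} e f = mk≋ λ n →
    trans (coeff-· a p n) (trans (*-cong e (at f n)) (sym (coeff-· b q n)))

  ·-zeroˡ : ∀ p → 0# · p ≋ []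
  ·-zeroˡ p = mk≋ λ n → trans (coeff-· 0# p n) (zeroˡ _)

  ·-identityˡ : ∀ p → 1# · p ≋ p
  ·-identityˡ p = mk≋ λ n → trans (coeff-· 1# p n) (*-identityˡ _)

  ·-distribˡ : ∀ a p q → a · (p ⊹ q) ≋ a · p ⊹ a · q
  ·-distribˡ a p q = mk≋ λ n →
    trans (coeff-· a (p ⊹ q) n) (trans (*-congˡ (coeff-⊹ p q n)) (trans (distribˡ _ _ _)
    (sym (trans (coeff-⊹ (a · p) (a · q) n) (+-cong (coeff-· a p n) (coeff-· a q n))))))

  ·-distribʳ : ∀ a b p → (a + b) · p ≋ a · p ⊹ b · p
  ·-distribʳ a b p = mk≋ λ n →
    trans (coeff-· (a + b) p n) (trans (distribʳ _ _ _)
    (sym (trans (coeff-⊹ (a · p) (b · p) n) (+-cong (coeff-· a p n) (coeff-· b p n)))))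

  ·-assoc : ∀ a b p → (a * b) · p ≋ a · (b · p)
  ·-assoc a b p = mk≋ λ n →
    trans (coeff-· (a * b) p n) (trans (*-assoc _ _ _)
    (sym (trans (coeff-· a (b · p) n) (*-congˡ (coeff-· b p n)))))

  shift-cong : ∀ {p q} → p ≋ q → shift p ≋ shift q
  shift-cong = ∷-cong refl

  shift-⊹ : ∀ p q → shift (p ⊹ q) ≋ shift p ⊹ shift q
  shift-⊹ p q = ∷-cong (sym (+-identityˡ 0#)) ≋-refl

  ·-shift : ∀ a p → a · shift p ≋ shift (a · p)
  ·-shift a p = ∷-cong (zeroʳ a) ≋-refl

  ✶-congˡ : ∀ p {q q′} → q ≋ q′ → p ✶ q ≋ p ✶ q′
  ✶-congˡ []      e = ≋-refl
  ✶-congˡ (a ∷ p) e = ⊹-cong (·-cong refl e) (shift-cong (✶-congˡ p e))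

  ✶-zeroˡ : ∀ p q → p ≋ [] → p ✶ q ≋ []
  ✶-zeroˡ []      q e = ≋-refl
  ✶-zeroˡ (a ∷ p) q e = begin
    a · q ⊹ shift (p ✶ q)
      ≈⟨ ⊹-cong (·-cong (at e 0) ≋-refl) (shift-cong (✶-zeroˡ p q (mk≋ λ n → at e (suc n)))) ⟩
    0# · q ⊹ shift []  ≈⟨ ⊹-cong (·-zeroˡ q) shift-0 ⟩
    []                 ∎

  ✶-congʳ : ∀ p p′ {q} → p ≋ p′ → p ✶ q ≋ p′ ✶ q
  ✶-congʳ []      p′       {q} e = ≋-sym (✶-zeroˡ p′ q (≋-sym e))
  ✶-congʳ (a ∷ p) []       {q} e = ✶-zeroˡ (a ∷ p) q e
  ✶-congʳ (a ∷ p) (b ∷ p′) {q} e =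
    ⊹-cong (·-cong (at e 0) ≋-refl) (shift-cong (✶-congʳ p p′ (≋-tail e)))

  ✶-cong : ∀ {p p′ q q′} → p ≋ p′ → q ≋ q′ → p ✶ q ≋ p′ ✶ q′
  ✶-cong {p} {p′} e f = ≋-trans (✶-congˡ p f) (✶-congʳ p p′ e)

  ✶-distribʳ : ∀ r p q → (p ⊹ q) ✶ r ≋ p ✶ r ⊹ q ✶ r
  ✶-distribʳ r []      q       = ≋-refl
  ✶-distribʳ r (a ∷ p) []      = ≋-sym (⊹-identityʳ _)
  ✶-distribʳ r (a ∷ p) (b ∷ q) = begin
    (a + b) · r ⊹ shift ((p ⊹ q) ✶ r)
      ≈⟨ ⊹-cong (·-distribʳ a b r) (shift-cong (✶-distribʳ r p q)) ⟩
    (a · r ⊹ b · r) ⊹ shift (p ✶ r ⊹ q ✶ r)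
      ≈⟨ ⊹-cong ≋-refl (shift-⊹ (p ✶ r) (q ✶ r)) ⟩
    (a · r ⊹ b · r) ⊹ (shift (p ✶ r) ⊹ shift (q ✶ r))
      ≈⟨ ⊹-swap (a · r) (b · r) _ _ ⟩
    (a ∷ p) ✶ r ⊹ (b ∷ q) ✶ r ∎

  ✶-zeroʳ : ∀ p → p ✶ [] ≋ []
  ✶-zeroʳ []      = ≋-refl
  ✶-zeroʳ (a ∷ p) = ≋-trans (shift-cong (✶-zeroʳ p)) shift-0

  ✶-∷ : ∀ p b q → p ✶ (b ∷ q) ≋ b · p ⊹ shift (p ✶ q)
  ✶-∷ []      b q = ≋-sym shift-0
  ✶-∷ (a ∷ p) b q = ∷-cong (+-congʳ (*-comm a b)) (begin
    a · q ⊹ p ✶ (b ∷ q)              ≈⟨ ⊹-cong ≋-refl (✶-∷ p b q) ⟩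
    a · q ⊹ (b · p ⊹ shift (p ✶ q))  ≈⟨ ⊹-assoc (a · q) (b · p) _ ⟨
    a · q ⊹ b · p ⊹ shift (p ✶ q)    ≈⟨ ⊹-cong (⊹-comm (a · q) (b · p)) ≋-refl ⟩
    b · p ⊹ a · q ⊹ shift (p ✶ q)    ≈⟨ ⊹-assoc (b · p) (a · q) _ ⟩
    b · p ⊹ (a · q ⊹ shift (p ✶ q))  ∎)

  ✶-comm : ∀ p q → p ✶ q ≋ q ✶ p
  ✶-comm []      q = ≋-sym (✶-zeroʳ q)
  ✶-comm (a ∷ p) q = begin
    a · q ⊹ shift (p ✶ q)  ≈⟨ ⊹-cong ≋-refl (shift-cong (✶-comm p q)) ⟩
    a · q ⊹ shift (q ✶ p)  ≈⟨ ✶-∷ q a p ⟨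
    q ✶ (a ∷ p)            ∎

  shift-✶ : ∀ p q → shift p ✶ q ≋ shift (p ✶ q)
  shift-✶ p q = ⊹-cong (·-zeroˡ q) ≋-refl

  ·-✶ : ∀ a p q → (a · p) ✶ q ≋ a · (p ✶ q)
  ·-✶ a []      q = ≋-refl
  ·-✶ a (b ∷ p) q = begin
    (a * b) · q ⊹ shift ((a · p) ✶ q)
      ≈⟨ ⊹-cong (·-assoc a b q) (shift-cong (·-✶ a p q)) ⟩
    a · (b · q) ⊹ shift (a · (p ✶ q))  ≈⟨ ⊹-cong ≋-refl (·-shift a (p ✶ q)) ⟨
    a · (b · q) ⊹ a · shift (p ✶ q)    ≈⟨ ·-distribˡ a (b · q) _ ⟨
    a · ((b ∷ p) ✶ q)                  ∎

  ✶-assoc : ∀ p q r → (p ✶ q) ✶ r ≋ p ✶ (q ✶ r)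
  ✶-assoc []      q r = ≋-refl
  ✶-assoc (a ∷ p) q r = begin
    (a · q ⊹ shift (p ✶ q)) ✶ r        ≈⟨ ✶-distribʳ r (a · q) _ ⟩
    (a · q) ✶ r ⊹ shift (p ✶ q) ✶ r    ≈⟨ ⊹-cong (·-✶ a q r) (shift-✶ (p ✶ q) r) ⟩
    a · (q ✶ r) ⊹ shift ((p ✶ q) ✶ r)  ≈⟨ ⊹-cong ≋-refl (shift-cong (✶-assoc p q r)) ⟩
    (a ∷ p) ✶ (q ✶ r)                  ∎

  one : Poly
  one = 1# ∷ []

  ✶-identityˡ : ∀ p → one ✶ p ≋ p
  ✶-identityˡ p = begin
    1# · p ⊹ shift []  ≈⟨ ⊹-cong (·-identityˡ p) shift-0 ⟩
    p ⊹ []             ≈⟨ ⊹-identityʳ p ⟩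
    p                  ∎

  polynomialRing : CommutativeRing c ℓ
  polynomialRing = record
    { Carrier = Poly
    ; _≈_ = _≋_
    ; _+_ = _⊹_
    ; _*_ = _✶_
    ; -_  = ⊟_
    ; 0#  = []
    ; 1#  = one
    ; isCommutativeRing = record
      { isRing = record
        { +-isAbelianGroup = record
          { isGroup = record
            { isMonoid = record
              { isSemigroup = record
                { isMagma = record
                  { isEquivalence = Setoid.isEquivalence ≋-setoid
                  ; ∙-cong = ⊹-cong
                  }
                ; assoc = ⊹-assoc
                }
              ; identity = (λ _ → ≋-refl) , ⊹-identityʳ
              }
            ; inverse = ⊟-inverseˡ , ⊟-inverseʳ
            ; ⁻¹-cong = ⊟-cong
            }
          ; comm = ⊹-comm
          }
        ; *-cong = ✶-cong
        ; *-assoc = ✶-assoc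
        ; *-identity = ✶-identityˡ , λ p → ≋-trans (✶-comm p one) (✶-identityˡ p)
        ; distrib = (λ p q r → ≋-trans (✶-comm p (q ⊹ r)) (≋-trans (✶-distribʳ p q r)
                                 (⊹-cong (✶-comm q p) (✶-comm r p))))
                  , ✶-distribʳ
        }
      ; *-comm = ✶-comm
      }
    }

  one≉0 : ¬ (1# ≈ 0#) → ¬ (one ≋ [])
  one≉0 1≉0 e = 1≉0 (at e 0)

  module _ (_≟_ : Decidable _≈_) where

    ≋-dec : Decidable _≋_
    ≋-dec [] [] = yes ≋-refl
    ≋-dec [] (b ∷ q) with b ≟ 0# | ≋-dec [] q
    ... | yes e | yes f = yes (mk≋ λ { zero → sym e ; (suc n) → at f n })
    ... | no ne | _     = no λ e → ne (sym (at e 0))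
    ... | _     | no nf = no λ e → nf (mk≋ λ n → at e (suc n))
    ≋-dec (a ∷ p) [] with a ≟ 0# | ≋-dec p []
    ... | yes e | yes f = yes (mk≋ λ { zero → e ; (suc n) → at f n })
    ... | no ne | _     = no λ e → ne (at e 0)
    ... | _     | no nf = no λ e → nf (mk≋ λ n → at e (suc n))
    ≋-dec (a ∷ p) (b ∷ q) with a ≟ b | ≋-dec p q
    ... | yes e | yes f = yes (∷-cong e f)
    ... | no ne | _     = no λ e → ne (at e 0)
    ... | _     | no nf = no λ e → nf (≋-tail e)

    module _ (noZeroDivisors : ∀ {a b} → a * b ≈ 0# → a ≈ 0# ⊎ b ≈ 0#) where

      private
        unshift : ∀ {a p} → a ≈ 0# → p ≋ [] → a ∷ p ≋ []
        unshift a≈0 p≋0 = ≋-trans (∷-cong a≈0 p≋0) shift-0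

        step : ∀ a p b q → Dec (a ≈ 0#) →
               (p ✶ (b ∷ q) ≋ [] → p ≋ [] ⊎ b ∷ q ≋ []) →
               ((a ∷ p) ✶ q ≋ [] → a ∷ p ≋ [] ⊎ q ≋ []) →
               (a ∷ p) ✶ (b ∷ q) ≋ [] → a ∷ p ≋ [] ⊎ b ∷ q ≋ []
        step a p b q (yes a≈0) rec₁ rec₂ e = case₁ (rec₁ (mk≋ λ n → at pq≋0 (suc n)))
          where
          pq≋0 : shift (p ✶ (b ∷ q)) ≋ []
          pq≋0 = begin
            shift (p ✶ (b ∷ q))  ≈⟨ shift-✶ p (b ∷ q) ⟨
            shift p ✶ (b ∷ q)    ≈⟨ ✶-congʳ (a ∷ p) (0# ∷ p) {b ∷ q} (∷-cong a≈0 ≋-refl) ⟨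
            (a ∷ p) ✶ (b ∷ q)    ≈⟨ e ⟩
            []                   ∎
          case₁ : p ≋ [] ⊎ b ∷ q ≋ [] → a ∷ p ≋ [] ⊎ b ∷ q ≋ []
          case₁ (inj₁ p≋0) = inj₁ (unshift a≈0 p≋0)
          case₁ (inj₂ q≋0) = inj₂ q≋0
        step a p b q (no a≉0) rec₁ rec₂ e = case₂ (rec₂ (mk≋ λ n → at pq≋0 (suc n)))
          where
          b≈0 : b ≈ 0#
          b≈0 with noZeroDivisors (trans (sym (+-identityʳ (a * b))) (at e 0))
          ... | inj₁ a≈0 = ⊥-elim (a≉0 a≈0)
          ... | inj₂ b≈0 = b≈0
          b·≋0 : b · (a ∷ p) ≋ []
          b·≋0 = ≋-trans (·-cong b≈0 (≋-refl {a ∷ p})) (·-zeroˡ (a ∷ p))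
          pq≋0 : shift ((a ∷ p) ✶ q) ≋ []
          pq≋0 = begin
            shift ((a ∷ p) ✶ q)
              ≈⟨ ⊹-cong b·≋0 (≋-refl {shift ((a ∷ p) ✶ q)}) ⟨
            b · (a ∷ p) ⊹ shift ((a ∷ p) ✶ q)  ≈⟨ ✶-∷ (a ∷ p) b q ⟨
            (a ∷ p) ✶ (b ∷ q)                  ≈⟨ e ⟩
            []                                 ∎
          case₂ : a ∷ p ≋ [] ⊎ q ≋ [] → a ∷ p ≋ [] ⊎ b ∷ q ≋ []
          case₂ (inj₁ p≋0) = inj₁ p≋0
          case₂ (inj₂ q≋0) = inj₂ (unshift b≈0 q≋0)

      ✶-noZeroDivisors : ∀ p q → p ✶ q ≋ [] → p ≋ [] ⊎ q ≋ []
      ✶-noZeroDivisors []      q       e = inj₁ ≋-refl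
      ✶-noZeroDivisors (a ∷ p) []      e = inj₂ ≋-refl
      ✶-noZeroDivisors (a ∷ p) (b ∷ q) e =
        step a p b q (a ≟ 0#) (✶-noZeroDivisors p (b ∷ q)) (✶-noZeroDivisors (a ∷ p) q) e

record DiscreteDomain c ℓ : Set (Level.suc (c Level.⊔ ℓ)) where
  field commutativeRing : CommutativeRing c ℓ
  open CommutativeRing commutativeRing public
  field
    _≟_            : Decidable _≈_
    noZeroDivisors : ∀ a b → a * b ≈ 0# → a ≈ 0# ⊎ b ≈ 0#
    1≉0            : ¬ (1# ≈ 0#)

module Fractions {c ℓ} (D : DiscreteDomain c ℓ) where

  open DiscreteDomain D
  open RingProperties ring using (-‿distribˡ-*)
  open SemiringSolver commutativeSemiring using (solve; _:+_; _:*_; _:=_; con)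
  open SetoidReasoning setoid
  open GroupProperties +-group using (x∙y⁻¹≈ε⇒x≈y)

  record Frac : Set (c Level.⊔ ℓ) where
    constructor _//_[_]
    field
      num   : Carrier
      den   : Carrier
      den≉0 : ¬ (den ≈ 0#)

  open Frac public

  infix 4 _≃_

  record _≃_ (x y : Frac) : Set ℓ where
    constructor mk≃
    field cross : num x * den y ≈ num y * den x

  open _≃_ public

  *-≉0 : ∀ {a b} → ¬ (a ≈ 0#) → ¬ (b ≈ 0#) → ¬ (a * b ≈ 0#)
  *-≉0 {a} {b} a≉0 b≉0 e with noZeroDivisors a b e
  ... | inj₁ a≈0 = a≉0 a≈0
  ... | inj₂ b≈0 = b≉0 b≈0

  *-cancelʳ : ∀ {a b d} → ¬ (d ≈ 0#) → a * d ≈ b * d → a ≈ b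
  *-cancelʳ {a} {b} {d} d≉0 e with noZeroDivisors (a - b) d (begin
      (a - b) * d          ≈⟨ distribʳ d a (- b) ⟩
      a * d + (- b) * d    ≈⟨ +-cong e (sym (-‿distribˡ-* b d)) ⟩
      b * d - b * d        ≈⟨ -‿inverseʳ _ ⟩
      0#                   ∎)
  ... | inj₁ a-b≈0 = x∙y⁻¹≈ε⇒x≈y a b a-b≈0
  ... | inj₂ d≈0   = ⊥-elim (d≉0 d≈0)

  fromD : Carrier → Frac
  fromD a = a // 1# [ 1≉0 ]

  0F 1F : Frac
  0F = fromD 0#
  1F = fromD 1#

  infixl 6 _⊕_
  infixl 7 _⊗_
  infix  8 ⊖_

  _⊕_ _⊗_ : Frac → Frac → Frac
  (a // b [ b≉0 ]) ⊕ (a′ // b′ [ b′≉0 ]) = (a * b′ + a′ * b) // b * b′ [ *-≉0 b≉0 b′≉0 ]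
  (a // b [ b≉0 ]) ⊗ (a′ // b′ [ b′≉0 ]) = (a * a′) // b * b′ [ *-≉0 b≉0 b′≉0 ]

  ⊖_ : Frac → Frac
  ⊖ (a // b [ b≉0 ]) = (- a) // b [ b≉0 ]

  ≃-refl : ∀ {x} → x ≃ x
  ≃-refl = mk≃ refl

  ≃-sym : ∀ {x y} → x ≃ y → y ≃ x
  ≃-sym e = mk≃ (sym (cross e))

  ≃-trans : ∀ {x y z} → x ≃ y → y ≃ z → x ≃ z
  ≃-trans {a // b [ _ ]} {a′ // b′ [ b′≉0 ]} {a″ // b″ [ _ ]} (mk≃ e) (mk≃ f) =
    mk≃ (*-cancelʳ b′≉0 (begin
      a * b″ * b′    ≈⟨ solve 3 (λ x y z → x :* y :* z := x :* z :* y) refl a b″ b′ ⟩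
      a * b′ * b″    ≈⟨ *-congʳ e ⟩
      a′ * b * b″    ≈⟨ solve 3 (λ x y z → x :* y :* z := x :* z :* y) refl a′ b b″ ⟩
      a′ * b″ * b    ≈⟨ *-congʳ f ⟩
      a″ * b′ * b    ≈⟨ solve 3 (λ x y z → x :* y :* z := x :* z :* y) refl a″ b′ b ⟩
      a″ * b * b′    ∎))

  ⊕-cong : ∀ {x x′ y y′} → x ≃ x′ → y ≃ y′ → x ⊕ y ≃ x′ ⊕ y′
  ⊕-cong {a // b [ _ ]} {a′ // b′ [ _ ]} {p // q [ _ ]} {p′ // q′ [ _ ]} (mk≃ e) (mk≃ f) = mk≃ (begin
    (a * q + p * b) * (b′ * q′)
      ≈⟨ solve 6 (λ a b b′ p q q′ → (a :* q :+ p :* b) :* (b′ :* q′)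
                    := a :* b′ :* (q :* q′) :+ p :* q′ :* (b :* b′)) refl a b b′ p q q′ ⟩
    a * b′ * (q * q′) + p * q′ * (b * b′)
      ≈⟨ +-cong (*-congʳ e) (*-congʳ f) ⟩
    a′ * b * (q * q′) + p′ * q * (b * b′)
      ≈⟨ solve 6 (λ a′ b b′ p′ q q′ → a′ :* b :* (q :* q′) :+ p′ :* q :* (b :* b′)
                    := (a′ :* q′ :+ p′ :* b′) :* (b :* q)) refl a′ b b′ p′ q q′ ⟩
    (a′ * q′ + p′ * b′) * (b * q) ∎)

  ⊗-cong : ∀ {x x′ y y′} → x ≃ x′ → y ≃ y′ → x ⊗ y ≃ x′ ⊗ y′
  ⊗-cong {a // b [ _ ]} {a′ // b′ [ _ ]} {p // q [ _ ]} {p′ // q′ [ _ ]} (mk≃ e) (mk≃ f) = mk≃ (begin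
    a * p * (b′ * q′)    ≈⟨ swap a p b′ q′ ⟩
    a * b′ * (p * q′)    ≈⟨ *-cong e f ⟩
    a′ * b * (p′ * q)    ≈⟨ swap a′ b p′ q ⟩
    a′ * p′ * (b * q)    ∎)
    where
    swap : ∀ w x y z → w * x * (y * z) ≈ w * y * (x * z)
    swap = solve 4 (λ w x y z → w :* x :* (y :* z) := w :* y :* (x :* z)) refl

  ⊖-cong : ∀ {x y} → x ≃ y → ⊖ x ≃ ⊖ y
  ⊖-cong {a // b [ _ ]} {a′ // b′ [ _ ]} (mk≃ e) = mk≃ (begin
    (- a) * b′     ≈⟨ -‿distribˡ-* a b′ ⟨
    - (a * b′)     ≈⟨ -‿cong e ⟩
    - (a′ * b)     ≈⟨ -‿distribˡ-* a′ b ⟩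
    (- a′) * b     ∎)

  ⊕-assoc : ∀ x y z → (x ⊕ y) ⊕ z ≃ x ⊕ (y ⊕ z)
  ⊕-assoc (a // b [ _ ]) (p // q [ _ ]) (s // t [ _ ]) = mk≃
    (solve 6 (λ a b p q s t →
        ((a :* q :+ p :* b) :* t :+ s :* (b :* q)) :* (b :* (q :* t))
     := (a :* (q :* t) :+ (p :* t :+ s :* q) :* b) :* (b :* q :* t)) refl a b p q s t)

  ⊕-comm : ∀ x y → x ⊕ y ≃ y ⊕ x
  ⊕-comm (a // b [ _ ]) (p // q [ _ ]) = mk≃
    (solve 4 (λ a b p q → (a :* q :+ p :* b) :* (q :* b) := (p :* b :+ a :* q) :* (b :* q))
      refl a b p q)

  ⊕-identityʳ : ∀ x → x ⊕ 0F ≃ x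
  ⊕-identityʳ (a // b [ _ ]) = mk≃
    (solve 2 (λ a b → (a :* con 1 :+ con 0 :* b) :* b := a :* (b :* con 1)) refl a b)

  ⊕-identityˡ : ∀ x → 0F ⊕ x ≃ x
  ⊕-identityˡ x = ≃-trans (⊕-comm 0F x) (⊕-identityʳ x)

  num≈0⇒≃0 : ∀ {x} → num x ≈ 0# → x ≃ 0F
  num≈0⇒≃0 {x} e = mk≃ (trans (*-identityʳ _) (trans e (sym (zeroˡ (den x)))))

  ≃0⇒num≈0 : ∀ {x} → x ≃ 0F → num x ≈ 0#
  ≃0⇒num≈0 {x} e = trans (sym (*-identityʳ _)) (trans (cross e) (zeroˡ (den x)))

  ⊖-inverseʳ : ∀ x → x ⊕ ⊖ x ≃ 0F
  ⊖-inverseʳ (a // b [ _ ]) = num≈0⇒≃0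
    (trans (+-congˡ (sym (-‿distribˡ-* a b))) (-‿inverseʳ (a * b)))

  ⊖-inverseˡ : ∀ x → ⊖ x ⊕ x ≃ 0F
  ⊖-inverseˡ x = ≃-trans (⊕-comm (⊖ x) x) (⊖-inverseʳ x)

  ⊗-assoc : ∀ x y z → (x ⊗ y) ⊗ z ≃ x ⊗ (y ⊗ z)
  ⊗-assoc (a // b [ _ ]) (p // q [ _ ]) (s // t [ _ ]) = mk≃
    (*-cong (*-assoc a p s) (sym (*-assoc b q t)))

  ⊗-comm : ∀ x y → x ⊗ y ≃ y ⊗ x
  ⊗-comm (a // b [ _ ]) (p // q [ _ ]) = mk≃ (*-cong (*-comm a p) (*-comm q b))

  ⊗-identityˡ : ∀ x → 1F ⊗ x ≃ x
  ⊗-identityˡ (a // b [ _ ]) = mk≃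
    (solve 2 (λ a b → con 1 :* a :* b := a :* (con 1 :* b)) refl a b)

  ⊗-distribʳ : ∀ z x y → (x ⊕ y) ⊗ z ≃ x ⊗ z ⊕ y ⊗ z
  ⊗-distribʳ (s // t [ _ ]) (a // b [ _ ]) (p // q [ _ ]) = mk≃
    (solve 6 (λ a b p q s t →
        ((a :* q :+ p :* b) :* s) :* ((b :* t) :* (q :* t))
     := ((a :* s) :* (q :* t) :+ (p :* s) :* (b :* t)) :* (b :* q :* t)) refl a b p q s t)

  _≃?_ : Decidable _≃_
  x ≃? y with (num x * den y) ≟ (num y * den x)
  ... | yes e = yes (mk≃ e)
  ... | no ne = no λ e → ne (cross e)

  private
    _≄_ : Frac → Frac → Set ℓ
    x ≄ y = ¬ (x ≃ y)

    1≄0 : 1F ≄ 0F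
    1≄0 e = 1≉0 (≃0⇒num≈0 e)

    inverse : ∀ {x} → x ≄ 0F → Σ[ y ∈ Frac ] (y ⊗ x ≃ 1F × x ⊗ y ≃ 1F)
    inverse {x@(a // b [ b≉0 ])} x≄0 = y , ≃-trans (⊗-comm y x) xy≃1 , xy≃1
      where
      y : Frac
      y = b // a [ (λ a≈0 → x≄0 (num≈0⇒≃0 a≈0)) ]
      xy≃1 : x ⊗ y ≃ 1F
      xy≃1 = mk≃ (solve 2 (λ a b → a :* b :* con 1 := con 1 :* (b :* a)) refl a b)

    ⊖≃0⇒≃ : ∀ {x y} → x ⊕ ⊖ y ≃ 0F → x ≃ y
    ⊖≃0⇒≃ {x} {y} e =
      ≃-trans (≃-sym (⊕-identityʳ x)) (≃-trans (⊕-cong (≃-refl {x}) (≃-sym (⊖-inverseˡ y)))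
      (≃-trans (≃-sym (⊕-assoc x (⊖ y) y)) (≃-trans (⊕-cong e (≃-refl {y})) (⊕-identityˡ y))))

    cotrans : ∀ {x y} → x ≄ y → ∀ z → x ≄ z ⊎ z ≄ y
    cotrans {x} x≄y z with x ≃? z
    ... | yes x≃z = inj₂ λ z≃y → x≄y (≃-trans x≃z z≃y)
    ... | no  x≄z = inj₁ x≄z

  fractionRing : CommutativeRing (c Level.⊔ ℓ) ℓ
  fractionRing = record
    { Carrier = Frac
    ; _≈_ = _≃_
    ; _+_ = _⊕_
    ; _*_ = _⊗_
    ; -_  = ⊖_
    ; 0#  = 0F
    ; 1#  = 1F
    ; isCommutativeRing = record
      { isRing = record
        { +-isAbelianGroup = record
          { isGroup = record
            { isMonoid = record
              { isSemigroup = record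
                { isMagma = record
                  { isEquivalence = record { refl = ≃-refl ; sym = ≃-sym ; trans = ≃-trans }
                  ; ∙-cong = ⊕-cong
                  }
                ; assoc = ⊕-assoc
                }
              ; identity = ⊕-identityˡ , ⊕-identityʳ
              }
            ; inverse = ⊖-inverseˡ , ⊖-inverseʳ
            ; ⁻¹-cong = ⊖-cong
            }
          ; comm = ⊕-comm
          }
        ; *-cong = ⊗-cong
        ; *-assoc = ⊗-assoc
        ; *-identity = ⊗-identityˡ , λ x → ≃-trans (⊗-comm x 1F) (⊗-identityˡ x)
        ; distrib = (λ x y z → ≃-trans (⊗-comm x (y ⊕ z)) (≃-trans (⊗-distribʳ x y z)
                                 (⊕-cong (⊗-comm y x) (⊗-comm z x))))
                  , ⊗-distribʳ
        }
      ; *-comm = ⊗-comm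
      }
    }

  fractionField : HeytingField (c Level.⊔ ℓ) ℓ ℓ
  fractionField = record
    { Carrier = Frac
    ; _≈_ = _≃_
    ; _#_ = _≄_
    ; _+_ = _⊕_
    ; _*_ = _⊗_
    ; -_  = ⊖_
    ; 0#  = 0F
    ; 1#  = 1F
    ; isHeytingField = record
      { isHeytingCommutativeRing = record
        { isCommutativeRing = CommutativeRing.isCommutativeRing fractionRing
        ; isApartnessRelation = record
          { irrefl = λ x≃y x≄y → x≄y x≃y
          ; sym = λ x≄y y≃x → x≄y (≃-sym y≃x)
          ; cotrans = cotrans
          }
        ; #⇒invertible = λ {x} {y} x≄y → inverse λ e → x≄y (⊖≃0⇒≃ {x} {y} e)
        ; invertible⇒# = λ {x} {y} inv x≃y → 1≄0
            (≃-trans (≃-sym (proj₂ (proj₂ inv)))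
            (≃-trans (⊗-cong (≃-trans (⊕-cong x≃y (≃-refl {⊖ y})) (⊖-inverseʳ y)) (≃-refl {proj₁ inv}))
            (CommutativeRing.zeroˡ fractionRing (proj₁ inv))))
        }
      ; tight = λ x y → (stable x y) , λ x≃y x≄y → x≄y x≃y
      }
    }
    where
    stable : ∀ x y → ¬ (x ≄ y) → x ≃ y
    stable x y ¬x≄y with x ≃? y
    ... | yes e = e
    ... | no ne = ⊥-elim (¬x≄y ne)

  _≄?_ : Decidable (HeytingField._#_ fractionField)
  x ≄? y with x ≃? y
  ... | yes e = no λ ne → ne e
  ... | no ne = yes ne

-- Y² = X³ + a₂ X² + a₄ X + a₆

record Weierstrass {c} (A : Set c) : Set c where
  constructor ⟨_,_,_⟩
  field a₂ a₄ a₆ : A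

module Discriminant {c ℓ} (R : CommutativeRing c ℓ) where

  open CommutativeRing R
  open RawMonoidDefinitions +-rawMonoid using () renaming (_×_ to _×ₙ_)

  Δ : Weierstrass Carrier → Carrier
  Δ ⟨ a₂ , a₄ , a₆ ⟩ =
    - (b₂ * b₂ * b₈) - 8 ×ₙ (b₄ * b₄ * b₄) - 27 ×ₙ (b₆ * b₆) + 9 ×ₙ (b₂ * b₄ * b₆)
    where
    b₂ b₄ b₆ b₈ : Carrier
    b₂ = 4 ×ₙ a₂
    b₄ = 2 ×ₙ a₄
    b₆ = 4 ×ₙ a₆
    b₈ = 4 ×ₙ (a₂ * a₆) - a₄ * a₄

-- The points of the curve over a field, with the chord-and-tangent operations.
-- Apartness is assumed decidable, which makes addition a total function.
-- Associativity is not needed to speak of multiples and linear combinations,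
-- so only a raw group is constructed.

module Points {c ℓ₁ ℓ₂} (K : HeytingField c ℓ₁ ℓ₂)
  (_#?_ : Decidable (HeytingField._#_ K))
  (E : Weierstrass (HeytingField.Carrier K)) where

  open HeytingField K using (_#_; #⇒invertible; tight; heytingCommutativeRing)

  commutativeRing : CommutativeRing c ℓ₁
  commutativeRing = HeytingCommutativeRing.commutativeRing heytingCommutativeRing

  open CommutativeRing commutativeRing
  open Weierstrass E
  open RingProperties ring using (-‿distribˡ-*; -‿distribʳ-*; -0#≈0#; -‿involutive; +-cancelʳ)
  open RawMonoidDefinitions +-rawMonoid using () renaming (_×_ to _×ₙ_)
  open SemiringSolver commutativeSemiring using (solve; _:+_; _:*_; _:=_; con)
  open SetoidReasoning setoid

  cubic : Carrier → Carrier
  cubic x = x * x * x + a₂ * (x * x) + a₄ * x + a₆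

  OnCurve : Carrier → Carrier → Set ℓ₁
  OnCurve x y = y * y ≈ cubic x

  data Point : Set (c Level.⊔ ℓ₁) where
    ∞      : Point
    affine : ∀ x y → OnCurve x y → Point

  infix 4 _≈ₚ_

  data _≈ₚ_ : Point → Point → Set (c Level.⊔ ℓ₁) where
    ∞≈      : ∞ ≈ₚ ∞
    affine≈ : ∀ {x y x′ y′ p p′} → x ≈ x′ → y ≈ y′ → affine x y p ≈ₚ affine x′ y′ p′

  private
    ¬#⇒≈ : ∀ {x y} → ¬ (x # y) → x ≈ y
    ¬#⇒≈ {x} {y} = proj₁ (tight x y)

    cancel-unit : ∀ {u v a b} → v * u ≈ 1# → a * u ≈ b * u → a ≈ b
    cancel-unit {u} {v} {a} {b} vu≈1 e = begin
      a            ≈⟨ expand a ⟩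
      v * (a * u)  ≈⟨ *-congˡ e ⟩
      v * (b * u)  ≈⟨ expand b ⟨
      b            ∎
      where
      expand : ∀ a → a ≈ v * (a * u)
      expand a = trans (sym (*-identityʳ a)) (trans (*-congˡ (sym vu≈1))
        (solve 3 (λ a u v → a :* (v :* u) := v :* (a :* u)) refl a u v))

    -‿cancel : ∀ x y → x - y + y ≈ x
    -‿cancel x y = trans (+-assoc x (- y) y) (trans (+-congˡ (-‿inverseˡ y)) (+-identityʳ x))

    neg-square : ∀ y → (- y) * (- y) ≈ y * y
    neg-square y = begin
      (- y) * (- y)  ≈⟨ -‿distribˡ-* y (- y) ⟨
      - (y * - y)    ≈⟨ -‿cong (-‿distribʳ-* y y) ⟨
      - (- (y * y))  ≈⟨ -‿involutive (y * y) ⟩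
      y * y          ∎

    -- (cubic x - cubic y) / (x - y)
    divided : Carrier → Carrier → Carrier
    divided x y = x * x + x * y + y * y + a₂ * (x + y) + a₄

    cubic-cong : ∀ {x y} → x ≈ y → cubic x ≈ cubic y
    cubic-cong e = +-congʳ (+-cong (+-cong (*-cong (*-cong e e) e) (*-congˡ (*-cong e e))) (*-congˡ e))

    cubic-divided : ∀ x y → cubic x + y * divided x y ≈ cubic y + x * divided x y
    cubic-divided x y = solve 5 (λ x y a b c →
        (x :* x :* x :+ a :* (x :* x) :+ b :* x :+ c)
          :+ y :* (x :* x :+ x :* y :+ y :* y :+ a :* (x :+ y) :+ b)
     := (y :* y :* y :+ a :* (y :* y) :+ b :* y :+ c)
          :+ x :* (x :* x :+ x :* y :+ y :* y :+ a :* (x :+ y) :+ b)) refl x y a₂ a₄ a₆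

  -- The slope m of the line through two points, or of the tangent.

  record Slope (x₁ y₁ x₂ y₂ : Carrier) : Set (c Level.⊔ ℓ₁) where
    field
      m      : Carrier
      line   : y₂ + m * x₁ ≈ y₁ + m * x₂
      secant : m * (y₁ + y₂) ≈ divided x₁ x₂

  chordSlope : ∀ {x₁ y₁ x₂ y₂} → OnCurve x₁ y₁ → OnCurve x₂ y₂ → x₁ # x₂ → Slope x₁ y₁ x₂ y₂
  chordSlope {x₁} {y₁} {x₂} {y₂} p₁ p₂ x₁#x₂ = record { m = m ; line = line ; secant = secant }
    where
    d⁻¹ d m M Q : Carrier
    d⁻¹ = proj₁ (#⇒invertible x₁#x₂)
    d   = x₁ - x₂
    m   = (y₁ - y₂) * d⁻¹
    M   = m * (y₁ + y₂)
    Q   = divided x₁ x₂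

    d⁻¹d≈1 : d⁻¹ * d ≈ 1#
    d⁻¹d≈1 = proj₁ (proj₂ (#⇒invertible x₁#x₂))

    md≈ : m * d ≈ y₁ - y₂
    md≈ = trans (*-assoc _ _ _) (trans (*-congˡ d⁻¹d≈1) (*-identityʳ _))

    line : y₂ + m * x₁ ≈ y₁ + m * x₂
    line = begin
      y₂ + m * x₁              ≈⟨ +-congˡ (*-congˡ (-‿cancel x₁ x₂)) ⟨
      y₂ + m * (d + x₂)        ≈⟨ solve 4 (λ y m d x → y :+ m :* (d :+ x) := m :* d :+ y :+ m :* x) refl y₂ m d x₂ ⟩
      m * d + y₂ + m * x₂      ≈⟨ +-congʳ (+-congʳ md≈) ⟩
      y₁ - y₂ + y₂ + m * x₂    ≈⟨ +-congʳ (-‿cancel y₁ y₂) ⟩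
      y₁ + m * x₂              ∎

    crossM : cubic x₂ + x₁ * M ≈ cubic x₁ + x₂ * M
    crossM = +-cancelʳ (y₁ * y₂) _ _ (begin
      cubic x₂ + x₁ * M + y₁ * y₂    ≈⟨ +-congʳ (+-congʳ p₂) ⟨
      y₂ * y₂ + x₁ * M + y₁ * y₂
        ≈⟨ solve 4 (λ x₁ y₁ y₂ m → y₂ :* y₂ :+ x₁ :* (m :* (y₁ :+ y₂)) :+ y₁ :* y₂
                      := (y₂ :+ m :* x₁) :* (y₁ :+ y₂)) refl x₁ y₁ y₂ m ⟩
      (y₂ + m * x₁) * (y₁ + y₂)      ≈⟨ *-congʳ line ⟩
      (y₁ + m * x₂) * (y₁ + y₂)
        ≈⟨ solve 4 (λ x₂ y₁ y₂ m → (y₁ :+ m :* x₂) :* (y₁ :+ y₂)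
                      := y₁ :* y₁ :+ x₂ :* (m :* (y₁ :+ y₂)) :+ y₁ :* y₂) refl x₂ y₁ y₂ m ⟩
      y₁ * y₁ + x₂ * M + y₁ * y₂     ≈⟨ +-congʳ (+-congʳ p₁) ⟩
      cubic x₁ + x₂ * M + y₁ * y₂    ∎)

    secant : M ≈ Q
    secant = cancel-unit d⁻¹d≈1 (+-cancelʳ (x₂ * M + x₂ * Q + (cubic x₁ + cubic x₂)) _ _ (begin
      M * d + (x₂ * M + x₂ * Q + (cubic x₁ + cubic x₂))
        ≈⟨ solve 6 (λ m d x q s t → m :* d :+ (x :* m :+ x :* q :+ (s :+ t))
                      := (t :+ (d :+ x) :* m) :+ (s :+ x :* q)) refl M d x₂ Q (cubic x₁) (cubic x₂) ⟩
      (cubic x₂ + (d + x₂) * M) + (cubic x₁ + x₂ * Q)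
        ≈⟨ +-cong (+-congˡ (*-congʳ (-‿cancel x₁ x₂))) (cubic-divided x₁ x₂) ⟩
      (cubic x₂ + x₁ * M) + (cubic x₂ + x₁ * Q)
        ≈⟨ +-cong crossM (+-congˡ (*-congʳ (sym (-‿cancel x₁ x₂)))) ⟩
      (cubic x₁ + x₂ * M) + (cubic x₂ + (d + x₂) * Q)
        ≈⟨ solve 6 (λ m d x q s t → (s :+ x :* m) :+ (t :+ (d :+ x) :* q)
                      := q :* d :+ (x :* m :+ x :* q :+ (s :+ t))) refl M d x₂ Q (cubic x₁) (cubic x₂) ⟩
      Q * d + (x₂ * M + x₂ * Q + (cubic x₁ + cubic x₂)) ∎))

  -- Two points with x₁ = x₂ that are not opposite coincide, so the
  -- denominator y₁ + y₂ below is the usual 2y₁.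

  tangentSlope : ∀ {x₁ y₁ x₂ y₂} → OnCurve x₁ y₁ → OnCurve x₂ y₂ →
                 x₁ ≈ x₂ → y₁ + y₂ # 0# → Slope x₁ y₁ x₂ y₂
  tangentSlope {x₁} {y₁} {x₂} {y₂} p₁ p₂ x₁≈x₂ s#0 =
    record { m = m ; line = line ; secant = secant }
    where
    s s⁻¹ m : Carrier
    s   = y₁ + y₂
    s⁻¹ = proj₁ (#⇒invertible s#0)
    m   = (3 ×ₙ (x₁ * x₁) + 2 ×ₙ (a₂ * x₁) + a₄) * s⁻¹

    s⁻¹s≈1 : s⁻¹ * s ≈ 1#
    s⁻¹s≈1 = trans (*-congˡ (sym (trans (+-congˡ -0#≈0#) (+-identityʳ s))))
                   (proj₁ (proj₂ (#⇒invertible s#0)))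

    y₁≈y₂ : y₁ ≈ y₂
    y₁≈y₂ = cancel-unit s⁻¹s≈1 (begin
      y₁ * (y₁ + y₂)       ≈⟨ distribˡ y₁ y₁ y₂ ⟩
      y₁ * y₁ + y₁ * y₂    ≈⟨ +-congʳ (trans p₁ (trans (cubic-cong x₁≈x₂) (sym p₂))) ⟩
      y₂ * y₂ + y₁ * y₂    ≈⟨ solve 2 (λ y z → z :* z :+ y :* z := z :* (y :+ z)) refl y₁ y₂ ⟩
      y₂ * (y₁ + y₂)       ∎)

    line : y₂ + m * x₁ ≈ y₁ + m * x₂
    line = +-cong (sym y₁≈y₂) (*-congˡ x₁≈x₂)

    secant : m * s ≈ divided x₁ x₂
    secant = begin
      m * s                                           ≈⟨ *-assoc _ _ _ ⟩
      (3 ×ₙ (x₁ * x₁) + 2 ×ₙ (a₂ * x₁) + a₄) * (s⁻¹ * s)  ≈⟨ *-congˡ s⁻¹s≈1 ⟩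
      (3 ×ₙ (x₁ * x₁) + 2 ×ₙ (a₂ * x₁) + a₄) * 1#
        ≈⟨ solve 3 (λ x a b →
              ((x :* x :+ (x :* x :+ (x :* x :+ con 0))) :+ (a :* x :+ (a :* x :+ con 0)) :+ b) :* con 1
           := x :* x :+ x :* x :+ x :* x :+ a :* (x :+ x) :+ b) refl x₁ a₂ a₄ ⟩
      divided x₁ x₁
        ≈⟨ +-congʳ (+-cong (+-cong (+-congˡ (*-congˡ x₁≈x₂)) (*-cong x₁≈x₂ x₁≈x₂))
                           (*-congˡ (+-congˡ x₁≈x₂))) ⟩
      divided x₁ x₂                                   ∎

  negate : Point → Point
  negate ∞              = ∞
  negate (affine x y p) = affine x (- y) (trans (neg-square y) p)

  -- The line of slope m through (x₁ , y₁) and (x₂ , y₂) meets the curve again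
  -- at (x₃ , w).

  thirdPoint : ∀ {x₁ y₁ x₂ y₂} → OnCurve x₁ y₁ → Slope x₁ y₁ x₂ y₂ → Point
  thirdPoint {x₁} {y₁} {x₂} {y₂} p₁ slope = affine x₃ w w∈
    where
    open Slope slope
    x₃ w Q : Carrier
    x₃ = m * m - (a₂ + x₁ + x₂)
    w  = y₁ + m * x₃ - m * x₁
    Q  = divided x₁ x₃

    x₃-eq : x₃ + (a₂ + x₁ + x₂) ≈ m * m
    x₃-eq = -‿cancel (m * m) _

    w-eq : w + m * x₁ ≈ y₁ + m * x₃
    w-eq = -‿cancel _ (m * x₁)

    w-eq′ : w + m * x₂ ≈ y₂ + m * x₃
    w-eq′ = +-cancelʳ (m * x₁) _ _ (begin
      w + m * x₂ + m * x₁      ≈⟨ swap w (m * x₂) (m * x₁) ⟩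
      w + m * x₁ + m * x₂      ≈⟨ +-congʳ w-eq ⟩
      y₁ + m * x₃ + m * x₂     ≈⟨ swap y₁ (m * x₃) (m * x₂) ⟩
      y₁ + m * x₂ + m * x₃     ≈⟨ +-congʳ line ⟨
      y₂ + m * x₁ + m * x₃     ≈⟨ swap y₂ (m * x₁) (m * x₃) ⟩
      y₂ + m * x₃ + m * x₁     ∎)
      where
      swap : ∀ x y z → x + y + z ≈ x + z + y
      swap = solve 3 (λ x y z → x :+ y :+ z := x :+ z :+ y) refl

    secant′ : m * (y₁ + w) ≈ Q
    secant′ = +-cancelʳ (m * m * x₂) _ _ (begin
      m * (y₁ + w) + m * m * x₂
        ≈⟨ solve 4 (λ m y w x → m :* (y :+ w) :+ m :* m :* x := m :* (y :+ (w :+ m :* x))) refl m y₁ w x₂ ⟩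
      m * (y₁ + (w + m * x₂))      ≈⟨ *-congˡ (+-congˡ w-eq′) ⟩
      m * (y₁ + (y₂ + m * x₃))
        ≈⟨ solve 4 (λ m y w x → m :* (y :+ (w :+ m :* x)) := m :* (y :+ w) :+ m :* m :* x) refl m y₁ y₂ x₃ ⟩
      m * (y₁ + y₂) + m * m * x₃   ≈⟨ +-cong secant (*-congʳ (sym x₃-eq)) ⟩
      divided x₁ x₂ + (x₃ + (a₂ + x₁ + x₂)) * x₃
        ≈⟨ solve 5 (λ x y z a b →
              (x :* x :+ x :* y :+ y :* y :+ a :* (x :+ y) :+ b) :+ (z :+ (a :+ x :+ y)) :* z
           := (x :* x :+ x :* z :+ z :* z :+ a :* (x :+ z) :+ b) :+ (z :+ (a :+ x :+ y)) :* y)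
           refl x₁ x₂ x₃ a₂ a₄ ⟩
      Q + (x₃ + (a₂ + x₁ + x₂)) * x₂   ≈⟨ +-congˡ (*-congʳ x₃-eq) ⟩
      Q + m * m * x₂                   ∎)

    w∈ : OnCurve x₃ w
    w∈ = +-cancelʳ (x₁ * Q + w * y₁) _ _ (begin
      w * w + (x₁ * Q + w * y₁)               ≈⟨ +-congˡ (+-congʳ (*-congˡ secant′)) ⟨
      w * w + (x₁ * (m * (y₁ + w)) + w * y₁)
        ≈⟨ solve 4 (λ w x m y → w :* w :+ (x :* (m :* (y :+ w)) :+ w :* y)
                      := (w :+ m :* x) :* (y :+ w)) refl w x₁ m y₁ ⟩
      (w + m * x₁) * (y₁ + w)                 ≈⟨ *-congʳ w-eq ⟩
      (y₁ + m * x₃) * (y₁ + w)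
        ≈⟨ solve 4 (λ w x m y → (y :+ m :* x) :* (y :+ w)
                      := y :* y :+ x :* (m :* (y :+ w)) :+ w :* y) refl w x₃ m y₁ ⟩
      y₁ * y₁ + x₃ * (m * (y₁ + w)) + w * y₁  ≈⟨ +-congʳ (+-cong p₁ (*-congˡ secant′)) ⟩
      cubic x₁ + x₃ * Q + w * y₁              ≈⟨ +-congʳ (cubic-divided x₁ x₃) ⟩
      cubic x₃ + x₁ * Q + w * y₁              ≈⟨ +-assoc _ _ _ ⟩
      cubic x₃ + (x₁ * Q + w * y₁)            ∎)

  add : Point → Point → Point
  add ∞                 Q                 = Q
  add P@(affine _ _ _)  ∞                 = P
  add (affine x₁ y₁ p₁) (affine x₂ y₂ p₂) with x₁ #? x₂ | (y₁ + y₂) #? 0#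
  ... | yes x₁#x₂ | _       = negate (thirdPoint p₁ (chordSlope p₁ p₂ x₁#x₂))
  ... | no ¬x₁#x₂ | yes s#0 = negate (thirdPoint p₁ (tangentSlope p₁ p₂ (¬#⇒≈ ¬x₁#x₂) s#0))
  ... | no _      | no _    = ∞

  points : RawGroup (c Level.⊔ ℓ₁) (c Level.⊔ ℓ₁)
  points = record { Carrier = Point ; _≈_ = _≈ₚ_ ; _∙_ = add ; ε = ∞ ; _⁻¹ = negate }

-- The rank of an abelian group is the largest size of a ℤ-independent family.

module Rank {c ℓ} (G : RawGroup c ℓ) where

  open RawGroup G
  open RawMonoidDefinitions rawMonoid using (sum) renaming (_×_ to _×ₙ_)

  infixr 8 _×ᶻ_

  _×ᶻ_ : ℤ → Carrier → Carrier
  (+ n)    ×ᶻ P = n ×ₙ P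
  -[1+ n ] ×ᶻ P = (suc n ×ₙ P) ⁻¹

  Independent : ∀ {n} → Vector Carrier n → Set ℓ
  Independent {n} P =
    (k : Vector ℤ n) → sum (λ i → k i ×ᶻ P i) ≈ ε → ∀ i → k i ≡ 0ℤ

  HasRank : ℕ → Set (c Level.⊔ ℓ)
  HasRank r = (Σ[ P ∈ Vector Carrier r ] Independent P)
            × ((P : Vector Carrier (suc r)) → ¬ Independent P)

module ℤ[·] = Polynomials ℤ.+-*-commutativeRing
module ℚ[T] = Polynomials ℚ.+-*-commutativeRing

ℚ-noZeroDivisors : ∀ {p q} → p ℚ.* q ≡ 0ℚ → p ≡ 0ℚ ⊎ q ≡ 0ℚ
ℚ-noZeroDivisors {p} {q} pq≡0 with p ℚ.≟ 0ℚ
... | yes p≡0 = inj₁ p≡0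
... | no  p≢0 = inj₂ (begin
  q                        ≡⟨ ℚ.*-identityˡ q ⟨
  ℚ.1ℚ ℚ.* q               ≡⟨ ≡.cong (ℚ._* q) (ℚ.*-inverseˡ p) ⟨
  (ℚ.1/ p) ℚ.* p ℚ.* q     ≡⟨ ℚ.*-assoc (ℚ.1/ p) p q ⟩
  (ℚ.1/ p) ℚ.* (p ℚ.* q)   ≡⟨ ≡.cong ((ℚ.1/ p) ℚ.*_) pq≡0 ⟩
  (ℚ.1/ p) ℚ.* 0ℚ          ≡⟨ ℚ.*-zeroʳ (ℚ.1/ p) ⟩
  0ℚ                       ∎)
  where
  open ≡.≡-Reasoning
  instance
    p-nonZero : ℚ.NonZero p
    p-nonZero = ℚ.≢-nonZero p≢0

ℚ[T]-domain : DiscreteDomain 0ℓ 0ℓ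
ℚ[T]-domain = record
  { commutativeRing = ℚ[T].polynomialRing
  ; _≟_ = ℚ[T].≋-dec ℚ._≟_
  ; noZeroDivisors = ℚ[T].✶-noZeroDivisors ℚ._≟_ ℚ-noZeroDivisors
  ; 1≉0 = ℚ[T].one≉0 ℚ.1≢0
  }

module ℚ⟨T⟩ = Fractions ℚ[T]-domain

ℤ[T]→ℚ⟨T⟩ : ℤ[·].Poly → ℚ⟨T⟩.Frac
ℤ[T]→ℚ⟨T⟩ p = ℚ⟨T⟩.fromD (map (λ n → n ℚ./ 1) p)

‖_‖ : ℤ[·].Poly → ℕ
‖ p ‖ = foldr (λ a m → ℤ.∣ a ∣ ⊔ m) 0 p

Deg≤ : ℕ → ℤ[·].Poly → Set
Deg≤ d p = ∀ n → d ℕ.< n → ℤ[·].coeff p n ≡ 0ℤ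

-- The curve Y² = A(X) T² + B(X) T + C(X), identified with its equation.  The fields list the coefficients
-- of 1, X, X² in A, B and C - X³; the equation determines them uniquely.

record Curve : Set where
  field
    A-coeffs B-coeffs C-X³-coeffs : Vec ℤ 3

  A B C-X³ C : ℤ[·].Poly
  A    = toList A-coeffs
  B    = toList B-coeffs
  C-X³ = toList C-X³-coeffs
  C    = C-X³ ++ 1ℤ ∷ []

  coeffOfX^ : ℕ → ℤ[·].Poly
  coeffOfX^ i = ℤ[·].coeff C i ∷ ℤ[·].coeff B i ∷ ℤ[·].coeff A i ∷ []

  α₂ α₄ α₆ : ℤ[·].Poly
  α₂ = coeffOfX^ 2
  α₄ = coeffOfX^ 1
  α₆ = coeffOfX^ 0

  NonSingular : Set
  NonSingular = ¬ (Discriminant.Δ ℤ[·].polynomialRing ⟨ α₂ , α₄ , α₆ ⟩ ℤ[·].≋ [])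

  group : RawGroup 0ℓ 0ℓ
  group = Points.points ℚ⟨T⟩.fractionField ℚ⟨T⟩._≄?_
    ⟨ ℤ[T]→ℚ⟨T⟩ α₂ , ℤ[T]→ℚ⟨T⟩ α₄ , ℤ[T]→ℚ⟨T⟩ α₆ ⟩

-- In 𝒮 ∗□ the coefficient of T² is the square a² of a nonzero constant; a and
-- - a give the same curve, which is counted once.

data Family : Set where
  ∗0 ∗□ ∗ℓ : Family

𝒮 : Family → ℕ → Pred Curve 0ℓ
𝒮 ∗0 H E = NonSingular
         × A-coeffs ≡ 0ℤ ∷ 0ℤ ∷ 0ℤ ∷ []
         × ‖ B ‖ ⊔ ‖ C ‖ ℕ.≤ H
  where open Curve E
𝒮 ∗□ H E = NonSingular
         × (Σ[ a ∈ ℤ ] a ≢ 0ℤ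
              × A-coeffs ≡ a ℤ.* a ∷ 0ℤ ∷ 0ℤ ∷ []
              × ‖ a ∷ [] ‖ ⊔ ‖ B ‖ ⊔ ‖ C ‖ ℕ.≤ H)
  where open Curve E
𝒮 ∗ℓ H E = NonSingular
         × Deg≤ 1 A × Deg≤ 1 B × Deg≤ 1 C-X³
         × ‖ A ‖ ⊔ ‖ B ‖ ⊔ ‖ C ‖ ℕ.≤ H
  where open Curve E

ℛ : Family → ℕ → Pred Curve 0ℓ
ℛ ∗ H E = 𝒮 ∗ H E × (Σ[ r ∈ ℕ ] Rank.HasRank (Curve.group E) r × 1 ℕ.≤ r)

HasCardinality : ∀ {A : Set} → Pred A 0ℓ → ℕ → Set
HasCardinality {A} P n =
  Σ[ xs ∈ List A ] Unique xs × (∀ x → x ∈ xs ⇔ P x) × length xs ≡ n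

-- #P(H) / #Q(H) → 0.  Constructively a subset of a finite set need not be
-- enumerable unless it is decidable, so the existence of #P(H) is asserted
-- under a double negation.  As the inequality on r is decidable, nothing else
-- is lost: it holds for the classical cardinality.

RatioTendsToZero : ∀ {A : Set} → (P Q : ℕ → Pred A 0ℓ) → Set
RatioTendsToZero P Q =
  ∀ (ε : ℚ) → 0ℚ ℚ.< ε →
  Σ[ N ∈ ℕ ] ∀ (H : ℕ) → N ℕ.≤ H →
  Σ[ s ∈ ℕ ] HasCardinality (Q H) s
    × Σ[ s≢0 ∈ ℕ.NonZero s ]
        ¬ ¬ (Σ[ r ∈ ℕ ] HasCardinality (P H) r)
        × (∀ r → HasCardinality (P H) r → ℚ._/_ (+ r) s {{s≢0}} ℚ.< ε)

module Submission where

-- Over ℚ(X) the equation Y² = q(X, T), quadratic in T, is a conic.  Let (x , y) be a ℚ(T)-rational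
-- point, x = p / e in lowest terms and of degree n in T.  By linear algebra there are U, V in
-- ℚ[X][T], of degree about n / 2 in T, with U + V y = 0 at X = x.  The norm U² - q V² vanishes there
-- and has degree at most n in T, so it is c(X) (p - X e).  If an irreducible factor of c always
-- either divides U and V or is, up to a constant, itself a norm, then c may be assumed constant;
-- but for a fixed T the cubic q is monic, so U² - q V² has even degree in X or degree at least 3,
-- while p - X e has degree 1.  Hence there is no affine point at all, and the rank is 0.  The
-- assumption holds when certain polynomials in the coefficients of the curve are not squares,
-- have no rational root or no quadratic factor.  Each of these conditions follows from a
-- condition modulo any odd prime, met by at least 1 in 80 residue classes, and sieving by more
-- and more primes leaves a set of density 0.

-- The degrees of U and V in T are the delicate point. Together they have n + 1 coefficients in
-- K[X], which is what makes the linear system solvable. For n = 2 m, degrees m and m - 1 keep the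
-- norm within degree n, since q has degree at most 2 in T. For n = 2 m + 1, degrees m and m would
-- allow degree n + 1. If A = a², replacing U by U - a T V cancels the term a² T² of q and saves one
-- degree; if A is linear, n is proved even instead, which is one use of the condition that - a1 is
-- not a square. An irreducible π that divides a norm but not both of U and V makes q a square
-- modulo π, so π divides B² - 4 A C. For A = 0 and for A linear this is excluded. For A = a² it can
-- happen, but there B² - 4 A C is itself the norm of B + 2 a² T + 2 a Y. Irreducibility of the
-- quartic B² - 4 A C is certified in two halves, at unrelated primes: no root modulo one, and
-- modulo another a root with a rootless cubic cofactor, which leaves no room for two quadratic
-- factors.

open import Algebra.Bundles using (CommutativeRing; RawRing; RawGroup)
import Algebra.Definitions.RawMonoid as RawMonoidDefinitions
import Algebra.Properties.AbelianGroup as AbelianGroupProperties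
import Algebra.Properties.Group as GroupProperties
import Algebra.Properties.Ring as RingProperties
import Algebra.Properties.Semiring.Mult.TCOptimised as Mult
import Algebra.Solver.Ring as Solver
open import Algebra.Solver.Ring.AlmostCommutativeRing using (fromCommutativeRing; _-Raw-AlmostCommutative⟶_)
import Algebra.Solver.Ring.NaturalCoefficients.Default as SemiringSolver
import Data.Bool.Base as Bool
open import Data.Empty using (⊥; ⊥-elim)
open import Data.Fin.Base using (Fin; zero; suc; _↑ˡ_; _↑ʳ_)
open import Data.Integer.Base as ℤ using (ℤ; +_; -[1+_]; 0ℤ; 1ℤ)
import Data.Integer.Divisibility.Signed as ℤ
import Data.Integer.Properties as ℤ
open import Data.List.Base using (List; []; _∷_; _++_; length; map; filter; cartesianProductWith)
open import Data.List.Membership.Propositional using (_∈_)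
open import Data.List.Membership.Propositional.Properties using (∈-∃++; ∈-map⁺; ∈-map⁻; ∈-filter⁺; ∈-filter⁻; ∈-cartesianProductWith⁺; ∈-cartesianProductWith⁻; ∈-++⁺ˡ; ∈-++⁺ʳ; ∈-++⁻)
import Data.List.Properties as List
open import Data.List.Relation.Unary.All as All using ([]; _∷_)
import Data.List.Relation.Unary.All.Properties as All
open import Data.List.Relation.Unary.AllPairs using ([]; _∷_)
open import Data.List.Relation.Unary.Any using (here; there)
open import Data.List.Relation.Unary.Unique.Propositional using (Unique)
import Data.List.Relation.Unary.Unique.Propositional.Properties as Unique
open import Data.Maybe.Base using (Maybe; just; nothing; is-just)
open import Data.Nat.Base as N using (ℕ; zero; suc; z≤n; s≤s)
import Data.Nat.Coprimality as Coprimality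
import Data.Nat.DivMod as N
import Data.Nat.Divisibility as N
import Data.Nat.GCD as GCD
import Data.Nat.ListAction as List
open import Data.Nat.Primality using (Prime; prime⇒irreducible; ¬prime[0]; ¬prime[1])
open import Data.Nat.Primality.Factorisation using (PrimeFactorisation; factorise)
import Data.Nat.Properties as N
open import Data.Nat.Solver using () renaming (module +-*-Solver to NS)
open import Data.Product using (Σ-syntax; _×_; _,_; proj₁; proj₂)
open import Data.Rational.Base as ℚ using (ℚ; 0ℚ; 1ℚ)
import Data.Rational.Properties as ℚ
import Data.Rational.Unnormalised.Base as ℚᵘ
import Data.Rational.Unnormalised.Properties as ℚᵘ
open import Data.Sum.Base as Sum using (_⊎_; inj₁; inj₂; [_,_]; [_,_]′)
open import Data.Vec.Base using (Vec; []; _∷_; replicate)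
import Data.Vec.Base as Vec
open import Data.Vec.Functional using (Vector)
open import Data.Vec.N-ary using (N-ary; Eq; curryⁿ; curryⁿ-cong; _$ⁿ_)
import Data.Vec.Properties as Vec
open import Data.Vec.Relation.Binary.Pointwise.Inductive using (Pointwise; []; _∷_)
open import Data.Vec.Relation.Unary.All as VecAll using ([]; _∷_)
open import Defs
open import Function.Bundles using (_⇔_; mk⇔; Equivalence)
open import Level using (Level; 0ℓ)
open import Relation.Binary.Definitions using (Decidable; tri<; tri≈; tri>)
open import Relation.Binary.PropositionalEquality as ≡ using (_≡_; _≢_)
import Relation.Binary.Reasoning.Setoid as SetoidReasoning
open import Relation.Nullary using (¬_; Dec; yes; no; ¬?)
open import Relation.Unary using (Pred)
import Relation.Unary as Unary

-- A ring solver with integer coefficients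

-- The constant con (a , b) stands for the integer a - b.

data Expression (n : ℕ) : Set where
 :var : Fin n → Expression n
 con : ℕ × ℕ → Expression n
 _:+_ _:*_ : Expression n → Expression n → Expression n
 :-_ : Expression n → Expression n

infixl 7 _:+_ _:-_
infixl 8 _:*_
infix 9 :-_
infix 4 _:=_

_:-_ : ∀ {n} → Expression n → Expression n → Expression n
x :- y = x :+ (:- y)

_:=_ : ∀ {n} → Expression n → Expression n → Expression n × Expression n
_:=_ = _,_

:0 :1 :2 :4 : ∀ {n} → Expression n
:0 = con (0 , 0)
:1 = con (1 , 0)
:2 = con (2 , 0)
:4 = con (4 , 0)

-- Among the pairs that stand for an integer, the coefficients are those with a zero entry.

module IntegerSolver {c ℓ} (R : CommutativeRing c ℓ) where

 open CommutativeRing R hiding (zero)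
 open Mult semiring using (×-homo-+; ×1-homo-*) renaming (_×_ to _×ₙ_)
 open RingProperties ring using (-0#≈0#; -‿distribˡ-*; -‿distribʳ-*; -‿involutive)
 open AbelianGroupProperties +-abelianGroup using (⁻¹-∙-comm; xyx⁻¹≈y)
 open SetoidReasoning setoid

 private
  module S = SemiringSolver commutativeSemiring

  normalise : ℕ → ℕ → ℕ × ℕ
  normalise zero b = zero , b
  normalise (suc a) zero = suc a , zero
  normalise (suc a) (suc b) = normalise a b

  coefficients : RawRing _ _
  coefficients = record
   { Carrier = ℕ × ℕ
   ; _≈_ = _≡_
   ; _+_ = λ (a , b) (c , d) → normalise (a N.+ c) (b N.+ d)
   ; _*_ = λ (a , b) (c , d) → normalise (a N.* c N.+ b N.* d) (a N.* d N.+ b N.* c)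
   ; -_ = λ (a , b) → b , a
   ; 0# = 0 , 0
   ; 1# = 1 , 0
   }

  ι : ℕ → Carrier
  ι n = n ×ₙ 1#

  value : ℕ × ℕ → Carrier
  value (a , zero) = ι a
  value (a , suc b) = ι a - ι (suc b)

  value≈ : ∀ a b → value (a , b) ≈ ι a - ι b
  value≈ a zero = sym (trans (+-congˡ -0#≈0#) (+-identityʳ _))
  value≈ a (suc b) = refl

  pad : ∀ x y z → x - y ≈ (x + z) + (- y + - z)

  value-normalise : ∀ a b → value (normalise a b) ≈ ι a - ι b
  value-normalise zero b = value≈ zero b
  value-normalise (suc a) zero = value≈ (suc a) zero
  value-normalise (suc a) (suc b) = begin
   value (normalise a b) ≈⟨ value-normalise a b ⟩
   ι a - ι b ≈⟨ pad (ι a) (ι b) (ι 1) ⟩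
   (ι a + ι 1) + (- ι b + - ι 1) ≈⟨ +-cong (+-comm _ _) (trans (⁻¹-∙-comm _ _) (-‿cong (+-comm _ _))) ⟩
   (ι 1 + ι a) - (ι 1 + ι b) ≈⟨ +-cong (×-homo-+ 1# 1 a) (-‿cong (×-homo-+ 1# 1 b)) ⟨
   ι (suc a) - ι (suc b) ∎

  swap : ∀ w x y z → (w + x) + (y + z) ≈ (w + y) + (x + z)
  swap = S.solve 4 (λ w x y z → (w S.:+ x) S.:+ (y S.:+ z) S.:= (w S.:+ y) S.:+ (x S.:+ z)) refl

  pad x y z = sym (begin
   (x + z) + (- y + - z) ≈⟨ swap _ _ _ _ ⟩
   (x - y) + (z - z) ≈⟨ +-congˡ (-‿inverseʳ z) ⟩
   (x - y) + 0# ≈⟨ +-identityʳ _ ⟩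
   x - y ∎)

  +-homo : ∀ p q → value (RawRing._+_ coefficients p q) ≈ value p + value q
  +-homo (a , b) (c , d) = begin
   value (normalise (a N.+ c) (b N.+ d)) ≈⟨ value-normalise (a N.+ c) (b N.+ d) ⟩
   ι (a N.+ c) - ι (b N.+ d) ≈⟨ +-cong (×-homo-+ 1# a c) (-‿cong (×-homo-+ 1# b d)) ⟩
   (ι a + ι c) - (ι b + ι d) ≈⟨ +-congˡ (⁻¹-∙-comm (ι b) (ι d)) ⟨
   (ι a + ι c) + (- ι b + - ι d) ≈⟨ swap _ _ _ _ ⟩
   (ι a - ι b) + (ι c - ι d) ≈⟨ +-cong (value≈ a b) (value≈ c d) ⟨
   value (a , b) + value (c , d) ∎

  *-homo : ∀ p q → value (RawRing._*_ coefficients p q) ≈ value p * value q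
  *-homo (a , b) (c , d) = begin
   value (normalise (a N.* c N.+ b N.* d) (a N.* d N.+ b N.* c))
    ≈⟨ value-normalise (a N.* c N.+ b N.* d) (a N.* d N.+ b N.* c) ⟩
   ι (a N.* c N.+ b N.* d) - ι (a N.* d N.+ b N.* c)
    ≈⟨ +-cong (mult a c b d) (-‿cong (mult a d b c)) ⟩
   (ι a * ι c + ι b * ι d) - (ι a * ι d + ι b * ι c)
    ≈⟨ +-cong (+-congˡ (neg² (ι b) (ι d)))
       (trans (sym (⁻¹-∙-comm _ _)) (+-cong (-‿distribʳ-* _ _) (-‿distribˡ-* _ _))) ⟩
   (ι a * ι c + (- ι b) * (- ι d)) + (ι a * (- ι d) + (- ι b) * ι c)
    ≈⟨ S.solve 4 (λ a b c d → (a S.:* c S.:+ b S.:* d) S.:+ (a S.:* d S.:+ b S.:* c)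
            S.:= (a S.:+ b) S.:* (c S.:+ d)) refl _ _ _ _ ⟩
   (ι a - ι b) * (ι c - ι d) ≈⟨ *-cong (value≈ a b) (value≈ c d) ⟨
   value (a , b) * value (c , d) ∎
   where
   mult : ∀ a c b d → ι (a N.* c N.+ b N.* d) ≈ ι a * ι c + ι b * ι d
   mult a c b d = trans (×-homo-+ 1# (a N.* c) (b N.* d)) (+-cong (×1-homo-* a c) (×1-homo-* b d))
   neg² : ∀ x y → x * y ≈ (- x) * (- y)
   neg² x y = begin
    x * y ≈⟨ -‿involutive (x * y) ⟨
    - (- (x * y)) ≈⟨ -‿cong (-‿distribʳ-* x y) ⟩
    - (x * - y) ≈⟨ -‿distribˡ-* x (- y) ⟩
    (- x) * (- y) ∎

  -‿homo : ∀ p → value (RawRing.-_ coefficients p) ≈ - value p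
  -‿homo (a , b) = begin
   value (b , a) ≈⟨ value≈ b a ⟩
   ι b - ι a ≈⟨ +-comm _ _ ⟩
   - ι a + ι b ≈⟨ +-congˡ (-‿involutive (ι b)) ⟨
   - ι a + - (- ι b) ≈⟨ ⁻¹-∙-comm _ _ ⟩
   - (ι a - ι b) ≈⟨ -‿cong (value≈ a b) ⟨
   - value (a , b) ∎

  morphism : coefficients -Raw-AlmostCommutative⟶ fromCommutativeRing R
  morphism = record
   { ⟦_⟧ = value
   ; +-homo = +-homo
   ; *-homo = *-homo
   ; -‿homo = -‿homo
   ; 0-homo = refl
   ; 1-homo = refl
   }

  _≟_ : ∀ p q → Maybe (value p ≈ value q)
  (a , b) ≟ (c , d) with a N.+ d N.≟ c N.+ b
  ... | no _ = nothing
  ... | yes e = just (begin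
   value (a , b) ≈⟨ value≈ a b ⟩
   ι a - ι b ≈⟨ pad (ι a) (ι b) (ι d) ⟩
   (ι a + ι d) + (- ι b + - ι d) ≈⟨ +-congʳ (×-homo-+ 1# a d) ⟨
   ι (a N.+ d) + (- ι b + - ι d) ≡⟨ ≡.cong (λ n → ι n + (- ι b + - ι d)) e ⟩
   ι (c N.+ b) + (- ι b + - ι d) ≈⟨ +-cong (×-homo-+ 1# c b) (+-comm _ _) ⟩
   (ι c + ι b) + (- ι d + - ι b) ≈⟨ pad (ι c) (ι d) (ι b) ⟨
   ι c - ι d ≈⟨ value≈ c d ⟨
   value (c , d) ∎)

  module P = Solver coefficients (fromCommutativeRing R) morphism _≟_

  polynomial : ∀ {n} → Expression n → P.Polynomial n
  polynomial (:var i) = P.var i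
  polynomial (con c) = P.con c
  polynomial (p :+ q) = polynomial p P.:+ polynomial q
  polynomial (p :* q) = polynomial p P.:* polynomial q
  polynomial (:- p) = P.:- polynomial p

  sameNormalForm : ∀ {n} (p q : P.Polynomial n) → Maybe (P.normalise p P.≈N P.normalise q)
  sameNormalForm p q = P.normalise p P.≟N P.normalise q

  sameNormalForm⇒≈ : ∀ {n} (p q : P.Polynomial n) → Bool.T (is-just (sameNormalForm p q)) → ∀ ρ → P.⟦ p ⟧ ρ ≈ P.⟦ q ⟧ ρ
  sameNormalForm⇒≈ p q t ρ with sameNormalForm p q
  ... | just e = trans (sym (P.correct p ρ)) (trans (P.⟦ e ⟧N-cong ρ) (P.correct q ρ))

 -- The hidden argument reduces to the unit type when the two normal forms agree, so it is filled in
 -- by eta; when they differ it reduces to the empty type and the call is rejected.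
 solve : ∀ n (f : N-ary n (Expression n) (Expression n × Expression n)) →
  let sides = f $ⁿ Vec.map :var (Vec.allFin n) ; lhs = polynomial (proj₁ sides) ; rhs = polynomial (proj₂ sides) in
  {Bool.T (is-just (sameNormalForm lhs rhs))} → Eq n _≈_ (curryⁿ P.⟦ lhs ⟧) (curryⁿ P.⟦ rhs ⟧)
 solve n f {t} = curryⁿ-cong _≈_ P.⟦ polynomial (proj₁ sides) ⟧ P.⟦ polynomial (proj₂ sides) ⟧
  (sameNormalForm⇒≈ (polynomial (proj₁ sides)) (polynomial (proj₂ sides)) t)
  where
  sides = f $ⁿ Vec.map :var (Vec.allFin n)

-- Ring homomorphisms, divisibility, quotients and discrete fields

record RingHom {c ℓ c′ ℓ′} (R : CommutativeRing c ℓ) (S : CommutativeRing c′ ℓ′) :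
        Set (c Level.⊔ ℓ Level.⊔ c′ Level.⊔ ℓ′) where
 private
  module R = CommutativeRing R
  module S = CommutativeRing S
 field
  ⟦_⟧ : R.Carrier → S.Carrier
  ⟦⟧-cong : ∀ {x y} → x R.≈ y → ⟦ x ⟧ S.≈ ⟦ y ⟧
  +-homo : ∀ x y → ⟦ x R.+ y ⟧ S.≈ ⟦ x ⟧ S.+ ⟦ y ⟧
  *-homo : ∀ x y → ⟦ x R.* y ⟧ S.≈ ⟦ x ⟧ S.* ⟦ y ⟧
  1-homo : ⟦ R.1# ⟧ S.≈ S.1#

 open GroupProperties S.+-group using (identityˡ-unique; inverseˡ-unique)

 0-homo : ⟦ R.0# ⟧ S.≈ S.0#
 0-homo = identityˡ-unique ⟦ R.0# ⟧ ⟦ R.0# ⟧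
  (S.trans (S.sym (+-homo R.0# R.0#)) (⟦⟧-cong (R.+-identityˡ R.0#)))

 -‿homo : ∀ x → ⟦ R.- x ⟧ S.≈ S.- ⟦ x ⟧
 -‿homo x = inverseˡ-unique ⟦ R.- x ⟧ ⟦ x ⟧
  (S.trans (S.sym (+-homo (R.- x) x)) (S.trans (⟦⟧-cong (R.-‿inverseˡ x)) 0-homo))

 sub-homo : ∀ x y → ⟦ x R.- y ⟧ S.≈ ⟦ x ⟧ S.- ⟦ y ⟧
 sub-homo x y = S.trans (+-homo x (R.- y)) (S.+-congˡ (-‿homo y))

identityHom : ∀ {c ℓ} (R : CommutativeRing c ℓ) → RingHom R R
identityHom R = record
 { ⟦_⟧ = λ x → x ; ⟦⟧-cong = λ e → e ; +-homo = λ _ _ → refl ; *-homo = λ _ _ → refl ; 1-homo = refl }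
 where open CommutativeRing R

composeHom : ∀ {a b c d e f} {R : CommutativeRing a b} {S : CommutativeRing c d} {T : CommutativeRing e f} →
       RingHom S T → RingHom R S → RingHom R T
composeHom {T = T} ψ φ = record
 { ⟦_⟧ = λ x → Ψ.⟦ Φ.⟦ x ⟧ ⟧
 ; ⟦⟧-cong = λ e → Ψ.⟦⟧-cong (Φ.⟦⟧-cong e)
 ; +-homo = λ x y → trans (Ψ.⟦⟧-cong (Φ.+-homo x y)) (Ψ.+-homo _ _)
 ; *-homo = λ x y → trans (Ψ.⟦⟧-cong (Φ.*-homo x y)) (Ψ.*-homo _ _)
 ; 1-homo = trans (Ψ.⟦⟧-cong Φ.1-homo) Ψ.1-homo
 }
 where
 open CommutativeRing T using (trans)
 module Ψ = RingHom ψ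
 module Φ = RingHom φ

polyRing : ∀ {c ℓ} → CommutativeRing c ℓ → CommutativeRing c ℓ
polyRing R = Polynomials.polynomialRing R

module Divisibility {c ℓ} (R : CommutativeRing c ℓ) where

 open CommutativeRing R
 open IntegerSolver R
 open SetoidReasoning setoid

 infix 4 _∣_

 record _∣_ (a b : Carrier) : Set (c Level.⊔ ℓ) where
  constructor divides
  field
   quotient : Carrier
   equality : b ≈ quotient * a

 open _∣_ public

 ∣-refl : ∀ {a} → a ∣ a
 ∣-refl = divides 1# (sym (*-identityˡ _))

 ∣-trans : ∀ {a b c} → a ∣ b → b ∣ c → a ∣ c
 ∣-trans (divides q e) (divides r f) = divides (r * q) (trans f (trans (*-congˡ e) (sym (*-assoc r q _))))

 ∣-respʳ : ∀ {a b c} → b ≈ c → a ∣ b → a ∣ c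
 ∣-respʳ e (divides q f) = divides q (trans (sym e) f)

 ∣-respˡ : ∀ {a b c} → a ≈ b → a ∣ c → b ∣ c
 ∣-respˡ e (divides q f) = divides q (trans f (*-congˡ e))

 ∣0 : ∀ {a} → a ∣ 0#
 ∣0 {a} = divides 0# (sym (zeroˡ a))

 ∣-+ : ∀ {a b c} → a ∣ b → a ∣ c → a ∣ b + c
 ∣-+ {a} (divides q e) (divides r f) = divides (q + r) (trans (+-cong e f) (sym (distribʳ a q r)))

 ∣-*ˡ : ∀ {a b} c → a ∣ b → a ∣ c * b
 ∣-*ˡ c (divides q e) = divides (c * q) (trans (*-congˡ e) (sym (*-assoc c q _)))

 ∣-*ʳ : ∀ {a b} c → a ∣ b → a ∣ b * c
 ∣-*ʳ c d = ∣-respʳ (*-comm c _) (∣-*ˡ c d)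

 ∣-neg : ∀ {a b} → a ∣ b → a ∣ - b
 ∣-neg {a} (divides q e) = divides (- q) (trans (-‿cong e) (solve 2 (λ q a → :- (q :* a) := (:- q) :* a) q a))

NoZeroDivisors : ∀ {c ℓ} → CommutativeRing c ℓ → Set (c Level.⊔ ℓ)
NoZeroDivisors R = ∀ a b → a * b ≈ 0# → a ≈ 0# ⊎ b ≈ 0#
 where open CommutativeRing R

-- Residues modulo m, represented by the elements of R themselves.

module Quotient {c ℓ} (R : CommutativeRing c ℓ) (m : CommutativeRing.Carrier R) where

 open CommutativeRing R
 open IntegerSolver R
 open Divisibility R

 infix 4 _≈ᵐ_

 record _≈ᵐ_ (x y : Carrier) : Set (c Level.⊔ ℓ) where
  constructor mod
  field m∣- : m ∣ x - y

 open _≈ᵐ_ public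

 embed : ∀ {x y} → x ≈ y → x ≈ᵐ y
 embed {x} {y} e = mod (∣-respʳ (sym (trans (+-congʳ e) (-‿inverseʳ y))) ∣0)

 ∣⇒≈0 : ∀ {x} → m ∣ x → x ≈ᵐ 0#
 ∣⇒≈0 {x} d = mod (∣-respʳ (solve 1 (λ x → x := x :- :0) x) d)

 ≈0⇒∣ : ∀ {x} → x ≈ᵐ 0# → m ∣ x
 ≈0⇒∣ {x} (mod d) = ∣-respʳ (solve 1 (λ x → x :- :0 := x) x) d

 private
  sym′ : ∀ {x y} → x ≈ᵐ y → y ≈ᵐ x
  sym′ {x} {y} (mod d) = mod (∣-respʳ (solve 2 (λ x y → :- (x :- y) := y :- x) x y) (∣-neg d))

  trans′ : ∀ {x y z} → x ≈ᵐ y → y ≈ᵐ z → x ≈ᵐ z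
  trans′ {x} {y} {z} (mod d) (mod e) =
   mod (∣-respʳ (solve 3 (λ x y z → (x :- y) :+ (y :- z) := x :- z) x y z) (∣-+ d e))

  +-cong′ : ∀ {x y z w} → x ≈ᵐ y → z ≈ᵐ w → x + z ≈ᵐ y + w
  +-cong′ {x} {y} {z} {w} (mod d) (mod e) =
   mod (∣-respʳ (solve 4 (λ x y z w → (x :- y) :+ (z :- w) := (x :+ z) :- (y :+ w)) x y z w) (∣-+ d e))

  *-cong′ : ∀ {x y z w} → x ≈ᵐ y → z ≈ᵐ w → x * z ≈ᵐ y * w
  *-cong′ {x} {y} {z} {w} (mod d) (mod e) =
   mod (∣-respʳ (solve 4 (λ x y z w → (x :- y) :* z :+ y :* (z :- w) := x :* z :- y :* w) x y z w)
          (∣-+ (∣-*ʳ z d) (∣-*ˡ y e)))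

  neg-cong′ : ∀ {x y} → x ≈ᵐ y → - x ≈ᵐ - y
  neg-cong′ {x} {y} (mod d) = mod (∣-respʳ (solve 2 (λ x y → :- (x :- y) := (:- x) :- (:- y)) x y) (∣-neg d))

 quotientRing : CommutativeRing c (c Level.⊔ ℓ)
 quotientRing = record
  { Carrier = Carrier
  ; _≈_ = _≈ᵐ_
  ; _+_ = _+_
  ; _*_ = _*_
  ; -_ = -_
  ; 0# = 0#
  ; 1# = 1#
  ; isCommutativeRing = record
   { isRing = record
    { +-isAbelianGroup = record
     { isGroup = record
      { isMonoid = record
       { isSemigroup = record
        { isMagma = record
         { isEquivalence = record { refl = embed refl ; sym = sym′ ; trans = trans′ }
         ; ∙-cong = +-cong′
         }
        ; assoc = λ x y z → embed (+-assoc x y z)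
        }
       ; identity = (λ x → embed (+-identityˡ x)) , (λ x → embed (+-identityʳ x))
       }
      ; inverse = (λ x → embed (-‿inverseˡ x)) , (λ x → embed (-‿inverseʳ x))
      ; ⁻¹-cong = neg-cong′
      }
     ; comm = λ x y → embed (+-comm x y)
     }
    ; *-cong = *-cong′
    ; *-assoc = λ x y z → embed (*-assoc x y z)
    ; *-identity = (λ x → embed (*-identityˡ x)) , (λ x → embed (*-identityʳ x))
    ; distrib = (λ x y z → embed (distribˡ x y z)) , (λ x y z → embed (distribʳ x y z))
    }
   ; *-comm = λ x y → embed (*-comm x y)
   }
  }

 projection : RingHom R quotientRing
 projection = record
  { ⟦_⟧ = λ x → x
  ; ⟦⟧-cong = embed
  ; +-homo = λ _ _ → embed refl
  ; *-homo = λ _ _ → embed refl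
  ; 1-homo = embed refl
  }

-- `invert` answers two questions at once: whether an element is zero and, if not, what its inverse
-- is. Decidable equality and the absence of zero divisors are derived from it.
record DiscreteField c ℓ : Set (Level.suc (c Level.⊔ ℓ)) where
 field commutativeRing : CommutativeRing c ℓ
 open CommutativeRing commutativeRing public
 field
  invert : ∀ a → a ≈ 0# ⊎ Σ[ b ∈ Carrier ] b * a ≈ 1#
  1≉0 : ¬ (1# ≈ 0#)

 open GroupProperties +-group using (x∙y⁻¹≈ε⇒x≈y; x≈y⇒x∙y⁻¹≈ε)
 open SetoidReasoning setoid

 zero? : ∀ a → Dec (a ≈ 0#)
 zero? a with invert a
 ... | inj₁ e = yes e
 ... | inj₂ (b , e) = no λ a≈0 → 1≉0 (trans (sym e) (trans (*-congˡ a≈0) (zeroʳ b)))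

 _≟_ : Decidable _≈_
 x ≟ y with zero? (x - y)
 ... | yes e = yes (x∙y⁻¹≈ε⇒x≈y x y e)
 ... | no ne = no λ e → ne (x≈y⇒x∙y⁻¹≈ε e)

 inverse : ∀ {a} → ¬ (a ≈ 0#) → Σ[ b ∈ Carrier ] b * a ≈ 1#
 inverse {a} a≉0 with invert a
 ... | inj₁ e = ⊥-elim (a≉0 e)
 ... | inj₂ i = i

 cancelˡ : ∀ a {x} → ¬ (a ≈ 0#) → a * x ≈ 0# → x ≈ 0#
 cancelˡ a {x} a≉0 e with inverse a≉0
 ... | b , ba≈1 = begin
  x ≈⟨ *-identityˡ x ⟨
  1# * x ≈⟨ *-congʳ ba≈1 ⟨
  b * a * x ≈⟨ *-assoc b a x ⟩
  b * (a * x) ≈⟨ *-congˡ e ⟩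
  b * 0# ≈⟨ zeroʳ b ⟩
  0# ∎

 noZeroDivisors : ∀ a b → a * b ≈ 0# → a ≈ 0# ⊎ b ≈ 0#
 noZeroDivisors a b e with zero? a
 ... | yes a≈0 = inj₁ a≈0
 ... | no a≉0 = inj₂ (cancelˡ a a≉0 e)

 domain : DiscreteDomain c ℓ
 domain = record
  { commutativeRing = commutativeRing ; _≟_ = _≟_ ; noZeroDivisors = noZeroDivisors ; 1≉0 = 1≉0 }

module DomainProperties {c ℓ} (D : DiscreteDomain c ℓ) where

 open DiscreteDomain D
 open IntegerSolver commutativeRing
 open GroupProperties +-group using (x∙y⁻¹≈ε⇒x≈y)

 *-≉0 : ∀ {a b} → ¬ (a ≈ 0#) → ¬ (b ≈ 0#) → ¬ (a * b ≈ 0#)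
 *-≉0 {a} {b} a≉0 b≉0 e with noZeroDivisors a b e
 ... | inj₁ a≈0 = a≉0 a≈0
 ... | inj₂ b≈0 = b≉0 b≈0

 cancel-≈0 : ∀ a {x} → ¬ (a ≈ 0#) → a * x ≈ 0# → x ≈ 0#
 cancel-≈0 a {x} a≉0 e with noZeroDivisors a x e
 ... | inj₁ a≈0 = ⊥-elim (a≉0 a≈0)
 ... | inj₂ x≈0 = x≈0

 square-≈0 : ∀ {x} → x * x ≈ 0# → x ≈ 0#
 square-≈0 {x} e with noZeroDivisors x x e
 ... | inj₁ x≈0 = x≈0
 ... | inj₂ x≈0 = x≈0

 *-cancel : ∀ a {x y} → ¬ (a ≈ 0#) → a * x ≈ a * y → x ≈ y
 *-cancel a {x} {y} a≉0 e = x∙y⁻¹≈ε⇒x≈y x y (cancel-≈0 a a≉0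
  (trans (solve 3 (λ a x y → a :* (x :- y) := a :* x :- a :* y) a x y)
  (trans (+-congʳ e) (-‿inverseʳ _))))

polyDomain : ∀ {c ℓ} → DiscreteDomain c ℓ → DiscreteDomain c ℓ
polyDomain D = record
 { commutativeRing = polyRing commutativeRing
 ; _≟_ = Polynomials.≋-dec commutativeRing _≟_
 ; noZeroDivisors = Polynomials.✶-noZeroDivisors commutativeRing _≟_ (λ {a} {b} → noZeroDivisors a b)
 ; 1≉0 = Polynomials.one≉0 commutativeRing 1≉0
 }
 where open DiscreteDomain D

-- Homomorphisms, evaluation and degrees of polynomials

module _ {c ℓ} (R : CommutativeRing c ℓ) where

 open CommutativeRing R
 open Polynomials R
 open SetoidReasoning ≋-setoid

 constantHom : RingHom R (polyRing R)
 constantHom = record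
  { ⟦_⟧ = λ a → a ∷ []
  ; ⟦⟧-cong = λ e → ∷-cong e ≋-refl
  ; +-homo = λ _ _ → ≋-refl
  ; *-homo = λ a b → ∷-cong (sym (+-identityʳ _)) ≋-refl
  ; 1-homo = ≋-refl
  }

module _ {c ℓ c′ ℓ′} {R : CommutativeRing c ℓ} {S : CommutativeRing c′ ℓ′} (φ : RingHom R S) where

 open RingHom φ
 private
  module R = CommutativeRing R
  module S = CommutativeRing S
  module P = Polynomials R
  module Q = Polynomials S

 coeff-map : ∀ p n → Q.coeff (map ⟦_⟧ p) n S.≈ ⟦ P.coeff p n ⟧
 coeff-map [] n = S.sym 0-homo
 coeff-map (a ∷ p) zero = S.refl
 coeff-map (a ∷ p) (suc n) = coeff-map p n

 private
  map-⊹ : ∀ p q → map ⟦_⟧ (p P.⊹ q) Q.≋ map ⟦_⟧ p Q.⊹ map ⟦_⟧ q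
  map-⊹ [] q = Q.≋-refl
  map-⊹ (a ∷ p) [] = Q.≋-refl
  map-⊹ (a ∷ p) (b ∷ q) = Q.∷-cong (+-homo a b) (map-⊹ p q)

  map-· : ∀ a p → map ⟦_⟧ (a P.· p) Q.≋ ⟦ a ⟧ Q.· map ⟦_⟧ p
  map-· a [] = Q.≋-refl
  map-· a (b ∷ p) = Q.∷-cong (*-homo a b) (map-· a p)

  map-✶ : ∀ p q → map ⟦_⟧ (p P.✶ q) Q.≋ map ⟦_⟧ p Q.✶ map ⟦_⟧ q
  map-✶ [] q = Q.≋-refl
  map-✶ (a ∷ p) q = Q.≋-trans (map-⊹ (a P.· q) (P.shift (p P.✶ q)))
            (Q.⊹-cong (map-· a q) (Q.∷-cong 0-homo (map-✶ p q)))

 polyHom : RingHom (polyRing R) (polyRing S)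
 polyHom = record
  { ⟦_⟧ = map ⟦_⟧
  ; ⟦⟧-cong = λ {p} {q} e → Q.mk≋ λ n →
    S.trans (coeff-map p n) (S.trans (⟦⟧-cong (P.at e n)) (S.sym (coeff-map q n)))
  ; +-homo = map-⊹
  ; *-homo = map-✶
  ; 1-homo = Q.∷-cong 1-homo Q.≋-refl
  }

-- The coefficients pass through φ first, so that one construction serves for values at field
-- elements, at polynomials and at elements of a function field.
module Evaluation {c ℓ c′ ℓ′} {R : CommutativeRing c ℓ} {S : CommutativeRing c′ ℓ′}
 (φ : RingHom R S) (a : CommutativeRing.Carrier S) where

 open RingHom φ
 private
  module R = CommutativeRing R
  module P = Polynomials R
 open CommutativeRing S
 open IntegerSolver S
 open SetoidReasoning setoid

 eval : P.Poly → Carrier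
 eval [] = 0#
 eval (b ∷ p) = ⟦ b ⟧ + a * eval p

 private
  eval-0 : ∀ p → p P.≋ [] → eval p ≈ 0#
  eval-0 [] e = refl
  eval-0 (b ∷ p) e = begin
   ⟦ b ⟧ + a * eval p ≈⟨ +-cong (trans (⟦⟧-cong (P.at e 0)) 0-homo) (*-congˡ (eval-0 p (P.mk≋ λ n → P.at e (suc n)))) ⟩
   0# + a * 0# ≈⟨ solve 1 (λ a → :0 :+ a :* :0 := :0) a ⟩
   0# ∎

  eval-cong : ∀ p q → p P.≋ q → eval p ≈ eval q
  eval-cong [] q e = sym (eval-0 q (P.≋-sym e))
  eval-cong (b ∷ p) [] e = eval-0 (b ∷ p) e
  eval-cong (b ∷ p) (d ∷ q) e = +-cong (⟦⟧-cong (P.at e 0)) (*-congˡ (eval-cong p q (P.≋-tail e)))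

  eval-⊹ : ∀ p q → eval (p P.⊹ q) ≈ eval p + eval q
  eval-⊹ [] q = sym (+-identityˡ _)
  eval-⊹ (b ∷ p) [] = sym (+-identityʳ _)
  eval-⊹ (b ∷ p) (d ∷ q) = begin
   ⟦ b R.+ d ⟧ + a * eval (p P.⊹ q) ≈⟨ +-cong (+-homo b d) (*-congˡ (eval-⊹ p q)) ⟩
   (⟦ b ⟧ + ⟦ d ⟧) + a * (eval p + eval q)
    ≈⟨ solve 5 (λ b d a p q → (b :+ d) :+ a :* (p :+ q) := (b :+ a :* p) :+ (d :+ a :* q)) _ _ _ _ _ ⟩
   (⟦ b ⟧ + a * eval p) + (⟦ d ⟧ + a * eval q) ∎

  eval-· : ∀ d p → eval (d P.· p) ≈ ⟦ d ⟧ * eval p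
  eval-· d [] = sym (zeroʳ _)
  eval-· d (b ∷ p) = begin
   ⟦ d R.* b ⟧ + a * eval (d P.· p) ≈⟨ +-cong (*-homo d b) (*-congˡ (eval-· d p)) ⟩
   ⟦ d ⟧ * ⟦ b ⟧ + a * (⟦ d ⟧ * eval p)
    ≈⟨ solve 4 (λ d b a p → d :* b :+ a :* (d :* p) := d :* (b :+ a :* p)) _ _ _ _ ⟩
   ⟦ d ⟧ * (⟦ b ⟧ + a * eval p) ∎

  eval-✶ : ∀ p q → eval (p P.✶ q) ≈ eval p * eval q
  eval-✶ [] q = sym (zeroˡ _)
  eval-✶ (b ∷ p) q = begin
   eval (b P.· q P.⊹ P.shift (p P.✶ q)) ≈⟨ eval-⊹ (b P.· q) _ ⟩
   eval (b P.· q) + (⟦ R.0# ⟧ + a * eval (p P.✶ q)) ≈⟨ +-cong (eval-· b q) (+-cong 0-homo (*-congˡ (eval-✶ p q))) ⟩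
   ⟦ b ⟧ * eval q + (0# + a * (eval p * eval q))
    ≈⟨ solve 4 (λ b q a p → b :* q :+ (:0 :+ a :* (p :* q)) := (b :+ a :* p) :* q) _ _ _ _ ⟩
   (⟦ b ⟧ + a * eval p) * eval q ∎

 evalHom : RingHom (polyRing R) S
 evalHom = record
  { ⟦_⟧ = eval
  ; ⟦⟧-cong = λ {p} {q} → eval-cong p q
  ; +-homo = eval-⊹
  ; *-homo = eval-✶
  ; 1-homo = begin
    ⟦ R.1# ⟧ + a * 0# ≈⟨ +-cong 1-homo (zeroʳ a) ⟩
    1# + 0# ≈⟨ +-identityʳ 1# ⟩
    1# ∎
  }

module Degrees {c ℓ} (R : CommutativeRing c ℓ) where

 open CommutativeRing R
 open Polynomials R
 open RingProperties ring using (-0#≈0#)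
 open IntegerSolver R

 infix 4 _⊏_

 -- deg p < n
 _⊏_ : Poly → ℕ → Set ℓ
 p ⊏ n = ∀ m → n N.≤ m → coeff p m ≈ 0#

 -- deg p ≤ n, and a (possibly 0) is the coefficient of degree n
 record Top (p : Poly) (n : ℕ) (a : Carrier) : Set ℓ where
  constructor top
  field
   below : p ⊏ suc n
   lead : coeff p n ≈ a

 open Top public

 ⊏-length : ∀ p → p ⊏ length p
 ⊏-length [] m _ = refl
 ⊏-length (a ∷ p) (suc m) (s≤s n≤m) = ⊏-length p m n≤m

 ⊏-weaken : ∀ {p m n} → m N.≤ n → p ⊏ m → p ⊏ n
 ⊏-weaken m≤n b k n≤k = b k (N.≤-trans m≤n n≤k)

 ⊏-resp : ∀ {p q n} → p ≋ q → p ⊏ n → q ⊏ n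
 ⊏-resp e b m n≤m = trans (sym (at e m)) (b m n≤m)

 ⊏0⇒≋[] : ∀ {p} → p ⊏ 0 → p ≋ []
 ⊏0⇒≋[] b = mk≋ λ n → b n z≤n

 []⊏ : ∀ {n} → [] ⊏ n
 []⊏ _ _ = refl

 ⊏-⊹ : ∀ {p q n} → p ⊏ n → q ⊏ n → p ⊹ q ⊏ n
 ⊏-⊹ {p} {q} b b′ m n≤m = trans (coeff-⊹ p q m) (trans (+-cong (b m n≤m) (b′ m n≤m)) (+-identityˡ 0#))

 ⊏-⊟ : ∀ {p n} → p ⊏ n → ⊟ p ⊏ n
 ⊏-⊟ {p} b m n≤m = trans (coeff-⊟ p m) (trans (-‿cong (b m n≤m)) -0#≈0#)

 ⊏-· : ∀ {a p n} → p ⊏ n → a · p ⊏ n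
 ⊏-· {a} {p} b m n≤m = trans (coeff-· a p m) (trans (*-congˡ (b m n≤m)) (zeroʳ a))

 ⊏-∷ : ∀ {a p n} → p ⊏ n → a ∷ p ⊏ suc n
 ⊏-∷ b (suc m) (s≤s n≤m) = b m n≤m

 ⊏-tail : ∀ {a p n} → a ∷ p ⊏ suc n → p ⊏ n
 ⊏-tail b m n≤m = b (suc m) (s≤s n≤m)

 ⊏-✶ : ∀ p q m n → p ⊏ m → q ⊏ suc n → p ✶ q ⊏ m N.+ n
 ⊏-✶ p q zero n b b′ = ⊏-resp (≋-sym (✶-zeroˡ p q (⊏0⇒≋[] b))) []⊏
 ⊏-✶ [] q (suc m) n b b′ = []⊏
 ⊏-✶ (a ∷ p) q (suc m) n b b′ =
  ⊏-⊹ {a · q} (⊏-· {a} {q} (⊏-weaken {q} (s≤s (N.m≤n+m n m)) b′))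
    (⊏-∷ {0#} {p ✶ q} (⊏-✶ p q m n (⊏-tail {a} {p} b) b′))

 private
  coeff-✶ : ∀ p q m n → p ⊏ suc m → q ⊏ suc n → coeff (p ✶ q) (m N.+ n) ≈ coeff p m * coeff q n
  coeff-✶ [] q m n b b′ = sym (zeroˡ _)
  coeff-✶ (a ∷ p) q zero n b b′ =
   trans (coeff-⊹ (a · q) (shift (p ✶ q)) n)
   (trans (+-cong (coeff-· a q n) (at (≋-trans (shift-cong (✶-zeroˡ p q (⊏0⇒≋[] (⊏-tail {a} {p} b)))) shift-0) n))
   (+-identityʳ _))
  coeff-✶ (a ∷ p) q (suc m) n b b′ =
   trans (coeff-⊹ (a · q) (shift (p ✶ q)) (suc (m N.+ n)))
   (trans (+-cong (⊏-· {a} {q} b′ (suc (m N.+ n)) (s≤s (N.m≤n+m n m)))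
           (coeff-✶ p q m n (⊏-tail {a} {p} b) b′))
   (+-identityˡ _))

 Top-✶ : ∀ {p q m n a b} → Top p m a → Top q n b → Top (p ✶ q) (m N.+ n) (a * b)
 Top-✶ {p} {q} {m} {n} (top b e) (top b′ e′) =
  top (⊏-✶ p q (suc m) n b b′) (trans (coeff-✶ p q m n b b′) (*-cong e e′))

 Top-⊹ : ∀ {p q n a b} → Top p n a → Top q n b → Top (p ⊹ q) n (a + b)
 Top-⊹ {p} {q} {n} (top b e) (top b′ e′) = top (⊏-⊹ {p} b b′) (trans (coeff-⊹ p q n) (+-cong e e′))

 Top-⊟ : ∀ {p n a} → Top p n a → Top (⊟ p) n (- a)
 Top-⊟ {p} {n} (top b e) = top (⊏-⊟ {p} b) (trans (coeff-⊟ p n) (-‿cong e))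

 Top-· : ∀ {p n a} d → Top p n a → Top (d · p) n (d * a)
 Top-· {p} {n} d (top b e) = top (⊏-· {d} {p} b) (trans (coeff-· d p n) (*-congˡ e))

 Top-0 : ∀ {p m} n → m N.≤ n → p ⊏ m → Top p n 0#
 Top-0 {p} n m≤n b = top (⊏-weaken {p} (N.m≤n⇒m≤1+n m≤n) b) (b n m≤n)

 Top-weaken : ∀ {p m a} n → m N.< n → Top p m a → Top p n 0#
 Top-weaken {p} n m<n t = Top-0 {p} n m<n (below t)

 Top-resp : ∀ {p q n a b} → p ≋ q → a ≈ b → Top p n a → Top q n b
 Top-resp {p} {q} {n} e f (top b g) = top (⊏-resp {p} e b) (trans (sym (at e n)) (trans g f))

 Top-∷ : ∀ {a p n b} → Top p n b → Top (a ∷ p) (suc n) b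
 Top-∷ {a} {p} (top b e) = top (⊏-∷ {a} {p} b) e

 Top-const : ∀ {a} → Top (a ∷ []) 0 a
 Top-const {a} = top (⊏-∷ {a} {[]} []⊏) refl

 const⇒ : ∀ {p} → p ⊏ 1 → p ≋ coeff p 0 ∷ []
 const⇒ {p} b = mk≋ λ { zero → refl ; (suc n) → b (suc n) (s≤s z≤n) }

module SyntheticDivision {c ℓ} (R : CommutativeRing c ℓ) (κ : CommutativeRing.Carrier R) where

 open CommutativeRing R hiding (zero)
 open Polynomials R
 open Degrees R
 open IntegerSolver R
 open Evaluation (identityHom R) κ public
 private
  module S = IntegerSolver polynomialRing

 X-κ : Poly
 X-κ = (- κ) ∷ 1# ∷ []

 X-κ-✶ : ∀ p → X-κ ✶ p ≋ (- κ) · p ⊹ shift p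
 X-κ-✶ p = ⊹-cong ≋-refl (shift-cong (≋-trans (⊹-cong (·-identityˡ p) shift-0) (⊹-identityʳ p)))

 -- Horner's scheme: the partial values met while evaluating at κ are the coefficients of the
 -- quotient by X - κ. The quotient has as many entries as the dividend, the last one being 0.
 quot : Poly → Poly
 quot [] = []
 quot (a ∷ f) = eval f ∷ quot f

 division : ∀ f → f ≋ X-κ ✶ quot f ⊹ (eval f ∷ [])
 division f = ≋-trans (lemma f) (⊹-cong (≋-sym (X-κ-✶ (quot f))) ≋-refl)
  where
  lemma : ∀ f → f ≋ ((- κ) · quot f ⊹ shift (quot f)) ⊹ (eval f ∷ [])
  lemma [] = mk≋ λ { zero → sym (+-identityˡ 0#) ; (suc n) → refl }
  lemma (a ∷ f) = ∷-cong
   (solve 3 (λ a κ ρ → a := (:- κ) :* ρ :+ :0 :+ (a :+ κ :* ρ)) a κ (eval f))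
   (≋-trans (lemma f) (≋-trans
    (S.solve 3 (λ u v w → (u :+ v) :+ w := u :+ (v :+ w)) ((- κ) · quot f) (shift (quot f)) (eval f ∷ []))
    (≋-trans (⊹-cong (≋-refl {(- κ) · quot f}) shifted) (≋-sym (⊹-identityʳ _)))))
   where
   shifted : shift (quot f) ⊹ (eval f ∷ []) ≋ eval f ∷ quot f
   shifted = ∷-cong (+-identityˡ _) (⊹-identityʳ _)

 factor : ∀ f → eval f ≈ 0# → f ≋ X-κ ✶ quot f
 factor f e = ≋-trans (division f) (≋-trans (⊹-cong ≋-refl (≋-trans (∷-cong e ≋-refl) shift-0)) (⊹-identityʳ _))

 quot-⊏ : ∀ f n → f ⊏ suc n → quot f ⊏ n
 quot-⊏ [] n b m n≤m = refl
 quot-⊏ (a ∷ f) zero b zero n≤m = RingHom.⟦⟧-cong evalHom {f} {[]} (⊏0⇒≋[] (⊏-tail {a} {f} b))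
 quot-⊏ (a ∷ f) zero b (suc m) n≤m = quot-⊏ f zero (⊏-weaken {f} z≤n (⊏-tail {a} {f} b)) m z≤n
 quot-⊏ (a ∷ f) (suc n) b (suc m) (s≤s n≤m) = quot-⊏ f n (⊏-tail {a} {f} b) m n≤m

 eval-X-κ : ∀ κ′ → Evaluation.eval (identityHom R) κ′ X-κ ≈ κ′ - κ
 eval-X-κ κ′ = solve 2 (λ k k′ → (:- k) :+ k′ :* (:1 :+ k′ :* :0) := k′ :- k) κ κ′

-- Polynomials over a field: division, irreducible factors, square roots

module FieldPolynomials (K : DiscreteField 0ℓ 0ℓ) where

 open DiscreteField K hiding (inverse; zero)
 private
  inv = DiscreteField.inverse K
 open Polynomials commutativeRing public
 open Degrees commutativeRing public
 open Divisibility polynomialRing public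
 open DomainProperties domain using (*-≉0)
 module ≈-Reasoning = SetoidReasoning setoid
 module ≋-Reasoning = SetoidReasoning ≋-setoid
 module PolyDomain = DiscreteDomain (polyDomain domain)
 module PolyDomainProperties = DomainProperties (polyDomain domain)
 private
  module S = IntegerSolver polynomialRing
  module KS = IntegerSolver commutativeRing

 classify : ∀ p → p ≋ [] ⊎ (Σ[ n ∈ ℕ ] Σ[ a ∈ Carrier ] ¬ (a ≈ 0#) × Top p n a)
 classify [] = inj₁ ≋-refl
 classify (a ∷ p) with classify p
 ... | inj₂ (n , b , b≉0 , t) = inj₂ (suc n , b , b≉0 , Top-∷ {a} {p} t)
 ... | inj₁ p≋0 with zero? a
 ... | yes a≈0 = inj₁ (≋-trans (∷-cong a≈0 p≋0) shift-0)
 ... | no a≉0 = inj₂ (0 , a , a≉0 , Top-resp (∷-cong refl (≋-sym p≋0)) refl Top-const)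

 Top-< : ∀ {p n a m} → ¬ (a ≈ 0#) → Top p n a → p ⊏ m → n N.< m
 Top-< {p} {n} {a} {m} a≉0 t b with n N.<? m
 ... | yes n<m = n<m
 ... | no n≮m = ⊥-elim (a≉0 (trans (sym (lead t)) (b n (N.≮⇒≥ n≮m))))

 Top-unique : ∀ {p m n a b} → ¬ (a ≈ 0#) → ¬ (b ≈ 0#) → Top p m a → Top p n b → m ≡ n
 Top-unique {p} a≉0 b≉0 t u =
  N.≤-antisym (N.s≤s⁻¹ (Top-< {p} a≉0 t (below u))) (N.s≤s⁻¹ (Top-< {p} b≉0 u (below t)))

 Top-≉0 : ∀ {p n a} → ¬ (a ≈ 0#) → Top p n a → ¬ (p ≋ [])
 Top-≉0 {p} {n} a≉0 t e = a≉0 (trans (sym (lead t)) (at e n))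

 -- The dividend is read from its constant term. If f = q g + r, then a + X f = (X q) g + (a + X r),
 -- and the new remainder has degree at most n, so that subtracting one scalar multiple of g removes
 -- its coefficient of degree n.
 divMod : ∀ {g n b} → ¬ (b ≈ 0#) → Top g n b → ∀ f →
      Σ[ q ∈ Poly ] Σ[ r ∈ Poly ] f ≋ q ✶ g ⊹ r × r ⊏ n
 divMod b≉0 t [] = [] , [] , ≋-refl , []⊏
 divMod {g} {n} {b} b≉0 t (a ∷ f) with divMod b≉0 t f
 ... | q , r , e , r⊏n = d ∷ q , s ⊹ ⊟ (d · g) , equality′ , smaller
  where
  s : Poly
  s = a ∷ r
  b⁻¹ d : Carrier
  b⁻¹ = proj₁ (inv b≉0)
  d = coeff s n * b⁻¹
  equality′ : a ∷ f ≋ (d ∷ q) ✶ g ⊹ (s ⊹ ⊟ (d · g))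
  equality′ = ≋-trans (∷-cong (sym (+-identityˡ a)) e)
   (S.solve 3 (λ u v w → u :+ v := (w :+ u) :+ (v :- w)) (shift (q ✶ g)) s (d · g))
  smaller : s ⊹ ⊟ (d · g) ⊏ n
  smaller m n≤m with N.m≤n⇒m<n∨m≡n n≤m
  ... | inj₁ n<m = ⊏-⊹ {s} {⊟ (d · g)} (⊏-∷ {a} {r} r⊏n) (⊏-⊟ {d · g} (⊏-· {d} {g} (below t))) m n<m
  ... | inj₂ ≡.refl = trans (coeff-⊹ s (⊟ (d · g)) n)
   (trans (+-congˡ (trans (coeff-⊟ (d · g) n) (-‿cong (trans (coeff-· d g n) (trans (*-congˡ (lead t))
    (trans (*-assoc _ _ _) (trans (*-congˡ (proj₂ (inv b≉0))) (*-identityʳ _))))))))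
   (-‿inverseʳ _))

 record Bézout (f g : Poly) : Set where
  field
   gcd u v : Poly
   combination : gcd ≋ u ✶ f ⊹ v ✶ g
   gcd∣f : gcd ∣ f
   gcd∣g : gcd ∣ g

 bézout : ∀ f g → Bézout f g
 bézout f g = euclid (length g) f g (⊏-length g)
  where
  trivial : ∀ f g → g ≋ [] → Bézout f g
  trivial f g g≋0 = record
   { gcd = f ; u = one ; v = []
   ; combination = S.solve 1 (λ f → f := :1 :* f :+ :0) f
   ; gcd∣f = ∣-refl
   ; gcd∣g = ∣-respʳ (≋-sym g≋0) ∣0
   }
  euclid : ∀ N f g → g ⊏ N → Bézout f g
  euclid zero f g b = trivial f g (⊏0⇒≋[] b)
  euclid (suc N) f g b with classify g
  ... | inj₁ g≋0 = trivial f g g≋0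
  ... | inj₂ (n , a , a≉0 , t) with divMod a≉0 t f
  ... | q , r , e , r⊏n = record
   { gcd = gcd ; u = v ; v = u ⊹ ⊟ (v ✶ q)
   ; combination = ≋-trans combination (≋-trans
     (S.solve 5 (λ u g v r q → u :* g :+ v :* r := v :* (q :* g :+ r) :+ (u :- v :* q) :* g) u g v r q)
     (⊹-cong (✶-congˡ v (≋-sym e)) ≋-refl))
   ; gcd∣f = ∣-respʳ (≋-sym e) (∣-+ (∣-*ˡ q gcd∣f) gcd∣g)
   ; gcd∣g = gcd∣f
   }
   where open Bézout (euclid N g r (⊏-weaken {r} (N.s≤s⁻¹ (Top-< {g} a≉0 t b)) r⊏n))

 Coprime : Poly → Poly → Set
 Coprime f g = Σ[ u ∈ Poly ] Σ[ v ∈ Poly ] u ✶ f ⊹ v ✶ g ≋ one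

 coprime-divisor : ∀ {f g h} → Coprime f g → f ∣ g ✶ h → f ∣ h
 coprime-divisor {f} {g} {h} (u , v , e) (divides q d) = divides (u ✶ h ⊹ v ✶ q) (begin
   h ≈⟨ S.solve 1 (λ h → h := :1 :* h) h ⟩
   one ✶ h ≈⟨ ✶-congʳ (u ✶ f ⊹ v ✶ g) one e ⟨
   (u ✶ f ⊹ v ✶ g) ✶ h
    ≈⟨ S.solve 5 (λ u f v g h → (u :* f :+ v :* g) :* h := u :* h :* f :+ v :* (g :* h)) u f v g h ⟩
   u ✶ h ✶ f ⊹ v ✶ (g ✶ h) ≈⟨ ⊹-cong ≋-refl (✶-congˡ v d) ⟩
   u ✶ h ✶ f ⊹ v ✶ (q ✶ f)
    ≈⟨ S.solve 5 (λ u h f v q → u :* h :* f :+ v :* (q :* f) := (u :* h :+ v :* q) :* f) u h f v q ⟩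
   (u ✶ h ⊹ v ✶ q) ✶ f ∎)
  where open ≋-Reasoning

 constant-inverse : ∀ {a} → ¬ (a ≈ 0#) → Σ[ b ∈ Carrier ] (b ∷ []) ✶ (a ∷ []) ≋ one
 constant-inverse a≉0 with inv a≉0
 ... | b , e = b , ≋-trans (≋-sym (RingHom.*-homo (constantHom commutativeRing) b _)) (∷-cong e ≋-refl)

 ∣one⇒⊏1 : ∀ {d} → d ∣ one → d ⊏ 1
 ∣one⇒⊏1 {d} (divides q e) with classify q | classify d
 ... | inj₁ q≋0 | _ = ⊥-elim (1≉0 (at (≋-trans e (✶-zeroˡ q d q≋0)) 0))
 ... | _ | inj₁ d≋0 = ⊏-resp (≋-sym d≋0) []⊏
 ... | inj₂ (m , a , a≉0 , t) | inj₂ (n , b , b≉0 , u) =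
  ≡.subst (λ k → d ⊏ suc k) n≡0 (below u)
  where
  n≡0 : n ≡ 0
  n≡0 = N.m+n≡0⇒n≡0 m (Top-unique (*-≉0 a≉0 b≉0) 1≉0 (Top-resp (≋-sym e) refl (Top-✶ t u)) Top-const)

 divisor-≉0 : ∀ {d f} → ¬ (f ≋ []) → d ∣ f → ¬ (d ≋ [])
 divisor-≉0 {d} f≉0 (divides q e) d≋0 = f≉0 (≋-trans e (≋-trans (✶-congˡ q d≋0) (✶-zeroʳ q)))

 record Irreducible (π : Poly) : Set where
  field
   {degree-1} : ℕ
   {leading} : Carrier
   leading≉0 : ¬ (leading ≈ 0#)
   degree : Top π (suc degree-1) leading
   divisors : ∀ d → d ∣ π → d ⊏ 1 ⊎ π ∣ d

 -- Over an arbitrary discrete field there is no procedure that finds a proper factor, so existence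
 -- is asserted under a double negation; the descent that consumes it ends in a contradiction
 -- anyway. If c had no irreducible divisor, then neither would any of its divisors of smaller
 -- positive degree, so there would be none of these and c would itself be irreducible.
 irreducibleDivisor : ∀ {c n a} → ¬ (a ≈ 0#) → Top c (suc n) a → ¬ ¬ (Σ[ π ∈ Poly ] Irreducible π × π ∣ c)
 irreducibleDivisor {n = n} a≉0 t = search (suc n) N.≤-refl a≉0 t
  where
  search : ∀ N {c n a} → n N.< N → ¬ (a ≈ 0#) → Top c (suc n) a → ¬ ¬ (Σ[ π ∈ Poly ] Irreducible π × π ∣ c)
  search (suc N) {c} {n} {a} (s≤s n≤N) a≉0 t none = none (c , record { leading≉0 = a≉0 ; degree = t ; divisors = divisors } , ∣-refl)
   where
   divisors : ∀ d → d ∣ c → d ⊏ 1 ⊎ c ∣ d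
   divisors d d∣c@(divides e c≋ed) with classify d | classify e
   ... | inj₁ d≋0 | _ = ⊥-elim (divisor-≉0 (Top-≉0 a≉0 t) d∣c d≋0)
   ... | inj₂ (zero , _ , _ , u) | _ = inj₁ (below u)
   ... | _ | inj₁ e≋0 = ⊥-elim (Top-≉0 a≉0 t (≋-trans c≋ed (✶-zeroˡ e d e≋0)))
   ... | inj₂ (suc m , b , b≉0 , u) | inj₂ (i , b′ , b′≉0 , u′)
    with Top-unique (*-≉0 b′≉0 b≉0) a≉0 (Top-resp (≋-sym c≋ed) refl (Top-✶ u′ u)) t
   divisors d (divides e c≋ed) | inj₂ (suc m , b , b≉0 , u) | inj₂ (zero , b′ , b′≉0 , u′) | i+m≡n
    with constant-inverse b′≉0
   ... | k , kb≋1 = inj₂ (divides (k ∷ []) (begin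
      d ≈⟨ S.solve 1 (λ d → d := :1 :* d) d ⟩
      one ✶ d ≈⟨ ✶-congʳ _ one kb≋1 ⟨
      (k ∷ []) ✶ (b′ ∷ []) ✶ d
       ≈⟨ ✶-assoc (k ∷ []) (b′ ∷ []) d ⟩
      (k ∷ []) ✶ ((b′ ∷ []) ✶ d) ≈⟨ ✶-congˡ (k ∷ []) (✶-congʳ (b′ ∷ []) e (≋-sym (≋-trans (const⇒ (below u′)) (∷-cong (lead u′) ≋-refl)))) ⟩
      (k ∷ []) ✶ (e ✶ d) ≈⟨ ✶-congˡ (k ∷ []) c≋ed ⟨
      (k ∷ []) ✶ c ∎))
    where open ≋-Reasoning
   divisors d d∣c | inj₂ (suc m , b , b≉0 , u) | inj₂ (suc i , b′ , b′≉0 , u′) | i+m≡n =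
    ⊥-elim (search N (N.≤-trans m<n n≤N) b≉0 u λ (π , irr , π∣d) → none (π , irr , ∣-trans π∣d d∣c))
    where
    m<n : m N.< n
    m<n = N.s≤s⁻¹ (≡.subst (suc m N.<_) i+m≡n (s≤s (N.m≤n+m (suc m) i)))

 module _ {π} (irreducible : Irreducible π) where

  open Irreducible irreducible
  open Quotient polynomialRing π

  -- The gcd of f and π divides π: either it is a multiple of π, and f is zero, or it is a constant,
  -- and Bézout's identity inverts f. As the result is again a discrete field, the theory of this
  -- module applies to polynomials in T with coefficients in K[X]/π.
  residueField : DiscreteField 0ℓ 0ℓ
  residueField = record
   { commutativeRing = quotientRing
   ; invert = invert′
   ; 1≉0 = λ e → N.n≮0 (N.s≤s⁻¹ (Top-< {π} leading≉0 degree (∣one⇒⊏1 (≈0⇒∣ e))))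
   }
   where
   invert′ : ∀ f → f ≈ᵐ [] ⊎ Σ[ g ∈ Poly ] g ✶ f ≈ᵐ one
   invert′ f with bézout f π
   ... | record { gcd = d ; u = u ; v = v ; combination = e ; gcd∣f = d∣f ; gcd∣g = d∣π } with divisors d d∣π
   ... | inj₂ π∣d = inj₁ (∣⇒≈0 (∣-trans π∣d d∣f))
   ... | inj₁ d⊏1 with zero? (coeff d 0)
   ... | yes d0≈0 = ⊥-elim (divisor-≉0 (Top-≉0 leading≉0 degree) d∣π
         (≋-trans (const⇒ d⊏1) (≋-trans (∷-cong d0≈0 ≋-refl) shift-0)))
   ... | no d0≉0 with constant-inverse d0≉0
   ... | k , kd≋1 = inj₂ ((k ∷ []) ✶ u , mod (divides (⊟ ((k ∷ []) ✶ v)) (begin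
      (k ∷ []) ✶ u ✶ f ⊹ ⊟ one
       ≈⟨ ⊹-cong ≋-refl (⊟-cong (≋-trans (≋-sym kd≋1) (✶-congˡ (k ∷ []) (≋-trans (≋-sym (const⇒ d⊏1)) e)))) ⟩
      (k ∷ []) ✶ u ✶ f ⊹ ⊟ ((k ∷ []) ✶ (u ✶ f ⊹ v ✶ π))
       ≈⟨ S.solve 5 (λ k u f v p → k :* u :* f :- k :* (u :* f :+ v :* p) := (:- (k :* v)) :* p) (k ∷ []) u f v π ⟩
      ⊟ ((k ∷ []) ✶ v) ✶ π ∎)))
    where open ≋-Reasoning

  residueHom : RingHom polynomialRing (DiscreteField.commutativeRing residueField)
  residueHom = record
   { ⟦_⟧ = λ f → f
   ; ⟦⟧-cong = embed
   ; +-homo = λ _ _ → embed ≋-refl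
   ; *-homo = λ _ _ → embed ≋-refl
   ; 1-homo = embed ≋-refl
   }

  residue-≈0 : ∀ {f} → DiscreteField._≈_ residueField f (DiscreteField.0# residueField) → π ∣ f
  residue-≈0 = ≈0⇒∣

  ∣⇒residue-≈0 : ∀ {f} → π ∣ f → DiscreteField._≈_ residueField f (DiscreteField.0# residueField)
  ∣⇒residue-≈0 = ∣⇒≈0

  divides? : ∀ f → Dec (π ∣ f)
  divides? f with DiscreteField.zero? residueField f
  ... | yes e = yes (≈0⇒∣ e)
  ... | no ne = no λ d → ne (∣⇒≈0 d)

  irreducible⇒prime : ∀ {f g} → π ∣ f ✶ g → π ∣ f ⊎ π ∣ g
  irreducible⇒prime {f} {g} d = Sum.map ≈0⇒∣ ≈0⇒∣ (DiscreteField.noZeroDivisors residueField f g (∣⇒≈0 d))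

 -- A quadratic element over K[T] whose square lies in K[T] and which is a quotient
 -- U/V is integral; division with remainder of U by V makes V smaller.

 square-root : ∀ {U V q} → ¬ (V ≋ []) → U ✶ U ≋ q ✶ (V ✶ V) → Σ[ Q ∈ Poly ] Q ✶ Q ≋ q
 square-root {U} {V} {q} = descend (length V) {U} {V} {q} (⊏-length V)
  where
  open PolyDomainProperties using () renaming (*-≉0 to ✶-≉0; *-cancel to ✶-cancel)
  descend : ∀ N {U V q} → V ⊏ N → ¬ (V ≋ []) → U ✶ U ≋ q ✶ (V ✶ V) → Σ[ Q ∈ Poly ] Q ✶ Q ≋ q
  descend zero b V≉0 _ = ⊥-elim (V≉0 (⊏0⇒≋[] b))
  descend (suc N) {U} {V} {q} b V≉0 e with classify V
  ... | inj₁ V≋0 = ⊥-elim (V≉0 V≋0)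
  ... | inj₂ (n , a , a≉0 , t) with divMod a≉0 t U
  ... | Q , r , U≋ , r⊏n with r PolyDomain.≟ []
  ... | yes r≋0 = Q , ✶-cancel (V ✶ V) {Q ✶ Q} {q} (✶-≉0 V≉0 V≉0) (begin
     (V ✶ V) ✶ (Q ✶ Q)
      ≈⟨ S.solve 2 (λ V Q → (V :* V) :* (Q :* Q) := (Q :* V :+ :0) :* (Q :* V :+ :0)) V Q ⟩
     (Q ✶ V ⊹ []) ✶ (Q ✶ V ⊹ []) ≈⟨ ✶-cong (≋-trans U≋ (⊹-cong (≋-refl {Q ✶ V}) r≋0)) (≋-trans U≋ (⊹-cong (≋-refl {Q ✶ V}) r≋0)) ⟨
     U ✶ U ≈⟨ e ⟩
     q ✶ (V ✶ V) ≈⟨ ✶-comm q (V ✶ V) ⟩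
     (V ✶ V) ✶ q ∎)
    where open ≋-Reasoning
  -- For z = U / V with z² = q one has z = (z² - Q z) / (z - Q) = (q V - Q U) / (U - Q V), and the
  -- new denominator is the remainder `r`.
  ... | no r≉0 = descend N {q ✶ V ⊹ ⊟ (Q ✶ U)} {r} {q} (⊏-weaken {r} (N.s≤s⁻¹ (Top-< {V} a≉0 t b)) r⊏n) r≉0 (begin
     (q ✶ V ⊹ ⊟ (Q ✶ U)) ✶ (q ✶ V ⊹ ⊟ (Q ✶ U))
      ≈⟨ S.solve 4 (λ q V Q U → (q :* V :- Q :* U) :* (q :* V :- Q :* U)
         := q :* ((U :- Q :* V) :* (U :- Q :* V)) :+ (Q :* Q :- q) :* (U :* U :- q :* (V :* V))) q V Q U ⟩
     q ✶ ((U ⊹ ⊟ (Q ✶ V)) ✶ (U ⊹ ⊟ (Q ✶ V))) ⊹ (Q ✶ Q ⊹ ⊟ q) ✶ (U ✶ U ⊹ ⊟ (q ✶ (V ✶ V)))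
      ≈⟨ ⊹-cong (✶-congˡ q (✶-cong r≋ r≋)) (✶-congˡ (Q ✶ Q ⊹ ⊟ q) (≋-trans (⊹-cong e ≋-refl) (⊟-inverseʳ (q ✶ (V ✶ V))))) ⟩
     q ✶ (r ✶ r) ⊹ (Q ✶ Q ⊹ ⊟ q) ✶ []
      ≈⟨ ≋-trans (⊹-cong ≋-refl (✶-zeroʳ (Q ✶ Q ⊹ ⊟ q))) (⊹-identityʳ _) ⟩
     q ✶ (r ✶ r) ∎)
    where
    open ≋-Reasoning
    r≋ : U ⊹ ⊟ (Q ✶ V) ≋ r
    r≋ = ≋-trans (⊹-cong U≋ ≋-refl) (S.solve 2 (λ x r → (x :+ r) :- x := r) (Q ✶ V) r)

 -- Comparing degrees makes Q affine, and the equations are the coefficients of (α T + β)².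
 quadratic-square-root : ∀ {Q a b d} → Q ✶ Q ≋ d ∷ b ∷ a ∷ [] →
  Σ[ α ∈ Carrier ] Σ[ β ∈ Carrier ] α * α ≈ a × α * β + α * β ≈ b × β * β ≈ d
 quadratic-square-root {Q} {a} {b} {d} e = α , β , at Q²≋ 2
  , trans (KS.solve 2 (λ a b → a :* b :+ a :* b := b :* a :+ (a :* b :+ :0)) α β) (at Q²≋ 1)
  , trans (sym (+-identityʳ _)) (at Q²≋ 0)
  where
  Q⊏2 : Q ⊏ 2
  Q⊏2 with classify Q
  ... | inj₁ Q≋0 = ⊏-resp (≋-sym Q≋0) []⊏
  ... | inj₂ (zero , _ , _ , t) = ⊏-weaken {Q} (s≤s z≤n) (below t)
  ... | inj₂ (suc zero , _ , _ , t) = below t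
  ... | inj₂ (suc (suc i) , x , x≉0 , t)
   with Top-< {d ∷ b ∷ a ∷ []} (*-≉0 x≉0 x≉0) (Top-resp e refl (Top-✶ t t)) (⊏-length (d ∷ b ∷ a ∷ []))
  ... | s≤s (s≤s (s≤s i+2+i≤0)) with ≡.trans (≡.sym (N.+-suc i (suc i))) (N.n≤0⇒n≡0 i+2+i≤0)
  ... | ()
  α β : Carrier
  α = coeff Q 1
  β = coeff Q 0
  Q≋ : Q ≋ β ∷ α ∷ []
  Q≋ = mk≋ λ { zero → refl ; (suc zero) → refl ; (suc (suc n)) → Q⊏2 (suc (suc n)) (s≤s (s≤s z≤n)) }
  Q²≋ : (β ∷ α ∷ []) ✶ (β ∷ α ∷ []) ≋ d ∷ b ∷ a ∷ []
  Q²≋ = ≋-trans (≋-sym (✶-cong Q≋ Q≋)) e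

 evaluate : Carrier → Poly → Carrier
 evaluate = Evaluation.eval (identityHom commutativeRing)

 linear-root : ∀ {f g a} → ¬ (a ≈ 0#) → Top g 1 a → g ∣ f → Σ[ κ ∈ Carrier ] evaluate κ f ≈ 0#
 linear-root {f} {g} {a} a≉0 t (divides h e) = κ , (begin
  evaluate κ f ≈⟨ E.⟦⟧-cong e ⟩
  evaluate κ (h ✶ g) ≈⟨ E.*-homo h g ⟩
  evaluate κ h * evaluate κ g ≈⟨ *-congˡ (E.⟦⟧-cong g≋) ⟩
  evaluate κ h * (g0 + κ * (a + κ * 0#))
   ≈⟨ KS.solve 4 (λ h g i a → h :* (g :+ (:- (g :* i)) :* (a :+ (:- (g :* i)) :* :0))
           := h :* (g :- g :* (i :* a))) _ g0 (proj₁ (inv a≉0)) a ⟩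
  evaluate κ h * (g0 - g0 * (proj₁ (inv a≉0) * a))
   ≈⟨ *-congˡ (trans (+-congˡ (-‿cong (trans (*-congˡ (proj₂ (inv a≉0))) (*-identityʳ g0)))) (-‿inverseʳ g0)) ⟩
  evaluate κ h * 0# ≈⟨ zeroʳ _ ⟩
  0# ∎)
  where
  open ≈-Reasoning
  g0 κ : Carrier
  g0 = coeff g 0
  κ = - (g0 * proj₁ (inv a≉0))
  module E = RingHom (Evaluation.evalHom (identityHom commutativeRing) κ)
  g≋ : g ≋ g0 ∷ a ∷ []
  g≋ = mk≋ λ { zero → refl ; (suc zero) → lead t ; (suc (suc n)) → below t (suc (suc n)) (s≤s (s≤s z≤n)) }

 NoRoot : Poly → Set
 NoRoot f = ∀ κ → ¬ (evaluate κ f ≈ 0#)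

 constant-∣ : ∀ {f g h k} → ¬ (k ≈ 0#) → g ≋ k ∷ [] → f ≋ g ✶ h → f ∣ h
 constant-∣ {f} {g} {h} {k} k≉0 g≋k e with constant-inverse k≉0
 ... | i , ik≋1 = divides (i ∷ []) (begin
  h ≈⟨ ✶-identityˡ h ⟨
  one ✶ h ≈⟨ ✶-congʳ ((i ∷ []) ✶ (k ∷ [])) one ik≋1 ⟨
  (i ∷ []) ✶ (k ∷ []) ✶ h ≈⟨ ✶-assoc (i ∷ []) (k ∷ []) h ⟩
  (i ∷ []) ✶ ((k ∷ []) ✶ h) ≈⟨ ✶-congˡ (i ∷ []) (≋-trans (✶-congʳ (k ∷ []) g (≋-sym g≋k)) (≋-sym e)) ⟩
  (i ∷ []) ✶ f ∎)
  where open ≋-Reasoning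

 -- Irreducibility is put in the form that the reductions need: f is an associate of each of its
 -- irreducible divisors. A constant cofactor gives this, and a cofactor of positive degree would
 -- leave a linear divisor and hence a root.
 quadratic-irreducible : ∀ {f a} → ¬ (a ≈ 0#) → Top f 2 a → NoRoot f → ∀ {π} → Irreducible π → π ∣ f → f ∣ π
 quadratic-irreducible {f} a≉0 t noRoot {π} irr π∣f@(divides g e) with classify g
 ... | inj₁ g≋0 = ⊥-elim (Top-≉0 a≉0 t (≋-trans e (✶-zeroˡ g π g≋0)))
 ... | inj₂ (i , k , k≉0 , v) = cases i v (Top-unique (*-≉0 k≉0 leading≉0) a≉0 (Top-resp (≋-sym e) refl (Top-✶ v degree)) t)
  where
  open Irreducible irr
  cases : ∀ i → Top g i k → i N.+ suc degree-1 ≡ 2 → f ∣ π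
  cases zero v _ = constant-∣ {f} {g} {π} k≉0 (≋-trans (const⇒ (below v)) (∷-cong (lead v) ≋-refl)) e
  cases (suc i) v eq = ⊥-elim (noRoot _ (proj₂ (linear-root {f} {π} leading≉0 (≡.subst (λ d → Top π (suc d) leading) d≡0 degree) π∣f)))
   where
   d≡0 : degree-1 ≡ 0
   d≡0 = N.m+n≡0⇒n≡0 i (N.suc-injective (≡.trans (≡.sym (N.+-suc i degree-1)) (N.suc-injective eq)))

 NoQuadraticFactors : Poly → Set
 NoQuadraticFactors f = ∀ {g h a b} → ¬ (a ≈ 0#) → Top g 2 a → ¬ (b ≈ 0#) → Top h 2 b → ¬ (f ≋ g ✶ h)

 quartic-irreducible : ∀ {f a} → ¬ (a ≈ 0#) → Top f 4 a → NoRoot f → NoQuadraticFactors f →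
            ∀ {π} → Irreducible π → π ∣ f → f ∣ π
 quartic-irreducible {f} a≉0 t noRoot noQuadratic {π} irr π∣f@(divides g e) with classify g
 ... | inj₁ g≋0 = ⊥-elim (Top-≉0 a≉0 t (≋-trans e (✶-zeroˡ g π g≋0)))
 ... | inj₂ (i , k , k≉0 , v) = cases i degree-1 v degree (Top-unique (*-≉0 k≉0 leading≉0) a≉0 (Top-resp (≋-sym e) refl (Top-✶ v degree)) t)
  where
  open Irreducible irr
  cases : ∀ i d → Top g i k → Top π (suc d) leading → i N.+ suc d ≡ 4 → f ∣ π
  cases 0 d v u _ = constant-∣ {f} {g} {π} k≉0 (≋-trans (const⇒ (below v)) (∷-cong (lead v) ≋-refl)) e
  cases 1 d v u _ = ⊥-elim (noRoot _ (proj₂ (linear-root {f} {g} k≉0 v (divides π (≋-trans e (✶-comm g π))))))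
  cases 2 1 v u _ = ⊥-elim (noQuadratic {g} {π} k≉0 v leading≉0 u e)
  cases 3 0 v u _ = ⊥-elim (noRoot _ (proj₂ (linear-root {f} {π} leading≉0 u π∣f)))
  cases (suc (suc (suc (suc i)))) d v u eq with ≡.trans (≡.sym (N.+-suc i d)) (N.suc-injective (N.suc-injective (N.suc-injective (N.suc-injective eq))))
  ... | ()

 -- The injective sequence t expresses that the field is infinite. Each root that is met is divided
 -- out as a linear factor, which lowers the degree and does not vanish at the later values.
 nonRoot : ∀ f → ¬ (f ≋ []) → (t : ℕ → Carrier) → (∀ {i j} → t i ≈ t j → i ≡ j) →
      Σ[ i ∈ ℕ ] ¬ (Evaluation.eval (identityHom commutativeRing) (t i) f ≈ 0#)
 nonRoot f f≉0 t inj = search (length f) f (⊏-length f) f≉0 t inj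
  where
  open PolyDomainProperties using () renaming (*-≉0 to ✶-≉0)
  search : ∀ N f → f ⊏ N → ¬ (f ≋ []) → (t : ℕ → Carrier) → (∀ {i j} → t i ≈ t j → i ≡ j) →
       Σ[ i ∈ ℕ ] ¬ (Evaluation.eval (identityHom commutativeRing) (t i) f ≈ 0#)
  search zero f b f≉0 t inj = ⊥-elim (f≉0 (⊏0⇒≋[] b))
  search (suc N) f b f≉0 t inj with zero? (Evaluation.eval (identityHom commutativeRing) (t 0) f)
  ... | no ft≉0 = 0 , ft≉0
  ... | yes ft≈0 = suc (proj₁ later) , λ e → *-≉0 t-t≉0 (proj₂ later)
      (trans (sym (trans (E.⟦⟧-cong fact) (trans (E.*-homo X-κ (quot f)) (*-congʳ (eval-X-κ (t (suc (proj₁ later)))))))) e)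
   where
   open SyntheticDivision commutativeRing (t 0)
   open GroupProperties +-group using (x∙y⁻¹≈ε⇒x≈y)
   fact : f ≋ X-κ ✶ quot f
   fact = factor f ft≈0
   later = search N (quot f) (quot-⊏ f N b) (λ e → f≉0 (≋-trans fact (≋-trans (✶-congˡ X-κ e) (✶-zeroʳ X-κ))))
        (λ i → t (suc i)) (λ e → N.suc-injective (inj e))
   module E = RingHom (Evaluation.evalHom (identityHom commutativeRing) (t (suc (proj₁ later))))
   t-t≉0 : ¬ (t (suc (proj₁ later)) - t 0 ≈ 0#)
   t-t≉0 e with inj {suc (proj₁ later)} {0} (x∙y⁻¹≈ε⇒x≈y _ _ e)
   ... | ()

 -- Linear algebra: a nonzero kernel vector

 record LinearMap (N : ℕ) : Set where
  field
   to : Vector Carrier N → Poly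
   to-+ : ∀ u v → to (λ i → u i + v i) ≋ to u ⊹ to v
   to-· : ∀ a u → to (λ i → a * u i) ≋ a · to u
   to-cong : ∀ {u v} → (∀ i → u i ≈ v i) → to u ≋ to v

 private
  -- `to-≉0` is injectivity in a positive form: a nonzero coordinate is traced to a nonzero
  -- coordinate of the image.
  record Embedding (M N : ℕ) : Set where
   field
    to : Vector Carrier M → Vector Carrier N
    to-+ : ∀ u v i → to (λ i → u i + v i) i ≈ to u i + to v i
    to-· : ∀ a u i → to (λ i → a * u i) i ≈ a * to u i
    to-cong : ∀ {u v} → (∀ i → u i ≈ v i) → ∀ i → to u i ≈ to v i
    to-≉0 : ∀ {u i} → ¬ (u i ≈ 0#) → Σ[ j ∈ Fin N ] ¬ (to u j ≈ 0#)

  record Functional (N : ℕ) : Set where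
   field
    to : Vector Carrier N → Carrier
    to-+ : ∀ u v → to (λ i → u i + v i) ≈ to u + to v
    to-· : ∀ a u → to (λ i → a * u i) ≈ a * to u
    to-cong : ∀ {u v} → (∀ i → u i ≈ v i) → to u ≈ to v

  infixr 5 _◂_
  _◂_ : ∀ {N} → Carrier → Vector Carrier N → Vector Carrier (suc N)
  (a ◂ u) zero = a
  (a ◂ u) (suc i) = u i

  -- If f is nonzero on the first basis vector, the first coordinate is solved for in terms of the
  -- others. Otherwise it stays free and the recursion goes on with the remaining coordinates.
  hyperplane : ∀ N (f : Functional (suc N)) →
         Σ[ ε ∈ Embedding N (suc N) ] (∀ u → Functional.to f (Embedding.to ε u) ≈ 0#)
  hyperplane zero f = record
   { to = λ _ _ → 0#
   ; to-+ = λ _ _ _ → sym (+-identityˡ 0#)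
   ; to-· = λ a _ _ → sym (zeroʳ a)
   ; to-cong = λ _ _ → refl
   ; to-≉0 = λ { {i = ()} }
   } , λ u → trans (to-cong (λ _ → sym (zeroˡ 0#))) (trans (to-· 0# (λ _ → 0#)) (zeroˡ _))
   where open Functional f
  hyperplane (suc N) f with invert (Functional.to f (1# ◂ (λ _ → 0#)))
  ... | inj₂ (b , ba≈1) = record
   { to = λ u → - (b * g u) ◂ u
   ; to-+ = λ u v → λ
     { zero → trans (-‿cong (*-congˡ (g-+ u v)))
           (KS.solve 3 (λ b x y → :- (b :* (x :+ y)) := :- (b :* x) :+ (:- (b :* y))) _ _ _)
     ; (suc i) → refl }
   ; to-· = λ a u → λ
     { zero → trans (-‿cong (*-congˡ (g-· a u)))
           (KS.solve 3 (λ b a x → :- (b :* (a :* x)) := a :* (:- (b :* x))) _ _ _)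
     ; (suc i) → refl }
   ; to-cong = λ e → λ { zero → -‿cong (*-congˡ (to-cong λ { zero → refl ; (suc i) → e i })) ; (suc i) → e i }
   ; to-≉0 = λ {u} {i} u≉0 → suc i , u≉0
   } , vanish
   where
   open Functional f
   g : Vector Carrier (suc N) → Carrier
   g u = to (0# ◂ u)
   g-+ : ∀ u v → g (λ i → u i + v i) ≈ g u + g v
   g-+ u v = trans (to-cong λ { zero → sym (+-identityˡ 0#) ; (suc i) → refl }) (to-+ (0# ◂ u) (0# ◂ v))
   g-· : ∀ a u → g (λ i → a * u i) ≈ a * g u
   g-· a u = trans (to-cong λ { zero → sym (zeroʳ a) ; (suc i) → refl }) (to-· a (0# ◂ u))
   a : Carrier
   a = to (1# ◂ (λ _ → 0#))
   vanish : ∀ u → to (- (b * g u) ◂ u) ≈ 0#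
   vanish u = begin
    to (- (b * g u) ◂ u)
     ≈⟨ to-cong (λ { zero → sym (trans (+-identityʳ _) (*-identityʳ _))
            ; (suc i) → sym (trans (+-congʳ (zeroʳ _)) (+-identityˡ _)) }) ⟩
    to (λ i → - (b * g u) * (1# ◂ (λ _ → 0#)) i + (0# ◂ u) i) ≈⟨ to-+ _ (0# ◂ u) ⟩
    to (λ i → - (b * g u) * (1# ◂ (λ _ → 0#)) i) + g u ≈⟨ +-congʳ (to-· _ _) ⟩
    - (b * g u) * a + g u
     ≈⟨ KS.solve 3 (λ b g a → (:- (b :* g)) :* a :+ g := g :- g :* (b :* a)) _ _ _ ⟩
    g u - g u * (b * a) ≈⟨ +-congˡ (-‿cong (trans (*-congˡ ba≈1) (*-identityʳ _))) ⟩
    g u - g u ≈⟨ -‿inverseʳ _ ⟩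
    0# ∎
    where open ≈-Reasoning
  ... | inj₁ a≈0 = record
   { to = λ u → u zero ◂ E.to (λ i → u (suc i))
   ; to-+ = λ u v → λ { zero → refl ; (suc i) → E.to-+ _ _ i }
   ; to-· = λ a u → λ { zero → refl ; (suc i) → E.to-· _ _ i }
   ; to-cong = λ e → λ { zero → e zero ; (suc i) → E.to-cong (λ i → e (suc i)) i }
   ; to-≉0 = λ { {i = zero} u≉0 → zero , u≉0
         ; {u} {suc i} u≉0 → suc (proj₁ (E.to-≉0 {λ i → u (suc i)} {i} u≉0)) , proj₂ (E.to-≉0 {λ i → u (suc i)} {i} u≉0) }
   } , vanish
   where
   open Functional f
   rest : Functional (suc N)
   rest = record
    { to = λ u → to (0# ◂ u)
    ; to-+ = λ u v → trans (to-cong λ { zero → sym (+-identityˡ 0#) ; (suc i) → refl }) (to-+ (0# ◂ u) (0# ◂ v))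
    ; to-· = λ a u → trans (to-cong λ { zero → sym (zeroʳ a) ; (suc i) → refl }) (to-· a (0# ◂ u))
    ; to-cong = λ e → to-cong λ { zero → refl ; (suc i) → e i }
    }
   module E = Embedding (proj₁ (hyperplane N rest))
   vanish : ∀ u → to (u zero ◂ E.to (λ i → u (suc i))) ≈ 0#
   vanish u = begin
    to (u zero ◂ E.to (λ i → u (suc i)))
     ≈⟨ to-cong (λ { zero → sym (trans (+-identityʳ _) (*-identityʳ _))
            ; (suc i) → sym (trans (+-congʳ (zeroʳ _)) (+-identityˡ _)) }) ⟩
    to (λ i → u zero * (1# ◂ (λ _ → 0#)) i + (0# ◂ E.to (λ i → u (suc i))) i)
     ≈⟨ to-+ _ _ ⟩
    to (λ i → u zero * (1# ◂ (λ _ → 0#)) i) + to (0# ◂ E.to (λ i → u (suc i)))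
     ≈⟨ +-cong (trans (to-· _ _) (trans (*-congˡ a≈0) (zeroʳ _))) (proj₂ (hyperplane N rest) _) ⟩
    0# + 0# ≈⟨ +-identityˡ 0# ⟩
    0# ∎
    where open ≈-Reasoning

 -- One coefficient is removed at a time: on an embedded space of one dimension less the coefficient
 -- of degree N vanishes, so that the values of the map have smaller degree there.
 kernel : ∀ N (φ : LinearMap (suc N)) → (∀ u → LinearMap.to φ u ⊏ N) →
      Σ[ u ∈ Vector Carrier (suc N) ] (Σ[ i ∈ Fin (suc N) ] ¬ (u i ≈ 0#)) × LinearMap.to φ u ≋ []
 kernel zero φ b = (λ _ → 1#) , (zero , 1≉0) , ⊏0⇒≋[] (b _)
 kernel (suc N) φ b with hyperplane (suc N) record
    { to = λ u → coeff (LinearMap.to φ u) N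
    ; to-+ = λ u v → trans (at (LinearMap.to-+ φ u v) N) (coeff-⊹ (LinearMap.to φ u) (LinearMap.to φ v) N)
    ; to-· = λ a u → trans (at (LinearMap.to-· φ a u) N) (coeff-· a (LinearMap.to φ u) N)
    ; to-cong = λ e → at (LinearMap.to-cong φ e) N
    }
 ... | ε , vanish with kernel N record
     { to = λ u → LinearMap.to φ (Embedding.to ε u)
     ; to-+ = λ u v → ≋-trans (LinearMap.to-cong φ (Embedding.to-+ ε u v)) (LinearMap.to-+ φ _ _)
     ; to-· = λ a u → ≋-trans (LinearMap.to-cong φ (Embedding.to-· ε a u)) (LinearMap.to-· φ _ _)
     ; to-cong = λ e → LinearMap.to-cong φ (Embedding.to-cong ε e)
     } bound
  where
  bound : ∀ u → LinearMap.to φ (Embedding.to ε u) ⊏ N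
  bound u m N≤m with N.m≤n⇒m<n∨m≡n N≤m
  ... | inj₁ N<m = b _ m N<m
  ... | inj₂ ≡.refl = vanish u
 ... | u , (i , u≉0) , e = Embedding.to ε u , Embedding.to-≉0 ε {u} {i} u≉0 , e

module _ {c ℓ} (R : CommutativeRing c ℓ) where

 open CommutativeRing R hiding (zero)
 open Polynomials R

 singleton-✶ : ∀ a p → (a ∷ []) ✶ p ≋ a · p
 singleton-✶ a p = ≋-trans (⊹-cong (≋-refl {a · p}) shift-0) (⊹-identityʳ (a · p))

-- Polynomials in X and T that vanish at a point

-- F plays the role of the fraction field of K[T].

record Overdomain (K : DiscreteField 0ℓ 0ℓ) : Set₁ where
 field
  F : CommutativeRing 0ℓ 0ℓ
  F-noZeroDivisors : NoZeroDivisors F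
  ι : RingHom (polyRing (DiscreteField.commutativeRing K)) F
  ι-injective : ∀ f → CommutativeRing._≈_ F (RingHom.⟦_⟧ ι f) (CommutativeRing.0# F) →
   Polynomials._≋_ (DiscreteField.commutativeRing K) f []
 Element : Set
 Element = CommutativeRing.Carrier F

-- Polynomials in two variables: the inner variable is X, the outer one is T.

module Bivariate (K : DiscreteField 0ℓ 0ℓ) where

 open DiscreteField K public using () renaming (Carrier to 𝕂; commutativeRing to K0; domain to K-domain)
 private module K = DiscreteField K
 module P = FieldPolynomials K
 K[X] : CommutativeRing 0ℓ 0ℓ
 K[X] = polyRing K0
 K[X][T] : CommutativeRing 0ℓ 0ℓ
 K[X][T] = polyRing K[X]
 module Q where
  open Polynomials K[X] public
  open Degrees K[X] public
  module ≋-Reasoning = SetoidReasoning ≋-setoid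
 module D1 = DomainProperties (polyDomain K-domain)
 module D2 = DomainProperties (polyDomain (polyDomain K-domain))
 module U = IntegerSolver K[X]
 module W = IntegerSolver K[X][T]

 -- The source is read as K[T]: a polynomial in T becomes one whose coefficients are constant in X.
 lift : RingHom K[X] K[X][T]
 lift = polyHom (constantHom K0)
 module lift = RingHom lift

 -- This is X as an element of K[X], and T wherever the same list is read as an element of K[T], as
 -- under `ι`.
 var : P.Poly
 var = K.0# ∷ K.1# ∷ []

 var-✶ : ∀ f → var P.✶ f P.≋ P.shift f
 var-✶ f = P.≋-trans (P.shift-✶ P.one f) (P.shift-cong (P.✶-identityˡ f))

 -- p - X e
 linear : P.Poly → P.Poly → Q.Poly
 linear p e = lift.⟦ p ⟧ Q.⊹ Q.⊟ (var Q.· lift.⟦ e ⟧)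

 coeff-linear : ∀ p e j → Q.coeff (linear p e) j P.≋ P.coeff p j ∷ (K.- P.coeff e j) ∷ []
 coeff-linear p e j = begin
  Q.coeff (linear p e) j
   ≈⟨ Q.coeff-⊹ lift.⟦ p ⟧ (Q.⊟ (var Q.· lift.⟦ e ⟧)) j ⟩
  Q.coeff lift.⟦ p ⟧ j P.⊹ Q.coeff (Q.⊟ (var Q.· lift.⟦ e ⟧)) j
   ≈⟨ P.⊹-cong (coeff-map (constantHom K0) p j)
      (P.≋-trans (Q.coeff-⊟ (var Q.· lift.⟦ e ⟧) j) (P.⊟-cong (P.≋-trans (Q.coeff-· var lift.⟦ e ⟧ j)
       (P.≋-trans (var-✶ (Q.coeff lift.⟦ e ⟧ j)) (P.shift-cong (coeff-map (constantHom K0) e j)))))) ⟩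
  (P.coeff p j K.+ K.- K.0#) ∷ (K.- P.coeff e j) ∷ []
   ≈⟨ P.∷-cong (KS.solve 1 (λ a → a :- :0 := a) _) P.≋-refl ⟩
  P.coeff p j ∷ (K.- P.coeff e j) ∷ [] ∎
  where
  open P.≋-Reasoning
  module KS = IntegerSolver K0

 XBound : ℕ → Q.Poly → Set
 XBound N M = ∀ j → Q.coeff M j P.⊏ N

 XBound-exists : ∀ M → Σ[ N ∈ ℕ ] XBound N M
 XBound-exists [] = 0 , λ _ → P.[]⊏
 XBound-exists (f ∷ M) with XBound-exists M
 ... | N , b = length f N.+ N , λ
  { zero → P.⊏-weaken {f} (N.m≤m+n (length f) N) (P.⊏-length f)
  ; (suc j) → P.⊏-weaken {Q.coeff M j} (N.m≤n+m N (length f)) (b j) }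

 XBound-linear : ∀ p e → XBound 2 (linear p e)
 XBound-linear p e j = P.⊏-resp (P.≋-sym (coeff-linear p e j)) (P.⊏-length (P.coeff p j ∷ (K.- P.coeff e j) ∷ []))

 linear-⊏ : ∀ {p e n} → p P.⊏ n → e P.⊏ n → linear p e Q.⊏ n
 linear-⊏ {p} {e} b b′ j n≤j = P.≋-trans (coeff-linear p e j)
  (P.≋-trans (P.∷-cong (b j n≤j) (P.∷-cong (K.trans (K.-‿cong (b′ j n≤j)) -0#≈0#) P.≋-refl))
  (P.≋-trans (P.shift-cong P.shift-0) P.shift-0))
  where open RingProperties K.ring using (-0#≈0#)

 -- X takes the value x.

 module AtPoint (𝓕 : Overdomain K) (x : Overdomain.Element 𝓕) where

  open Overdomain 𝓕
  open CommutativeRing F hiding (zero)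
  module ≈-Reasoning = SetoidReasoning setoid
  private
   module ι = RingHom ι
   module S = IntegerSolver F
  open S using (solve)

  evX : RingHom K[X] F
  evX = Evaluation.evalHom (composeHom ι (constantHom K0)) x
  module evX = RingHom evX

  ev : RingHom K[X][T] F
  ev = Evaluation.evalHom evX ι.⟦ var ⟧
  module ev = RingHom ev

  cancelF : ∀ a {b} → ¬ (a ≈ 0#) → a * b ≈ 0# → b ≈ 0#
  cancelF a {b} a≉0 e with F-noZeroDivisors a b e
  ... | inj₁ a≈0 = ⊥-elim (a≉0 a≈0)
  ... | inj₂ b≈0 = b≈0

  ι-≉0 : ∀ {f} → ¬ (f P.≋ []) → ¬ (ι.⟦ f ⟧ ≈ 0#)
  ι-≉0 {f} f≉0 e = f≉0 (ι-injective f e)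

  ι-shift : ∀ f → ι.⟦ P.shift f ⟧ ≈ ι.⟦ var ⟧ * ι.⟦ f ⟧
  ι-shift f = trans (ι.⟦⟧-cong (P.≋-sym (var-✶ f))) (ι.*-homo var f)

  ι-∷ : ∀ a f → ι.⟦ a ∷ f ⟧ ≈ ι.⟦ a ∷ [] ⟧ + ι.⟦ var ⟧ * ι.⟦ f ⟧
  ι-∷ a f = trans (ι.⟦⟧-cong (P.∷-cong (K.sym (K.+-identityʳ a)) (P.≋-refl {f})))
        (trans (ι.+-homo (a ∷ []) (P.shift f)) (+-congˡ (ι-shift f)))

  evX-constant : ∀ a → evX.⟦ a ∷ [] ⟧ ≈ ι.⟦ a ∷ [] ⟧
  evX-constant a = trans (+-congˡ (zeroʳ x)) (+-identityʳ _)

  ev-constant : ∀ f → ev.⟦ f ∷ [] ⟧ ≈ evX.⟦ f ⟧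
  ev-constant f = trans (+-congˡ (zeroʳ _)) (+-identityʳ _)

  ev-lift : ∀ f → ev.⟦ lift.⟦ f ⟧ ⟧ ≈ ι.⟦ f ⟧
  ev-lift [] = sym ι.0-homo
  ev-lift (a ∷ f) = trans (+-cong (evX-constant a) (*-congˡ (ev-lift f))) (sym (ι-∷ a f))

  evX-var : evX.⟦ var ⟧ ≈ x
  evX-var = begin
   ι.⟦ K.0# ∷ [] ⟧ + x * (ι.⟦ K.1# ∷ [] ⟧ + x * 0#)
    ≈⟨ +-cong (trans (ι.⟦⟧-cong P.shift-0) ι.0-homo) (*-congˡ (+-congʳ ι.1-homo)) ⟩
   0# + x * (1# + x * 0#) ≈⟨ solve 1 (λ x → :0 :+ x :* (:1 :+ x :* :0) := x) x ⟩
   x ∎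
   where open ≈-Reasoning

  -- κ is a value of X at which p - X e still has degree n in T, and `p′` is that specialisation.
  -- The aim is that a polynomial of degree at most n in T which vanishes at X = x is the product of
  -- p - X e and a polynomial in X alone: p - X e is primitive over K[T] because p and e are
  -- coprime, and the degrees in T leave no power of T for the quotient.
  module Proportional {p e p′ : P.Poly} {κ : 𝕂} {n : ℕ} {lc : 𝕂}
   (e≉0 : ¬ (e P.≋ [])) (xe≈p : x * ι.⟦ e ⟧ ≈ ι.⟦ p ⟧)
   (p⊏ : p P.⊏ suc n) (e⊏ : e P.⊏ suc n)
   (p′≋ : p′ P.≋ p P.⊹ P.⊟ (κ P.· e))
   (lc≉0 : ¬ (lc K.≈ K.0#)) (p′-top : P.Top p′ n lc)
   (coprime : P.Coprime p e) where

   Φ : Q.Poly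
   Φ = linear p e

   private
    module SD = SyntheticDivision K0 κ
    κ′ : Carrier
    κ′ = ι.⟦ κ ∷ [] ⟧
    specialise : RingHom K[X][T] K[X]
    specialise = polyHom SD.evalHom
    module σ = RingHom specialise

    κe : ∀ f → κ P.· f P.≋ (κ ∷ []) P.✶ f
    κe f = P.≋-sym (singleton-✶ K0 κ f)

    coprime′ : P.Coprime p′ e
    coprime′ = u , u P.✶ (κ ∷ []) P.⊹ v , (begin
     u P.✶ p′ P.⊹ (u P.✶ (κ ∷ []) P.⊹ v) P.✶ e
      ≈⟨ P.⊹-cong (P.✶-congˡ u (P.≋-trans p′≋ (P.⊹-cong (P.≋-refl {p}) (P.⊟-cong (κe e))))) P.≋-refl ⟩
     u P.✶ (p P.⊹ P.⊟ ((κ ∷ []) P.✶ e)) P.⊹ (u P.✶ (κ ∷ []) P.⊹ v) P.✶ e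
      ≈⟨ U.solve 5 (λ u p k e v → u :* (p :- k :* e) :+ (u :* k :+ v) :* e
               := u :* p :+ v :* e) u p (κ ∷ []) e v ⟩
     u P.✶ p P.⊹ v P.✶ e ≈⟨ eq ⟩
     P.one ∎)
     where
     open P.≋-Reasoning
     u v : P.Poly
     u = proj₁ coprime
     v = proj₁ (proj₂ coprime)
     eq : u P.✶ p P.⊹ v P.✶ e P.≋ P.one
     eq = proj₂ (proj₂ coprime)

    xκ : (x - κ′) * ι.⟦ e ⟧ ≈ ι.⟦ p′ ⟧
    xκ = begin
     (x - κ′) * ι.⟦ e ⟧ ≈⟨ solve 3 (λ x k e → (x :- k) :* e := x :* e :- k :* e) _ _ _ ⟩
     x * ι.⟦ e ⟧ - κ′ * ι.⟦ e ⟧ ≈⟨ +-cong xe≈p (-‿cong (trans (sym (ι.*-homo _ e)) (ι.⟦⟧-cong (P.≋-sym (κe e))))) ⟩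
     ι.⟦ p ⟧ - ι.⟦ κ P.· e ⟧ ≈⟨ ι.sub-homo p _ ⟨
     ι.⟦ p P.⊹ P.⊟ (κ P.· e) ⟧ ≈⟨ ι.⟦⟧-cong p′≋ ⟨
     ι.⟦ p′ ⟧ ∎
     where open ≈-Reasoning

    x-κ≉0 : ¬ (x - κ′ ≈ 0#)
    x-κ≉0 eq = ι-≉0 (P.Top-≉0 lc≉0 p′-top) (trans (sym xκ) (trans (*-congʳ eq) (zeroˡ _)))

    decompose : ∀ M → M Q.≋ SD.X-κ Q.· map SD.quot M Q.⊹ lift.⟦ σ.⟦ M ⟧ ⟧
    decompose [] = Q.≋-refl
    decompose (f ∷ M) = Q.∷-cong (SD.division f) (decompose M)

    evX-X-κ : evX.⟦ SD.X-κ ⟧ ≈ x - κ′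
    evX-X-κ = begin
     ι.⟦ (K.- κ) ∷ [] ⟧ + x * (ι.⟦ K.1# ∷ [] ⟧ + x * 0#)
      ≈⟨ +-cong (trans (ι.⟦⟧-cong P.≋-refl) (ι.-‿homo (κ ∷ []))) (*-congˡ (+-congʳ ι.1-homo)) ⟩
     - κ′ + x * (1# + x * 0#)
      ≈⟨ solve 2 (λ x k → :- k :+ x :* (:1 :+ x :* :0) := x :- k) x κ′ ⟩
     x - κ′ ∎
     where open ≈-Reasoning

    ev-decompose : ∀ M → ev.⟦ M ⟧ ≈ (x - κ′) * ev.⟦ map SD.quot M ⟧ + ι.⟦ σ.⟦ M ⟧ ⟧
    ev-decompose M = begin
     ev.⟦ M ⟧ ≈⟨ ev.⟦⟧-cong (Q.≋-trans (decompose M) (Q.⊹-cong (Q.≋-sym (singleton-✶ K[X] SD.X-κ (map SD.quot M))) Q.≋-refl)) ⟩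
     ev.⟦ (SD.X-κ ∷ []) Q.✶ map SD.quot M Q.⊹ lift.⟦ σ.⟦ M ⟧ ⟧ ⟧
      ≈⟨ trans (ev.+-homo ((SD.X-κ ∷ []) Q.✶ map SD.quot M) lift.⟦ σ.⟦ M ⟧ ⟧) (+-cong (ev.*-homo (SD.X-κ ∷ []) (map SD.quot M)) (ev-lift σ.⟦ M ⟧)) ⟩
     ev.⟦ SD.X-κ ∷ [] ⟧ * ev.⟦ map SD.quot M ⟧ + ι.⟦ σ.⟦ M ⟧ ⟧
      ≈⟨ +-congʳ (*-congʳ (trans (ev-constant SD.X-κ) evX-X-κ)) ⟩
     (x - κ′) * ev.⟦ map SD.quot M ⟧ + ι.⟦ σ.⟦ M ⟧ ⟧ ∎
     where open ≈-Reasoning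

    power : ℕ → P.Poly
    power zero = P.one
    power (suc k) = e P.✶ power k

    -- Membership of z in K[T][1/e]. Every value of a polynomial at X = x = p / e lies there.
    Integral : Carrier → Set _
    Integral z = Σ[ k ∈ ℕ ] Σ[ h ∈ P.Poly ] ι.⟦ power k ⟧ * z ≈ ι.⟦ h ⟧

    integral-*x : ∀ {z} → Integral z → Integral (x * z)
    integral-*x {z} (k , h , eq) = suc k , p P.✶ h , (begin
     ι.⟦ e P.✶ power k ⟧ * (x * z) ≈⟨ *-congʳ (ι.*-homo e _) ⟩
     ι.⟦ e ⟧ * ι.⟦ power k ⟧ * (x * z)
      ≈⟨ solve 4 (λ e d x z → e :* d :* (x :* z) := (x :* e) :* (d :* z)) _ _ _ _ ⟩
     x * ι.⟦ e ⟧ * (ι.⟦ power k ⟧ * z) ≈⟨ *-cong xe≈p eq ⟩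
     ι.⟦ p ⟧ * ι.⟦ h ⟧ ≈⟨ ι.*-homo p h ⟨
     ι.⟦ p P.✶ h ⟧ ∎)
     where open ≈-Reasoning

    integral-ι+ : ∀ f {z} → Integral z → Integral (ι.⟦ f ⟧ + z)
    integral-ι+ f {z} (k , h , eq) = k , power k P.✶ f P.⊹ h ,
     trans (distribˡ _ _ _) (trans (+-cong (sym (ι.*-homo (power k) f)) eq) (sym (ι.+-homo (power k P.✶ f) h)))

    integral-evX : ∀ f → Integral evX.⟦ f ⟧
    integral-evX [] = 0 , [] , trans (zeroʳ _) (sym ι.0-homo)
    integral-evX (a ∷ f) = integral-ι+ (a ∷ []) (integral-*x (integral-evX f))

    power-+ : ∀ k l → power (k N.+ l) P.≋ power k P.✶ power l
    power-+ zero l = P.≋-sym (P.✶-identityˡ _)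
    power-+ (suc k) l = P.≋-trans (P.✶-congˡ e (power-+ k l)) (P.≋-sym (P.✶-assoc e (power k) (power l)))

    integral-+T* : ∀ {z w} → Integral z → Integral w → Integral (z + ι.⟦ var ⟧ * w)
    integral-+T* {z} {w} (k , h , eq) (l , g , eq′) = k N.+ l , power l P.✶ h P.⊹ power k P.✶ (var P.✶ g) , (begin
     ι.⟦ power (k N.+ l) ⟧ * (z + ι.⟦ var ⟧ * w)
      ≈⟨ *-congʳ (trans (ι.⟦⟧-cong (power-+ k l)) (ι.*-homo _ _)) ⟩
     ι.⟦ power k ⟧ * ι.⟦ power l ⟧ * (z + ι.⟦ var ⟧ * w)
      ≈⟨ solve 5 (λ d e z t w → d :* e :* (z :+ t :* w) := e :* (d :* z) :+ d :* (t :* (e :* w))) _ _ _ _ _ ⟩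
     ι.⟦ power l ⟧ * (ι.⟦ power k ⟧ * z) + ι.⟦ power k ⟧ * (ι.⟦ var ⟧ * (ι.⟦ power l ⟧ * w))
      ≈⟨ +-cong (*-congˡ eq) (*-congˡ (*-congˡ eq′)) ⟩
     ι.⟦ power l ⟧ * ι.⟦ h ⟧ + ι.⟦ power k ⟧ * (ι.⟦ var ⟧ * ι.⟦ g ⟧)
      ≈⟨ +-cong (ι.*-homo _ _) (trans (ι.*-homo (power k) (var P.✶ g)) (*-congˡ (ι.*-homo var g))) ⟨
     ι.⟦ power l P.✶ h ⟧ + ι.⟦ power k P.✶ (var P.✶ g) ⟧ ≈⟨ ι.+-homo _ _ ⟨
     ι.⟦ power l P.✶ h P.⊹ power k P.✶ (var P.✶ g) ⟧ ∎)
     where open ≈-Reasoning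

    integral-ev : ∀ M → Integral ev.⟦ M ⟧
    integral-ev [] = 0 , [] , trans (zeroʳ _) (sym ι.0-homo)
    integral-ev (f ∷ M) = integral-+T* (integral-evX f) (integral-ev M)

    cancel-power : ∀ k {f} → p′ P.∣ power k P.✶ f → p′ P.∣ f
    cancel-power zero d = P.∣-respʳ (P.✶-identityˡ _) d
    cancel-power (suc k) {f} d = cancel-power k (P.coprime-divisor coprime′ (P.∣-respʳ (P.✶-assoc e (power k) f) d))

    -- Write M = (X - κ) M′ + M(κ) and evaluate at X = x. Since (x - κ) e = `p′`, multiplication by
    -- a power of e turns 0 = M(x) into 0 = p′ h + e^(k+1) M(κ), and `p′` is coprime to e.
    p′∣ : ∀ M → ev.⟦ M ⟧ ≈ 0# → p′ P.∣ σ.⟦ M ⟧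
    p′∣ M evM≈0 with integral-ev (map SD.quot M)
    ... | k , h , eq = cancel-power (suc k) (P.∣-respʳ
     (P.≋-trans (U.solve 2 (λ a b → :- a := b :- (a :+ b)) (p′ P.✶ h) (power (suc k) P.✶ σ.⟦ M ⟧))
      (P.≋-trans (P.⊹-cong P.≋-refl (P.⊟-cong zero≋)) (P.⊹-identityʳ _)))
     (P.∣-neg (P.∣-*ʳ h P.∣-refl)))
     where
     open ≈-Reasoning
     zero≋ : p′ P.✶ h P.⊹ power (suc k) P.✶ σ.⟦ M ⟧ P.≋ []
     zero≋ = ι-injective _ (begin
      ι.⟦ p′ P.✶ h P.⊹ power (suc k) P.✶ σ.⟦ M ⟧ ⟧
       ≈⟨ trans (ι.+-homo _ _) (+-cong (ι.*-homo p′ h) (trans (ι.*-homo (power (suc k)) σ.⟦ M ⟧) (*-congʳ (ι.*-homo e (power k))))) ⟩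
      ι.⟦ p′ ⟧ * ι.⟦ h ⟧ + ι.⟦ e ⟧ * ι.⟦ power k ⟧ * ι.⟦ σ.⟦ M ⟧ ⟧
       ≈⟨ +-congʳ (*-cong (sym xκ) (sym eq)) ⟩
      (x - κ′) * ι.⟦ e ⟧ * (ι.⟦ power k ⟧ * ev.⟦ map SD.quot M ⟧) + ι.⟦ e ⟧ * ι.⟦ power k ⟧ * ι.⟦ σ.⟦ M ⟧ ⟧
       ≈⟨ solve 5 (λ z e d w m → z :* e :* (d :* w) :+ e :* d :* m := e :* d :* (z :* w :+ m)) _ _ _ _ _ ⟩
      ι.⟦ e ⟧ * ι.⟦ power k ⟧ * ((x - κ′) * ev.⟦ map SD.quot M ⟧ + ι.⟦ σ.⟦ M ⟧ ⟧)
       ≈⟨ *-congˡ (trans (sym (ev-decompose M)) evM≈0) ⟩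
      ι.⟦ e ⟧ * ι.⟦ power k ⟧ * 0# ≈⟨ zeroʳ _ ⟩
      0# ∎)

    σ-lift : ∀ f → σ.⟦ lift.⟦ f ⟧ ⟧ P.≋ f
    σ-lift [] = P.≋-refl
    σ-lift (a ∷ f) = P.∷-cong (K.trans (K.+-congˡ (K.zeroʳ κ)) (K.+-identityʳ a)) (σ-lift f)

    σ-Φ : σ.⟦ Φ ⟧ P.≋ p′
    σ-Φ = begin
     σ.⟦ Φ ⟧ ≈⟨ σ.sub-homo lift.⟦ p ⟧ (var Q.· lift.⟦ e ⟧) ⟩
     σ.⟦ lift.⟦ p ⟧ ⟧ P.⊹ P.⊟ σ.⟦ var Q.· lift.⟦ e ⟧ ⟧
      ≈⟨ P.⊹-cong (σ-lift p) (P.⊟-cong (P.≋-trans (σ.⟦⟧-cong (Q.≋-sym (singleton-✶ K[X] var lift.⟦ e ⟧)))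
         (P.≋-trans (σ.*-homo (var ∷ []) lift.⟦ e ⟧) (P.✶-cong {SD.eval var ∷ []} {κ ∷ []} (P.∷-cong var≈κ P.≋-refl) (σ-lift e))))) ⟩
     p P.⊹ P.⊟ ((κ ∷ []) P.✶ e) ≈⟨ P.⊹-cong P.≋-refl (P.⊟-cong (κe e)) ⟨
     p P.⊹ P.⊟ (κ P.· e) ≈⟨ p′≋ ⟨
     p′ ∎
     where
     open P.≋-Reasoning
     module KS = IntegerSolver K0
     var≈κ : SD.eval var K.≈ κ
     var≈κ = KS.solve 1 (λ k → :0 :+ k :* (:1 :+ k :* :0) := k) κ

    constant-multiple : ∀ {f} → f P.⊏ suc n → p′ P.∣ f → Σ[ μ ∈ 𝕂 ] f P.≋ (μ ∷ []) P.✶ p′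
    constant-multiple {f} b (P.divides g eq) with P.classify g
    ... | inj₁ g≋0 = K.0# , P.≋-trans eq (P.✶-congʳ g _ (P.≋-trans g≋0 (P.≋-sym P.shift-0)))
    ... | inj₂ (i , a , a≉0 , t) = a , P.≋-trans eq (P.✶-congʳ g _ (P.≋-trans (P.const⇒ g⊏1) (P.∷-cong g0≈a P.≋-refl)))
     where
     i≡0 : i ≡ 0
     i≡0 = N.n≤0⇒n≡0 (N.+-cancelʳ-≤ n i 0 (N.s≤s⁻¹ (P.Top-< {f} (DomainProperties.*-≉0 K-domain a≉0 lc≉0)
         (P.Top-resp (P.≋-sym eq) K.refl (P.Top-✶ t p′-top)) b)))
     g⊏1 : g P.⊏ 1
     g⊏1 = ≡.subst (λ i → g P.⊏ suc i) i≡0 (P.below t)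
     g0≈a : P.coeff g 0 K.≈ a
     g0≈a = ≡.subst (λ i → P.coeff g i K.≈ a) i≡0 (P.lead t)

    coeff-quot : ∀ M j → Q.coeff (map SD.quot M) j ≡ SD.quot (Q.coeff M j)
    coeff-quot [] j = ≡.refl
    coeff-quot (f ∷ M) zero = ≡.refl
    coeff-quot (f ∷ M) (suc j) = coeff-quot M j

   -- Induction on the degree in X. At X = κ the polynomial M becomes a multiple of `p′` of degree
   -- at most n, hence μ p′ with μ constant. Then M - μ (p - X e) vanishes at X = κ, and dividing it
   -- by X - κ lowers the degree in X and keeps the value 0 at x, because x ≠ κ. At the bottom M
   -- does not involve X, so its value at x is M itself and M = 0.
   proportional : ∀ N M → XBound (suc N) M → M Q.⊏ suc n → ev.⟦ M ⟧ ≈ 0# → Σ[ d ∈ P.Poly ] M Q.≋ (d ∷ []) Q.✶ Φ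
   proportional zero M b _ evM≈0 = [] , Q.≋-trans M≋0 (Q.≋-sym (Q.✶-congʳ ([] ∷ []) [] Q.shift-0))
    where
    quot≋0 : map SD.quot M Q.≋ []
    quot≋0 = Q.mk≋ λ j → ≡.subst (P._≋ []) (≡.sym (coeff-quot M j)) (P.⊏0⇒≋[] (SD.quot-⊏ (Q.coeff M j) 0 (b j)))
    M≋lift : M Q.≋ lift.⟦ σ.⟦ M ⟧ ⟧
    M≋lift = Q.≋-trans (decompose M) (Q.⊹-cong (Q.·-cong {SD.X-κ} P.≋-refl quot≋0) Q.≋-refl)
    M≋0 : M Q.≋ []
    M≋0 = Q.≋-trans M≋lift (lift.⟦⟧-cong {σ.⟦ M ⟧} {[]} (ι-injective _ (trans (sym (ev-lift σ.⟦ M ⟧)) (trans (ev.⟦⟧-cong (Q.≋-sym M≋lift)) evM≈0))))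
   proportional (suc N) M b M⊏ evM≈0 = (μ ∷ []) P.⊹ SD.X-κ P.✶ proj₁ IH , (begin
    M ≈⟨ W.solve 2 (λ m z → m := z :+ (m :- z)) M μΦ ⟩
    μΦ Q.⊹ M1
     ≈⟨ Q.⊹-cong (Q.≋-refl {μΦ}) (Q.≋-trans M1≋ (Q.✶-congˡ (SD.X-κ ∷ []) (proj₂ IH))) ⟩
    ((μ ∷ []) ∷ []) Q.✶ Φ Q.⊹ (SD.X-κ ∷ []) Q.✶ ((proj₁ IH ∷ []) Q.✶ Φ)
     ≈⟨ W.solve 4 (λ m f k d → m :* f :+ k :* (d :* f) := (m :+ k :* d) :* f) ((μ ∷ []) ∷ []) Φ (SD.X-κ ∷ []) (proj₁ IH ∷ []) ⟩
    (((μ ∷ []) ∷ []) Q.⊹ (SD.X-κ ∷ []) Q.✶ (proj₁ IH ∷ [])) Q.✶ Φ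
     ≈⟨ Q.✶-congʳ _ _ (Q.⊹-cong (Q.≋-refl {(μ ∷ []) ∷ []}) (RingHom.*-homo (constantHom K[X]) SD.X-κ (proj₁ IH))) ⟨
    (((μ ∷ []) P.⊹ SD.X-κ P.✶ proj₁ IH) ∷ []) Q.✶ Φ ∎)
    where
    open Q.≋-Reasoning
    σM⊏ : σ.⟦ M ⟧ P.⊏ suc n
    σM⊏ j n<j = K.trans (coeff-map SD.evalHom M j) (RingHom.⟦⟧-cong SD.evalHom (M⊏ j n<j))
    multiple : Σ[ μ ∈ 𝕂 ] σ.⟦ M ⟧ P.≋ (μ ∷ []) P.✶ p′
    multiple = constant-multiple {σ.⟦ M ⟧} σM⊏ (p′∣ M evM≈0)
    μ : 𝕂
    μ = proj₁ multiple
    σM≋ : σ.⟦ M ⟧ P.≋ (μ ∷ []) P.✶ p′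
    σM≋ = proj₂ multiple
    μΦ M1 M′ : Q.Poly
    μΦ = ((μ ∷ []) ∷ []) Q.✶ Φ
    M1 = M Q.⊹ Q.⊟ μΦ
    M′ = map SD.quot M1
    σM1≋0 : σ.⟦ M1 ⟧ P.≋ []
    σM1≋0 = P.≋-trans (σ.sub-homo M μΦ) (P.≋-trans (P.⊹-cong σM≋ (P.⊟-cong
     (P.≋-trans (σ.*-homo ((μ ∷ []) ∷ []) Φ) (P.✶-cong {SD.eval (μ ∷ []) ∷ []} {μ ∷ []} (P.∷-cong (K.trans (K.+-congˡ (K.zeroʳ κ)) (K.+-identityʳ μ)) P.≋-refl) σ-Φ))))
     (P.⊟-inverseʳ ((μ ∷ []) P.✶ p′)))
    M1≋ : M1 Q.≋ (SD.X-κ ∷ []) Q.✶ M′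
    M1≋ = Q.≋-trans (decompose M1) (Q.≋-trans (Q.⊹-cong (Q.≋-sym (singleton-✶ K[X] SD.X-κ M′))
     (lift.⟦⟧-cong {σ.⟦ M1 ⟧} {[]} σM1≋0)) (Q.⊹-identityʳ _))
    coeff-M1 : ∀ j → Q.coeff M1 j P.≋ Q.coeff M j P.⊹ P.⊟ ((μ ∷ []) P.✶ Q.coeff Φ j)
    coeff-M1 j = P.≋-trans (Q.coeff-⊹ M (Q.⊟ μΦ) j) (P.⊹-cong P.≋-refl (P.≋-trans (Q.coeff-⊟ μΦ j)
     (P.⊟-cong (P.≋-trans (Q.at (singleton-✶ K[X] (μ ∷ []) Φ) j) (Q.coeff-· (μ ∷ []) Φ j)))))
    M1-bound : XBound (suc (suc N)) M1
    M1-bound j = P.⊏-resp (P.≋-sym (coeff-M1 j)) (P.⊏-⊹ {Q.coeff M j} {P.⊟ ((μ ∷ []) P.✶ Q.coeff Φ j)} (b j)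
     (P.⊏-⊟ {(μ ∷ []) P.✶ Q.coeff Φ j} (P.⊏-resp (P.≋-sym (singleton-✶ K0 μ (Q.coeff Φ j)))
      (P.⊏-· {μ} {Q.coeff Φ j} (P.⊏-weaken {Q.coeff Φ j} (s≤s (s≤s z≤n)) (XBound-linear p e j))))))
    M1⊏ : M1 Q.⊏ suc n
    M1⊏ = Q.⊏-⊹ {M} {Q.⊟ μΦ} M⊏ (Q.⊏-⊟ {μΦ} (Q.⊏-resp (Q.≋-sym (singleton-✶ K[X] (μ ∷ []) Φ))
     (Q.⊏-· {μ ∷ []} {Φ} (linear-⊏ {p} {e} p⊏ e⊏))))
    M′-bound : XBound (suc N) M′
    M′-bound j = ≡.subst (P._⊏ suc N) (≡.sym (coeff-quot M1 j)) (SD.quot-⊏ (Q.coeff M1 j) (suc N) (M1-bound j))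
    M′⊏ : M′ Q.⊏ suc n
    M′⊏ j n<j = ≡.subst (P._≋ []) (≡.sym (coeff-quot M1 j))
     (P.⊏0⇒≋[] (SD.quot-⊏ (Q.coeff M1 j) 0 (P.⊏-resp (P.≋-sym (M1⊏ j n<j)) P.[]⊏)))
    evΦ≈0 : ev.⟦ Φ ⟧ ≈ 0#
    evΦ≈0 = trans (ev.sub-homo lift.⟦ p ⟧ (var Q.· lift.⟦ e ⟧)) (trans (+-cong (ev-lift p) (-‿cong
     (trans (ev.⟦⟧-cong (Q.≋-sym (singleton-✶ K[X] var lift.⟦ e ⟧))) (trans (ev.*-homo (var ∷ []) lift.⟦ e ⟧)
     (trans (*-cong (trans (ev-constant var) evX-var) (ev-lift e)) xe≈p))))) (-‿inverseʳ _))
    evM1≈0 : ev.⟦ M1 ⟧ ≈ 0#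
    evM1≈0 = trans (ev.sub-homo M μΦ) (trans (+-cong evM≈0 (-‿cong (trans (ev.*-homo ((μ ∷ []) ∷ []) Φ) (trans (*-congˡ evΦ≈0) (zeroʳ _)))))
     (-‿inverseʳ 0#))
    evM′≈0 : ev.⟦ M′ ⟧ ≈ 0#
    evM′≈0 = cancelF (x - κ′) x-κ≉0 (trans (*-congʳ (sym (trans (ev-constant SD.X-κ) evX-X-κ)))
     (trans (sym (ev.*-homo (SD.X-κ ∷ []) M′)) (trans (ev.⟦⟧-cong (Q.≋-sym M1≋)) evM1≈0)))
    IH : Σ[ d ∈ P.Poly ] M′ Q.≋ (d ∷ []) Q.✶ Φ
    IH = proportional N M′ M′-bound M′⊏ evM′≈0

-- Numerators of values at the point, as functions of the coefficients

module Tabulation (K : DiscreteField 0ℓ 0ℓ) where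

 open Bivariate K
 private module K = DiscreteField K

 tabulate : ∀ k → Vector 𝕂 k → P.Poly
 tabulate zero v = []
 tabulate (suc k) v = v zero ∷ tabulate k (λ i → v (suc i))

 tabulate-≉0 : ∀ k v i → ¬ (v i K.≈ K.0#) → ¬ (tabulate k v P.≋ [])
 tabulate-≉0 (suc k) v zero v≉0 e = v≉0 (P.at e 0)
 tabulate-≉0 (suc k) v (suc i) v≉0 e = tabulate-≉0 k (λ i → v (suc i)) i v≉0 (P.mk≋ λ n → P.at e (suc n))

 -- The coordinates come in m blocks of length k, one for each power of T, so that the degree is
 -- less than m in T and less than k in X.
 tabulate2 : ∀ m k → Vector 𝕂 (m N.* k) → Q.Poly
 tabulate2 zero k v = []
 tabulate2 (suc m) k v = tabulate k (λ i → v (i ↑ˡ m N.* k)) ∷ tabulate2 m k (λ i → v (k ↑ʳ i))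

 tabulate2-⊏ : ∀ m k v → tabulate2 m k v Q.⊏ m
 tabulate2-⊏ zero k v = Q.[]⊏
 tabulate2-⊏ (suc m) k v = Q.⊏-∷ {tabulate k (λ i → v (i ↑ˡ m N.* k))} (tabulate2-⊏ m k _)

 split-≉0 : ∀ m k (v : Vector 𝕂 (m N.+ k)) i → ¬ (v i K.≈ K.0#) →
       (Σ[ j ∈ Fin m ] ¬ (v (j ↑ˡ k) K.≈ K.0#)) ⊎ (Σ[ j ∈ Fin k ] ¬ (v (m ↑ʳ j) K.≈ K.0#))
 split-≉0 zero k v i v≉0 = inj₂ (i , v≉0)
 split-≉0 (suc m) k v zero v≉0 = inj₁ (zero , v≉0)
 split-≉0 (suc m) k v (suc i) v≉0 with split-≉0 m k (λ i → v (suc i)) i v≉0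
 ... | inj₁ (j , w) = inj₁ (suc j , w)
 ... | inj₂ (j , w) = inj₂ (j , w)

 tabulate2-≉0 : ∀ m k v i → ¬ (v i K.≈ K.0#) → ¬ (tabulate2 m k v Q.≋ [])
 tabulate2-≉0 (suc m) k v i v≉0 e with split-≉0 k (m N.* k) v i v≉0
 ... | inj₁ (j , w) = tabulate-≉0 k _ j w (Q.at e 0)
 ... | inj₂ (j , w) = tabulate2-≉0 m k _ j w (Q.mk≋ λ n → Q.at e (suc n))

 -- Σ vᵢ pⁱ eᵏ⁻¹⁻ⁱ, the numerator of the value at p/e of a polynomial of degree < k.

 module Homogenised (p e : P.Poly) where

  power : ℕ → P.Poly
  power zero = P.one
  power (suc k) = e P.✶ power k

  numerator : ∀ k → Vector 𝕂 k → P.Poly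
  numerator zero v = []
  numerator (suc k) v = (v zero ∷ []) P.✶ power k P.⊹ p P.✶ numerator k (λ i → v (suc i))

  numerator2 : ∀ m k → Vector 𝕂 (m N.* k) → P.Poly
  numerator2 zero k v = []
  numerator2 (suc m) k v = numerator k (λ i → v (i ↑ˡ m N.* k)) P.⊹ P.shift (numerator2 m k (λ i → v (k ↑ʳ i)))

  module _ {n} (p⊏ : p P.⊏ suc n) (e⊏ : e P.⊏ suc n) where

   power-⊏ : ∀ k → power k P.⊏ suc (k N.* n)
   power-⊏ zero = P.⊏-length P.one
   power-⊏ (suc k) = P.⊏-✶ e (power k) (suc n) (k N.* n) e⊏ (power-⊏ k)

   numerator-⊏ : ∀ k v → numerator k v P.⊏ suc (k N.* n)
   numerator-⊏ zero v = P.[]⊏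
   numerator-⊏ (suc k) v = P.⊏-⊹ {(v zero ∷ []) P.✶ power k} {p P.✶ numerator k _}
    (P.⊏-weaken {(v zero ∷ []) P.✶ power k} (s≤s (N.m≤n+m (k N.* n) n))
     (P.⊏-✶ (v zero ∷ []) (power k) 1 (k N.* n) (P.⊏-length (v zero ∷ [])) (power-⊏ k)))
    (P.⊏-✶ p (numerator k _) (suc n) (k N.* n) p⊏ (numerator-⊏ k _))

   numerator2-⊏ : ∀ m k v → numerator2 m k v P.⊏ m N.+ suc (k N.* n)
   numerator2-⊏ zero k v = P.[]⊏
   numerator2-⊏ (suc m) k v = P.⊏-⊹ {numerator k _} {P.shift (numerator2 m k _)}
    (P.⊏-weaken {numerator k _} (N.m≤n+m (suc (k N.* n)) (suc m)) (numerator-⊏ k _))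
    (P.⊏-∷ {K.0#} {numerator2 m k _} (numerator2-⊏ m k _))

  numerator-cong : ∀ k {u v} → (∀ i → u i K.≈ v i) → numerator k u P.≋ numerator k v
  numerator-cong zero e′ = P.≋-refl
  numerator-cong (suc k) {u} {v} e′ = P.⊹-cong {(u zero ∷ []) P.✶ power k} {(v zero ∷ []) P.✶ power k}
   (P.✶-congʳ (u zero ∷ []) (v zero ∷ []) (P.∷-cong (e′ zero) P.≋-refl))
   (P.✶-congˡ p (numerator-cong k (λ i → e′ (suc i))))

  numerator-+ : ∀ k u v → numerator k (λ i → u i K.+ v i) P.≋ numerator k u P.⊹ numerator k v
  numerator-+ zero u v = P.≋-refl
  numerator-+ (suc k) u v = P.≋-trans
   (P.⊹-cong (P.≋-refl {(u zero K.+ v zero ∷ []) P.✶ power k}) (P.✶-congˡ p (numerator-+ k _ _)))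
   (U.solve 6 (λ a b d p x y → (a :+ b) :* d :+ p :* (x :+ y)
           := (a :* d :+ p :* x) :+ (b :* d :+ p :* y))
    (u zero ∷ []) (v zero ∷ []) (power k) p (numerator k (λ i → u (suc i))) (numerator k (λ i → v (suc i))))

  numerator-· : ∀ k a v → numerator k (λ i → a K.* v i) P.≋ (a ∷ []) P.✶ numerator k v
  numerator-· zero a v = P.≋-sym (P.✶-zeroʳ (a ∷ []))
  numerator-· (suc k) a v = P.≋-trans
   (P.⊹-cong (P.✶-congʳ (a K.* v zero ∷ []) ((a ∷ []) P.✶ (v zero ∷ [])) (RingHom.*-homo (constantHom K0) a (v zero)))
         (P.✶-congˡ p (numerator-· k a _)))
   (U.solve 5 (λ a b d p x → (a :* b) :* d :+ p :* (a :* x) := a :* (b :* d :+ p :* x))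
    (a ∷ []) (v zero ∷ []) (power k) p (numerator k (λ i → v (suc i))))

  numerator2-cong : ∀ m k {u v} → (∀ i → u i K.≈ v i) → numerator2 m k u P.≋ numerator2 m k v
  numerator2-cong zero k e′ = P.≋-refl
  numerator2-cong (suc m) k e′ = P.⊹-cong (numerator-cong k (λ i → e′ (i ↑ˡ m N.* k)))
   (P.shift-cong (numerator2-cong m k (λ i → e′ (k ↑ʳ i))))

  numerator2-+ : ∀ m k u v → numerator2 m k (λ i → u i K.+ v i) P.≋ numerator2 m k u P.⊹ numerator2 m k v
  numerator2-+ zero k u v = P.≋-refl
  numerator2-+ (suc m) k u v = P.≋-trans
   (P.⊹-cong (numerator-+ k _ _) (P.≋-trans (P.shift-cong (numerator2-+ m k _ _)) (P.shift-⊹ (numerator2 m k (λ i → u (k ↑ʳ i))) (numerator2 m k (λ i → v (k ↑ʳ i))))))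
   (U.solve 4 (λ a b x y → (a :+ b) :+ (x :+ y) := (a :+ x) :+ (b :+ y))
    (numerator k (λ i → u (i ↑ˡ m N.* k))) (numerator k (λ i → v (i ↑ˡ m N.* k)))
    (P.shift (numerator2 m k (λ i → u (k ↑ʳ i)))) (P.shift (numerator2 m k (λ i → v (k ↑ʳ i)))))

  numerator2-· : ∀ m k a v → numerator2 m k (λ i → a K.* v i) P.≋ (a ∷ []) P.✶ numerator2 m k v
  numerator2-· zero k a v = P.≋-sym (P.✶-zeroʳ (a ∷ []))
  numerator2-· (suc m) k a v = begin
   numerator k _ P.⊹ P.shift (numerator2 m k (λ i → a K.* v (k ↑ʳ i)))
    ≈⟨ P.⊹-cong (numerator-· k a _) (P.≋-trans (P.shift-cong (numerator2-· m k a _)) (P.≋-sym (var-✶ ((a ∷ []) P.✶ x)))) ⟩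
   (a ∷ []) P.✶ w P.⊹ var P.✶ ((a ∷ []) P.✶ x)
    ≈⟨ U.solve 4 (λ a w t x → a :* w :+ t :* (a :* x) := a :* (w :+ t :* x)) (a ∷ []) w var x ⟩
   (a ∷ []) P.✶ (w P.⊹ var P.✶ x) ≈⟨ P.✶-congˡ (a ∷ []) (P.⊹-cong (P.≋-refl {w}) (var-✶ x)) ⟩
   (a ∷ []) P.✶ (w P.⊹ P.shift x) ∎
   where
   open P.≋-Reasoning
   w x : P.Poly
   w = numerator k (λ i → v (i ↑ˡ m N.* k))
   x = numerator2 m k (λ i → v (k ↑ʳ i))

  -- The first m k coordinates are the coefficients of U, the others those of V. With f the
  -- denominator of a fraction z and g its numerator, the result is a numerator of the value of U +
  -- z V at the point.
  combine : ∀ m m′ k → P.Poly → P.Poly → P.LinearMap (m N.* k N.+ m′ N.* k)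
  combine m m′ k f g = record
   { to = λ v → f P.✶ numerator2 m k (λ i → v (i ↑ˡ m′ N.* k)) P.⊹ g P.✶ numerator2 m′ k (λ i → v (m N.* k ↑ʳ i))
   ; to-+ = λ u v → P.≋-trans (P.⊹-cong (P.✶-congˡ f (numerator2-+ m k _ _)) (P.✶-congˡ g (numerator2-+ m′ k _ _)))
     (U.solve 6 (λ f a b g x y → f :* (a :+ b) :+ g :* (x :+ y)
             := (f :* a :+ g :* x) :+ (f :* b :+ g :* y))
       f (numerator2 m k _) (numerator2 m k _) g (numerator2 m′ k _) (numerator2 m′ k _))
   ; to-· = λ a v → P.≋-trans (P.⊹-cong (P.✶-congˡ f (numerator2-· m k a _)) (P.✶-congˡ g (numerator2-· m′ k a _)))
     (P.≋-trans (U.solve 5 (λ f a x g y → f :* (a :* x) :+ g :* (a :* y) := a :* (f :* x :+ g :* y))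
       f (a ∷ []) (numerator2 m k _) g (numerator2 m′ k _)) (singleton-✶ K0 a _))
   ; to-cong = λ e′ → P.⊹-cong (P.✶-congˡ f (numerator2-cong m k (λ i → e′ (i ↑ˡ m′ N.* k))))
                  (P.✶-congˡ g (numerator2-cong m′ k (λ i → e′ (m N.* k ↑ʳ i))))
   }

kernel′ : (K : DiscreteField 0ℓ 0ℓ) → let open FieldPolynomials K in
     ∀ {N d} → N N.< d → (φ : LinearMap d) → (∀ u → LinearMap.to φ u ⊏ N) →
     Σ[ u ∈ Vector (DiscreteField.Carrier K) d ]
      (Σ[ i ∈ Fin d ] ¬ (DiscreteField._≈_ K (u i) (DiscreteField.0# K))) × LinearMap.to φ u ≋ []
kernel′ K {d = suc d} (s≤s N≤d) φ b = kernel d φ (λ u → ⊏-weaken {LinearMap.to φ u} N≤d (b u))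
 where open FieldPolynomials K

module Section (K : DiscreteField 0ℓ 0ℓ) (𝓕 : Overdomain K) (x y : Overdomain.Element 𝓕) where

 open Overdomain 𝓕
 open Bivariate K
 private
  module K = DiscreteField K
  module ι = RingHom ι
  module S = IntegerSolver F
 open Tabulation K
 open AtPoint 𝓕 x
 open CommutativeRing F hiding (zero)
 open S using (solve)

 module _ {p e r s : P.Poly} {n : ℕ}
  (e≉0 : ¬ (e P.≋ [])) (s≉0 : ¬ (s P.≋ []))
  (xe≈p : x * ι.⟦ e ⟧ ≈ ι.⟦ p ⟧) (ys≈r : y * ι.⟦ s ⟧ ≈ ι.⟦ r ⟧)
  (p⊏ : p P.⊏ suc n) (e⊏ : e P.⊏ suc n) where

  open Homogenised p e

  ι-power-≉0 : ∀ k → ¬ (ι.⟦ power k ⟧ ≈ 0#)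
  ι-power-≉0 zero = ι-≉0 λ e → K.1≉0 (P.at e 0)
  ι-power-≉0 (suc k) eq = ι-power-≉0 k (cancelF ι.⟦ e ⟧ (ι-≉0 e≉0) (trans (sym (ι.*-homo e (power k))) eq))

  -- The numerator contains the products p^i e^(k-1-i); the extra factor e raises k - 1 to k, so
  -- that the formula makes sense for k = 0 as well.
  ι-numerator : ∀ k v → ι.⟦ numerator k v ⟧ * ι.⟦ e ⟧ ≈ ι.⟦ power k ⟧ * evX.⟦ tabulate k v ⟧
  ι-numerator zero v = trans (*-congʳ ι.0-homo) (trans (zeroˡ _) (sym (zeroʳ _)))
  ι-numerator (suc k) v = begin
   ι.⟦ (v zero ∷ []) P.✶ power k P.⊹ p P.✶ numerator k v′ ⟧ * ι.⟦ e ⟧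
    ≈⟨ *-congʳ (trans (ι.+-homo ((v zero ∷ []) P.✶ power k) (p P.✶ numerator k v′)) (+-cong (ι.*-homo (v zero ∷ []) (power k)) (ι.*-homo p (numerator k v′)))) ⟩
   (ι.⟦ v zero ∷ [] ⟧ * ι.⟦ power k ⟧ + ι.⟦ p ⟧ * ι.⟦ numerator k v′ ⟧) * ι.⟦ e ⟧
    ≈⟨ solve 5 (λ a d p h e → (a :* d :+ p :* h) :* e := a :* d :* e :+ p :* (h :* e)) _ _ _ _ _ ⟩
   ι.⟦ v zero ∷ [] ⟧ * ι.⟦ power k ⟧ * ι.⟦ e ⟧ + ι.⟦ p ⟧ * (ι.⟦ numerator k v′ ⟧ * ι.⟦ e ⟧)
    ≈⟨ +-congˡ (*-cong (sym xe≈p) (ι-numerator k v′)) ⟩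
   ι.⟦ v zero ∷ [] ⟧ * ι.⟦ power k ⟧ * ι.⟦ e ⟧ + x * ι.⟦ e ⟧ * (ι.⟦ power k ⟧ * evX.⟦ tabulate k v′ ⟧)
    ≈⟨ solve 5 (λ a d e x w → a :* d :* e :+ x :* e :* (d :* w) := e :* d :* (a :+ x :* w)) _ _ _ _ _ ⟩
   ι.⟦ e ⟧ * ι.⟦ power k ⟧ * (ι.⟦ v zero ∷ [] ⟧ + x * evX.⟦ tabulate k v′ ⟧)
    ≈⟨ *-congʳ (ι.*-homo e (power k)) ⟨
   ι.⟦ e P.✶ power k ⟧ * (ι.⟦ v zero ∷ [] ⟧ + x * evX.⟦ tabulate k v′ ⟧) ∎
   where
   open ≈-Reasoning
   v′ : Vector 𝕂 k
   v′ i = v (suc i)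

  ι-numerator2 : ∀ m k v → ι.⟦ numerator2 m k v ⟧ * ι.⟦ e ⟧ ≈ ι.⟦ power k ⟧ * ev.⟦ tabulate2 m k v ⟧
  ι-numerator2 zero k v = trans (*-congʳ ι.0-homo) (trans (zeroˡ _) (sym (zeroʳ _)))
  ι-numerator2 (suc m) k v = begin
   ι.⟦ numerator k v1 P.⊹ P.shift (numerator2 m k v2) ⟧ * ι.⟦ e ⟧
    ≈⟨ *-congʳ (trans (ι.+-homo (numerator k v1) (P.shift (numerator2 m k v2))) (+-congˡ (ι-shift (numerator2 m k v2)))) ⟩
   (ι.⟦ numerator k v1 ⟧ + ι.⟦ var ⟧ * ι.⟦ numerator2 m k v2 ⟧) * ι.⟦ e ⟧
    ≈⟨ solve 4 (λ a t b e → (a :+ t :* b) :* e := a :* e :+ t :* (b :* e)) _ _ _ _ ⟩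
   ι.⟦ numerator k v1 ⟧ * ι.⟦ e ⟧ + ι.⟦ var ⟧ * (ι.⟦ numerator2 m k v2 ⟧ * ι.⟦ e ⟧)
    ≈⟨ +-cong (ι-numerator k v1) (*-congˡ (ι-numerator2 m k v2)) ⟩
   ι.⟦ power k ⟧ * evX.⟦ tabulate k v1 ⟧ + ι.⟦ var ⟧ * (ι.⟦ power k ⟧ * ev.⟦ tabulate2 m k v2 ⟧)
    ≈⟨ solve 4 (λ d a t b → d :* a :+ t :* (d :* b) := d :* (a :+ t :* b)) _ _ _ _ ⟩
   ι.⟦ power k ⟧ * (evX.⟦ tabulate k v1 ⟧ + ι.⟦ var ⟧ * ev.⟦ tabulate2 m k v2 ⟧) ∎
   where
   open ≈-Reasoning
   v1 : Vector 𝕂 k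
   v1 i = v (i ↑ˡ m N.* k)
   v2 : Vector 𝕂 (m N.* k)
   v2 i = v (k ↑ʳ i)

  -- The function that vanishes is (U - f V) + y V. The shift by the polynomial f in T is the
  -- freedom that lowers the degree of the norm when n is odd.
  record Vanishing (f : P.Poly) (m m′ : ℕ) : Set where
   field
    U V : Q.Poly
    U⊏ : U Q.⊏ m
    V⊏ : V Q.⊏ m′
    nonzero : ¬ (U Q.≋ [] × V Q.≋ [])
    vanish : ev.⟦ U Q.⊹ Q.⊟ (lift.⟦ f ⟧ Q.✶ V) ⟧ + y * ev.⟦ V ⟧ ≈ 0#

  -- There are (n + 1) k unknown coefficients and n k + O(1) conditions.

  vanishing : ∀ f m m′ → suc m N.+ m′ ≡ suc n → Vanishing f (suc m) m′
  vanishing f m m′ m+m′≡n = record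
   { U = tabulate2 (suc m) k u1 ; V = tabulate2 m′ k u2
   ; U⊏ = tabulate2-⊏ (suc m) k u1 ; V⊏ = tabulate2-⊏ m′ k u2
   ; nonzero = λ (e1 , e2) → [ (λ (j , w) → tabulate2-≉0 (suc m) k u1 j w e1) , (λ (j , w) → tabulate2-≉0 m′ k u2 j w e2) ]
           (split-≉0 (suc m N.* k) (m′ N.* k) u (proj₁ (proj₁ (proj₂ solution))) (proj₂ (proj₁ (proj₂ solution))))
   ; vanish = vanish
   }
   where
   r′ : P.Poly
   r′ = r P.⊹ P.⊟ (f P.✶ s)
   σ k : ℕ
   σ = length s N.+ length r′
   -- Chosen so that the (n + 1) k unknowns exceed the σ + (n + 1) + (k n + 1) conditions by exactly
   -- one.
   k = suc (σ N.+ suc (suc n))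
   φ : P.LinearMap (suc m N.* k N.+ m′ N.* k)
   φ = combine (suc m) m′ k s r′
   N : ℕ
   N = σ N.+ (suc n N.+ suc (k N.* n))
   m≤n : m N.≤ suc n
   m≤n = N.≤-trans (N.≤-trans (N.n≤1+n m) (N.m≤m+n (suc m) m′)) (N.≤-reflexive m+m′≡n)
   m′≤n : m′ N.≤ suc n
   m′≤n = N.≤-trans (N.m≤n+m m′ (suc m)) (N.≤-reflexive m+m′≡n)
   bound : ∀ u → P.LinearMap.to φ u P.⊏ N
   bound u = P.⊏-⊹ {s P.✶ h1} {r′ P.✶ h2}
    (P.⊏-weaken {s P.✶ h1} (N.+-mono-≤ (N.m≤m+n (length s) (length r′)) (N.+-monoˡ-≤ (suc (k N.* n)) m≤n))
     (P.⊏-✶ s h1 (length s) (m N.+ suc (k N.* n)) (P.⊏-length s) (numerator2-⊏ p⊏ e⊏ (suc m) k (λ i → u (i ↑ˡ m′ N.* k)))))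
    (P.⊏-weaken {r′ P.✶ h2} (N.+-mono-≤ (N.m≤n+m (length r′) (length s)) (N.+-monoˡ-≤ (suc (k N.* n)) m′≤n))
     (P.⊏-✶ r′ h2 (length r′) (m′ N.+ suc (k N.* n)) (P.⊏-length r′)
      (P.⊏-weaken {h2} (N.n≤1+n _) (numerator2-⊏ p⊏ e⊏ m′ k (λ i → u (suc m N.* k ↑ʳ i))))))
    where
    h1 h2 : P.Poly
    h1 = numerator2 (suc m) k (λ i → u (i ↑ˡ m′ N.* k))
    h2 = numerator2 m′ k (λ i → u (suc m N.* k ↑ʳ i))
   enough : N N.< suc m N.* k N.+ m′ N.* k
   enough = N.≤-reflexive (begin
    suc (σ N.+ (suc n N.+ suc (k N.* n))) ≡⟨ ≡.cong (λ z → suc (σ N.+ z)) (N.+-suc (suc n) (k N.* n)) ⟩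
    suc (σ N.+ (suc (suc n) N.+ k N.* n)) ≡⟨ ≡.cong suc (≡.sym (N.+-assoc σ (suc (suc n)) (k N.* n))) ⟩
    k N.+ k N.* n ≡⟨ ≡.cong (k N.+_) (N.*-comm k n) ⟩
    suc n N.* k ≡⟨ ≡.cong (N._* k) (≡.sym m+m′≡n) ⟩
    (suc m N.+ m′) N.* k ≡⟨ N.*-distribʳ-+ k (suc m) m′ ⟩
    suc m N.* k N.+ m′ N.* k ∎)
    where open ≡.≡-Reasoning
   solution = kernel′ K {N} {suc m N.* k N.+ m′ N.* k} enough φ bound
   u : Vector 𝕂 (suc m N.* k N.+ m′ N.* k)
   u = proj₁ solution
   u1 : Vector 𝕂 (suc m N.* k)
   u1 i = u (i ↑ˡ m′ N.* k)
   u2 : Vector 𝕂 (m′ N.* k)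
   u2 i = u (suc m N.* k ↑ʳ i)
   U V : Q.Poly
   U = tabulate2 (suc m) k u1
   V = tabulate2 m′ k u2
   h1 h2 : P.Poly
   h1 = numerator2 (suc m) k u1
   h2 = numerator2 m′ k u2
   open ≈-Reasoning
   ιr′ : ι.⟦ r′ ⟧ ≈ (y - ι.⟦ f ⟧) * ι.⟦ s ⟧
   ιr′ = begin
    ι.⟦ r′ ⟧ ≈⟨ ι.sub-homo r (f P.✶ s) ⟩
    ι.⟦ r ⟧ - ι.⟦ f P.✶ s ⟧ ≈⟨ +-cong (sym ys≈r) (-‿cong (ι.*-homo f s)) ⟩
    y * ι.⟦ s ⟧ - ι.⟦ f ⟧ * ι.⟦ s ⟧ ≈⟨ solve 3 (λ y f s → y :* s :- f :* s := (y :- f) :* s) _ _ _ ⟩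
    (y - ι.⟦ f ⟧) * ι.⟦ s ⟧ ∎
   total≈0 : ι.⟦ s ⟧ * ι.⟦ h1 ⟧ + (y - ι.⟦ f ⟧) * ι.⟦ s ⟧ * ι.⟦ h2 ⟧ ≈ 0#
   total≈0 = begin
    ι.⟦ s ⟧ * ι.⟦ h1 ⟧ + (y - ι.⟦ f ⟧) * ι.⟦ s ⟧ * ι.⟦ h2 ⟧
     ≈⟨ +-cong (ι.*-homo s h1) (trans (ι.*-homo r′ h2) (*-congʳ ιr′)) ⟨
    ι.⟦ s P.✶ h1 ⟧ + ι.⟦ r′ P.✶ h2 ⟧ ≈⟨ ι.+-homo (s P.✶ h1) (r′ P.✶ h2) ⟨
    ι.⟦ s P.✶ h1 P.⊹ r′ P.✶ h2 ⟧ ≈⟨ ι.⟦⟧-cong (proj₂ (proj₂ solution)) ⟩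
    ι.⟦ [] ⟧ ≈⟨ ι.0-homo ⟩
    0# ∎
   vanish : ev.⟦ U Q.⊹ Q.⊟ (lift.⟦ f ⟧ Q.✶ V) ⟧ + y * ev.⟦ V ⟧ ≈ 0#
   vanish = begin
    ev.⟦ U Q.⊹ Q.⊟ (lift.⟦ f ⟧ Q.✶ V) ⟧ + y * ev.⟦ V ⟧
     ≈⟨ +-congʳ (trans (ev.sub-homo U (lift.⟦ f ⟧ Q.✶ V)) (+-congˡ (-‿cong (trans (ev.*-homo lift.⟦ f ⟧ V) (*-congʳ (ev-lift f)))))) ⟩
    ev.⟦ U ⟧ - ι.⟦ f ⟧ * ev.⟦ V ⟧ + y * ev.⟦ V ⟧
     ≈⟨ cancelF (ι.⟦ power k ⟧ * ι.⟦ s ⟧) (λ z → ι-≉0 s≉0 (cancelF ι.⟦ power k ⟧ (ι-power-≉0 k) z)) (begin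
      ι.⟦ power k ⟧ * ι.⟦ s ⟧ * (ev.⟦ U ⟧ - ι.⟦ f ⟧ * ev.⟦ V ⟧ + y * ev.⟦ V ⟧)
       ≈⟨ solve 6 (λ d s u f v y → d :* s :* (u :- f :* v :+ y :* v) := s :* (d :* u) :+ (y :- f) :* s :* (d :* v)) _ _ _ _ _ _ ⟩
      ι.⟦ s ⟧ * (ι.⟦ power k ⟧ * ev.⟦ U ⟧) + (y - ι.⟦ f ⟧) * ι.⟦ s ⟧ * (ι.⟦ power k ⟧ * ev.⟦ V ⟧)
       ≈⟨ +-cong (*-congˡ (ι-numerator2 (suc m) k u1)) (*-congˡ (ι-numerator2 m′ k u2)) ⟨
      ι.⟦ s ⟧ * (ι.⟦ h1 ⟧ * ι.⟦ e ⟧) + (y - ι.⟦ f ⟧) * ι.⟦ s ⟧ * (ι.⟦ h2 ⟧ * ι.⟦ e ⟧)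
       ≈⟨ solve 5 (λ s a e z b → s :* (a :* e) :+ z :* s :* (b :* e) := (s :* a :+ z :* s :* b) :* e) _ _ _ _ _ ⟩
      (ι.⟦ s ⟧ * ι.⟦ h1 ⟧ + (y - ι.⟦ f ⟧) * ι.⟦ s ⟧ * ι.⟦ h2 ⟧) * ι.⟦ e ⟧
       ≈⟨ trans (*-congʳ total≈0) (zeroˡ _) ⟩
      0# ∎) ⟩
    0# ∎

-- Parity, and the norm form of a conic over K(X)

even≢odd : ∀ i j → i N.+ i ≢ suc (j N.+ j)
even≢odd (suc i) (suc j) e = even≢odd i j (N.suc-injective (N.suc-injective
 (≡.trans (≡.cong suc (≡.sym (N.+-suc i i))) (≡.trans e (≡.cong (λ k → suc (suc k)) (N.+-suc j j))))))
even≢odd (suc i) zero e with ≡.trans (≡.sym (N.+-suc i i)) (N.suc-injective e)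
... | ()

parity : ∀ n → (Σ[ m ∈ ℕ ] n ≡ m N.+ m) ⊎ (Σ[ m ∈ ℕ ] n ≡ suc (m N.+ m))
parity zero = inj₁ (0 , ≡.refl)
parity (suc n) with parity n
... | inj₁ (m , e) = inj₂ (m , ≡.cong suc e)
... | inj₂ (m , e) = inj₁ (suc m , ≡.trans (≡.cong suc e) (≡.cong suc (≡.sym (N.+-suc m m))))

record Conic (K : DiscreteField 0ℓ 0ℓ) : Set where
 field
  {A B C} : List (DiscreteField.Carrier K)
  A⊏3 : FieldPolynomials._⊏_ K A 3
  B⊏3 : FieldPolynomials._⊏_ K B 3
  C-top : FieldPolynomials.Top K C 3 (DiscreteField.1# K)

module Conics (K : DiscreteField 0ℓ 0ℓ) (𝒞 : Conic K) where

 open Conic 𝒞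
 open Bivariate K
 private
  module K = DiscreteField K
  module KS = IntegerSolver K0

 module NormForm where

  open DomainProperties K-domain using () renaming (*-≉0 to K-*-≉0)

  q : Q.Poly
  q = C ∷ B ∷ A ∷ []

  norm : Q.Poly → Q.Poly → Q.Poly
  norm U V = U Q.✶ U Q.⊹ Q.⊟ (q Q.✶ (V Q.✶ V))

  norm-cong : ∀ {U U′ V V′} → U Q.≋ U′ → V Q.≋ V′ → norm U V Q.≋ norm U′ V′
  norm-cong e f = Q.⊹-cong (Q.✶-cong e e) (Q.⊟-cong (Q.✶-congˡ q (Q.✶-cong f f)))

  norm-scale : ∀ w U V → norm (w Q.✶ U) (w Q.✶ V) Q.≋ (w Q.✶ w) Q.✶ norm U V
  norm-scale = W.solve 4 (λ q w U V → (w :* U) :* (w :* U) :- q :* ((w :* V) :* (w :* V))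
          := (w :* w) :* (U :* U :- q :* (V :* V))) q

  -- The degrees 2 deg u and 3 + 2 deg v have different parity, so the leading terms cannot cancel
  -- and v ≠ 0 would force degree at least 3. With v = 0 the polynomial w is a square of degree at
  -- most 1, hence constant.
  degree-parity : ∀ {g u v w} → P.Top g 3 K.1# → u P.✶ u P.⊹ P.⊟ (g P.✶ (v P.✶ v)) P.≋ w → w P.⊏ 2 →
          v P.≋ [] × P.coeff w 1 K.≈ K.0#
  degree-parity {g} {u} {v} {w} g-top e w⊏2 with P.classify v
  ... | inj₁ v≋0 = v≋0 , w1≈0
   where
   u²≋w : u P.✶ u P.≋ w
   u²≋w = P.≋-trans (P.≋-sym (P.≋-trans (P.⊹-cong (P.≋-refl {u P.✶ u}) (P.⊟-cong
    (P.≋-trans (P.✶-congˡ g (P.✶-zeroˡ v v v≋0)) (P.✶-zeroʳ g)))) (P.⊹-identityʳ _))) e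
   w1≈0 : P.coeff w 1 K.≈ K.0#
   w1≈0 with P.classify u
   ... | inj₁ u≋0 = K.trans (K.sym (P.at u²≋w 1)) (P.at (P.✶-zeroˡ u u u≋0) 1)
   ... | inj₂ (zero , a , _ , t) = K.trans (K.sym (P.at u²≋w 1)) (P.below (P.Top-✶ t t) 1 N.≤-refl)
   ... | inj₂ (suc i , a , a≉0 , t)
    with P.Top-< {w} (K-*-≉0 a≉0 a≉0) (P.Top-resp u²≋w K.refl (P.Top-✶ t t)) w⊏2
   ... | s≤s (s≤s i+1+i≤0) with ≡.trans (≡.sym (N.+-suc i i)) (N.n≤0⇒n≡0 i+1+i≤0)
   ... | ()
  ... | inj₂ (j , b , b≉0 , tv) = ⊥-elim absurd
   where
   gv² : P.Top (P.⊟ (g P.✶ (v P.✶ v))) (3 N.+ (j N.+ j)) (K.- (K.1# K.* (b K.* b)))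
   gv² = P.Top-⊟ {g P.✶ (v P.✶ v)} (P.Top-✶ g-top (P.Top-✶ tv tv))
   open RingProperties K.ring using (-0#≈0#; -‿involutive)
   neg≉0 : ¬ (K.- (K.1# K.* (b K.* b)) K.≈ K.0#)
   neg≉0 z = K-*-≉0 K.1≉0 (K-*-≉0 b≉0 b≉0) (K.trans (K.sym (-‿involutive _)) (K.trans (K.-‿cong z) -0#≈0#))
   too-big : ∀ {n a} → ¬ (a K.≈ K.0#) → 2 N.≤ n → P.Top (u P.✶ u P.⊹ P.⊟ (g P.✶ (v P.✶ v))) n a → ⊥
   too-big a≉0 2≤n t = N.<⇒≱ (P.Top-< {w} a≉0 (P.Top-resp e K.refl t) w⊏2) 2≤n
   absurd : ⊥
   absurd with P.classify u
   ... | inj₁ u≋0 = too-big (λ z → neg≉0 (K.trans (K.sym (K.+-identityˡ _)) z)) (s≤s (s≤s z≤n))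
      (P.Top-⊹ (P.Top-0 (3 N.+ (j N.+ j)) z≤n (P.⊏-resp (P.≋-sym (P.✶-zeroˡ u u u≋0)) P.[]⊏)) gv²)
   ... | inj₂ (i , a , a≉0 , tu) with N.<-cmp (i N.+ i) (3 N.+ (j N.+ j))
   ... | tri< i<j _ _ = too-big (λ z → neg≉0 (K.trans (K.sym (K.+-identityˡ _)) z)) (s≤s (s≤s z≤n))
       (P.Top-⊹ (P.Top-weaken (3 N.+ (j N.+ j)) i<j (P.Top-✶ tu tu)) gv²)
   ... | tri≈ _ i≡j _ = even≢odd i (suc j) (≡.trans i≡j (≡.cong (λ k → suc (suc k)) (≡.sym (N.+-suc j j))))
   ... | tri> _ _ j<i = too-big (λ z → K-*-≉0 a≉0 a≉0 (K.trans (K.sym (K.+-identityʳ _)) z)) (N.≤-trans (s≤s (s≤s z≤n)) j<i)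
       (P.Top-⊹ (P.Top-✶ tu tu) (P.Top-weaken (i N.+ i) j<i gv²))

  module AtT (t : 𝕂) where

   evalT : RingHom K[X][T] K[X]
   evalT = Evaluation.evalHom (identityHom K[X]) (t ∷ [])
   open RingHom evalT public

   q-top : P.Top ⟦ q ⟧ 3 K.1#
   q-top = P.Top-resp (P.≋-refl {⟦ q ⟧}) (K.+-identityʳ _) (P.Top-⊹ C-top (P.Top-0 3 N.≤-refl
    (P.⊏-✶ (t ∷ []) (B P.⊹ (t ∷ []) P.✶ (A P.⊹ (t ∷ []) P.✶ [])) 1 2 (P.⊏-length (t ∷ []))
     (P.⊏-⊹ {B} B⊏3 (P.⊏-✶ (t ∷ []) (A P.⊹ (t ∷ []) P.✶ []) 1 2 (P.⊏-length (t ∷ []))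
      (P.⊏-⊹ {A} A⊏3 (P.⊏-resp (P.≋-sym (P.✶-zeroʳ (t ∷ []))) P.[]⊏)))))))

   eval-norm : ∀ U V → ⟦ norm U V ⟧ P.≋ ⟦ U ⟧ P.✶ ⟦ U ⟧ P.⊹ P.⊟ (⟦ q ⟧ P.✶ (⟦ V ⟧ P.✶ ⟦ V ⟧))
   eval-norm U V = P.≋-trans (sub-homo (U Q.✶ U) (q Q.✶ (V Q.✶ V))) (P.⊹-cong (*-homo U U)
    (P.⊟-cong (P.≋-trans (*-homo q (V Q.✶ V)) (P.✶-congˡ ⟦ q ⟧ (*-homo V V)))))

   eval-lift : ∀ f → ⟦ lift.⟦ f ⟧ ⟧ P.≋ Evaluation.eval (identityHom K0) t f ∷ []
   eval-lift [] = P.≋-sym P.shift-0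
   eval-lift (a ∷ f) = P.≋-trans (P.⊹-cong (P.≋-refl {a ∷ []}) (P.✶-congˡ (t ∷ []) (eval-lift f)))
    (P.∷-cong (K.+-congˡ (K.+-identityʳ _)) P.≋-refl)

  private
   tail : Q.Poly → Q.Poly
   tail [] = []
   tail (f ∷ U) = U

   head∷tail : ∀ U → U Q.≋ Q.coeff U 0 ∷ tail U
   head∷tail [] = Q.≋-sym Q.shift-0
   head∷tail (f ∷ U) = Q.≋-refl

   T : Q.Poly
   T = [] ∷ P.one ∷ []

   T-✶ : ∀ U → T Q.✶ U Q.≋ Q.shift U
   T-✶ U = Q.≋-trans (Q.shift-✶ Q.one U) (Q.shift-cong (Q.✶-identityˡ U))

  -- Setting T = 0 and comparing degrees in X shows that the constant terms in T of U and V vanish.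
  -- Both are then divisible by T, the quotients again have norm 0, and the list V has become
  -- shorter.
  norm≋0 : ∀ V U → norm U V Q.≋ [] → U Q.≋ [] × V Q.≋ []
  norm≋0 [] U e = D2.square-≈0 {U} (Q.≋-trans (Q.≋-sym (Q.≋-trans (Q.⊹-cong (Q.≋-refl {U Q.✶ U})
           (Q.⊟-cong (Q.✶-zeroʳ q))) (Q.⊹-identityʳ _))) e) , Q.≋-refl
  norm≋0 (v ∷ V) U e = Q.≋-trans U≋ (Q.≋-trans (Q.✶-congˡ T (proj₁ IH)) (Q.✶-zeroʳ T))
            , Q.≋-trans V≋ (Q.≋-trans (Q.✶-congˡ T (proj₂ IH)) (Q.✶-zeroʳ T))
   where
   open AtT K.0#
   u : P.Poly
   u = Q.coeff U 0
   at0 : ∀ f W → ⟦ f ∷ W ⟧ P.≋ f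
   at0 f W = P.≋-trans (P.⊹-cong (P.≋-refl {f}) (P.✶-zeroˡ (K.0# ∷ []) ⟦ W ⟧ P.shift-0)) (P.⊹-identityʳ f)
   reduced : ⟦ U ⟧ P.✶ ⟦ U ⟧ P.⊹ P.⊟ (⟦ q ⟧ P.✶ (⟦ v ∷ V ⟧ P.✶ ⟦ v ∷ V ⟧)) P.≋ []
   reduced = P.≋-trans (P.≋-sym (eval-norm U (v ∷ V))) (P.≋-trans (⟦⟧-cong e) P.≋-refl)
   ⟦V⟧≋0 : ⟦ v ∷ V ⟧ P.≋ []
   ⟦V⟧≋0 = proj₁ (degree-parity {⟦ q ⟧} {⟦ U ⟧} {⟦ v ∷ V ⟧} q-top reduced P.[]⊏)
   v≋0 : v P.≋ []
   v≋0 = P.≋-trans (P.≋-sym (at0 v V)) ⟦V⟧≋0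
   u≋0 : u P.≋ []
   u≋0 = P.≋-trans (P.≋-sym (P.≋-trans (⟦⟧-cong (head∷tail U)) (at0 u (tail U)))) (D1.square-≈0 {⟦ U ⟧}
    (P.≋-trans (P.≋-sym (P.≋-trans (P.⊹-cong (P.≋-refl {⟦ U ⟧ P.✶ ⟦ U ⟧}) (P.⊟-cong (P.≋-trans (P.✶-congˡ ⟦ q ⟧
     (P.✶-zeroˡ ⟦ v ∷ V ⟧ ⟦ v ∷ V ⟧ ⟦V⟧≋0)) (P.✶-zeroʳ ⟦ q ⟧)))) (P.⊹-identityʳ _))) reduced))
   U≋ : U Q.≋ T Q.✶ tail U
   U≋ = Q.≋-trans (head∷tail U) (Q.≋-trans (Q.∷-cong u≋0 Q.≋-refl) (Q.≋-sym (T-✶ (tail U))))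
   V≋ : v ∷ V Q.≋ T Q.✶ V
   V≋ = Q.≋-trans (Q.∷-cong v≋0 Q.≋-refl) (Q.≋-sym (T-✶ V))
   T≉0 : ¬ (T Q.≋ [])
   T≉0 z = K.1≉0 (P.at (Q.at z 1) 0)
   IH : tail U Q.≋ [] × V Q.≋ []
   IH = norm≋0 V (tail U) (D2.cancel-≈0 (T Q.✶ T) {norm (tail U) V} (D2.*-≉0 {T} {T} T≉0 T≉0)
       (Q.≋-trans (Q.≋-sym (norm-scale T (tail U) V)) (Q.≋-trans (norm-cong (Q.≋-sym U≋) (Q.≋-sym V≋)) e)))

  -- Choose a value t of T with e(t) ≠ 0. There k (p(t) - X e(t)) has degree exactly 1 in X, which
  -- `degree-parity` rules out for a norm.
  no-constant-multiple : (t : ℕ → 𝕂) → (∀ {i j} → t i K.≈ t j → i ≡ j) →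
   ∀ {p e k U V} → ¬ (e P.≋ []) → ¬ (k K.≈ K.0#) → ¬ (norm U V Q.≋ ((k ∷ []) ∷ []) Q.✶ linear p e)
  no-constant-multiple t t-injective {p} {e} {k} {U} {V} e≉0 k≉0 eq =
   K-*-≉0 k≉0 (proj₂ point) (K.trans (K.sym (-‿involutive _)) (K.trans (K.-‿cong
    (K.trans (K.sym coefficient) (proj₂ (degree-parity {⟦ q ⟧} {⟦ U ⟧} {⟦ V ⟧} {w} q-top
     (P.≋-trans (P.≋-sym (eval-norm U V)) (P.≋-trans (⟦⟧-cong eq) w≋)) (P.⊏-length w))))) -0#≈0#))
   where
   open RingProperties K.ring using (-0#≈0#; -‿involutive)
   point : Σ[ i ∈ ℕ ] ¬ (Evaluation.eval (identityHom K0) (t i) e K.≈ K.0#)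
   point = P.nonRoot e e≉0 t t-injective
   open AtT (t (proj₁ point))
   pₜ eₜ : 𝕂
   pₜ = Evaluation.eval (identityHom K0) (t (proj₁ point)) p
   eₜ = Evaluation.eval (identityHom K0) (t (proj₁ point)) e
   w : P.Poly
   w = (k K.* pₜ) ∷ (K.- (k K.* eₜ)) ∷ []
   coefficient : P.coeff w 1 K.≈ K.- (k K.* eₜ)
   coefficient = K.refl
   w≋ : ⟦ ((k ∷ []) ∷ []) Q.✶ linear p e ⟧ P.≋ w
   w≋ = begin
    ⟦ ((k ∷ []) ∷ []) Q.✶ linear p e ⟧ ≈⟨ *-homo ((k ∷ []) ∷ []) (linear p e) ⟩
    ⟦ (k ∷ []) ∷ [] ⟧ P.✶ ⟦ linear p e ⟧
     ≈⟨ P.✶-cong (P.≋-trans (P.⊹-cong (P.≋-refl {k ∷ []}) (P.✶-zeroʳ (t (proj₁ point) ∷ []))) (P.⊹-identityʳ (k ∷ [])))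
        (P.≋-trans (sub-homo lift.⟦ p ⟧ (var Q.· lift.⟦ e ⟧)) (P.⊹-cong (eval-lift p) (P.⊟-cong
         (P.≋-trans (⟦⟧-cong (Q.≋-sym (singleton-✶ K[X] var lift.⟦ e ⟧))) (P.≋-trans (*-homo (var ∷ []) lift.⟦ e ⟧)
          (P.✶-cong (P.≋-trans (P.⊹-cong (P.≋-refl {var}) (P.✶-zeroʳ (t (proj₁ point) ∷ []))) (P.⊹-identityʳ var)) (eval-lift e))))))) ⟩
    (k ∷ []) P.✶ ((pₜ ∷ []) P.⊹ P.⊟ (var P.✶ (eₜ ∷ [])))
     ≈⟨ P.≋-trans (singleton-✶ K0 k _) (P.·-cong K.refl (P.⊹-cong (P.≋-refl {pₜ ∷ []}) (P.⊟-cong (var-✶ (eₜ ∷ []))))) ⟩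
    (k K.* (pₜ K.- K.0#)) ∷ (k K.* (K.- eₜ)) ∷ []
     ≈⟨ P.∷-cong (KS.solve 2 (λ k p → k :* (p :- :0) := k :* p) k pₜ)
        (P.∷-cong (KS.solve 2 (λ k e → k :* (:- e) := :- (k :* e)) k eₜ) P.≋-refl) ⟩
    w ∎
    where open P.≋-Reasoning

  -- The polynomial q is congruent to (α T + β)² modulo π.
  record SquareModulo (π : P.Poly) : Set where
   field
    α β : P.Poly
    A≡α² : π P.∣ A P.⊹ P.⊟ (α P.✶ α)
    B≡2αβ : π P.∣ B P.⊹ P.⊟ (α P.✶ β P.⊹ α P.✶ β)
    C≡β² : π P.∣ C P.⊹ P.⊟ (β P.✶ β)

  DividesBoth : P.Poly → Q.Poly → Q.Poly → Set
  DividesBoth π U V = Σ[ U1 ∈ Q.Poly ] Σ[ V1 ∈ Q.Poly ] U Q.≋ (π ∷ []) Q.✶ U1 × V Q.≋ (π ∷ []) Q.✶ V1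

  -- L stands for K[X]/π, described by the kernel and the surjectivity of φ alone.
  module Residues {π : P.Poly} (L : DiscreteField 0ℓ 0ℓ)
   (φ : RingHom K[X] (DiscreteField.commutativeRing L))
   (φ-kernel : ∀ f → DiscreteField._≈_ L (RingHom.⟦_⟧ φ f) (DiscreteField.0# L) → π P.∣ f)
   (φπ≈0 : DiscreteField._≈_ L (RingHom.⟦_⟧ φ π) (DiscreteField.0# L))
   (φ-surjective : ∀ a → Σ[ f ∈ P.Poly ] DiscreteField._≈_ L (RingHom.⟦_⟧ φ f) a) where

   module L = DiscreteField L
   module PL = FieldPolynomials L
   module φ = RingHom φ
   reduce : RingHom K[X][T] PL.polynomialRing
   reduce = polyHom φ
   open RingHom reduce

   reduce-≋0 : ∀ {U} → ⟦ U ⟧ PL.≋ [] → Σ[ U1 ∈ Q.Poly ] U Q.≋ (π ∷ []) Q.✶ U1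
   reduce-≋0 {[]} e = [] , Q.≋-sym (Q.✶-zeroʳ (π ∷ []))
   reduce-≋0 {f ∷ U} e with φ-kernel f (PL.at e 0) | reduce-≋0 {U} (PL.mk≋ λ n → PL.at e (suc n))
   ... | P.divides g f≋ | U1 , U≋ = g ∷ U1 , Q.≋-trans
    (Q.∷-cong (P.≋-trans f≋ (P.✶-comm g π)) (Q.≋-trans U≋ (singleton-✶ K[X] π U1))) (Q.≋-sym (singleton-✶ K[X] π (g ∷ U1)))

   multiple-≋0 : ∀ W → ⟦ (π ∷ []) Q.✶ W ⟧ PL.≋ []
   multiple-≋0 W = PL.≋-trans (*-homo (π ∷ []) W) (PL.✶-zeroˡ ⟦ π ∷ [] ⟧ ⟦ W ⟧
    (PL.≋-trans (PL.∷-cong φπ≈0 PL.≋-refl) PL.shift-0))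

   reduce-norm : ∀ {U V W} → norm U V Q.≋ (π ∷ []) Q.✶ W → ⟦ U ⟧ PL.✶ ⟦ U ⟧ PL.≋ ⟦ q ⟧ PL.✶ (⟦ V ⟧ PL.✶ ⟦ V ⟧)
   reduce-norm {U} {V} {W} e = x∙y⁻¹≈ε⇒x≈y (⟦ U ⟧ PL.✶ ⟦ U ⟧) (⟦ q ⟧ PL.✶ (⟦ V ⟧ PL.✶ ⟦ V ⟧)) (begin
    ⟦ U ⟧ PL.✶ ⟦ U ⟧ PL.⊹ PL.⊟ (⟦ q ⟧ PL.✶ (⟦ V ⟧ PL.✶ ⟦ V ⟧))
     ≈⟨ PL.⊹-cong (*-homo U U) (PL.⊟-cong (PL.≋-trans (*-homo q (V Q.✶ V)) (PL.✶-congˡ ⟦ q ⟧ (*-homo V V)))) ⟨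
    ⟦ U Q.✶ U ⟧ PL.⊹ PL.⊟ ⟦ q Q.✶ (V Q.✶ V) ⟧ ≈⟨ sub-homo (U Q.✶ U) (q Q.✶ (V Q.✶ V)) ⟨
    ⟦ norm U V ⟧ ≈⟨ ⟦⟧-cong e ⟩
    ⟦ (π ∷ []) Q.✶ W ⟧ ≈⟨ multiple-≋0 W ⟩
    [] ∎)
    where
    open GroupProperties (CommutativeRing.+-group PL.polynomialRing) using (x∙y⁻¹≈ε⇒x≈y)
    open PL.≋-Reasoning

   squareModulo : ∀ {Q} → Q PL.✶ Q PL.≋ ⟦ q ⟧ → SquareModulo π
   squareModulo {Q} e = record
    { α = α ; β = β
    ; A≡α² = φ-kernel _ (L.trans (φ.sub-homo A (α P.✶ α)) (difference
      (L.trans (φ.*-homo α α) (L.trans (L.*-cong φα φα) (proj₁ (proj₂ (proj₂ root)))))))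
    ; B≡2αβ = φ-kernel _ (L.trans (φ.sub-homo B (α P.✶ β P.⊹ α P.✶ β)) (difference
      (L.trans (φ.+-homo (α P.✶ β) (α P.✶ β)) (L.trans (L.+-cong φαβ φαβ) (proj₁ (proj₂ (proj₂ (proj₂ root))))))))
    ; C≡β² = φ-kernel _ (L.trans (φ.sub-homo C (β P.✶ β)) (difference
      (L.trans (φ.*-homo β β) (L.trans (L.*-cong φβ φβ) (proj₂ (proj₂ (proj₂ (proj₂ root))))))))
    }
    where
    root = PL.quadratic-square-root {Q} e
    α β : P.Poly
    α = proj₁ (φ-surjective (proj₁ root))
    β = proj₁ (φ-surjective (proj₁ (proj₂ root)))
    φα : φ.⟦ α ⟧ L.≈ proj₁ root
    φα = proj₂ (φ-surjective (proj₁ root))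
    φβ : φ.⟦ β ⟧ L.≈ proj₁ (proj₂ root)
    φβ = proj₂ (φ-surjective (proj₁ (proj₂ root)))
    φαβ : φ.⟦ α P.✶ β ⟧ L.≈ proj₁ root L.* proj₁ (proj₂ root)
    φαβ = L.trans (φ.*-homo α β) (L.*-cong φα φβ)
    difference : ∀ {x y} → y L.≈ x → x L.- y L.≈ L.0#
    difference e = L.trans (L.+-congˡ (L.-‿cong e)) (L.-‿inverseʳ _)

   reduce-prime : ∀ {U V W} → U Q.✶ V Q.≋ (π ∷ []) Q.✶ W →
    (Σ[ U1 ∈ Q.Poly ] U Q.≋ (π ∷ []) Q.✶ U1) ⊎ (Σ[ V1 ∈ Q.Poly ] V Q.≋ (π ∷ []) Q.✶ V1)
   reduce-prime {U} {V} {W} e with PL.PolyDomain.noZeroDivisors ⟦ U ⟧ ⟦ V ⟧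
    (PL.≋-trans (PL.≋-sym (*-homo U V)) (PL.≋-trans (⟦⟧-cong e) (multiple-≋0 W)))
   ... | inj₁ z = inj₁ (reduce-≋0 {U} z)
   ... | inj₂ z = inj₂ (reduce-≋0 {V} z)

   -- Modulo π the hypothesis reads U² = q V². If V is nonzero there, q is the square of a fraction
   -- and, by integrality, of a polynomial in T over K[X]/π; otherwise U² = 0 as well and π divides
   -- both.
   divides-norm : ∀ {U V W} → norm U V Q.≋ (π ∷ []) Q.✶ W → DividesBoth π U V ⊎ SquareModulo π
   divides-norm {U} {V} {W} e with ⟦ V ⟧ PL.PolyDomain.≟ []
   ... | no V≉0 = inj₂ (squareModulo {proj₁ root} (proj₂ root))
    where root = PL.square-root {⟦ U ⟧} {⟦ V ⟧} {⟦ q ⟧} V≉0 (reduce-norm {U} {V} {W} e)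
   ... | yes V≋0 with reduce-≋0 {U} (PL.PolyDomainProperties.square-≈0 {⟦ U ⟧} (PL.≋-trans (reduce-norm {U} {V} {W} e)
              (PL.≋-trans (PL.✶-congˡ ⟦ q ⟧ (PL.✶-zeroˡ ⟦ V ⟧ ⟦ V ⟧ V≋0)) (PL.✶-zeroʳ ⟦ q ⟧))))
            | reduce-≋0 {V} V≋0
   ... | U1 , U≋ | V1 , V≋ = inj₁ (U1 , V1 , U≋ , V≋)

  -- When an irreducible π divides a norm, it can be cancelled: either trivially
  -- or because π is itself a norm (up to constants) of an element dividing U + VY.

  Reduction : Set
  Reduction = ∀ {π U V W} → P.Irreducible π → norm U V Q.≋ (π ∷ []) Q.✶ W → DividesBoth π U V ⊎
   (Σ[ U1 ∈ Q.Poly ] Σ[ V1 ∈ Q.Poly ] Σ[ k ∈ 𝕂 ] ¬ (k K.≈ K.0#) ×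
    (π ∷ []) Q.✶ norm U1 V1 Q.≋ ((k ∷ []) ∷ []) Q.✶ norm U V)

 -- Descent on the multiplier of a norm

 module Descent where

  open NormForm public
  open DomainProperties K-domain using () renaming (*-≉0 to K-*-≉0)

  divides-norm : ∀ {π U V W} → P.Irreducible π → norm U V Q.≋ (π ∷ []) Q.✶ W → DividesBoth π U V ⊎ SquareModulo π
  divides-norm irr = Residues.divides-norm (P.residueField irr) (P.residueHom irr)
   (λ f → P.residue-≈0 irr) (P.∣⇒residue-≈0 irr P.∣-refl) (λ f → f , DiscreteField.refl (P.residueField irr))

  prime2 : ∀ {π U V W} → P.Irreducible π → U Q.✶ V Q.≋ (π ∷ []) Q.✶ W →
   (Σ[ U1 ∈ Q.Poly ] U Q.≋ (π ∷ []) Q.✶ U1) ⊎ (Σ[ V1 ∈ Q.Poly ] V Q.≋ (π ∷ []) Q.✶ V1)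
  prime2 irr = Residues.reduce-prime (P.residueField irr) (P.residueHom irr)
   (λ f → P.residue-≈0 irr) (P.∣⇒residue-≈0 irr P.∣-refl) (λ f → f , DiscreteField.refl (P.residueField irr))

  -- For x = p / e this says that x is not a constant.
  NotProportional : P.Poly → P.Poly → Set
  NotProportional p e = ∀ κ → ¬ (p P.≋ κ P.· e)

  -- Each coefficient p_j - X e_j in T has degree at most 1 in X. If π has degree at least 2, all of
  -- them vanish and e = 0. If π is linear, they are all scalar multiples of π, and p = κ e for the
  -- root κ of π.
  linear-primitive : ∀ {p e π} → ¬ (e P.≋ []) → NotProportional p e → P.Irreducible π →
        ¬ (∀ j → π P.∣ Q.coeff (linear p e) j)
  linear-primitive {p} {e} {π} e≉0 p≉κe irr π∣ = contradiction
   where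
   open P.Irreducible irr using (leading; leading≉0; degree) renaming (degree-1 to d)
   π0 π1 : 𝕂
   π0 = P.coeff π 0
   π1 = P.coeff π 1
   relation : ∀ j → (P.coeff p j K.≈ K.0# × P.coeff e j K.≈ K.0#) ⊎
         (d ≡ 0 × Σ[ b ∈ 𝕂 ] P.coeff p j K.≈ b K.* π0 × K.- P.coeff e j K.≈ b K.* π1)
   relation j with π∣ j
   ... | P.divides g eq with P.classify g
   ... | inj₁ g≋0 = inj₁ (P.at zero≋ 0 , K.trans (K.sym (-‿involutive _)) (K.trans (K.-‿cong (P.at zero≋ 1)) -0#≈0#))
    where
    open RingProperties K.ring using (-0#≈0#; -‿involutive)
    zero≋ : P.coeff p j ∷ (K.- P.coeff e j) ∷ [] P.≋ []
    zero≋ = P.≋-trans (P.≋-sym (coeff-linear p e j)) (P.≋-trans eq (P.✶-zeroˡ g π g≋0))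
   ... | inj₂ (i , b , b≉0 , t) = inj₂ (d≡0 , b , P.at multiple 0 , P.at multiple 1)
    where
    i+d+1<2 : i N.+ suc d N.< 2
    i+d+1<2 = P.Top-< {P.coeff p j ∷ (K.- P.coeff e j) ∷ []} (K-*-≉0 b≉0 leading≉0)
     (P.Top-resp (P.≋-trans (P.≋-sym eq) (coeff-linear p e j)) K.refl (P.Top-✶ t degree)) (P.⊏-length _)
    i+d≡0 : i N.+ d ≡ 0
    i+d≡0 = N.n≤0⇒n≡0 (N.s≤s⁻¹ (N.s≤s⁻¹ (≡.subst (N._< 2) (N.+-suc i d) i+d+1<2)))
    i≡0 : i ≡ 0
    i≡0 = N.m+n≡0⇒m≡0 i i+d≡0
    d≡0 : d ≡ 0
    d≡0 = N.m+n≡0⇒n≡0 i i+d≡0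
    g≋b : g P.≋ b ∷ []
    g≋b = P.≋-trans (P.const⇒ (≡.subst (λ i → g P.⊏ suc i) i≡0 (P.below t)))
        (P.∷-cong (≡.subst (λ i → P.coeff g i K.≈ b) i≡0 (P.lead t)) P.≋-refl)
    multiple : P.coeff p j ∷ (K.- P.coeff e j) ∷ [] P.≋ (b K.* π0) ∷ (b K.* π1) ∷ []
    multiple = P.≋-trans (P.≋-sym (coeff-linear p e j)) (P.≋-trans eq (P.≋-trans (P.✶-congʳ g (b ∷ []) g≋b)
     (P.≋-trans (singleton-✶ K0 b π) (P.mk≋ λ
      { zero → P.coeff-· b π 0 ; (suc zero) → P.coeff-· b π 1
      ; (suc (suc n)) → K.trans (P.coeff-· b π (suc (suc n))) (K.trans (K.*-congˡ
        (≡.subst (λ d → π P.⊏ suc (suc d)) d≡0 (P.below degree) (suc (suc n)) (s≤s (s≤s z≤n)))) (K.zeroʳ b)) }))))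
   contradiction : ⊥
   contradiction with d N.≟ 0
   ... | no d≢0 = e≉0 (P.mk≋ λ j → [ proj₂ , (λ z → ⊥-elim (d≢0 (proj₁ z))) ] (relation j))
   ... | yes d≡0 = p≉κe κ (P.mk≋ λ j → K.trans ([ left j , right j ]′ (relation j)) (K.sym (P.coeff-· κ e j)))
    where
    π1≉0 : ¬ (π1 K.≈ K.0#)
    π1≉0 z = leading≉0 (K.trans (K.sym (P.lead degree)) (≡.subst (λ d → P.coeff π (suc d) K.≈ K.0#) (≡.sym d≡0) z))
    π1⁻¹ κ : 𝕂
    π1⁻¹ = proj₁ (K.inverse π1≉0)
    κ = K.- (π0 K.* π1⁻¹)
    left : ∀ j → P.coeff p j K.≈ K.0# × P.coeff e j K.≈ K.0# → P.coeff p j K.≈ κ K.* P.coeff e j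
    left j (u , v) = K.trans u (K.sym (K.trans (K.*-congˡ v) (K.zeroʳ κ)))
    right : ∀ j → d ≡ 0 × (Σ[ b ∈ 𝕂 ] P.coeff p j K.≈ b K.* π0 × K.- P.coeff e j K.≈ b K.* π1) →
        P.coeff p j K.≈ κ K.* P.coeff e j
    right j (_ , b , u , v) = begin
     P.coeff p j ≈⟨ u ⟩
     b K.* π0 ≈⟨ KS.solve 2 (λ b x → b :* x := x :* b :* :1) b π0 ⟩
     π0 K.* b K.* K.1# ≈⟨ K.*-congˡ (proj₂ (K.inverse π1≉0)) ⟨
     π0 K.* b K.* (π1⁻¹ K.* π1) ≈⟨ KS.solve 4 (λ x b i y → x :* b :* (i :* y) := x :* i :* (b :* y)) π0 b π1⁻¹ π1 ⟩
     π0 K.* π1⁻¹ K.* (b K.* π1) ≈⟨ K.*-congˡ v ⟨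
     π0 K.* π1⁻¹ K.* (K.- P.coeff e j) ≈⟨ KS.solve 2 (λ x e → x :* (:- e) := (:- x) :* e) _ _ ⟩
     κ K.* P.coeff e j ∎
     where open P.≈-Reasoning

  quotient-⊏ : ∀ {π f g N} → P.Irreducible π → f P.≋ g P.✶ π → f P.⊏ suc N → g P.⊏ N
  quotient-⊏ {f = f} {g} irr eq f⊏ with P.classify g
  ... | inj₁ g≋0 = P.⊏-resp (P.≋-sym g≋0) P.[]⊏
  ... | inj₂ (i , b , b≉0 , t) = P.⊏-weaken {g} (N.≤-trans (N.≤-trans (s≤s (N.m≤m+n i d)) (N.≤-reflexive (≡.sym (N.+-suc i d))))
    (N.s≤s⁻¹ (P.Top-< {f} (K-*-≉0 b≉0 leading≉0) (P.Top-resp (P.≋-sym eq) K.refl (P.Top-✶ t degree)) f⊏))) (P.below t)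
   where open P.Irreducible irr renaming (degree-1 to d)

  constant2-* : ∀ f g → (f P.✶ g) ∷ [] Q.≋ (f ∷ []) Q.✶ (g ∷ [])
  constant2-* = RingHom.*-homo (constantHom K[X])

  -- Descent on the degree of f, with f = g π and π irreducible. If π divides U and V, then π²
  -- divides the norm; as p - X e is primitive, π divides g too, and π² is cancelled from both
  -- sides. Otherwise the reduction supplies another norm, with the multiplier g up to a constant.
  -- The descent ends at a constant f, which `no-constant-multiple` excludes.
  norm-never-multiple : Reduction → (t : ℕ → 𝕂) → (∀ {i j} → t i K.≈ t j → i ≡ j) →
   ∀ {p e} → ¬ (e P.≋ []) → NotProportional p e →
   ∀ N {f U V} → f P.⊏ N → ¬ (f P.≋ []) → ¬ (norm U V Q.≋ (f ∷ []) Q.✶ linear p e)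
  norm-never-multiple reduction t t-injective {p} {e} e≉0 p≉κe = descend
   where
   Φ : Q.Poly
   Φ = linear p e
   descend : ∀ N {f U V} → f P.⊏ N → ¬ (f P.≋ []) → ¬ (norm U V Q.≋ (f ∷ []) Q.✶ Φ)
   descend zero f⊏ f≉0 _ = f≉0 (P.⊏0⇒≋[] f⊏)
   descend (suc N) {f} {U} {V} f⊏ f≉0 eq with P.classify f
   ... | inj₁ f≋0 = f≉0 f≋0
   ... | inj₂ (zero , a , a≉0 , tf) = no-constant-multiple t t-injective {p} {e} {a} {U} {V} e≉0 a≉0
       (Q.≋-trans eq (Q.✶-congʳ (f ∷ []) ((a ∷ []) ∷ []) (Q.∷-cong (P.≋-trans (P.const⇒ (P.below tf)) (P.∷-cong (P.lead tf) P.≋-refl)) Q.≋-refl)))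
   ... | inj₂ (suc n , a , a≉0 , tf) = P.irreducibleDivisor a≉0 tf step
    where
    step : ¬ (Σ[ π ∈ P.Poly ] P.Irreducible π × π P.∣ f)
    step (π , irr , P.divides g f≋gπ) = cases (reduction {π} {U} {V} {(g ∷ []) Q.✶ Φ} irr eq′)
     where
     open Q.≋-Reasoning
     [π] [g] : Q.Poly
     [π] = π ∷ []
     [g] = g ∷ []
     [π]≉0 : ¬ ([π] Q.≋ [])
     [π]≉0 z = P.Top-≉0 (P.Irreducible.leading≉0 irr) (P.Irreducible.degree irr) (Q.at z 0)
     g⊏N : g P.⊏ N
     g⊏N = quotient-⊏ {π} {f} {g} irr f≋gπ f⊏
     g≉0 : ¬ (g P.≋ [])
     g≉0 z = f≉0 (P.≋-trans f≋gπ (P.✶-zeroˡ g π z))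
     eq′ : norm U V Q.≋ [π] Q.✶ ([g] Q.✶ Φ)
     eq′ = begin
      norm U V ≈⟨ eq ⟩
      (f ∷ []) Q.✶ Φ ≈⟨ Q.✶-congʳ (f ∷ []) ([g] Q.✶ [π]) (Q.≋-trans (Q.∷-cong f≋gπ Q.≋-refl) (constant2-* g π)) ⟩
      [g] Q.✶ [π] Q.✶ Φ ≈⟨ W.solve 3 (λ g p x → g :* p :* x := p :* (g :* x)) [g] [π] Φ ⟩
      [π] Q.✶ ([g] Q.✶ Φ) ∎
     cases : DividesBoth π U V ⊎ (Σ[ U1 ∈ Q.Poly ] Σ[ V1 ∈ Q.Poly ] Σ[ k ∈ 𝕂 ] ¬ (k K.≈ K.0#) ×
          [π] Q.✶ norm U1 V1 Q.≋ ((k ∷ []) ∷ []) Q.✶ norm U V) → ⊥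
     cases (inj₂ (U1 , V1 , k , k≉0 , e′)) = descend N {g P.✶ (k ∷ [])} {U1} {V1}
      (≡.subst (g P.✶ (k ∷ []) P.⊏_) (N.+-identityʳ N) (P.⊏-✶ g (k ∷ []) N 0 g⊏N (P.⊏-length (k ∷ []))))
      (D1.*-≉0 {g} {k ∷ []} g≉0 (λ z → k≉0 (P.at z 0)))
      (D2.*-cancel [π] {norm U1 V1} {((g P.✶ (k ∷ [])) ∷ []) Q.✶ Φ} [π]≉0 (begin
       [π] Q.✶ norm U1 V1 ≈⟨ e′ ⟩
       ((k ∷ []) ∷ []) Q.✶ norm U V ≈⟨ Q.✶-congˡ ((k ∷ []) ∷ []) eq′ ⟩
       ((k ∷ []) ∷ []) Q.✶ ([π] Q.✶ ([g] Q.✶ Φ))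
        ≈⟨ W.solve 4 (λ k p g x → k :* (p :* (g :* x)) := p :* ((g :* k) :* x)) ((k ∷ []) ∷ []) [π] [g] Φ ⟩
       [π] Q.✶ (([g] Q.✶ ((k ∷ []) ∷ [])) Q.✶ Φ)
        ≈⟨ Q.✶-congˡ [π] (Q.✶-congʳ ((g P.✶ (k ∷ [])) ∷ []) ([g] Q.✶ ((k ∷ []) ∷ [])) (constant2-* g (k ∷ []))) ⟨
       [π] Q.✶ (((g P.✶ (k ∷ [])) ∷ []) Q.✶ Φ) ∎))
     cases (inj₁ (U1 , V1 , U≋ , V≋)) = split (P.divides? irr g)
      where
      πN≋gΦ : [π] Q.✶ norm U1 V1 Q.≋ [g] Q.✶ Φ
      πN≋gΦ = D2.*-cancel [π] {[π] Q.✶ norm U1 V1} {[g] Q.✶ Φ} [π]≉0 (begin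
       [π] Q.✶ ([π] Q.✶ norm U1 V1) ≈⟨ Q.✶-assoc [π] [π] (norm U1 V1) ⟨
       ([π] Q.✶ [π]) Q.✶ norm U1 V1 ≈⟨ norm-scale [π] U1 V1 ⟨
       norm ([π] Q.✶ U1) ([π] Q.✶ V1) ≈⟨ norm-cong U≋ V≋ ⟨
       norm U V ≈⟨ eq′ ⟩
       [π] Q.✶ ([g] Q.✶ Φ) ∎)
      split : Dec (π P.∣ g) → ⊥
      split (yes (P.divides h g≋hπ)) = descend N {h} {U1} {V1}
       (quotient-⊏ {π} {g} {h} irr g≋hπ (P.⊏-weaken {g} (N.n≤1+n N) g⊏N))
       (λ z → g≉0 (P.≋-trans g≋hπ (P.✶-zeroˡ h π z)))
       (D2.*-cancel [π] {norm U1 V1} {(h ∷ []) Q.✶ Φ} [π]≉0 (begin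
        [π] Q.✶ norm U1 V1 ≈⟨ πN≋gΦ ⟩
        [g] Q.✶ Φ ≈⟨ Q.✶-congʳ [g] ((h ∷ []) Q.✶ [π]) (Q.≋-trans (Q.∷-cong g≋hπ Q.≋-refl) (constant2-* h π)) ⟩
        (h ∷ []) Q.✶ [π] Q.✶ Φ ≈⟨ W.solve 3 (λ g p x → g :* p :* x := p :* (g :* x)) (h ∷ []) [π] Φ ⟩
        [π] Q.✶ ((h ∷ []) Q.✶ Φ) ∎))
      split (no π∤g) = linear-primitive {p} {e} e≉0 p≉κe irr λ j →
       [ (λ d → ⊥-elim (π∤g d)) , (λ d → d) ] (P.irreducible⇒prime irr (P.divides (Q.coeff (norm U1 V1) j)
        (P.≋-trans (P.≋-sym (P.≋-trans (Q.at (singleton-✶ K[X] g Φ) j) (Q.coeff-· g Φ j)))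
        (P.≋-trans (P.≋-sym (Q.at πN≋gΦ j)) (P.≋-trans (Q.at (singleton-✶ K[X] π (norm U1 V1)) j)
        (P.≋-trans (Q.coeff-· π (norm U1 V1) j) (P.✶-comm π (Q.coeff (norm U1 V1) j))))))))

  -- This excludes points with constant X-coordinate κ: their Y-coordinate would be a square root of
  -- q at X = κ.
  NeverSquare : Set
  NeverSquare = ∀ κ Q → ¬ (Q P.✶ Q P.≋ map (Evaluation.eval (identityHom K0) κ) q)

  module _ (𝓕 : Overdomain K) (x y : Overdomain.Element 𝓕) where

   open Overdomain 𝓕
   open CommutativeRing F hiding (zero)
   open AtPoint 𝓕 x
   private
    module ι = RingHom ι
    module S = IntegerSolver F
   open S using (solve)
   open ≈-Reasoning

   -- x = p / e is in lowest terms and n is the larger of the two degrees: `degree-n` says that p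
   -- and e do not both lose the coefficient of degree n. Of r / s only that it represents y is
   -- asked.
   record PointData : Set where
    field
     {p e r s} : P.Poly
     {n} : ℕ
     e≉0 : ¬ (e P.≋ [])
     s≉0 : ¬ (s P.≋ [])
     xe≈p : x * ι.⟦ e ⟧ ≈ ι.⟦ p ⟧
     ys≈r : y * ι.⟦ s ⟧ ≈ ι.⟦ r ⟧
     coprime : P.Coprime p e
     p⊏ : p P.⊏ suc n
     e⊏ : e P.⊏ suc n
     degree-n : P.coeff p n K.≈ K.0# → ¬ (P.coeff e n K.≈ K.0#)

   lowestTerms : ∀ {p e r s} → ¬ (e P.≋ []) → ¬ (s P.≋ []) →
          x * ι.⟦ e ⟧ ≈ ι.⟦ p ⟧ → y * ι.⟦ s ⟧ ≈ ι.⟦ r ⟧ → PointData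
   lowestTerms {p} {e} {r} {s} e≉0 s≉0 xe≈p ys≈r with P.bézout p e
   ... | record { gcd = d ; u = u ; v = v ; combination = d≋ ; gcd∣f = P.divides p′ p≋ ; gcd∣g = P.divides e′ e≋ } =
    record { p = p′ ; e = e′ ; r = r ; s = s ; n = proj₁ size ; e≉0 = e′≉0 ; s≉0 = s≉0 ; xe≈p = xe′≈p′ ; ys≈r = ys≈r
        ; coprime = u , v , coprime ; p⊏ = proj₁ (proj₂ size) ; e⊏ = proj₁ (proj₂ (proj₂ size))
        ; degree-n = proj₂ (proj₂ (proj₂ size)) }
    where
    e′≉0 : ¬ (e′ P.≋ [])
    e′≉0 z = e≉0 (P.≋-trans e≋ (P.✶-zeroˡ e′ d z))
    d≉0 : ¬ (d P.≋ [])
    d≉0 z = e≉0 (P.≋-trans e≋ (P.≋-trans (P.✶-congˡ e′ z) (P.✶-zeroʳ e′)))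
    coprime : u P.✶ p′ P.⊹ v P.✶ e′ P.≋ P.one
    coprime = D1.*-cancel d {u P.✶ p′ P.⊹ v P.✶ e′} {P.one} d≉0 (P.≋-trans
     (U.solve 5 (λ d u p v e → d :* (u :* p :+ v :* e) := u :* (p :* d) :+ v :* (e :* d)) d u p′ v e′)
     (P.≋-trans (P.⊹-cong (P.✶-congˡ u (P.≋-sym p≋)) (P.✶-congˡ v (P.≋-sym e≋)))
     (P.≋-trans (P.≋-sym d≋) (U.solve 1 (λ d → d := d :* :1) d))))
    xe′≈p′ : x * ι.⟦ e′ ⟧ ≈ ι.⟦ p′ ⟧
    xe′≈p′ = x∙y⁻¹≈ε⇒x≈y _ _ (cancelF ι.⟦ d ⟧ (ι-≉0 d≉0) (begin
     ι.⟦ d ⟧ * (x * ι.⟦ e′ ⟧ - ι.⟦ p′ ⟧)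
      ≈⟨ solve 4 (λ d x e p → d :* (x :* e :- p) := x :* (e :* d) :- p :* d) _ _ _ _ ⟩
     x * (ι.⟦ e′ ⟧ * ι.⟦ d ⟧) - ι.⟦ p′ ⟧ * ι.⟦ d ⟧
      ≈⟨ +-cong (*-congˡ (ι.*-homo e′ d)) (-‿cong (ι.*-homo p′ d)) ⟨
     x * ι.⟦ e′ P.✶ d ⟧ - ι.⟦ p′ P.✶ d ⟧ ≈⟨ +-cong (*-congˡ (ι.⟦⟧-cong e≋)) (-‿cong (ι.⟦⟧-cong p≋)) ⟨
     x * ι.⟦ e ⟧ - ι.⟦ p ⟧ ≈⟨ +-congʳ xe≈p ⟩
     ι.⟦ p ⟧ - ι.⟦ p ⟧ ≈⟨ -‿inverseʳ _ ⟩
     0# ∎))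
     where open GroupProperties +-group using (x∙y⁻¹≈ε⇒x≈y)
    size : Σ[ n ∈ ℕ ] p′ P.⊏ suc n × e′ P.⊏ suc n × (P.coeff p′ n K.≈ K.0# → ¬ (P.coeff e′ n K.≈ K.0#))
    size with P.classify e′ | P.classify p′
    ... | inj₁ e′≋0 | _ = ⊥-elim (e′≉0 e′≋0)
    ... | inj₂ (j , b , b≉0 , t) | inj₁ p′≋0 = j , P.⊏-resp (P.≋-sym p′≋0) P.[]⊏ , P.below t , λ _ z → b≉0 (K.trans (K.sym (P.lead t)) z)
    ... | inj₂ (j , b , b≉0 , t) | inj₂ (i , a , a≉0 , t′) with i N.≤? j
    ... | yes i≤j = j , P.⊏-weaken {p′} (s≤s i≤j) (P.below t′) , P.below t , λ _ z → b≉0 (K.trans (K.sym (P.lead t)) z)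
    ... | no i≰j = i , P.below t′ , P.⊏-weaken {e′} (N.m≤n⇒m≤1+n (N.≰⇒> i≰j)) (P.below t) , λ z _ → a≉0 (K.trans (K.sym (P.lead t′)) z)

   module _ (y²≈q : y * y ≈ ev.⟦ q ⟧) where

    -- If x = κ, then y is a rational function of T whose square is the polynomial q at X = κ, and
    -- by integrality it is a polynomial.
    not-constant : NeverSquare → (P : PointData) → NotProportional (PointData.p P) (PointData.e P)
    not-constant never P κ p≋κe = never κ (proj₁ root) (proj₂ root)
     where
     open PointData P
     specialise : RingHom K[X][T] K[X]
     specialise = polyHom (Evaluation.evalHom (identityHom K0) κ)
     module σ = RingHom specialise
     evalκ : P.Poly → 𝕂
     evalκ = Evaluation.eval (identityHom K0) κ
     open GroupProperties +-group using (x∙y⁻¹≈ε⇒x≈y)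
     x≈κ : x ≈ ι.⟦ κ ∷ [] ⟧
     x≈κ = x∙y⁻¹≈ε⇒x≈y _ _ (cancelF ι.⟦ e ⟧ (ι-≉0 e≉0) (begin
      ι.⟦ e ⟧ * (x - ι.⟦ κ ∷ [] ⟧) ≈⟨ solve 3 (λ e x k → e :* (x :- k) := x :* e :- k :* e) _ _ _ ⟩
      x * ι.⟦ e ⟧ - ι.⟦ κ ∷ [] ⟧ * ι.⟦ e ⟧
       ≈⟨ +-cong (trans xe≈p (ι.⟦⟧-cong (P.≋-trans p≋κe (P.≋-sym (singleton-✶ K0 κ e))))) (-‿cong (sym (ι.*-homo (κ ∷ []) e))) ⟩
      ι.⟦ (κ ∷ []) P.✶ e ⟧ - ι.⟦ (κ ∷ []) P.✶ e ⟧ ≈⟨ -‿inverseʳ _ ⟩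
      0# ∎))
     evX-value : ∀ f → evX.⟦ f ⟧ ≈ ι.⟦ evalκ f ∷ [] ⟧
     evX-value [] = sym (trans (ι.⟦⟧-cong P.shift-0) ι.0-homo)
     evX-value (a ∷ f) = begin
      ι.⟦ a ∷ [] ⟧ + x * evX.⟦ f ⟧ ≈⟨ +-congˡ (*-cong x≈κ (evX-value f)) ⟩
      ι.⟦ a ∷ [] ⟧ + ι.⟦ κ ∷ [] ⟧ * ι.⟦ evalκ f ∷ [] ⟧
       ≈⟨ +-congˡ (trans (sym (ι.*-homo (κ ∷ []) (evalκ f ∷ []))) (ι.⟦⟧-cong (P.≋-sym (RingHom.*-homo (constantHom K0) κ (evalκ f))))) ⟩
      ι.⟦ a ∷ [] ⟧ + ι.⟦ (κ K.* evalκ f) ∷ [] ⟧ ≈⟨ ι.+-homo (a ∷ []) ((κ K.* evalκ f) ∷ []) ⟨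
      ι.⟦ evalκ (a ∷ f) ∷ [] ⟧ ∎
     ev-value : ∀ M → ev.⟦ M ⟧ ≈ ι.⟦ σ.⟦ M ⟧ ⟧
     ev-value [] = sym ι.0-homo
     ev-value (f ∷ M) = trans (+-cong (evX-value f) (*-congˡ (ev-value M))) (sym (ι-∷ (evalκ f) σ.⟦ M ⟧))
     identity : r P.✶ r P.≋ σ.⟦ q ⟧ P.✶ (s P.✶ s)
     identity = GroupProperties.x∙y⁻¹≈ε⇒x≈y (CommutativeRing.+-group P.polynomialRing) _ _
      (ι-injective (r P.✶ r P.⊹ P.⊟ (σ.⟦ q ⟧ P.✶ (s P.✶ s))) (begin
      ι.⟦ r P.✶ r P.⊹ P.⊟ (σ.⟦ q ⟧ P.✶ (s P.✶ s)) ⟧ ≈⟨ ι.sub-homo (r P.✶ r) (σ.⟦ q ⟧ P.✶ (s P.✶ s)) ⟩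
      ι.⟦ r P.✶ r ⟧ - ι.⟦ σ.⟦ q ⟧ P.✶ (s P.✶ s) ⟧
       ≈⟨ +-cong (ι.*-homo r r) (-‿cong (trans (ι.*-homo σ.⟦ q ⟧ (s P.✶ s)) (*-congˡ (ι.*-homo s s)))) ⟩
      ι.⟦ r ⟧ * ι.⟦ r ⟧ - ι.⟦ σ.⟦ q ⟧ ⟧ * (ι.⟦ s ⟧ * ι.⟦ s ⟧)
       ≈⟨ +-cong (*-cong ys≈r ys≈r) (-‿cong (*-congʳ (trans y²≈q (ev-value q)))) ⟨
      y * ι.⟦ s ⟧ * (y * ι.⟦ s ⟧) - y * y * (ι.⟦ s ⟧ * ι.⟦ s ⟧)
       ≈⟨ solve 2 (λ y s → y :* s :* (y :* s) :- y :* y :* (s :* s) := :0) _ _ ⟩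
      0# ∎))
     root : Σ[ Q ∈ P.Poly ] Q P.✶ Q P.≋ σ.⟦ q ⟧
     root = P.square-root {r} {s} {σ.⟦ q ⟧} s≉0 identity

    -- A choice of degree bounds that balances two demands: n + 1 coefficients in T for U and V
    -- together, and a norm of degree at most n in T.
    record Shape (n : ℕ) : Set where
     field
      f : P.Poly
      m m′ : ℕ
      m+m′≡n : suc m N.+ m′ ≡ suc n
      bound : ∀ {U V} → U Q.⊏ suc m → V Q.⊏ m′ → norm (U Q.⊹ Q.⊟ (lift.⟦ f ⟧ Q.✶ V)) V Q.⊏ suc n

    -- The norm of the section vanishes at x and has degree at most n in T, so it is a multiple of p
    -- - X e by a polynomial in X. That multiplier is nonzero, because a norm vanishes only for U =
    -- V = 0, and the descent rules it out.
    impossible : Reduction → NeverSquare → (t : ℕ → 𝕂) → (∀ {i j} → t i K.≈ t j → i ≡ j) →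
           (P : PointData) → Shape (PointData.n P) → ⊥
    impossible reduction never t t-injective P shape =
     norm-never-multiple reduction t t-injective {p} {e} e≉0 (not-constant never P) (length (proj₁ multiple)) {proj₁ multiple} {U0} {V}
      (P.⊏-length (proj₁ multiple)) multiple≉0 (proj₂ multiple)
     where
     open PointData P
     open Shape shape
     open Section K 𝓕 x y
     open Vanishing (vanishing {p} {e} {r} {s} {n} e≉0 s≉0 xe≈p ys≈r p⊏ e⊏ f m m′ m+m′≡n)
     U0 : Q.Poly
     U0 = U Q.⊹ Q.⊟ (lift.⟦ f ⟧ Q.✶ V)
     ev-norm : ev.⟦ norm U0 V ⟧ ≈ 0#
     ev-norm = begin
      ev.⟦ norm U0 V ⟧ ≈⟨ ev.sub-homo (U0 Q.✶ U0) (q Q.✶ (V Q.✶ V)) ⟩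
      ev.⟦ U0 Q.✶ U0 ⟧ - ev.⟦ q Q.✶ (V Q.✶ V) ⟧
       ≈⟨ +-cong (ev.*-homo U0 U0) (-‿cong (trans (ev.*-homo q (V Q.✶ V)) (*-cong (sym y²≈q) (ev.*-homo V V)))) ⟩
      ev.⟦ U0 ⟧ * ev.⟦ U0 ⟧ - y * y * (ev.⟦ V ⟧ * ev.⟦ V ⟧)
       ≈⟨ solve 3 (λ u y v → u :* u :- y :* y :* (v :* v) := (u :- y :* v) :* (u :+ y :* v)) _ _ _ ⟩
      (ev.⟦ U0 ⟧ - y * ev.⟦ V ⟧) * (ev.⟦ U0 ⟧ + y * ev.⟦ V ⟧) ≈⟨ *-congˡ vanish ⟩
      (ev.⟦ U0 ⟧ - y * ev.⟦ V ⟧) * 0# ≈⟨ zeroʳ _ ⟩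
      0# ∎
     -- A value κ of X at which p - κ e still has degree n.
     good-value : Σ[ κ ∈ 𝕂 ] ¬ (P.coeff p n K.- κ K.* P.coeff e n K.≈ K.0#)
     good-value with K.zero? (P.coeff p n)
     ... | no pₙ≉0 = K.0# , λ z → pₙ≉0 (K.trans (KS.solve 2 (λ p e → p := p :- :0 :* e) _ (P.coeff e n)) z)
     ... | yes pₙ≈0 = K.1# , λ z → degree-n pₙ≈0 (K.trans (KS.solve 2 (λ p e → e := p :- (p :- :1 :* e)) _ _)
         (K.trans (K.+-cong pₙ≈0 (K.-‿cong z)) (K.-‿inverseʳ K.0#)))
     κ : 𝕂
     κ = proj₁ good-value
     p′ : P.Poly
     p′ = p P.⊹ P.⊟ (κ P.· e)
     p′-top : P.Top p′ n (P.coeff p n K.- κ K.* P.coeff e n)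
     p′-top = P.Top-⊹ (P.top p⊏ K.refl) (P.Top-⊟ {κ P.· e} (P.Top-· {e} κ (P.top e⊏ K.refl)))
     multiple : Σ[ d ∈ P.Poly ] norm U0 V Q.≋ (d ∷ []) Q.✶ linear p e
     multiple = Proportional.proportional {p} {e} {p′} {κ} {n} e≉0 xe≈p p⊏ e⊏ P.≋-refl (proj₂ good-value) p′-top coprime
      (proj₁ (XBound-exists (norm U0 V))) (norm U0 V)
      (λ j → P.⊏-weaken {Q.coeff (norm U0 V) j} (N.n≤1+n _) (proj₂ (XBound-exists (norm U0 V)) j))
      (bound {U} {V} U⊏ V⊏) ev-norm
     multiple≉0 : ¬ (proj₁ multiple P.≋ [])
     multiple≉0 z = nonzero (U≋0 , V≋0)
      where
      zeros : U0 Q.≋ [] × V Q.≋ []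
      zeros = norm≋0 V U0 (Q.≋-trans (proj₂ multiple) (Q.≋-trans (singleton-✶ K[X] (proj₁ multiple) (linear p e))
           (Q.≋-trans (Q.·-cong {q = linear p e} z Q.≋-refl) (Q.·-zeroˡ (linear p e)))))
      V≋0 : V Q.≋ []
      V≋0 = proj₂ zeros
      U≋0 : U Q.≋ []
      U≋0 = Q.≋-trans (Q.≋-sym (Q.≋-trans (Q.⊹-cong (Q.≋-refl {U}) (Q.⊟-cong
          (Q.≋-trans (Q.✶-congˡ lift.⟦ f ⟧ V≋0) (Q.✶-zeroʳ lift.⟦ f ⟧)))) (Q.⊹-identityʳ U))) (proj₁ zeros)

    -- With U of degree at most m and V of degree at most m - 1 (V = 0 if m = 0), both U² and q V²
    -- have degree at most 2 m in T.
    even-shape : ∀ m → Shape (m N.+ m)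
    even-shape m = record { f = [] ; m = m ; m′ = m ; m+m′≡n = ≡.refl ; bound = λ {U} {V} → bound m {U} {V} }
     where
     bound : ∀ m {U V} → U Q.⊏ suc m → V Q.⊏ m → norm (U Q.⊹ Q.⊟ ([] Q.✶ V)) V Q.⊏ suc (m N.+ m)
     bound m {U} {V} U⊏ V⊏ = Q.⊏-resp (norm-cong {U} {U Q.⊹ []} {V} {V} (Q.≋-sym (Q.⊹-identityʳ U)) Q.≋-refl)
      (Q.⊏-⊹ {U Q.✶ U} {Q.⊟ (q Q.✶ (V Q.✶ V))} (Q.⊏-✶ U U (suc m) m U⊏ U⊏) (Q.⊏-⊟ {q Q.✶ (V Q.✶ V)} (qV² m V⊏)))
      where
      qV² : ∀ m → V Q.⊏ m → q Q.✶ (V Q.✶ V) Q.⊏ suc (m N.+ m)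
      qV² zero V⊏ = Q.⊏-resp (Q.≋-sym (Q.≋-trans (Q.✶-congˡ q (Q.✶-zeroˡ V V (Q.⊏0⇒≋[] V⊏))) (Q.✶-zeroʳ q))) Q.[]⊏
      qV² (suc m) V⊏ = ≡.subst (q Q.✶ (V Q.✶ V) Q.⊏_) (≡.cong (λ k → suc (suc k)) (≡.sym (N.+-suc m m)))
       (Q.⊏-✶ q (V Q.✶ V) 3 (m N.+ m) (Q.⊏-length q) (Q.⊏-✶ V V (suc m) m V⊏ V⊏))

    -- For f = a T the difference q - f² has degree at most 1 in T, and the norm belonging to U - f
    -- V is U² - 2 f U V - (q - f²) V². For U and V of degree at most m this has degree at most 2 m
    -- + 1.
    odd-shape : ∀ {a} → A P.≋ (a K.* a) ∷ [] → ∀ m → Shape (suc (m N.+ m))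
    odd-shape {a} A≋a² m = record
     { f = f ; m = m ; m′ = suc m ; m+m′≡n = ≡.cong suc (N.+-suc m m) ; bound = λ {U} {V} → bound {U} {V} }
     where
     f : P.Poly
     f = K.0# ∷ a ∷ []
     q1 : Q.Poly
     q1 = C ∷ B ∷ []
     q≋ : q Q.≋ q1 Q.⊹ lift.⟦ f ⟧ Q.✶ lift.⟦ f ⟧
     q≋ = Q.∷-cong (P.≋-sym (P.≋-trans (P.⊹-cong (P.≋-refl {C}) z≋0) (P.⊹-identityʳ C)))
      (Q.∷-cong (P.≋-sym (P.≋-trans (P.⊹-cong (P.≋-refl {B}) w≋0) (P.⊹-identityʳ B)))
      (Q.∷-cong (P.≋-trans A≋a² (P.∷-cong (KS.solve 1 (λ a → a :* a := a :* a :+ :0) a) P.≋-refl)) Q.≋-refl))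
      where
      zero∷ : ∀ {b} → b K.≈ K.0# → b ∷ [] P.≋ []
      zero∷ e = P.≋-trans (P.∷-cong e P.≋-refl) P.shift-0
      z≋0 : Q.coeff (lift.⟦ f ⟧ Q.✶ lift.⟦ f ⟧) 0 P.≋ []
      z≋0 = zero∷ (K.trans (K.+-identityʳ _) (K.zeroʳ K.0#))
      w≋0 : Q.coeff (lift.⟦ f ⟧ Q.✶ lift.⟦ f ⟧) 1 P.≋ []
      w≋0 = zero∷ (KS.solve 1 (λ a → :0 :* a :+ :0 :+ (a :* :0 :+ :0) := :0) a)
     bound : ∀ {U V} → U Q.⊏ suc m → V Q.⊏ suc m → norm (U Q.⊹ Q.⊟ (lift.⟦ f ⟧ Q.✶ V)) V Q.⊏ suc (suc (m N.+ m))
     bound {U} {V} U⊏ V⊏ = Q.⊏-resp (Q.≋-sym expand)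
      (Q.⊏-⊹ {U Q.✶ U Q.⊹ Q.⊟ (2f Q.✶ (U Q.✶ V))} {Q.⊟ (q1 Q.✶ (V Q.✶ V))}
       (Q.⊏-⊹ {U Q.✶ U} {Q.⊟ (2f Q.✶ (U Q.✶ V))}
        (Q.⊏-weaken {U Q.✶ U} (N.n≤1+n _) (Q.⊏-✶ U U (suc m) m U⊏ U⊏))
        (Q.⊏-⊟ {2f Q.✶ (U Q.✶ V)} (Q.⊏-✶ 2f (U Q.✶ V) 2 (m N.+ m) (Q.⊏-length 2f) (Q.⊏-✶ U V (suc m) m U⊏ V⊏))))
       (Q.⊏-⊟ {q1 Q.✶ (V Q.✶ V)} (Q.⊏-✶ q1 (V Q.✶ V) 2 (m N.+ m) (Q.⊏-length q1) (Q.⊏-✶ V V (suc m) m V⊏ V⊏))))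
      where
      2f : Q.Poly
      2f = lift.⟦ f ⟧ Q.⊹ lift.⟦ f ⟧
      expand : norm (U Q.⊹ Q.⊟ (lift.⟦ f ⟧ Q.✶ V)) V Q.≋ (U Q.✶ U Q.⊹ Q.⊟ (2f Q.✶ (U Q.✶ V))) Q.⊹ Q.⊟ (q1 Q.✶ (V Q.✶ V))
      expand = Q.≋-trans
       (Q.⊹-cong (Q.≋-refl {(U Q.⊹ Q.⊟ (lift.⟦ f ⟧ Q.✶ V)) Q.✶ (U Q.⊹ Q.⊟ (lift.⟦ f ⟧ Q.✶ V))})
        (Q.⊟-cong (Q.✶-congʳ q (q1 Q.⊹ lift.⟦ f ⟧ Q.✶ lift.⟦ f ⟧) {V Q.✶ V} q≋)))
       (W.solve 4 (λ U V f q → (U :- f :* V) :* (U :- f :* V) :- (q :+ f :* f) :* (V :* V)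
         := (U :* U :- (f :+ f) :* (U :* V)) :- q :* (V :* V)) U V lift.⟦ f ⟧ q1)

 -- The reduction step in each of the three families

 -- The discriminant of the conic bundle

 module ConicDiscriminant where

  open Descent public

  4₁ : P.Poly
  4₁ = P.one P.⊹ P.one P.⊹ P.one P.⊹ P.one

  4# : 𝕂
  4# = K.1# K.+ K.1# K.+ K.1# K.+ K.1#

  disc : P.Poly
  disc = B P.✶ B P.⊹ P.⊟ (4₁ P.✶ (A P.✶ C))

  evaluate-disc : ∀ κ → P.evaluate κ disc K.≈
   P.evaluate κ B K.* P.evaluate κ B K.- 4# K.* (P.evaluate κ A K.* P.evaluate κ C)
  evaluate-disc κ = K.trans (sub-homo (B P.✶ B) (4₁ P.✶ (A P.✶ C))) (K.+-cong (*-homo B B)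
   (K.-‿cong (K.trans (*-homo 4₁ (A P.✶ C)) (K.*-cong (K.trans (K.+-congˡ (K.zeroʳ κ)) (K.+-identityʳ _)) (*-homo A C)))))
   where open RingHom (Evaluation.evalHom (identityHom K0) κ)

  never-square : P.NoRoot disc → NeverSquare
  never-square noRoot κ Q e = vanish (P.quadratic-square-root {Q} e)
   where
   Aκ Bκ Cκ : 𝕂
   Aκ = P.evaluate κ A
   Bκ = P.evaluate κ B
   Cκ = P.evaluate κ C
   vanish : (Σ[ α ∈ 𝕂 ] Σ[ β ∈ 𝕂 ] α K.* α K.≈ Aκ × α K.* β K.+ α K.* β K.≈ Bκ × β K.* β K.≈ Cκ) → ⊥
   vanish (α , β , α²≈ , 2αβ≈ , β²≈) = noRoot κ (K.trans (evaluate-disc κ) (K.trans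
    (K.+-cong (K.*-cong (K.sym 2αβ≈) (K.sym 2αβ≈)) (K.-‿cong (K.*-congˡ (K.*-cong (K.sym α²≈) (K.sym β²≈)))))
    (KS.solve 2 (λ a b → (a :* b :+ a :* b) :* (a :* b :+ a :* b) :- :4 :* ((a :* a) :* (b :* b))
      := :0) α β)))

  -- A square (α T + β)² has discriminant (2 α β)² - 4 α² β² = 0.
  square⇒∣disc : ∀ {π} → SquareModulo π → π P.∣ disc
  square⇒∣disc {π} sq = P.∣-respʳ
   (U.solve 5 (λ A B C a b → (B :- (a :* b :+ a :* b)) :* (B :+ (a :* b :+ a :* b))
     :+ (:- (:4 :* ((A :- a :* a) :* C :+ (a :* a) :* (C :- b :* b))))
     := B :* B :- :4 :* (A :* C)) A B C α β)
   (P.∣-+ (P.∣-*ʳ (B P.⊹ (α P.✶ β P.⊹ α P.✶ β)) B≡2αβ)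
       (P.∣-neg (P.∣-*ˡ 4₁ (P.∣-+ (P.∣-*ʳ C A≡α²) (P.∣-*ˡ (α P.✶ α) C≡β²)))))
   where open SquareModulo sq

  no-square⇒reduction : (∀ {π} → P.Irreducible π → ¬ SquareModulo π) → Reduction
  no-square⇒reduction none {π} {U} {V} {W} irr e = [ inj₁ , (λ sq → ⊥-elim (none irr sq)) ]′ (divides-norm {π} {U} {V} {W} irr e)

 -- Y² = B(X) T + C(X)

 module LinearInT where

  open ConicDiscriminant public

  module _ (A≋0 : A P.≋ []) {b0 b1 b2 c0 c1 c2 : 𝕂} (B≋ : B P.≋ b0 ∷ b1 ∷ b2 ∷ [])
   (C≋ : C P.≋ c0 ∷ c1 ∷ c2 ∷ K.1# ∷ []) (b2≉0 : ¬ (b2 K.≈ K.0#)) (noRoot : P.NoRoot B) where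

   -- b2² C ≡ k1 X + k0 mod B, and b2² times the norm of k1 X + k0 from K[X]/B is resultant.

   k0 k1 resultant : 𝕂
   k1 = b2 K.* b2 K.* c1 K.- b2 K.* b1 K.* c2 K.+ (b1 K.* b1 K.- b0 K.* b2)
   k0 = b2 K.* b2 K.* c0 K.- b2 K.* b0 K.* c2 K.+ b0 K.* b1
   resultant = b2 K.* (b2 K.* k0 K.* k0 K.- b1 K.* k0 K.* k1 K.+ b0 K.* k1 K.* k1)

   B-top : P.Top B 2 b2
   B-top = P.Top-resp (P.≋-sym B≋) K.refl (P.top (P.⊏-length (b0 ∷ b1 ∷ b2 ∷ [])) K.refl)

   -- The norm from K[X]/B is multiplicative, so if C is congruent to β², the norm of C is the
   -- square of the norm of β. The witness `w` is b2³ times the norm of the remainder γ of β; the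
   -- identities between coefficients carry this out without forming K[X]/B.
   square-mod-B : ∀ {β} → B P.∣ C P.⊹ P.⊟ (β P.✶ β) → Σ[ w ∈ 𝕂 ] w K.* w K.≈ resultant
   square-mod-B {β} (P.divides h0 eq0) with P.divMod b2≉0 B-top β
   ... | Q , γ , β≋ , γ⊏2 = w , K.sym resultant≈
    where
    h : P.Poly
    h = h0 P.⊹ Q P.✶ (Q P.✶ B P.⊹ γ P.⊹ γ)
    eq : C P.⊹ P.⊟ (γ P.✶ γ) P.≋ h P.✶ B
    eq = begin
     C P.⊹ P.⊟ (γ P.✶ γ)
      ≈⟨ U.solve 4 (λ C g Q B → C :- g :* g := (C :- (Q :* B :+ g) :* (Q :* B :+ g)) :+ Q :* (Q :* B :+ g :+ g) :* B) C γ Q B ⟩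
     (C P.⊹ P.⊟ ((Q P.✶ B P.⊹ γ) P.✶ (Q P.✶ B P.⊹ γ))) P.⊹ Q P.✶ (Q P.✶ B P.⊹ γ P.⊹ γ) P.✶ B
      ≈⟨ P.⊹-cong (P.≋-trans (P.⊹-cong (P.≋-refl {C}) (P.⊟-cong (P.≋-sym (P.✶-cong β≋ β≋)))) eq0) P.≋-refl ⟩
     h0 P.✶ B P.⊹ Q P.✶ (Q P.✶ B P.⊹ γ P.⊹ γ) P.✶ B ≈⟨ P.✶-distribʳ B h0 _ ⟨
     h P.✶ B ∎
     where open P.≋-Reasoning
    h⊏2 : h P.⊏ 2
    h⊏2 with P.classify h
    ... | inj₁ h≋0 = P.⊏-resp (P.≋-sym h≋0) P.[]⊏
    ... | inj₂ (i , a , a≉0 , t) = P.⊏-weaken {h} (N.+-cancelʳ-≤ 2 (suc i) 2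
      (P.Top-< {C P.⊹ P.⊟ (γ P.✶ γ)} (DomainProperties.*-≉0 K-domain a≉0 b2≉0) (P.Top-resp (P.≋-sym eq) K.refl (P.Top-✶ t B-top))
       (P.⊏-⊹ {C} {P.⊟ (γ P.✶ γ)} (P.below C-top) (P.⊏-⊟ {γ P.✶ γ} (P.⊏-weaken {γ P.✶ γ} (N.n≤1+n 3) (P.⊏-✶ γ γ 2 1 γ⊏2 γ⊏2)))))) (P.below t)
    two-terms : ∀ {f} → f P.⊏ 2 → f P.≋ P.coeff f 0 ∷ P.coeff f 1 ∷ []
    two-terms b = P.mk≋ λ { zero → K.refl ; (suc zero) → K.refl ; (suc (suc n)) → b (suc (suc n)) (s≤s (s≤s z≤n)) }
    g0 g1 h0′ h1′ : 𝕂
    g0 = P.coeff γ 0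
    g1 = P.coeff γ 1
    h0′ = P.coeff h 0
    h1′ = P.coeff h 1
    explicit : (c0 ∷ c1 ∷ c2 ∷ K.1# ∷ []) P.⊹ P.⊟ ((g0 ∷ g1 ∷ []) P.✶ (g0 ∷ g1 ∷ [])) P.≋ (h0′ ∷ h1′ ∷ []) P.✶ (b0 ∷ b1 ∷ b2 ∷ [])
    explicit = P.≋-trans (P.⊹-cong (P.≋-sym C≋) (P.⊟-cong (P.≋-sym (P.✶-cong (two-terms {γ} γ⊏2) (two-terms {γ} γ⊏2)))))
     (P.≋-trans eq (P.✶-cong (two-terms {h} h⊏2) B≋))
    open P.≈-Reasoning
    move : ∀ {c g h} → c K.- g K.≈ h → c K.≈ h K.+ g
    move {c} {g} e = K.trans (KS.solve 2 (λ c g → c := (c :- g) :+ g) c g) (K.+-congʳ e)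
    c0≈ : c0 K.≈ h0′ K.* b0 K.+ g0 K.* g0
    c0≈ = K.trans (move (P.at explicit 0)) (K.+-cong (K.+-identityʳ _) (K.+-identityʳ _))
    c1≈ : c1 K.≈ h0′ K.* b1 K.+ h1′ K.* b0 K.+ (g0 K.* g1 K.+ g1 K.* g0)
    c1≈ = K.trans (move (P.at explicit 1)) (K.+-cong (K.+-congˡ (K.+-identityʳ _)) (K.+-congˡ (K.+-identityʳ _)))
    c2≈ : c2 K.≈ h0′ K.* b2 K.+ h1′ K.* b1 K.+ g1 K.* g1
    c2≈ = move (P.at explicit 2)
    1≈ : K.1# K.≈ h1′ K.* b2
    1≈ = P.at explicit 3
    m0 m1 w : 𝕂
    m1 = b2 K.* (b2 K.* (g0 K.* g1 K.+ g0 K.* g1) K.- b1 K.* g1 K.* g1)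
    m0 = b2 K.* (b2 K.* g0 K.* g0 K.- b0 K.* g1 K.* g1)
    w = b2 K.* b2 K.* (b2 K.* g0 K.* g0 K.- b1 K.* g0 K.* g1 K.+ b0 K.* g1 K.* g1)
    k1≈ : k1 K.≈ m1
    k1≈ = begin
     b2 K.* b2 K.* c1 K.- b2 K.* b1 K.* c2 K.+ (b1 K.* b1 K.- b0 K.* b2)
      ≈⟨ K.+-cong (K.+-cong (K.*-congˡ c1≈) (K.-‿cong (K.*-congˡ c2≈))) (K.trans (K.sym (K.*-identityʳ _)) (K.*-congˡ 1≈)) ⟩
     b2 K.* b2 K.* (h0′ K.* b1 K.+ h1′ K.* b0 K.+ (g0 K.* g1 K.+ g1 K.* g0)) K.- b2 K.* b1 K.* (h0′ K.* b2 K.+ h1′ K.* b1 K.+ g1 K.* g1)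
      K.+ (b1 K.* b1 K.- b0 K.* b2) K.* (h1′ K.* b2)
      ≈⟨ KS.solve 7 (λ h0 h1 g0 g1 b0 b1 b2 →
         b2 :* b2 :* (h0 :* b1 :+ h1 :* b0 :+ (g0 :* g1 :+ g1 :* g0)) :- b2 :* b1 :* (h0 :* b2 :+ h1 :* b1 :+ g1 :* g1)
         :+ (b1 :* b1 :- b0 :* b2) :* (h1 :* b2)
         := b2 :* (b2 :* (g0 :* g1 :+ g0 :* g1) :- b1 :* g1 :* g1)) h0′ h1′ g0 g1 b0 b1 b2 ⟩
     m1 ∎
    k0≈ : k0 K.≈ m0
    k0≈ = begin
     b2 K.* b2 K.* c0 K.- b2 K.* b0 K.* c2 K.+ b0 K.* b1
      ≈⟨ K.+-cong (K.+-cong (K.*-congˡ c0≈) (K.-‿cong (K.*-congˡ c2≈))) (K.trans (K.sym (K.*-identityʳ _)) (K.*-congˡ 1≈)) ⟩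
     b2 K.* b2 K.* (h0′ K.* b0 K.+ g0 K.* g0) K.- b2 K.* b0 K.* (h0′ K.* b2 K.+ h1′ K.* b1 K.+ g1 K.* g1) K.+ b0 K.* b1 K.* (h1′ K.* b2)
      ≈⟨ KS.solve 7 (λ h0 h1 g0 g1 b0 b1 b2 →
         b2 :* b2 :* (h0 :* b0 :+ g0 :* g0) :- b2 :* b0 :* (h0 :* b2 :+ h1 :* b1 :+ g1 :* g1) :+ b0 :* b1 :* (h1 :* b2)
         := b2 :* (b2 :* g0 :* g0 :- b0 :* g1 :* g1)) h0′ h1′ g0 g1 b0 b1 b2 ⟩
     m0 ∎
    resultant≈ : resultant K.≈ w K.* w
    resultant≈ = begin
     b2 K.* (b2 K.* k0 K.* k0 K.- b1 K.* k0 K.* k1 K.+ b0 K.* k1 K.* k1)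
      ≈⟨ K.*-congˡ (K.+-cong (K.+-cong (K.*-cong (K.*-congˡ k0≈) k0≈) (K.-‿cong (K.*-cong (K.*-congˡ k0≈) k1≈))) (K.*-cong (K.*-congˡ k1≈) k1≈)) ⟩
     b2 K.* (b2 K.* m0 K.* m0 K.- b1 K.* m0 K.* m1 K.+ b0 K.* m1 K.* m1)
      ≈⟨ KS.solve 5 (λ g0 g1 b0 b1 b2 →
         let
          m1 = b2 :* (b2 :* (g0 :* g1 :+ g0 :* g1) :- b1 :* g1 :* g1)
          m0 = b2 :* (b2 :* g0 :* g0 :- b0 :* g1 :* g1)
          w = b2 :* b2 :* (b2 :* g0 :* g0 :- b1 :* g0 :* g1 :+ b0 :* g1 :* g1)
         in b2 :* (b2 :* m0 :* m0 :- b1 :* m0 :* m1 :+ b0 :* m1 :* m1) := w :* w) g0 g1 b0 b1 b2 ⟩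
     w K.* w ∎

   -- As A = 0, a square (α T + β)² modulo π has π dividing α, so π divides B. By irreducibility B
   -- divides π, and C would be a square modulo B, against the choice of the resultant.
   reduction : (∀ w → ¬ (w K.* w K.≈ resultant)) → Reduction
   reduction nonSquare = no-square⇒reduction λ irr sq → let open SquareModulo sq in
    let
     π∣α = [ (λ d → d) , (λ d → d) ]′ (P.irreducible⇒prime irr {α} {α} (P.∣-respʳ
         (P.≋-trans (P.⊟-cong (P.⊹-cong A≋0 (P.≋-refl {P.⊟ (α P.✶ α)})))
           (U.solve 1 (λ a → :- (:- (a :* a)) := a :* a) α)) (P.∣-neg A≡α²)))
     π∣B = P.∣-respʳ (U.solve 2 (λ B x → (B :- x) :+ x := B) B (α P.✶ β P.⊹ α P.✶ β))
         (P.∣-+ B≡2αβ (P.∣-+ (P.∣-*ʳ β π∣α) (P.∣-*ʳ β π∣α)))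
     B∣π = P.quadratic-irreducible b2≉0 B-top noRoot irr π∣B
     square = square-mod-B {β} (P.∣-trans B∣π C≡β²)
    in nonSquare (proj₁ square) (proj₂ square)

   disc-noRoot : P.NoRoot disc
   disc-noRoot κ e = noRoot κ (DomainProperties.square-≈0 K-domain (K.trans (K.sym (K.trans (evaluate-disc κ) (K.trans (K.+-congˡ (K.-‿cong (K.trans (K.*-congˡ (K.trans (K.*-congʳ
    (RingHom.⟦⟧-cong (Evaluation.evalHom (identityHom K0) κ) {A} {[]} A≋0)) (K.zeroˡ _))) (K.zeroʳ 4#)))) (KS.solve 1 (λ b → b :- :0 := b) _)))) e))

 -- Y² = a² T² + B(X) T + C(X)

 module SquareLeading where

  open ConicDiscriminant public

  module _ {a : 𝕂} (A≋ : A P.≋ (a K.* a) ∷ []) (2a≉0 : ¬ (a K.+ a K.≈ K.0#)) (disc≉0 : ¬ (disc P.≋ []))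
   (irreducible : ∀ {π} → P.Irreducible π → π P.∣ disc → disc P.∣ π) where

   private
    [_]₂ : P.Poly → Q.Poly
    [ f ]₂ = f ∷ []
    -- Completing the square in T: with τ = 2 a and G = B + 2 a² T one has τ² q = G² - disc, so that
    -- G + τ Y has norm disc.
    T τ G a2 : Q.Poly
    T = [] ∷ P.one ∷ []
    a2 = [ a ∷ [] ]₂
    τ = a2 Q.⊹ a2
    G = [ B ]₂ Q.⊹ T Q.✶ (a2 Q.✶ a2 Q.⊹ a2 Q.✶ a2)

    T-✶ : ∀ U → T Q.✶ U Q.≋ Q.shift U
    T-✶ U = Q.≋-trans (Q.shift-✶ Q.one U) (Q.shift-cong (Q.✶-identityˡ U))

    ∷-expand : ∀ f U → f ∷ U Q.≋ [ f ]₂ Q.⊹ T Q.✶ U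
    ∷-expand f U = Q.≋-sym (Q.≋-trans (Q.⊹-cong (Q.≋-refl {[ f ]₂}) (T-✶ U)) (Q.∷-cong (P.⊹-identityʳ f) Q.≋-refl))

    A≋a2² : [ A ]₂ Q.≋ a2 Q.✶ a2
    A≋a2² = Q.≋-trans (Q.∷-cong (P.≋-trans A≋ (RingHom.*-homo (constantHom K0) a a)) Q.≋-refl) (constant2-* (a ∷ []) (a ∷ []))

    q≋ : q Q.≋ [ C ]₂ Q.⊹ T Q.✶ ([ B ]₂ Q.⊹ T Q.✶ (a2 Q.✶ a2))
    q≋ = Q.≋-trans (∷-expand C (B ∷ A ∷ [])) (Q.⊹-cong (Q.≋-refl {[ C ]₂}) (Q.✶-congˡ T
        (Q.≋-trans (∷-expand B (A ∷ [])) (Q.⊹-cong (Q.≋-refl {[ B ]₂}) (Q.✶-congˡ T A≋a2²)))))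

    disc≋ : [ disc ]₂ Q.≋ [ B ]₂ Q.✶ [ B ]₂ Q.⊹ Q.⊟ ((Q.one Q.⊹ Q.one Q.⊹ Q.one Q.⊹ Q.one) Q.✶ (a2 Q.✶ a2 Q.✶ [ C ]₂))
    disc≋ = Q.≋-trans (sub-homo (B P.✶ B) (4₁ P.✶ (A P.✶ C)))
     (Q.⊹-cong {[ B P.✶ B ]₂} {[ B ]₂ Q.✶ [ B ]₂} (*-homo B B) (Q.⊟-cong {[ 4₁ P.✶ (A P.✶ C) ]₂} {[ 4₁ ]₂ Q.✶ (a2 Q.✶ a2 Q.✶ [ C ]₂)} 4AC))
     where
     open RingHom (constantHom K[X])
     AC : [ A P.✶ C ]₂ Q.≋ a2 Q.✶ a2 Q.✶ [ C ]₂
     AC = Q.≋-trans (*-homo A C) (Q.✶-congʳ [ A ]₂ (a2 Q.✶ a2) {[ C ]₂} A≋a2²)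
     4AC : [ 4₁ P.✶ (A P.✶ C) ]₂ Q.≋ [ 4₁ ]₂ Q.✶ (a2 Q.✶ a2 Q.✶ [ C ]₂)
     4AC = Q.≋-trans (*-homo 4₁ (A P.✶ C)) (Q.✶-congˡ [ 4₁ ]₂ {[ A P.✶ C ]₂} {a2 Q.✶ a2 Q.✶ [ C ]₂} AC)

    τ²q≋ : τ Q.✶ τ Q.✶ q Q.≋ G Q.✶ G Q.⊹ Q.⊟ [ disc ]₂
    τ²q≋ = Q.≋-trans (Q.✶-congˡ (τ Q.✶ τ) q≋) (Q.≋-trans
     (W.solve 4 (λ B C T a → (a :+ a) :* (a :+ a) :* (C :+ T :* (B :+ T :* (a :* a)))
       := (B :+ T :* (a :* a :+ a :* a)) :* (B :+ T :* (a :* a :+ a :* a))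
          :- (B :* B :- :4 :* (a :* a :* C))) [ B ]₂ [ C ]₂ T a2)
     (Q.⊹-cong (Q.≋-refl {G Q.✶ G}) (Q.⊟-cong (Q.≋-sym disc≋))))

    Reduced : P.Poly → Q.Poly → Q.Poly → Set
    Reduced π U V = Σ[ U1 ∈ Q.Poly ] Σ[ V1 ∈ Q.Poly ] Σ[ k ∈ 𝕂 ] ¬ (k K.≈ K.0#) ×
     [ π ]₂ Q.✶ norm U1 V1 Q.≋ [ k ∷ [] ]₂ Q.✶ norm U V

    associate : ∀ {π g h} → P.Irreducible π → disc P.≋ g P.✶ π → π P.≋ h P.✶ disc → Σ[ k ∈ 𝕂 ] ¬ (k K.≈ K.0#) × h P.≋ k ∷ []
    associate {π} {g} {h} irr disc≋gπ π≋h = P.coeff h 0 , h0≉0 , P.const⇒ h⊏1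
     where
     h⊏1 : h P.⊏ 1
     h⊏1 = P.∣one⇒⊏1 (P.divides g (D1.*-cancel disc {P.one} {g P.✶ h} disc≉0 (P.≋-trans
      (P.≋-trans (P.≋-trans (P.✶-comm disc P.one) (P.✶-identityˡ disc)) (P.≋-trans disc≋gπ (P.✶-congˡ g π≋h)))
      (U.solve 3 (λ g h d → g :* (h :* d) := d :* (g :* h)) g h disc))))
     h0≉0 : ¬ (P.coeff h 0 K.≈ K.0#)
     h0≉0 z = P.Top-≉0 (P.Irreducible.leading≉0 irr) (P.Irreducible.degree irr)
      (P.≋-trans π≋h (P.✶-zeroˡ h disc (P.≋-trans (P.const⇒ h⊏1) (P.≋-trans (P.∷-cong z P.≋-refl) P.shift-0))))

    -- 2 a U = G V + π W says that G + 2 a Y, whose norm is disc, divides 2 a (U + V Y).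
    divide : ∀ {π h U V W k} → π P.≋ h P.✶ disc → h P.≋ k ∷ [] → ¬ (k K.≈ K.0#) →
         τ Q.✶ U Q.≋ G Q.✶ V Q.⊹ [ π ]₂ Q.✶ W → Reduced π U V
    -- Here τ (U + V Y) = V (G + τ Y) + π W, and π = h (G + τ Y) (G - τ Y). Dividing by G + τ Y
    -- gives V + h W (G - τ Y), which are the two components chosen.
    divide {π} {h} {U} {V} {W} {k} π≋ h≋ k≉0 eq = V Q.⊹ H Q.✶ G Q.✶ W , Q.⊟ (τ Q.✶ H Q.✶ W) , k K.* ((a K.+ a) K.* (a K.+ a))
     , DomainProperties.*-≉0 K-domain k≉0 (DomainProperties.*-≉0 K-domain 2a≉0 2a≉0) , (begin
     [ π ]₂ Q.✶ norm (V Q.⊹ H Q.✶ G Q.✶ W) (Q.⊟ (τ Q.✶ H Q.✶ W))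
      ≈⟨ Q.✶-cong [π]≋ (W.solve 6 (λ V H G W t q → (V :+ H :* G :* W) :* (V :+ H :* G :* W)
          :- q :* ((:- (t :* H :* W)) :* (:- (t :* H :* W)))
          := (V :+ H :* G :* W) :* (V :+ H :* G :* W) :- (t :* t :* q) :* (H :* W :* (H :* W))) V H G W τ q) ⟩
     H Q.✶ Δ Q.✶ ((V Q.⊹ H Q.✶ G Q.✶ W) Q.✶ (V Q.⊹ H Q.✶ G Q.✶ W) Q.⊹ Q.⊟ (τ Q.✶ τ Q.✶ q Q.✶ (H Q.✶ W Q.✶ (H Q.✶ W))))
      ≈⟨ Q.✶-congˡ (H Q.✶ Δ) (Q.⊹-cong (Q.≋-refl {(V Q.⊹ H Q.✶ G Q.✶ W) Q.✶ (V Q.⊹ H Q.✶ G Q.✶ W)})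
         (Q.⊟-cong (Q.✶-congʳ (τ Q.✶ τ Q.✶ q) (G Q.✶ G Q.⊹ Q.⊟ Δ) τ²q≋))) ⟩
     H Q.✶ Δ Q.✶ ((V Q.⊹ H Q.✶ G Q.✶ W) Q.✶ (V Q.⊹ H Q.✶ G Q.✶ W) Q.⊹ Q.⊟ ((G Q.✶ G Q.⊹ Q.⊟ Δ) Q.✶ (H Q.✶ W Q.✶ (H Q.✶ W))))
      ≈⟨ W.solve 5 (λ V H G W D →
         H :* D :* ((V :+ H :* G :* W) :* (V :+ H :* G :* W) :- (G :* G :- D) :* (H :* W :* (H :* W)))
         := H :* ((G :* V :+ H :* D :* W) :* (G :* V :+ H :* D :* W) :- (G :* G :- D) :* (V :* V))) V H G W Δ ⟩
     H Q.✶ ((G Q.✶ V Q.⊹ H Q.✶ Δ Q.✶ W) Q.✶ (G Q.✶ V Q.⊹ H Q.✶ Δ Q.✶ W) Q.⊹ Q.⊟ ((G Q.✶ G Q.⊹ Q.⊟ Δ) Q.✶ (V Q.✶ V)))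
      ≈⟨ Q.✶-congˡ H (Q.⊹-cong (Q.✶-cong eq′ eq′) (Q.⊟-cong (Q.✶-congʳ (τ Q.✶ τ Q.✶ q) (G Q.✶ G Q.⊹ Q.⊟ Δ) τ²q≋))) ⟨
     H Q.✶ ((τ Q.✶ U) Q.✶ (τ Q.✶ U) Q.⊹ Q.⊟ ((τ Q.✶ τ Q.✶ q) Q.✶ (V Q.✶ V)))
      ≈⟨ W.solve 5 (λ H t U q V → H :* ((t :* U) :* (t :* U) :- (t :* t :* q) :* (V :* V))
         := (H :* (t :* t)) :* (U :* U :- q :* (V :* V))) H τ U q V ⟩
     (H Q.✶ (τ Q.✶ τ)) Q.✶ norm U V ≈⟨ Q.✶-congʳ (H Q.✶ (τ Q.✶ τ)) [ k K.* ((a K.+ a) K.* (a K.+ a)) ∷ [] ]₂ constant ⟩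
     [ k K.* ((a K.+ a) K.* (a K.+ a)) ∷ [] ]₂ Q.✶ norm U V ∎)
     where
     open Q.≋-Reasoning
     H Δ : Q.Poly
     H = [ h ]₂
     Δ = [ disc ]₂
     [π]≋ : [ π ]₂ Q.≋ H Q.✶ Δ
     [π]≋ = Q.≋-trans (Q.∷-cong π≋ Q.≋-refl) (constant2-* h disc)
     eq′ : τ Q.✶ U Q.≋ G Q.✶ V Q.⊹ H Q.✶ Δ Q.✶ W
     eq′ = Q.≋-trans eq (Q.⊹-cong (Q.≋-refl {G Q.✶ V}) (Q.✶-congʳ [ π ]₂ (H Q.✶ Δ) [π]≋))
     constant : H Q.✶ (τ Q.✶ τ) Q.≋ [ k K.* ((a K.+ a) K.* (a K.+ a)) ∷ [] ]₂
     constant = Q.≋-sym (Q.≋-trans (⟦⟧-cong (C0.*-homo k ((a K.+ a) K.* (a K.+ a)))) (Q.≋-trans (*-homo (k ∷ []) ((a K.+ a) K.* (a K.+ a) ∷ []))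
      (Q.✶-cong {[ k ∷ [] ]₂} {H} {[ (a K.+ a) K.* (a K.+ a) ∷ [] ]₂} {τ Q.✶ τ} (⟦⟧-cong (P.≋-sym h≋)) (Q.≋-trans (⟦⟧-cong (C0.*-homo (a K.+ a) (a K.+ a))) (*-homo (a K.+ a ∷ []) (a K.+ a ∷ []))))))
      where
      open RingHom (constantHom K[X])
      module C0 = RingHom (constantHom K0)

   -- If π does not divide both U and V, then it divides disc and is an associate of it. The product
   -- (τ U - G V) (τ U + G V) equals τ² times the norm minus disc V², so π divides one of the
   -- factors. The second factor is the first with - V in place of V, which has the same norm.
   reduction : Reduction
   reduction {π} {U} {V} {W} irr e = [ inj₁ , (λ sq → inj₂ (reduced (square⇒∣disc sq))) ]′ (divides-norm {π} {U} {V} {W} irr e)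
    where
    open Q.≋-Reasoning
    E1 E2 : Q.Poly
    E1 = τ Q.✶ U Q.⊹ Q.⊟ (G Q.✶ V)
    E2 = τ Q.✶ U Q.⊹ G Q.✶ V
    product : ∀ {g} → disc P.≋ g P.✶ π → E1 Q.✶ E2 Q.≋ [ π ]₂ Q.✶ (τ Q.✶ τ Q.✶ W Q.⊹ Q.⊟ ([ g ]₂ Q.✶ (V Q.✶ V)))
    product {g} disc≋gπ = begin
     E1 Q.✶ E2
      ≈⟨ W.solve 5 (λ t U G V q → (t :* U :- G :* V) :* (t :* U :+ G :* V)
         := t :* t :* (U :* U :- q :* (V :* V)) :+ (t :* t :* q :- G :* G) :* (V :* V)) τ U G V q ⟩
     τ Q.✶ τ Q.✶ norm U V Q.⊹ (τ Q.✶ τ Q.✶ q Q.⊹ Q.⊟ (G Q.✶ G)) Q.✶ (V Q.✶ V)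
      ≈⟨ Q.⊹-cong (Q.✶-congˡ (τ Q.✶ τ) e) (Q.✶-congʳ (τ Q.✶ τ Q.✶ q Q.⊹ Q.⊟ (G Q.✶ G)) (Q.⊟ ([ g ]₂ Q.✶ [ π ]₂))
         (Q.≋-trans (Q.⊹-cong τ²q≋ (Q.≋-refl {Q.⊟ (G Q.✶ G)})) (Q.≋-trans
          (W.solve 2 (λ x d → (x :- d) :- x := :- d) (G Q.✶ G) [ disc ]₂)
          (Q.⊟-cong (Q.≋-trans (Q.∷-cong disc≋gπ Q.≋-refl) (constant2-* g π)))))) ⟩
     τ Q.✶ τ Q.✶ ([ π ]₂ Q.✶ W) Q.⊹ Q.⊟ ([ g ]₂ Q.✶ [ π ]₂) Q.✶ (V Q.✶ V)
      ≈⟨ W.solve 5 (λ t p W g V → t :* t :* (p :* W) :+ (:- (g :* p)) :* (V :* V)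
         := p :* (t :* t :* W :- g :* (V :* V))) τ [ π ]₂ W [ g ]₂ V ⟩
     [ π ]₂ Q.✶ (τ Q.✶ τ Q.✶ W Q.⊹ Q.⊟ ([ g ]₂ Q.✶ (V Q.✶ V))) ∎
    Division : Q.Poly → Set
    Division X = Σ[ X1 ∈ Q.Poly ] X Q.≋ [ π ]₂ Q.✶ X1
    finish : ∀ {h k} → π P.≋ h P.✶ disc → ¬ (k K.≈ K.0#) → h P.≋ k ∷ [] → Division E1 ⊎ Division E2 → Reduced π U V
    finish {h} {k} π≋h k≉0 h≋k (inj₁ (W′ , eq)) = divide {π} {h} {U} {V} {W′} {k} π≋h h≋k k≉0
     (Q.≋-trans (W.solve 2 (λ x y → x := y :+ (x :- y)) (τ Q.✶ U) (G Q.✶ V)) (Q.⊹-cong (Q.≋-refl {G Q.✶ V}) eq))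
    finish {h} {k} π≋h k≉0 h≋k (inj₂ (W′ , eq)) = negate (divide {π} {h} {U} {Q.⊟ V} {W′} {k} π≋h h≋k k≉0
     (Q.≋-trans (W.solve 3 (λ x g v → x := g :* (:- v) :+ (x :+ g :* v)) (τ Q.✶ U) G V) (Q.⊹-cong (Q.≋-refl {G Q.✶ (Q.⊟ V)}) eq)))
     where
     negate : Reduced π U (Q.⊟ V) → Reduced π U V
     negate (U1 , V1 , l , l≉0 , eq′) = U1 , V1 , l , l≉0 , Q.≋-trans eq′ (Q.✶-congˡ [ l ∷ [] ]₂
      (W.solve 3 (λ U V q → U :* U :- q :* ((:- V) :* (:- V)) := U :* U :- q :* (V :* V)) U V q))
    reduced : π P.∣ disc → Reduced π U V
    reduced π∣disc@(P.divides g disc≋gπ) = finish {h} {proj₁ constant} (P.equality disc∣π) (proj₁ (proj₂ constant)) (proj₂ (proj₂ constant))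
     (prime2 {π} {E1} {E2} {τ Q.✶ τ Q.✶ W Q.⊹ Q.⊟ ([ g ]₂ Q.✶ (V Q.✶ V))} irr (product {g} disc≋gπ))
     where
     disc∣π : disc P.∣ π
     disc∣π = irreducible irr π∣disc
     h : P.Poly
     h = P.quotient disc∣π
     constant : Σ[ k ∈ 𝕂 ] ¬ (k K.≈ K.0#) × h P.≋ k ∷ []
     constant = associate {π} {g} {h} irr disc≋gπ (P.equality disc∣π)

 -- Y² = A(X) T² + B(X) T + C(X) with A and B linear

 module LinearInX where

  open ConicDiscriminant public
  open DomainProperties K-domain using () renaming (*-≉0 to K-*-≉0; square-≈0 to K-square-≈0)

  private
   combination : ∀ N → Vector P.Poly N → P.LinearMap N
   combination N g = record { to = to N g ; to-+ = to-+ N g ; to-· = to-· N g ; to-cong = to-cong N g }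
    where
    to : ∀ N → Vector P.Poly N → Vector 𝕂 N → P.Poly
    to zero g v = []
    to (suc N) g v = (v zero ∷ []) P.✶ g zero P.⊹ to N (λ i → g (suc i)) (λ i → v (suc i))
    to-cong : ∀ N g {u v} → (∀ i → u i K.≈ v i) → to N g u P.≋ to N g v
    to-cong zero g e = P.≋-refl
    to-cong (suc N) g {u} {v} e = P.⊹-cong (P.✶-congʳ (u zero ∷ []) (v zero ∷ []) (P.∷-cong (e zero) P.≋-refl)) (to-cong N _ (λ i → e (suc i)))
    to-+ : ∀ N g u v → to N g (λ i → u i K.+ v i) P.≋ to N g u P.⊹ to N g v
    to-+ zero g u v = P.≋-refl
    to-+ (suc N) g u v = P.≋-trans (P.⊹-cong (P.≋-refl {(u zero K.+ v zero ∷ []) P.✶ g zero}) (to-+ N _ _ _))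
     (U.solve 5 (λ a b g x y → (a :+ b) :* g :+ (x :+ y) := (a :* g :+ x) :+ (b :* g :+ y))
      (u zero ∷ []) (v zero ∷ []) (g zero) (to N (λ i → g (suc i)) (λ i → u (suc i))) (to N (λ i → g (suc i)) (λ i → v (suc i))))
    to-· : ∀ N g a v → to N g (λ i → a K.* v i) P.≋ a P.· to N g v
    to-· zero g a v = P.≋-refl
    to-· (suc N) g a v = P.≋-trans
     (P.⊹-cong (P.✶-congʳ ((a K.* v zero) ∷ []) (a P.· (v zero ∷ [])) P.≋-refl) (to-· N _ a _))
     (P.≋-trans (P.⊹-cong (P.·-✶ a (v zero ∷ []) (g zero)) P.≋-refl) (P.≋-sym (P.·-distribˡ a ((v zero ∷ []) P.✶ g zero) _)))

   combination-∣ : ∀ {d} N g h v → (∀ i → d P.∣ g i P.⊹ P.⊟ h i) →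
    d P.∣ P.LinearMap.to (combination N g) v P.⊹ P.⊟ P.LinearMap.to (combination N h) v
   combination-∣ zero g h v d∣ = P.∣0
   combination-∣ (suc N) g h v d∣ = P.∣-respʳ
    (U.solve 5 (λ a g h x y → a :* (g :- h) :+ (x :- y) := (a :* g :+ x) :- (a :* h :+ y))
     (v zero ∷ []) (g zero) (h zero) _ _)
    (P.∣-+ (P.∣-*ˡ (v zero ∷ []) (d∣ zero)) (combination-∣ N (λ i → g (suc i)) (λ i → h (suc i)) (λ i → v (suc i)) (λ i → d∣ (suc i))))

   combination-⊏ : ∀ {n} N g v → (∀ i → g i P.⊏ n) → P.LinearMap.to (combination N g) v P.⊏ n
   combination-⊏ zero g v b = P.[]⊏
   combination-⊏ {n} (suc N) g v b = P.⊏-⊹ {(v zero ∷ []) P.✶ g zero}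
    (P.⊏-resp (P.≋-sym (singleton-✶ K0 (v zero) (g zero))) (P.⊏-· {v zero} {g zero} (b zero)))
    (combination-⊏ N (λ i → g (suc i)) (λ i → v (suc i)) (λ i → b (suc i)))

  module _ {a0 a1 b0 b1 c0 c1 : 𝕂} (A≋ : A P.≋ a0 ∷ a1 ∷ []) (B≋ : B P.≋ b0 ∷ b1 ∷ [])
   (C≋ : C P.≋ c0 ∷ c1 ∷ K.0# ∷ K.1# ∷ []) (2≉0 : ¬ (K.1# K.+ K.1# K.≈ K.0#)) (a1≉0 : ¬ (a1 K.≈ K.0#))
   (nonSquare : ∀ u w → ¬ (w K.≈ K.0#) → ¬ (u K.* u K.≈ (K.- a1) K.* (w K.* w)))
   (noRoot : P.NoRoot disc)
   (irreducible : ∀ {π} → P.Irreducible π → π P.∣ disc → disc P.∣ π) where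

   private
    A-top : P.Top A 1 a1
    A-top = P.Top-resp (P.≋-sym A≋) K.refl (P.top (P.⊏-length (a0 ∷ a1 ∷ [])) K.refl)

   disc-top : P.Top disc 4 (K.- (4# K.* (a1 K.* K.1#)))
   disc-top = P.Top-resp P.≋-refl (K.+-identityˡ _) (P.Top-⊹
    (P.Top-0 4 (s≤s (s≤s (s≤s z≤n))) (P.⊏-✶ B B 2 1 B⊏2 B⊏2))
    (P.Top-⊟ {4₁ P.✶ (A P.✶ C)} (P.Top-✶ {4₁} {A P.✶ C} (P.top (P.⊏-length 4₁) K.refl) (P.Top-✶ A-top C-top))))
    where
    B⊏2 : B P.⊏ 2
    B⊏2 = P.⊏-resp (P.≋-sym B≋) (P.⊏-length (b0 ∷ b1 ∷ []))

   4≉0 : ¬ (4# K.≈ K.0#)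
   4≉0 e = K-*-≉0 2≉0 2≉0 (K.trans (KS.solve 0 ((:1 :+ :1) :* (:1 :+ :1) := :4)) e)

   disc-lead≉0 : ¬ (K.- (4# K.* (a1 K.* K.1#)) K.≈ K.0#)
   disc-lead≉0 e = K-*-≉0 4≉0 (K-*-≉0 a1≉0 K.1≉0) (K.trans (K.sym (-‿involutive _)) (K.trans (K.-‿cong e) -0#≈0#))
    where open RingProperties K.ring using (-0#≈0#; -‿involutive)

   -- E and O are of degree 2 and 1 in A.  If α² = A mod disc, choose them with E + α O = 0;
   -- then disc divides E² - A O², and comparing the two at the top degree and at the
   -- zero of A, where disc = B², shows that - a1 is a square.

   private
    affine : 𝕂 → 𝕂 → P.Poly
    affine u v = (u ∷ []) P.⊹ (v ∷ []) P.✶ A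

    affine-top : ∀ u v → P.Top (affine u v) 1 (v K.* a1)
    affine-top u v = P.Top-resp P.≋-refl (K.+-identityˡ _) (P.Top-⊹ (P.Top-weaken 1 (s≤s z≤n) P.Top-const)
     (P.Top-✶ {v ∷ []} {A} P.Top-const A-top))

    cancel-a1 : ∀ {v} → v K.* a1 K.≈ K.0# → v K.≈ K.0#
    cancel-a1 {v} e = DomainProperties.cancel-≈0 K-domain a1 a1≉0 (K.trans (K.*-comm a1 v) e)

    affine-≋0 : ∀ {u v} → affine u v P.≋ [] → u K.≈ K.0# × v K.≈ K.0#
    affine-≋0 {u} {v} e = P.at u≋0 0 , v≈0
     where
     v≈0 : v K.≈ K.0#
     v≈0 = cancel-a1 (K.trans (K.sym (P.lead (affine-top u v))) (P.at e 1))
     u≋0 : u ∷ [] P.≋ []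
     u≋0 = P.≋-trans (P.≋-sym (P.≋-trans (P.⊹-cong (P.≋-refl {u ∷ []}) (P.✶-zeroˡ (v ∷ []) A (P.≋-trans (P.∷-cong v≈0 P.≋-refl) P.shift-0)))
          (P.⊹-identityʳ (u ∷ [])))) e

    quadratic : 𝕂 → 𝕂 → 𝕂 → P.Poly
    quadratic u v w = affine u v P.⊹ (w ∷ []) P.✶ (A P.✶ A)

    quadratic-top : ∀ u v w → P.Top (quadratic u v w) 2 (w K.* (a1 K.* a1))
    quadratic-top u v w = P.Top-resp P.≋-refl (K.+-identityˡ _) (P.Top-⊹ (P.Top-weaken 2 N.≤-refl (affine-top u v))
     (P.Top-✶ {w ∷ []} {A P.✶ A} P.Top-const (P.Top-✶ A-top A-top)))

    quadratic-≋0 : ∀ {u v w} → quadratic u v w P.≋ [] → u K.≈ K.0# × v K.≈ K.0# × w K.≈ K.0#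
    quadratic-≋0 {u} {v} {w} e = proj₁ uv≈0 , proj₂ uv≈0 , w≈0
     where
     w≈0 : w K.≈ K.0#
     w≈0 = cancel-a1 (cancel-a1 (K.trans (K.*-assoc w a1 a1) (K.trans (K.sym (P.lead (quadratic-top u v w))) (P.at e 2))))
     uv≈0 : u K.≈ K.0# × v K.≈ K.0#
     uv≈0 = affine-≋0 (P.≋-trans (P.≋-sym (P.≋-trans (P.⊹-cong (P.≋-refl {affine u v}) (P.✶-zeroˡ (w ∷ []) (A P.✶ A)
          (P.≋-trans (P.∷-cong w≈0 P.≋-refl) P.shift-0))) (P.⊹-identityʳ (affine u v)))) e)

    -- Unless both are zero, E² would have even degree and A O² odd degree.
    E²≋AO² : ∀ {E O} → E P.✶ E P.≋ A P.✶ (O P.✶ O) → E P.≋ [] × O P.≋ []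
    E²≋AO² {E} {O} e with P.classify O | P.classify E
    ... | inj₁ O≋0 | _ = D1.square-≈0 {E} (P.≋-trans e (P.≋-trans (P.✶-congˡ A (P.✶-zeroˡ O O O≋0)) (P.✶-zeroʳ A))) , O≋0
    ... | inj₂ (j , b , b≉0 , t) | inj₁ E≋0 = ⊥-elim (P.Top-≉0 (K-*-≉0 a1≉0 (K-*-≉0 b≉0 b≉0)) (P.Top-✶ A-top (P.Top-✶ t t))
        (P.≋-trans (P.≋-sym e) (P.✶-zeroˡ E E E≋0)))
    ... | inj₂ (j , b , b≉0 , t) | inj₂ (i , x , x≉0 , u) = ⊥-elim (even≢odd i j
        (P.Top-unique (K-*-≉0 x≉0 x≉0) (K-*-≉0 a1≉0 (K-*-≉0 b≉0 b≉0)) (P.Top-resp e K.refl (P.Top-✶ u u)) (P.Top-✶ A-top (P.Top-✶ t t))))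

   module _ (v0 v1 v2 v3 v4 : 𝕂) where

    private
     E O R : P.Poly
     E = quadratic v0 v1 v2
     O = affine v3 v4
     R = E P.✶ E P.⊹ P.⊟ (A P.✶ (O P.✶ O))

    -- E² - A O² = (E + α O) (E - α O) - (A - α²) O².
    ∣norm : ∀ {α} → disc P.∣ A P.⊹ P.⊟ (α P.✶ α) → disc P.∣ E P.⊹ α P.✶ O → disc P.∣ R
    ∣norm {α} disc∣ disc∣E+αO = P.∣-respʳ (U.solve 4 (λ E O A α → (E :+ α :* O) :* (E :- α :* O) :+ (:- ((A :- α :* α) :* (O :* O)))
      := E :* E :- A :* (O :* O)) E O A α)
     (P.∣-+ (P.∣-*ʳ (E P.⊹ P.⊟ (α P.✶ O)) disc∣E+αO) (P.∣-neg (P.∣-*ʳ (O P.✶ O) disc∣)))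

    norm-not-multiple : ¬ (v0 K.≈ K.0# × v1 K.≈ K.0# × v2 K.≈ K.0# × v3 K.≈ K.0# × v4 K.≈ K.0#) → ∀ κ → ¬ (R P.≋ κ P.✶ disc)
    norm-not-multiple v≉0 κ R≋κdisc = contradiction (P.classify κ)
     where
     lead² lead : 𝕂
     lead = v2 K.* (a1 K.* a1)
     lead² = lead K.* lead
     R-top : P.Top R 4 lead²
     R-top = P.Top-resp P.≋-refl (KS.solve 1 (λ x → x :- :0 := x) lead²)
      (P.Top-⊹ (P.Top-✶ (quadratic-top v0 v1 v2) (quadratic-top v0 v1 v2))
       (P.Top-⊟ {A P.✶ (O P.✶ O)} (P.Top-weaken 4 N.≤-refl (P.Top-✶ A-top (P.Top-✶ (affine-top v3 v4) (affine-top v3 v4))))))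
     R≉0 : ¬ (R P.≋ [])
     R≉0 R≋0 = v≉0 (proj₁ E≈0 , proj₁ (proj₂ E≈0) , proj₂ (proj₂ E≈0) , proj₁ O≈0 , proj₂ O≈0)
      where
      both : E P.≋ [] × O P.≋ []
      both = E²≋AO² {E} {O} (GroupProperties.x∙y⁻¹≈ε⇒x≈y (CommutativeRing.+-group P.polynomialRing) (E P.✶ E) (A P.✶ (O P.✶ O)) R≋0)
      E≈0 : v0 K.≈ K.0# × v1 K.≈ K.0# × v2 K.≈ K.0#
      E≈0 = quadratic-≋0 {v0} {v1} {v2} (proj₁ both)
      O≈0 : v3 K.≈ K.0# × v4 K.≈ K.0#
      O≈0 = affine-≋0 {v3} {v4} (proj₂ both)
     ξ : 𝕂
     ξ = proj₁ (P.linear-root {A} {A} a1≉0 A-top P.∣-refl)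
     A[ξ]≈0 : P.evaluate ξ A K.≈ K.0#
     A[ξ]≈0 = proj₂ (P.linear-root {A} {A} a1≉0 A-top P.∣-refl)
     β : 𝕂
     β = P.evaluate ξ B
     module Eξ = RingHom (Evaluation.evalHom (identityHom K0) ξ)
     eval-constant : ∀ u → P.evaluate ξ (u ∷ []) K.≈ u
     eval-constant u = K.trans (K.+-congˡ (K.zeroʳ ξ)) (K.+-identityʳ u)
     E[ξ] : P.evaluate ξ E K.≈ v0
     E[ξ] = begin
      P.evaluate ξ E ≈⟨ K.trans (Eξ.+-homo (affine v0 v1) ((v2 ∷ []) P.✶ (A P.✶ A))) (K.+-cong (Eξ.+-homo (v0 ∷ []) ((v1 ∷ []) P.✶ A))
                  (K.trans (Eξ.*-homo (v2 ∷ []) (A P.✶ A)) (K.*-congˡ (Eξ.*-homo A A)))) ⟩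
      P.evaluate ξ (v0 ∷ []) K.+ P.evaluate ξ ((v1 ∷ []) P.✶ A) K.+ P.evaluate ξ (v2 ∷ []) K.* (P.evaluate ξ A K.* P.evaluate ξ A)
       ≈⟨ K.+-cong (K.+-cong (eval-constant v0) (K.trans (Eξ.*-homo (v1 ∷ []) A) (K.*-congˡ A[ξ]≈0))) (K.*-congˡ (K.*-congʳ A[ξ]≈0)) ⟩
      v0 K.+ P.evaluate ξ (v1 ∷ []) K.* K.0# K.+ P.evaluate ξ (v2 ∷ []) K.* (K.0# K.* P.evaluate ξ A)
       ≈⟨ KS.solve 4 (λ v x y z → v :+ x :* :0 :+ y :* (:0 :* z) := v) _ _ _ _ ⟩
      v0 ∎
      where open P.≈-Reasoning
     R[ξ] : P.evaluate ξ R K.≈ v0 K.* v0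
     R[ξ] = K.trans (Eξ.sub-homo (E P.✶ E) (A P.✶ (O P.✶ O))) (K.trans (K.+-cong (K.trans (Eξ.*-homo E E) (K.*-cong E[ξ] E[ξ]))
      (K.-‿cong (K.trans (Eξ.*-homo A (O P.✶ O)) (K.trans (K.*-congʳ A[ξ]≈0) (K.zeroˡ _))))) (KS.solve 1 (λ v → v :- :0 := v) _))
     disc[ξ] : P.evaluate ξ disc K.≈ β K.* β
     disc[ξ] = K.trans (evaluate-disc ξ) (K.trans (K.+-congˡ (K.-‿cong (K.*-congˡ (K.*-congʳ A[ξ]≈0))))
      (KS.solve 3 (λ b f c → b :- f :* (:0 :* c) := b) _ _ _))
     contradiction : κ P.≋ [] ⊎ (Σ[ n ∈ ℕ ] Σ[ k ∈ 𝕂 ] ¬ (k K.≈ K.0#) × P.Top κ n k) → ⊥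
     contradiction (inj₁ κ≋0) = R≉0 (P.≋-trans (R≋κdisc) (P.✶-zeroˡ κ disc κ≋0))
     -- The top degree gives `lead²` = - 4 a1 k, and the zero ξ of A gives k β² = v0². Hence (lead
     -- β)² = - a1 (2 v0)², and v0 ≠ 0 because disc, equal to β² at ξ, has no root.
     contradiction (inj₂ (n , k , k≉0 , t)) = nonSquare (lead K.* β) (v0 K.+ v0) 2v0≉0 (begin
      lead K.* β K.* (lead K.* β) ≈⟨ KS.solve 2 (λ x b → x :* b :* (x :* b) := x :* x :* (b :* b)) lead β ⟩
      lead² K.* (β K.* β) ≈⟨ K.*-congʳ top-coefficient ⟩
      k K.* (K.- (4# K.* (a1 K.* K.1#))) K.* (β K.* β)
       ≈⟨ KS.solve 3 (λ k a b → k :* (:- (:4 :* (a :* :1))) :* b := (:- a) :* (:4 :* (k :* b))) k a1 _ ⟩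
      (K.- a1) K.* (4# K.* (k K.* (β K.* β))) ≈⟨ K.*-congˡ (K.*-congˡ value) ⟩
      (K.- a1) K.* (4# K.* (v0 K.* v0))
       ≈⟨ K.*-congˡ (KS.solve 1 (λ v → :4 :* (v :* v) := (v :+ v) :* (v :+ v)) v0) ⟩
      (K.- a1) K.* ((v0 K.+ v0) K.* (v0 K.+ v0)) ∎)
      where
      open P.≈-Reasoning
      n≡0 : n ≡ 0
      n≡0 = N.n≤0⇒n≡0 (N.+-cancelʳ-≤ 4 n 0 (N.s≤s⁻¹ (P.Top-< {R} (K-*-≉0 k≉0 disc-lead≉0)
          (P.Top-resp (P.≋-sym (R≋κdisc)) K.refl (P.Top-✶ t disc-top)) (P.below R-top))))
      κ≋k : κ P.≋ k ∷ []
      κ≋k = P.≋-trans (P.const⇒ (≡.subst (λ n → κ P.⊏ suc n) n≡0 (P.below t)))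
          (P.∷-cong (≡.subst (λ n → P.coeff κ n K.≈ k) n≡0 (P.lead t)) P.≋-refl)
      R≋ : R P.≋ (k ∷ []) P.✶ disc
      R≋ = P.≋-trans (R≋κdisc) (P.✶-congʳ κ (k ∷ []) κ≋k)
      top-coefficient : lead² K.≈ k K.* (K.- (4# K.* (a1 K.* K.1#)))
      top-coefficient = K.trans (K.sym (P.lead R-top)) (K.trans (P.at R≋ 4) (P.lead (P.Top-✶ {k ∷ []} {disc} P.Top-const disc-top)))
      value : k K.* (β K.* β) K.≈ v0 K.* v0
      value = K.trans (K.sym (K.*-cong (eval-constant k) disc[ξ])) (K.trans (K.sym (Eξ.*-homo (k ∷ []) disc)) (K.trans (Eξ.⟦⟧-cong (P.≋-sym R≋)) R[ξ]))
      v0≉0 : ¬ (v0 K.≈ K.0#)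
      v0≉0 z = K-*-≉0 k≉0 (λ e → noRoot ξ (K.trans disc[ξ] e)) (K.trans value (K.trans (K.*-congʳ z) (K.zeroˡ v0)))
      2v0≉0 : ¬ (v0 K.+ v0 K.≈ K.0#)
      2v0≉0 z = K-*-≉0 2≉0 v0≉0 (K.trans (KS.solve 1 (λ v → (:1 :+ :1) :* v := v :+ v) v0) z)

   -- Modulo the quartic disc polynomials form a space of dimension 4, so the remainders of the five
   -- polynomials 1, A, A², α and α A are linearly dependent. The relation has the form E + α O with
   -- E quadratic and O affine in A.
   A-nonSquare : ∀ {α} → ¬ (disc P.∣ A P.⊹ P.⊟ (α P.✶ α))
   A-nonSquare {α} disc∣ = conclude (kernel′ K {4} {5} N.≤-refl (combination 5 r)
     (λ u → combination-⊏ 5 r u (λ i → proj₂ (proj₂ (proj₂ (P.divMod disc-lead≉0 disc-top (g i)))))))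
    where
    g r : Vector P.Poly 5
    g zero = P.one
    g (suc zero) = A
    g (suc (suc zero)) = A P.✶ A
    g (suc (suc (suc zero))) = α
    g (suc (suc (suc (suc zero)))) = α P.✶ A
    r i = proj₁ (proj₂ (P.divMod disc-lead≉0 disc-top (g i)))
    conclude : (Σ[ v ∈ Vector 𝕂 5 ] (Σ[ i ∈ Fin 5 ] ¬ (v i K.≈ K.0#)) × P.LinearMap.to (combination 5 r) v P.≋ []) → ⊥
    conclude (v , (i , v≉0) , relation) = norm-not-multiple v0 v1 v2 v3 v4 (λ z → v≉0 (all z i)) (P.quotient disc∣R) (P.equality disc∣R)
     where
     v0 v1 v2 v3 v4 : 𝕂
     v0 = v zero
     v1 = v (suc zero)
     v2 = v (suc (suc zero))
     v3 = v (suc (suc (suc zero)))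
     v4 = v (suc (suc (suc (suc zero))))
     all : v0 K.≈ K.0# × v1 K.≈ K.0# × v2 K.≈ K.0# × v3 K.≈ K.0# × v4 K.≈ K.0# → ∀ i → v i K.≈ K.0#
     all z zero = proj₁ z
     all z (suc zero) = proj₁ (proj₂ z)
     all z (suc (suc zero)) = proj₁ (proj₂ (proj₂ z))
     all z (suc (suc (suc zero))) = proj₁ (proj₂ (proj₂ (proj₂ z)))
     all z (suc (suc (suc (suc zero)))) = proj₂ (proj₂ (proj₂ (proj₂ z)))
     disc∣E+αO : disc P.∣ quadratic v0 v1 v2 P.⊹ α P.✶ affine v3 v4
     disc∣E+αO = P.∣-respʳ (P.≋-trans
      (P.⊹-cong (P.≋-refl {P.LinearMap.to (combination 5 g) v}) (P.⊟-cong relation))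
      (U.solve 7 (λ v0 v1 v2 v3 v4 A α →
       (v0 :* :1 :+ (v1 :* A :+ (v2 :* (A :* A) :+ (v3 :* α :+ (v4 :* (α :* A) :+ :0))))) :- :0
       := (v0 :+ v1 :* A :+ v2 :* (A :* A)) :+ α :* (v3 :+ v4 :* A))
       (v0 ∷ []) (v1 ∷ []) (v2 ∷ []) (v3 ∷ []) (v4 ∷ []) A α))
      (combination-∣ 5 g r v (λ i → P.divides (proj₁ (P.divMod disc-lead≉0 disc-top (g i)))
       (P.≋-trans (P.⊹-cong (proj₁ (proj₂ (proj₂ (P.divMod disc-lead≉0 disc-top (g i))))) (P.≋-refl {P.⊟ r i}))
        (U.solve 2 (λ x r → (x :+ r) :- r := x) (proj₁ (P.divMod disc-lead≉0 disc-top (g i)) P.✶ disc) (r i)))))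
     disc∣R = ∣norm v0 v1 v2 v3 v4 {α} disc∣ disc∣E+αO

   reduction : Reduction
   reduction = no-square⇒reduction λ irr sq →
    A-nonSquare {SquareModulo.α sq} (P.∣-trans (irreducible irr (square⇒∣disc sq)) (SquareModulo.A≡α² sq))

 -- Parity of the degree of the point when A is linear

 module SquareProducts where

  open DomainProperties K-domain using () renaming (*-≉0 to K-*-≉0)

  degree-of : ∀ {f} → ¬ (f P.≋ []) → Σ[ n ∈ ℕ ] Σ[ a ∈ 𝕂 ] ¬ (a K.≈ K.0#) × P.Top f n a
  degree-of {f} f≉0 with P.classify f
  ... | inj₁ f≋0 = ⊥-elim (f≉0 f≋0)
  ... | inj₂ d = d

  -- Let d be the gcd of e and Q, with e = e′ d and Q = Q′ d. Then Q′² d = e′ w, where e′ is coprime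
  -- to Q′ and d is coprime to w. Hence e′ and d divide each other and have the same degree.
  square-factor : ∀ {e w Q} → ¬ (e P.≋ []) → P.Coprime w e → Q P.✶ Q P.≋ e P.✶ w → Σ[ j ∈ ℕ ] Σ[ a ∈ 𝕂 ] ¬ (a K.≈ K.0#) × P.Top e (j N.+ j) a
  square-factor {e} {w} {Q} e≉0 (u0 , v0 , eq0) Q²≋ew with P.bézout e Q
  ... | record { gcd = d ; u = u ; v = v ; combination = d≋ ; gcd∣f = P.divides e′ e≋ ; gcd∣g = P.divides Q′ Q≋ } =
   i , (proj₁ (proj₂ de)) K.* proj₁ (proj₂ dd) , K-*-≉0 (proj₁ (proj₂ (proj₂ de))) (proj₁ (proj₂ (proj₂ dd)))
    , P.Top-resp (P.≋-sym e≋) K.refl (≡.subst (λ k → P.Top (e′ P.✶ d) (k N.+ i) ((proj₁ (proj₂ de)) K.* proj₁ (proj₂ dd))) same (P.Top-✶ (proj₂ (proj₂ (proj₂ de))) (proj₂ (proj₂ (proj₂ dd)))))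
   where
   d≉0 : ¬ (d P.≋ [])
   d≉0 z = e≉0 (P.≋-trans e≋ (P.≋-trans (P.✶-congˡ e′ z) (P.✶-zeroʳ e′)))
   e′≉0 : ¬ (e′ P.≋ [])
   e′≉0 z = e≉0 (P.≋-trans e≋ (P.✶-zeroˡ e′ d z))
   de = degree-of e′≉0
   dd = degree-of d≉0
   i : ℕ
   i = proj₁ dd
   Q′²d≋e′w : Q′ P.✶ (Q′ P.✶ d) P.≋ e′ P.✶ w
   Q′²d≋e′w = D1.*-cancel d {Q′ P.✶ (Q′ P.✶ d)} {e′ P.✶ w} d≉0 (P.≋-trans
    (U.solve 2 (λ q d → d :* (q :* (q :* d)) := (q :* d) :* (q :* d)) Q′ d)
    (P.≋-trans (P.✶-cong (P.≋-sym Q≋) (P.≋-sym Q≋)) (P.≋-trans Q²≋ew (P.≋-trans (P.✶-congʳ e (e′ P.✶ d) e≋)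
     (U.solve 3 (λ e d w → e :* d :* w := d :* (e :* w)) e′ d w)))))
   coprime-e′Q′ : P.Coprime e′ Q′
   coprime-e′Q′ = u , v , D1.*-cancel d {u P.✶ e′ P.⊹ v P.✶ Q′} {P.one} d≉0 (P.≋-trans
    (U.solve 5 (λ d u p v e → d :* (u :* p :+ v :* e) := u :* (p :* d) :+ v :* (e :* d)) d u e′ v Q′)
    (P.≋-trans (P.⊹-cong (P.✶-congˡ u (P.≋-sym e≋)) (P.✶-congˡ v (P.≋-sym Q≋)))
    (P.≋-trans (P.≋-sym d≋) (U.solve 1 (λ d → d := d :* :1) d))))
   e′∣d : e′ P.∣ d
   e′∣d = P.coprime-divisor coprime-e′Q′ (P.coprime-divisor coprime-e′Q′ (P.divides w (P.≋-trans Q′²d≋e′w (P.✶-comm e′ w))))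
   d∣e′ : d P.∣ e′
   d∣e′ = P.coprime-divisor coprime-dw (P.divides (Q′ P.✶ Q′) (P.≋-trans (P.✶-comm w e′) (P.≋-trans (P.≋-sym Q′²d≋e′w) (P.≋-sym (P.✶-assoc Q′ Q′ d)))))
    where
    coprime-dw : P.Coprime d w
    coprime-dw = v0 P.✶ e′ , u0 , P.≋-trans
     (P.⊹-cong (P.≋-trans (P.✶-assoc (v0) e′ d) (P.✶-congˡ (v0) (P.≋-sym e≋))) (P.≋-refl {u0 P.✶ w}))
     (P.≋-trans (P.⊹-comm (v0 P.✶ e) (u0 P.✶ w)) (eq0))
   divisor-degree : ∀ {f g m n a b} → ¬ (g P.≋ []) → ¬ (a K.≈ K.0#) → P.Top f m a → ¬ (b K.≈ K.0#) → P.Top g n b → f P.∣ g → m N.≤ n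
   divisor-degree {f} {g} {m} {n} g≉0 a≉0 t b≉0 u (P.divides h eq) with P.classify h
   ... | inj₁ h≋0 = ⊥-elim (g≉0 (P.≋-trans eq (P.✶-zeroˡ h f h≋0)))
   ... | inj₂ (k , z , z≉0 , v) = ≡.subst (m N.≤_) (P.Top-unique (K-*-≉0 z≉0 a≉0) b≉0 (P.Top-resp (P.≋-sym eq) K.refl (P.Top-✶ v t)) u) (N.m≤n+m m k)
   same : proj₁ de ≡ i
   same = N.≤-antisym
    (divisor-degree d≉0 (proj₁ (proj₂ (proj₂ de))) (proj₂ (proj₂ (proj₂ de))) (proj₁ (proj₂ (proj₂ dd))) (proj₂ (proj₂ (proj₂ dd))) e′∣d)
    (divisor-degree e′≉0 (proj₁ (proj₂ (proj₂ dd))) (proj₂ (proj₂ (proj₂ dd))) (proj₁ (proj₂ (proj₂ de))) (proj₂ (proj₂ (proj₂ de))) d∣e′)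

  -- deg p = 2m + 1 and deg e = 2j ≤ 2m
  cubic-top : ∀ {p e α₄ α₆ a1 a0} (m j : ℕ) {a b} → P.Top α₄ 2 a1 → P.Top α₆ 2 a0 →
        (∀ u w → ¬ (w K.≈ K.0#) → ¬ (u K.* u K.≈ (K.- a1) K.* (w K.* w))) →
        ¬ (a K.≈ K.0#) → ¬ (b K.≈ K.0#) → P.Top p (suc (m N.+ m)) a → P.Top e (j N.+ j) b → j N.≤ m →
      Σ[ z ∈ 𝕂 ] ¬ (z K.≈ K.0#) × P.Top (p P.✶ (p P.✶ p) P.⊹ (α₄ P.✶ (p P.✶ (e P.✶ e)) P.⊹ α₆ P.✶ (e P.✶ (e P.✶ e)))) (suc (m N.+ m) N.+ (suc (m N.+ m) N.+ suc (m N.+ m))) z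
  cubic-top {p} {e} {α₄} {α₆} {a1} {a0} m j {a} {b} t4 t6 nonSquare a≉0 b≉0 tp te j≤m with N.m≤n⇒m<n∨m≡n j≤m
  ... | inj₁ j<m = a K.* (a K.* a) K.+ (K.0# K.+ K.0#)
    , (λ z → K-*-≉0 a≉0 (K-*-≉0 a≉0 a≉0) (K.trans (KS.solve 1 (λ z → z := z :+ (:0 :+ :0)) _) z))
    , P.Top-⊹ ppp (P.Top-⊹ (P.Top-weaken _ pee< pee) (P.Top-weaken _ eee< eee))
   where
   N M : ℕ
   N = m N.+ m
   M = j N.+ j
   ppp = P.Top-✶ tp (P.Top-✶ tp tp)
   pee = P.Top-✶ t4 (P.Top-✶ tp (P.Top-✶ te te))
   eee = P.Top-✶ t6 (P.Top-✶ te (P.Top-✶ te te))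
   M+2≤N : 2 N.+ M N.≤ N
   M+2≤N = N.≤-trans (N.≤-reflexive (≡.cong suc (≡.sym (N.+-suc j j)))) (N.+-mono-≤ j<m j<m)
   M+1≤N+1 : suc M N.≤ suc N
   M+1≤N+1 = s≤s (N.≤-trans (N.≤-trans (N.n≤1+n M) (N.n≤1+n (suc M))) M+2≤N)
   pee< : 2 N.+ (suc N N.+ (M N.+ M)) N.< suc N N.+ (suc N N.+ suc N)
   pee< = N.≤-trans (N.≤-reflexive lhs) (N.+-monoʳ-≤ (suc N) (N.+-mono-≤ (s≤s M+2≤N) (N.≤-trans (N.n≤1+n M) M+1≤N+1)))
    where
    lhs : suc (2 N.+ (suc N N.+ (M N.+ M))) ≡ suc N N.+ (suc (2 N.+ M) N.+ M)
    lhs = NS.solve 2 (λ N M → NS.con 3 NS.:+ (N NS.:+ (M NS.:+ M)) NS.:= N NS.:+ (NS.con 3 NS.:+ M NS.:+ M)) ≡.refl (suc N) M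
   eee< : 2 N.+ (M N.+ (M N.+ M)) N.< suc N N.+ (suc N N.+ suc N)
   eee< = N.≤-trans (N.≤-reflexive lhs) (N.+-mono-≤ M+1≤N+1 (N.+-mono-≤ M+1≤N+1 M+1≤N+1))
    where
    lhs : suc (2 N.+ (M N.+ (M N.+ M))) ≡ suc M N.+ (suc M N.+ suc M)
    lhs = NS.solve 1 (λ M → NS.con 3 NS.:+ (M NS.:+ (M NS.:+ M)) NS.:= (NS.con 1 NS.:+ M) NS.:+ ((NS.con 1 NS.:+ M) NS.:+ (NS.con 1 NS.:+ M))) ≡.refl M
  -- Now α₄ p e² reaches the degree of p³. The leading coefficients add up to a (a² + a1 b²), which
  -- is nonzero because - a1 is not the square of a / b.
  ... | inj₂ ≡.refl = a K.* (a K.* a) K.+ (a1 K.* (a K.* (b K.* b)) K.+ K.0#) , lead≉0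
    , P.Top-⊹ ppp (P.Top-⊹ (≡.subst (λ k → P.Top (α₄ P.✶ (p P.✶ (e P.✶ e))) k (a1 K.* (a K.* (b K.* b)))) pee≡ pee) (P.Top-weaken _ eee< eee))
   where
   N : ℕ
   N = m N.+ m
   ppp = P.Top-✶ tp (P.Top-✶ tp tp)
   pee = P.Top-✶ t4 (P.Top-✶ tp (P.Top-✶ te te))
   eee = P.Top-✶ t6 (P.Top-✶ te (P.Top-✶ te te))
   pee≡ : 2 N.+ (suc N N.+ (N N.+ N)) ≡ suc N N.+ (suc N N.+ suc N)
   pee≡ = NS.solve 1 (λ N → NS.con 2 NS.:+ ((NS.con 1 NS.:+ N) NS.:+ (N NS.:+ N))
        NS.:= (NS.con 1 NS.:+ N) NS.:+ ((NS.con 1 NS.:+ N) NS.:+ (NS.con 1 NS.:+ N))) ≡.refl N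
   eee< : 2 N.+ (N N.+ (N N.+ N)) N.< suc N N.+ (suc N N.+ suc N)
   eee< = N.≤-reflexive (NS.solve 1 (λ N → NS.con 3 NS.:+ (N NS.:+ (N NS.:+ N))
        NS.:= (NS.con 1 NS.:+ N) NS.:+ ((NS.con 1 NS.:+ N) NS.:+ (NS.con 1 NS.:+ N))) ≡.refl N)
   lead≉0 : ¬ (a K.* (a K.* a) K.+ (a1 K.* (a K.* (b K.* b)) K.+ K.0#) K.≈ K.0#)
   lead≉0 z = nonSquare a b b≉0 (GroupProperties.x∙y⁻¹≈ε⇒x≈y K.+-group _ _ (DomainProperties.cancel-≈0 K-domain a a≉0
    (K.trans (KS.solve 3 (λ a b c → a :* (a :* a :- (:- c) :* (b :* b)) := a :* (a :* a) :+ (c :* (a :* (b :* b)) :+ :0)) a b a1) z)))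

  -- A nonzero square has even degree, whereas e w has degree 2 j + 2 k + 1.
  square-product-degree : ∀ {e w Q j k a z} → ¬ (z K.≈ K.0#) → P.Top w (suc (k N.+ k)) z → ¬ (a K.≈ K.0#) → P.Top e (j N.+ j) a →
              ¬ (Q P.✶ Q P.≋ e P.✶ w)
  square-product-degree {e} {w} {Q} {j} {k} z≉0 tw a≉0 te Q²≋ with P.classify Q
  ... | inj₁ Q≋0 = P.Top-≉0 (K-*-≉0 a≉0 z≉0) (P.Top-✶ te tw) (P.≋-trans (P.≋-sym Q²≋) (P.✶-zeroˡ Q Q Q≋0))
  ... | inj₂ (h , x , x≉0 , tQ) = even≢odd h (j N.+ k) (≡.trans
      (P.Top-unique (K-*-≉0 x≉0 x≉0) (K-*-≉0 a≉0 z≉0) (P.Top-resp Q²≋ K.refl (P.Top-✶ tQ tQ)) (P.Top-✶ te tw))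
      (NS.solve 2 (λ j k → (j NS.:+ j) NS.:+ (NS.con 1 NS.:+ (k NS.:+ k)) NS.:= NS.con 1 NS.:+ ((j NS.:+ k) NS.:+ (j NS.:+ k))) ≡.refl j k))

  -- If w = 0, coprimality makes e a unit, of degree 0; otherwise e w is a square with coprime
  -- factors.
  even-degree-factor : ∀ {e w i b} → ¬ (e P.≋ []) → P.Coprime w e → (¬ (w P.≋ []) → Σ[ Q ∈ P.Poly ] Q P.✶ Q P.≋ e P.✶ w) →
             ¬ (b K.≈ K.0#) → P.Top e i b → Σ[ j ∈ ℕ ] i ≡ j N.+ j
  even-degree-factor {e} {w} {i} {b} e≉0 coprime square b≉0 te = cases (w P.PolyDomain.≟ [])
   where
   u v : P.Poly
   u = proj₁ coprime
   v = proj₁ (proj₂ coprime)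
   finish : (Σ[ j ∈ ℕ ] Σ[ a ∈ 𝕂 ] ¬ (a K.≈ K.0#) × P.Top e (j N.+ j) a) → Σ[ j ∈ ℕ ] i ≡ j N.+ j
   finish (j , a , a≉0 , t) = j , P.Top-unique b≉0 a≉0 te t
   cases : Dec (w P.≋ []) → Σ[ j ∈ ℕ ] i ≡ j N.+ j
   cases (yes w≋0) = 0 , N.n≤0⇒n≡0 (N.s≤s⁻¹ (P.Top-< {e} b≉0 te (P.∣one⇒⊏1 (P.divides v
    (P.≋-trans (P.≋-sym (proj₂ (proj₂ coprime))) (P.⊹-cong {u P.✶ w} {[]} (P.≋-trans (P.✶-congˡ u w≋0) (P.✶-zeroʳ u)) (P.≋-refl {v P.✶ e})))))))
   cases (no w≉0) = finish (square-factor {e} {w} {proj₁ (square w≉0)} e≉0 coprime (proj₂ (square w≉0)))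

 module EvenDegree (𝓕 : Overdomain K) (x y : Overdomain.Element 𝓕) where

  open Overdomain 𝓕
  open Descent
  private
   module S = IntegerSolver F
   module ι = RingHom ι
  open DomainProperties K-domain using () renaming (*-≉0 to K-*-≉0; square-≈0 to K-square-≈0)
  open CommutativeRing F hiding (zero)
  open AtPoint 𝓕 x
  open ≈-Reasoning

  -- The numerator of X³ + α₄ X + α₆ at p/e has odd degree when deg p is odd and
  -- greater than deg e, whereas y² makes its product with e a square.

  module _ {a0 a1 b0 b1 c0 c1 : 𝕂} (A≋ : A P.≋ a0 ∷ a1 ∷ []) (B≋ : B P.≋ b0 ∷ b1 ∷ [])
   (C≋ : C P.≋ c0 ∷ c1 ∷ K.0# ∷ K.1# ∷ [])
   (nonSquare : ∀ u w → ¬ (w K.≈ K.0#) → ¬ (u K.* u K.≈ (K.- a1) K.* (w K.* w)))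
   (y²≈q : y * y ≈ ev.⟦ q ⟧) (P : PointData 𝓕 x y) where

   open PointData P

   private
    α₄ α₆ w : P.Poly
    α₄ = c1 ∷ b1 ∷ a1 ∷ []
    α₆ = c0 ∷ b0 ∷ a0 ∷ []
    w = p P.✶ (p P.✶ p) P.⊹ (α₄ P.✶ (p P.✶ (e P.✶ e)) P.⊹ α₆ P.✶ (e P.✶ (e P.✶ e)))

    ιc : 𝕂 → Carrier
    ιc a = ι.⟦ a ∷ [] ⟧

    τ : Carrier
    τ = ι.⟦ var ⟧

    ι-quadratic : ∀ a b d → ι.⟦ a ∷ b ∷ d ∷ [] ⟧ ≈ ιc a + τ * (ιc b + τ * ιc d)
    ι-quadratic a b d = trans (ι-∷ a (b ∷ d ∷ [])) (+-congˡ (*-congˡ (ι-∷ b (d ∷ []))))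

    evX-linear : ∀ a b → evX.⟦ a ∷ b ∷ [] ⟧ ≈ ιc a + x * ιc b
    evX-linear a b = +-congˡ (*-congˡ (trans (+-congˡ (zeroʳ x)) (+-identityʳ _)))

    evX-C : evX.⟦ C ⟧ ≈ ιc c0 + x * (ιc c1 + x * (x * 1#))
    evX-C = trans (evX.⟦⟧-cong C≋) (+-congˡ (*-congˡ (+-congˡ (*-congˡ (trans (+-cong (trans (ι.⟦⟧-cong P.shift-0) ι.0-homo)
     (*-congˡ (trans (+-cong ι.1-homo (zeroʳ x)) (+-identityʳ 1#)))) (+-identityˡ _))))))

    ev-q : ev.⟦ q ⟧ ≈ (ιc c0 + x * (ιc c1 + x * (x * 1#))) + τ * ((ιc b0 + x * ιc b1) + τ * (ιc a0 + x * ιc a1))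
    ev-q = +-cong evX-C (*-congˡ (+-cong (trans (evX.⟦⟧-cong B≋) (evX-linear b0 b1))
     (*-congˡ (trans (+-congˡ (zeroʳ τ)) (trans (+-identityʳ _) (trans (evX.⟦⟧-cong A≋) (evX-linear a0 a1)))))))

    ι-w : ι.⟦ w ⟧ ≈ ι.⟦ e ⟧ * (ι.⟦ e ⟧ * ι.⟦ e ⟧) * (y * y)
    ι-w = begin
     ι.⟦ w ⟧ ≈⟨ trans (ι.+-homo (p P.✶ (p P.✶ p)) (α₄ P.✶ (p P.✶ (e P.✶ e)) P.⊹ α₆ P.✶ (e P.✶ (e P.✶ e))))
             (+-cong (cube p p p) (trans (ι.+-homo (α₄ P.✶ (p P.✶ (e P.✶ e))) (α₆ P.✶ (e P.✶ (e P.✶ e))))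
              (+-cong (trans (ι.*-homo α₄ (p P.✶ (e P.✶ e))) (*-congˡ (cube p e e))) (trans (ι.*-homo α₆ (e P.✶ (e P.✶ e))) (*-congˡ (cube e e e)))))) ⟩
     ι.⟦ p ⟧ * (ι.⟦ p ⟧ * ι.⟦ p ⟧) + (ι.⟦ α₄ ⟧ * (ι.⟦ p ⟧ * (ι.⟦ e ⟧ * ι.⟦ e ⟧)) + ι.⟦ α₆ ⟧ * (ι.⟦ e ⟧ * (ι.⟦ e ⟧ * ι.⟦ e ⟧)))
      ≈⟨ +-cong (*-cong p≈ (*-cong p≈ p≈)) (+-cong (*-cong (ι-quadratic c1 b1 a1) (*-congʳ p≈)) (*-congʳ (ι-quadratic c0 b0 a0))) ⟩
     x * ε * (x * ε * (x * ε)) + ((ιc c1 + τ * (ιc b1 + τ * ιc a1)) * (x * ε * (ε * ε)) + (ιc c0 + τ * (ιc b0 + τ * ιc a0)) * (ε * (ε * ε)))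
      ≈⟨ S.solve 9 (λ x e t c0 c1 b0 b1 a0 a1 →
         x :* e :* (x :* e :* (x :* e)) :+ ((c1 :+ t :* (b1 :+ t :* a1)) :* (x :* e :* (e :* e)) :+ (c0 :+ t :* (b0 :+ t :* a0)) :* (e :* (e :* e)))
         := e :* (e :* e) :* ((c0 :+ x :* (c1 :+ x :* (x :* :1))) :+ t :* ((b0 :+ x :* b1) :+ t :* (a0 :+ x :* a1)))) x ε τ (ιc c0) (ιc c1) (ιc b0) (ιc b1) (ιc a0) (ιc a1) ⟩
     ε * (ε * ε) * ((ιc c0 + x * (ιc c1 + x * (x * 1#))) + τ * ((ιc b0 + x * ιc b1) + τ * (ιc a0 + x * ιc a1)))
      ≈⟨ *-congˡ (trans y²≈q ev-q) ⟨
     ε * (ε * ε) * (y * y) ∎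
     where
     ε : Carrier
     ε = ι.⟦ e ⟧
     p≈ : ι.⟦ p ⟧ ≈ x * ε
     p≈ = sym xe≈p
     cube : ∀ f g h → ι.⟦ f P.✶ (g P.✶ h) ⟧ ≈ ι.⟦ f ⟧ * (ι.⟦ g ⟧ * ι.⟦ h ⟧)
     cube f g h = trans (ι.*-homo f (g P.✶ h)) (*-congˡ (ι.*-homo g h))

    r²e³≋s²w : r P.✶ r P.✶ (e P.✶ (e P.✶ e)) P.≋ s P.✶ s P.✶ w
    r²e³≋s²w = GroupProperties.x∙y⁻¹≈ε⇒x≈y (CommutativeRing.+-group P.polynomialRing) _ _
     (ι-injective (r P.✶ r P.✶ (e P.✶ (e P.✶ e)) P.⊹ P.⊟ (s P.✶ s P.✶ w)) (begin
     ι.⟦ r P.✶ r P.✶ (e P.✶ (e P.✶ e)) P.⊹ P.⊟ (s P.✶ s P.✶ w) ⟧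
      ≈⟨ trans (ι.sub-homo (r P.✶ r P.✶ (e P.✶ (e P.✶ e))) (s P.✶ s P.✶ w)) (+-cong
         (trans (ι.*-homo (r P.✶ r) (e P.✶ (e P.✶ e))) (*-cong (ι.*-homo r r) (trans (ι.*-homo e (e P.✶ e)) (*-congˡ (ι.*-homo e e)))))
         (-‿cong (trans (ι.*-homo (s P.✶ s) w) (*-cong (ι.*-homo s s) ι-w)))) ⟩
     ι.⟦ r ⟧ * ι.⟦ r ⟧ * (ι.⟦ e ⟧ * (ι.⟦ e ⟧ * ι.⟦ e ⟧)) - ι.⟦ s ⟧ * ι.⟦ s ⟧ * (ι.⟦ e ⟧ * (ι.⟦ e ⟧ * ι.⟦ e ⟧) * (y * y))
      ≈⟨ +-congʳ (*-congʳ (*-cong (sym ys≈r) (sym ys≈r))) ⟩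
     y * ι.⟦ s ⟧ * (y * ι.⟦ s ⟧) * (ι.⟦ e ⟧ * (ι.⟦ e ⟧ * ι.⟦ e ⟧)) - ι.⟦ s ⟧ * ι.⟦ s ⟧ * (ι.⟦ e ⟧ * (ι.⟦ e ⟧ * ι.⟦ e ⟧) * (y * y))
      ≈⟨ S.solve 3 (λ y s e → y :* s :* (y :* s) :* (e :* (e :* e)) :- s :* s :* (e :* (e :* e) :* (y :* y)) := :0) y ι.⟦ s ⟧ ι.⟦ e ⟧ ⟩
     0# ∎))

    coprime-ew : P.Coprime w e
    -- The cube of u p + v e = 1 is expanded: its part free of e is u³ p³, which agrees with u³ w up
    -- to multiples of e.
    coprime-ew = u P.✶ (u P.✶ u) , g , P.≋-trans
     (U.solve 6 (λ u v p e α₄ α₆ →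
      let
       w = p :* (p :* p) :+ (α₄ :* (p :* (e :* e)) :+ α₆ :* (e :* (e :* e)))
       o = u :* p :+ v :* e
       z = v :* (u :* p :* (u :* p) :+ u :* p :* o :+ o :* o)
         :- u :* (u :* u) :* (α₄ :* (p :* e) :+ α₆ :* (e :* e))
      in u :* (u :* u) :* w :+ z :* e := o :* (o :* o)) u v p e α₄ α₆)
     (P.≋-trans (P.✶-cong coprime′ (P.✶-cong coprime′ coprime′)) (P.≋-trans (P.✶-identityˡ _) (P.✶-identityˡ P.one)))
     where
     u v g : P.Poly
     u = proj₁ coprime
     v = proj₁ (proj₂ coprime)
     coprime′ : u P.✶ p P.⊹ v P.✶ e P.≋ P.one
     coprime′ = proj₂ (proj₂ coprime)
     o : P.Poly
     o = u P.✶ p P.⊹ v P.✶ e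
     g = v P.✶ (u P.✶ p P.✶ (u P.✶ p) P.⊹ u P.✶ p P.✶ o P.⊹ o P.✶ o)
        P.⊹ P.⊟ (u P.✶ (u P.✶ u) P.✶ (α₄ P.✶ (p P.✶ e) P.⊹ α₆ P.✶ (e P.✶ e)))

    -- From r² e³ = s² w follows (s w)² = e w (r e)², and a fraction whose square is a polynomial is
    -- a polynomial.
    w≉0⇒square : ¬ (w P.≋ []) → Σ[ Q ∈ P.Poly ] Q P.✶ Q P.≋ e P.✶ w
    w≉0⇒square w≉0 = P.square-root {s P.✶ w} {r P.✶ e} {e P.✶ w} re≉0 (P.≋-trans
      (U.solve 2 (λ s w → (s :* w) :* (s :* w) := (s :* s :* w) :* w) s w)
      (P.≋-trans (P.✶-congʳ (s P.✶ s P.✶ w) (r P.✶ r P.✶ (e P.✶ (e P.✶ e))) (P.≋-sym r²e³≋s²w))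
      (U.solve 3 (λ r e w → r :* r :* (e :* (e :* e)) :* w := e :* w :* ((r :* e) :* (r :* e))) r e w)))
     where
     r≉0 : ¬ (r P.≋ [])
     r≉0 z = D1.*-≉0 {s P.✶ s} {w} (D1.*-≉0 {s} {s} s≉0 s≉0) w≉0 (P.≋-trans (P.≋-sym r²e³≋s²w)
      (P.✶-zeroˡ (r P.✶ r) (e P.✶ (e P.✶ e)) (P.✶-zeroˡ r r z)))
     re≉0 : ¬ (r P.✶ e P.≋ [])
     re≉0 = D1.*-≉0 {r} {e} r≉0 e≉0

   even-degree : Σ[ m ∈ ℕ ] n ≡ m N.+ m
   even-degree = [ (λ even → even) , (λ odd → ⊥-elim (contradiction (proj₁ odd) (proj₂ odd) (proj₁ even-i) (proj₂ even-i) (K.zero? (P.coeff e n)))) ]′ (parity n)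
    where
    open SquareProducts
    e-degree : Σ[ n ∈ ℕ ] Σ[ a ∈ 𝕂 ] ¬ (a K.≈ K.0#) × P.Top e n a
    e-degree = degree-of e≉0
    i : ℕ
    i = proj₁ e-degree
    b : 𝕂
    b = proj₁ (proj₂ e-degree)
    b≉0 : ¬ (b K.≈ K.0#)
    b≉0 = proj₁ (proj₂ (proj₂ e-degree))
    te : P.Top e i b
    te = proj₂ (proj₂ (proj₂ e-degree))
    even-i : Σ[ j ∈ ℕ ] i ≡ j N.+ j
    even-i = even-degree-factor {e} {w} e≉0 coprime-ew w≉0⇒square b≉0 te
    3N : ∀ m → suc (m N.+ m) N.+ (suc (m N.+ m) N.+ suc (m N.+ m)) ≡ suc ((m N.+ m N.+ m N.+ 1) N.+ (m N.+ m N.+ m N.+ 1))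
    3N = NS.solve 1 (λ m → let N = NS.con 1 NS.:+ (m NS.:+ m) in N NS.:+ (N NS.:+ N)
        NS.:= NS.con 1 NS.:+ ((m NS.:+ m NS.:+ m NS.:+ NS.con 1) NS.:+ (m NS.:+ m NS.:+ m NS.:+ NS.con 1))) ≡.refl
    halve : ∀ {j m} → j N.+ j N.≤ m N.+ m → j N.≤ m
    halve {j} {m} 2j≤2m = N.≮⇒≥ λ m<j → N.<⇒≱ (N.+-mono-< m<j m<j) 2j≤2m
    i≢n : P.coeff e n K.≈ K.0# → i ≢ n
    i≢n eₙ≈0 i≡n = b≉0 (K.trans (K.sym (P.lead te)) (≡.subst (λ k → P.coeff e k K.≈ K.0#) (≡.sym i≡n) eₙ≈0))
    contradiction : ∀ m → n ≡ suc (m N.+ m) → ∀ j → i ≡ j N.+ j → Dec (P.coeff e n K.≈ K.0#) → ⊥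
    contradiction m n≡ j i≡ (no eₙ≉0) = even≢odd j m (≡.trans (≡.sym i≡) (≡.trans (P.Top-unique b≉0 eₙ≉0 te (P.top e⊏ K.refl)) n≡))
    contradiction m n≡ j i≡ (yes eₙ≈0) = square-product-degree {e} {w} {proj₁ square} {j} {m N.+ m N.+ m N.+ 1} z≉0
     (≡.subst (λ k → P.Top w k z) (3N m) (proj₂ (proj₂ top-w))) b≉0 te′ (proj₂ square)
     where
     te′ : P.Top e (j N.+ j) b
     te′ = ≡.subst (λ k → P.Top e k b) i≡ te
     i<n : i N.< n
     i<n = N.≤∧≢⇒< (N.s≤s⁻¹ (P.Top-< {e} b≉0 te e⊏)) (i≢n eₙ≈0)
     top-w : Σ[ z ∈ 𝕂 ] ¬ (z K.≈ K.0#) × P.Top w (suc (m N.+ m) N.+ (suc (m N.+ m) N.+ suc (m N.+ m))) z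
     top-w = cubic-top {p} {e} {α₄} {α₆} m j {P.coeff p n} (P.top (P.⊏-length α₄) K.refl) (P.top (P.⊏-length α₆) K.refl) nonSquare (λ z → degree-n z eₙ≈0) b≉0 (≡.subst (λ k → P.Top p k (P.coeff p n)) n≡ (P.top p⊏ K.refl)) te′
      (halve (N.s≤s⁻¹ (≡.subst₂ N._<_ i≡ n≡ i<n)))
     z : 𝕂
     z = proj₁ top-w
     z≉0 : ¬ (z K.≈ K.0#)
     z≉0 = proj₁ (proj₂ top-w)
     square : Σ[ Q ∈ P.Poly ] Q P.✶ Q P.≋ e P.✶ w
     square = w≉0⇒square (P.Top-≉0 z≉0 (proj₂ (proj₂ top-w)))

-- Finite sums, indicators and incidences

∑ : ∀ {a} {A : Set a} → List A → (A → ℕ) → ℕ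
∑ [] f = 0
∑ (x ∷ xs) f = f x N.+ ∑ xs f

module _ {a} {A : Set a} where

 ∑-cong : ∀ (xs : List A) {f g} → (∀ x → f x ≡ g x) → ∑ xs f ≡ ∑ xs g
 ∑-cong [] e = ≡.refl
 ∑-cong (x ∷ xs) e = ≡.cong₂ N._+_ (e x) (∑-cong xs e)

 ∑-mono : ∀ (xs : List A) {f g} → (∀ x → f x N.≤ g x) → ∑ xs f N.≤ ∑ xs g
 ∑-mono [] e = z≤n
 ∑-mono (x ∷ xs) e = N.+-mono-≤ (e x) (∑-mono xs e)

 ∑-+ : ∀ (xs : List A) f g → ∑ xs (λ x → f x N.+ g x) ≡ ∑ xs f N.+ ∑ xs g
 ∑-+ [] f g = ≡.refl
 ∑-+ (x ∷ xs) f g = ≡.trans (≡.cong (f x N.+ g x N.+_) (∑-+ xs f g))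
  (NS.solve 4 (λ a b c d → a NS.:+ b NS.:+ (c NS.:+ d) NS.:= a NS.:+ c NS.:+ (b NS.:+ d)) ≡.refl (f x) (g x) (∑ xs f) (∑ xs g))

 ∑-*ˡ : ∀ (xs : List A) k f → ∑ xs (λ x → k N.* f x) ≡ k N.* ∑ xs f
 ∑-*ˡ [] k f = ≡.sym (N.*-zeroʳ k)
 ∑-*ˡ (x ∷ xs) k f = ≡.trans (≡.cong (k N.* f x N.+_) (∑-*ˡ xs k f)) (≡.sym (N.*-distribˡ-+ k (f x) (∑ xs f)))

 ∑-*ʳ : ∀ (xs : List A) k f → ∑ xs (λ x → f x N.* k) ≡ ∑ xs f N.* k
 ∑-*ʳ xs k f = ≡.trans (∑-cong xs λ x → N.*-comm (f x) k) (≡.trans (∑-*ˡ xs k f) (N.*-comm k (∑ xs f)))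

 ∑-const : ∀ (xs : List A) k → ∑ xs (λ _ → k) ≡ length xs N.* k
 ∑-const [] k = ≡.refl
 ∑-const (x ∷ xs) k = ≡.cong (k N.+_) (∑-const xs k)

 ∑-0 : ∀ (xs : List A) → ∑ xs (λ _ → 0) ≡ 0
 ∑-0 xs = ≡.trans (∑-const xs 0) (N.*-zeroʳ (length xs))

 ∑-++ : ∀ (xs ys : List A) f → ∑ (xs ++ ys) f ≡ ∑ xs f N.+ ∑ ys f
 ∑-++ [] ys f = ≡.refl
 ∑-++ (x ∷ xs) ys f = ≡.trans (≡.cong (f x N.+_) (∑-++ xs ys f)) (≡.sym (N.+-assoc (f x) _ _))

 ∑-map : ∀ {b} {B : Set b} (h : B → A) ys f → ∑ (map h ys) f ≡ ∑ ys (λ y → f (h y))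
 ∑-map h [] f = ≡.refl
 ∑-map h (y ∷ ys) f = ≡.cong (f (h y) N.+_) (∑-map h ys f)

 ∑≢0 : ∀ (xs : List A) f → ∑ xs f ≢ 0 → Σ[ x ∈ A ] f x ≢ 0
 ∑≢0 [] f ne = ⊥-elim (ne ≡.refl)
 ∑≢0 (x ∷ xs) f ne with f x N.≟ 0
 ... | no fx≢0 = x , fx≢0
 ... | yes fx≡0 = ∑≢0 xs f λ e → ne (≡.cong₂ N._+_ fx≡0 e)

∑-swap : ∀ {a b} {A : Set a} {B : Set b} (xs : List A) (ys : List B) (f : A → B → ℕ) →
     ∑ xs (λ x → ∑ ys (f x)) ≡ ∑ ys (λ y → ∑ xs (λ x → f x y))
∑-swap [] ys f = ≡.sym (∑-0 ys)
∑-swap (x ∷ xs) ys f = ≡.trans (≡.cong (∑ ys (f x) N.+_) (∑-swap xs ys f)) (≡.sym (∑-+ ys (f x) _))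

pairs : ∀ {a b} {A : Set a} {B : Set b} → List A → List B → List (A × B)
pairs [] ys = []
pairs (x ∷ xs) ys = map (x ,_) ys ++ pairs xs ys

∑-pairs : ∀ {a b} {A : Set a} {B : Set b} (xs : List A) (ys : List B) (f : A × B → ℕ) →
     ∑ (pairs xs ys) f ≡ ∑ xs (λ x → ∑ ys (λ y → f (x , y)))
∑-pairs [] ys f = ≡.refl
∑-pairs (x ∷ xs) ys f = ≡.trans (∑-++ (map (x ,_) ys) (pairs xs ys) f) (≡.cong₂ N._+_ (∑-map (x ,_) ys f) (∑-pairs xs ys f))

∑ⱽ : ∀ {a} {A : Set a} {m} → Vec (List A) m → (Vec A m → ℕ) → ℕ
∑ⱽ [] f = f []
∑ⱽ (xs ∷ xss) f = ∑ xs (λ x → ∑ⱽ xss (λ v → f (x ∷ v)))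

𝟙 : ∀ {p} {P : Set p} → Dec P → ℕ
𝟙 (yes _) = 1
𝟙 (no _) = 0

module _ {p q} {P : Set p} {Q : Set q} where

 𝟙-⇒ : (d : Dec P) (e : Dec Q) → (P → Q) → 𝟙 d N.≤ 𝟙 e
 𝟙-⇒ (no _) e f = z≤n
 𝟙-⇒ (yes p) (yes _) f = N.≤-refl
 𝟙-⇒ (yes p) (no ¬q) f = ⊥-elim (¬q (f p))

 𝟙-⇔ : (d : Dec P) (e : Dec Q) → (P → Q) → (Q → P) → 𝟙 d ≡ 𝟙 e
 𝟙-⇔ (no _) (no _) f g = ≡.refl
 𝟙-⇔ (yes p) (yes _) f g = ≡.refl
 𝟙-⇔ (yes p) (no ¬q) f g = ⊥-elim (¬q (f p))
 𝟙-⇔ (no ¬p) (yes q) f g = ⊥-elim (¬p (g q))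

module _ {p} {P : Set p} where

 𝟙-yes : (d : Dec P) → P → 𝟙 d ≡ 1
 𝟙-yes (yes _) p = ≡.refl
 𝟙-yes (no ¬p) p = ⊥-elim (¬p p)

 𝟙-no : (d : Dec P) → ¬ P → 𝟙 d ≡ 0
 𝟙-no (yes p) ¬p = ⊥-elim (¬p p)
 𝟙-no (no _) ¬p = ≡.refl

 𝟙≤1 : (d : Dec P) → 𝟙 d N.≤ 1
 𝟙≤1 (yes _) = N.≤-refl
 𝟙≤1 (no _) = z≤n

 𝟙≢0 : (d : Dec P) → 𝟙 d ≢ 0 → P
 𝟙≢0 (yes p) _ = p
 𝟙≢0 (no _) ne = ⊥-elim (ne ≡.refl)

-- Every residue class has exactly one representative in elements.

record FiniteRing : Set₁ where
 field commutativeRing : CommutativeRing 0ℓ 0ℓ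
 open CommutativeRing commutativeRing public
 field
  _≟_ : Decidable _≈_
  elements : List Carrier
  unique-representative : ∀ c → ∑ elements (λ x → 𝟙 (x ≟ c)) ≡ 1

module FiniteSums (R : FiniteRing) where

 open FiniteRing R hiding (zero)
 open IntegerSolver commutativeRing
 private module ≈R = SetoidReasoning setoid

 size : ℕ
 size = length elements

 Respects : (Carrier → ℕ) → Set
 Respects f = ∀ {x y} → x ≈ y → f x ≡ f y

 ∑-select : ∀ {f} → Respects f → ∀ c → ∑ elements (λ x → 𝟙 (x ≟ c) N.* f x) ≡ f c
 ∑-select {f} resp c = begin
  ∑ elements (λ x → 𝟙 (x ≟ c) N.* f x) ≡⟨ ∑-cong elements (λ x → replace (x ≟ c)) ⟩
  ∑ elements (λ x → 𝟙 (x ≟ c) N.* f c) ≡⟨ ∑-*ʳ elements (f c) (λ x → 𝟙 (x ≟ c)) ⟩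
  ∑ elements (λ x → 𝟙 (x ≟ c)) N.* f c ≡⟨ ≡.cong (N._* f c) (unique-representative c) ⟩
  1 N.* f c ≡⟨ N.*-identityˡ (f c) ⟩
  f c ∎
  where
  open ≡.≡-Reasoning
  replace : ∀ {x} (d : Dec (x ≈ c)) → 𝟙 d N.* f x ≡ 𝟙 d N.* f c
  replace (yes e) = ≡.cong (1 N.*_) (resp e)
  replace (no _) = ≡.refl

 -- The value u x + w need not be a chosen representative, so the list is not simply permuted.
 -- Instead the value of f is written as a sum over all representatives t of the indicator of t = u
 -- x + w, and the two sums are exchanged.
 ∑-reindex : ∀ {f} → Respects f → ∀ {u v} → v * u ≈ 1# → ∀ w → ∑ elements (λ x → f (u * x + w)) ≡ ∑ elements f
 ∑-reindex {f} resp {u} {v} vu≈1 w = begin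
  ∑ elements (λ x → f (u * x + w))
   ≡⟨ ∑-cong elements (λ x → ≡.sym (∑-select resp (u * x + w))) ⟩
  ∑ elements (λ x → ∑ elements (λ t → 𝟙 (t ≟ (u * x + w)) N.* f t))
   ≡⟨ ∑-swap elements elements (λ x t → 𝟙 (t ≟ (u * x + w)) N.* f t) ⟩
  ∑ elements (λ t → ∑ elements (λ x → 𝟙 (t ≟ (u * x + w)) N.* f t))
   ≡⟨ ∑-cong elements (λ t → begin
    ∑ elements (λ x → 𝟙 (t ≟ (u * x + w)) N.* f t) ≡⟨ ∑-*ʳ elements (f t) (λ x → 𝟙 (t ≟ (u * x + w))) ⟩
    ∑ elements (λ x → 𝟙 (t ≟ (u * x + w))) N.* f t
     ≡⟨ ≡.cong (N._* f t) (∑-cong elements λ x → 𝟙-⇔ (t ≟ (u * x + w)) (x ≟ (v * (t - w))) (to x t) (from x t)) ⟩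
    ∑ elements (λ x → 𝟙 (x ≟ (v * (t - w)))) N.* f t ≡⟨ ≡.cong (N._* f t) (unique-representative (v * (t - w))) ⟩
    1 N.* f t ≡⟨ N.*-identityˡ (f t) ⟩
    f t ∎) ⟩
  ∑ elements f ∎
  where
  open ≡.≡-Reasoning
  to : ∀ x t → t ≈ u * x + w → x ≈ v * (t - w)
  to x t e = ≈R.begin
   x ≈R.≈⟨ *-identityˡ x ⟨
   1# * x ≈R.≈⟨ *-congʳ vu≈1 ⟨
   v * u * x ≈R.≈⟨ solve 4 (λ u v x w → v :* u :* x := v :* (u :* x :+ w :- w)) u v x w ⟩
   v * (u * x + w - w) ≈R.≈⟨ *-congˡ (+-congʳ e) ⟨
   v * (t - w) ≈R.∎
  from : ∀ x t → x ≈ v * (t - w) → t ≈ u * x + w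
  from x t e = ≈R.begin
   t ≈R.≈⟨ solve 2 (λ t w → t := :1 :* (t :- w) :+ w) t w ⟩
   1# * (t - w) + w ≈R.≈⟨ +-congʳ (*-congʳ vu≈1) ⟨
   v * u * (t - w) + w ≈R.≈⟨ +-congʳ (solve 3 (λ u v z → v :* u :* z := u :* (v :* z)) u v (t - w)) ⟩
   u * (v * (t - w)) + w ≈R.≈⟨ +-congʳ (*-congˡ e) ⟨
   u * x + w ≈R.∎

 ∑-translate : ∀ {f} → Respects f → ∀ w → ∑ elements (λ x → f (x + w)) ≡ ∑ elements f
 ∑-translate resp w = ≡.trans (∑-cong elements λ x → resp (+-congʳ (sym (*-identityˡ x)))) (∑-reindex resp (*-identityˡ 1#) w)

 ∑-≥ : ∀ {f} → Respects f → ∀ c → f c N.≤ ∑ elements f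
 ∑-≥ {f} resp c = ≡.subst (N._≤ ∑ elements f) (∑-select resp c)
  (∑-mono elements λ x → N.≤-trans (N.*-monoˡ-≤ (f x) (𝟙≤1 (x ≟ c))) (N.≤-reflexive (N.*-identityˡ (f x))))

-- Counting the lines y = k1 X + k0 that miss n given points: each line meets at most
-- n of them, and a pair of points lies on exactly one line, so the first two moments of
-- the number of incidences are known.

module Incidences {a b} {A : Set a} {B : Set b} (points : List A) (lines : List B) (I : A → B → ℕ) where

 count : B → ℕ
 count k = ∑ points (λ x → I x k)

 missed : ℕ
 missed = ∑ lines (λ k → 𝟙 (count k N.≟ 0))

 private
  -- For N = 0 both sides are equal, and for 1 ≤ N ≤ n the inequality is (N - 1) (n - N) ≥ 0.
  pointwise : ∀ n N → N N.≤ n → N N.* N N.+ n N.≤ n N.* 𝟙 (N N.≟ 0) N.+ suc n N.* N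
  pointwise n zero _ = N.≤-reflexive (NS.solve 1 (λ n → n NS.:= n NS.:* NS.con 1 NS.:+ (NS.con 1 NS.:+ n) NS.:* NS.con 0) ≡.refl n)
  pointwise n (suc N) N<n = begin
   suc N N.* suc N N.+ n ≡⟨ NS.solve 2 (λ N n → (NS.con 1 NS.:+ N) NS.:* (NS.con 1 NS.:+ N) NS.:+ n
                      NS.:= N NS.:* (NS.con 1 NS.:+ N) NS.:+ (NS.con 1 NS.:+ N NS.:+ n)) ≡.refl N n ⟩
   N N.* suc N N.+ (suc N N.+ n) ≤⟨ N.+-monoˡ-≤ (suc N N.+ n) (N.*-monoʳ-≤ N N<n) ⟩
   N N.* n N.+ (suc N N.+ n) ≡⟨ NS.solve 2 (λ N n → N NS.:* n NS.:+ (NS.con 1 NS.:+ N NS.:+ n)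
                      NS.:= n NS.:* NS.con 0 NS.:+ (NS.con 1 NS.:+ n) NS.:* (NS.con 1 NS.:+ N)) ≡.refl N n ⟩
   n N.* 0 N.+ suc n N.* suc N ∎
   where open N.≤-Reasoning

  second-moment : ∑ lines (λ k → count k N.* count k) ≡ ∑ points (λ x → ∑ points (λ y → ∑ lines (λ k → I x k N.* I y k)))
  second-moment = begin
   ∑ lines (λ k → count k N.* count k)
    ≡⟨ ∑-cong lines (λ k → ≡.trans (≡.sym (∑-*ʳ points (count k) (λ x → I x k)))
       (∑-cong points λ x → ≡.sym (∑-*ˡ points (I x k) (λ y → I y k)))) ⟩
   ∑ lines (λ k → ∑ points (λ x → ∑ points (λ y → I x k N.* I y k)))
    ≡⟨ ∑-swap lines points (λ k x → ∑ points (λ y → I x k N.* I y k)) ⟩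
   ∑ points (λ x → ∑ lines (λ k → ∑ points (λ y → I x k N.* I y k)))
    ≡⟨ ∑-cong points (λ x → ∑-swap lines points (λ k y → I x k N.* I y k)) ⟩
   ∑ points (λ x → ∑ points (λ y → ∑ lines (λ k → I x k N.* I y k))) ∎
   where open ≡.≡-Reasoning

 -- The inequality `pointwise` is summed over all lines. The bound on joint incidences counts s
 -- lines for each of the X pairs of equal points and one line for each of the X² - X other pairs.
 -- Beyond X² - X there remains n s (s - X), which is nonnegative.
 many-missed : ∀ n s X → (∀ k → count k N.≤ n) → X N.≤ s → length lines ≡ s N.* s →
  ∑ points (λ x → ∑ lines (I x)) ≡ X N.* s →
  X N.* (s N.+ X) N.≤ ∑ points (λ x → ∑ points (λ y → ∑ lines (λ k → I x k N.* I y k))) N.+ X →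
  X N.* X N.≤ n N.* missed N.+ X
 many-missed n s X count≤n X≤s lines≡ first second =
  N.+-cancelʳ-≤ (n N.* (s N.* s) N.+ suc n N.* (X N.* s)) (X N.* X) (n N.* missed N.+ X) (begin
   X N.* X N.+ (n N.* (s N.* s) N.+ suc n N.* (X N.* s))
    ≡⟨ NS.solve 3 (λ X n s → X NS.:* X NS.:+ (n NS.:* (s NS.:* s) NS.:+ (NS.con 1 NS.:+ n) NS.:* (X NS.:* s))
       NS.:= X NS.:* (s NS.:+ X) NS.:+ n NS.:* (s NS.:* s) NS.:+ n NS.:* (X NS.:* s)) ≡.refl X n s ⟩
   X N.* (s N.+ X) N.+ n N.* (s N.* s) N.+ n N.* (X N.* s)
    ≤⟨ N.+-mono-≤ (N.+-monoˡ-≤ (n N.* (s N.* s)) second) (N.*-monoʳ-≤ n (N.*-monoˡ-≤ s X≤s)) ⟩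
   S2 N.+ X N.+ n N.* (s N.* s) N.+ n N.* (s N.* s)
    ≡⟨ NS.solve 3 (λ S X m → S NS.:+ X NS.:+ m NS.:+ m NS.:= S NS.:+ m NS.:+ (X NS.:+ m)) ≡.refl S2 X (n N.* (s N.* s)) ⟩
   S2 N.+ n N.* (s N.* s) N.+ (X N.+ n N.* (s N.* s)) ≤⟨ N.+-monoˡ-≤ _ moments ⟩
   n N.* missed N.+ suc n N.* (X N.* s) N.+ (X N.+ n N.* (s N.* s))
    ≡⟨ NS.solve 4 (λ r t X m → r NS.:+ t NS.:+ (X NS.:+ m) NS.:= r NS.:+ X NS.:+ (m NS.:+ t)) ≡.refl
       (n N.* missed) (suc n N.* (X N.* s)) X (n N.* (s N.* s)) ⟩
   n N.* missed N.+ X N.+ (n N.* (s N.* s) N.+ suc n N.* (X N.* s)) ∎)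
  where
  open N.≤-Reasoning
  S2 : ℕ
  S2 = ∑ points (λ x → ∑ points (λ y → ∑ lines (λ k → I x k N.* I y k)))
  moments : S2 N.+ n N.* (s N.* s) N.≤ n N.* missed N.+ suc n N.* (X N.* s)
  moments = begin
   S2 N.+ n N.* (s N.* s)
    ≡⟨ ≡.cong₂ N._+_ (≡.sym second-moment) (≡.trans (N.*-comm n (s N.* s)) (≡.trans (≡.cong (N._* n) (≡.sym lines≡)) (≡.sym (∑-const lines n)))) ⟩
   ∑ lines (λ k → count k N.* count k) N.+ ∑ lines (λ _ → n) ≡⟨ ∑-+ lines (λ k → count k N.* count k) (λ _ → n) ⟨
   ∑ lines (λ k → count k N.* count k N.+ n) ≤⟨ ∑-mono lines (λ k → pointwise n (count k) (count≤n k)) ⟩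
   ∑ lines (λ k → n N.* 𝟙 (count k N.≟ 0) N.+ suc n N.* count k)
    ≡⟨ ∑-+ lines (λ k → n N.* 𝟙 (count k N.≟ 0)) (λ k → suc n N.* count k) ⟩
   ∑ lines (λ k → n N.* 𝟙 (count k N.≟ 0)) N.+ ∑ lines (λ k → suc n N.* count k)
    ≡⟨ ≡.cong₂ N._+_ (∑-*ˡ lines n _) (≡.trans (∑-*ˡ lines (suc n) count)
       (≡.cong (suc n N.*_) (≡.trans (∑-swap lines points (λ k x → I x k)) first))) ⟩
   n N.* missed N.+ suc n N.* (X N.* s) ∎

-- Polynomials without roots over a finite field

module FiniteFieldSums (F : DiscreteField 0ℓ 0ℓ) (elements : List (DiscreteField.Carrier F))
 (unique-representative : ∀ a → ∑ elements (λ x → 𝟙 (DiscreteField._≟_ F x a)) ≡ 1) where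

 open DiscreteField F hiding (zero; inverse)
 private
  inv = DiscreteField.inverse F
 open FieldPolynomials F hiding (∣-refl; ∣-trans; divides; quotient)
 open IntegerSolver commutativeRing using (solve)
 open DomainProperties domain using (*-≉0; cancel-≈0; square-≈0)
 open GroupProperties +-group using (x∙y⁻¹≈ε⇒x≈y)
 private module ≈R = SetoidReasoning setoid

 finiteRing : FiniteRing
 finiteRing = record { commutativeRing = commutativeRing ; _≟_ = _≟_ ; elements = elements ; unique-representative = unique-representative }

 open FiniteSums finiteRing public

 ∑ₑ : (Carrier → ℕ) → ℕ
 ∑ₑ = ∑ elements

 ν : Carrier → ℕ
 ν a = 𝟙 (¬? (zero? a))

 ν≤1 : ∀ a → ν a N.≤ 1
 ν≤1 a = 𝟙≤1 (¬? (zero? a))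

 ζ : Carrier → ℕ
 ζ a = 𝟙 (zero? a)

 ζ-cong : ∀ {a b} → a ≈ b → ζ a ≡ ζ b
 ζ-cong {a} {b} e = 𝟙-⇔ (zero? a) (zero? b) (trans (sym e)) (trans e)

 ν-cong : ∀ {a b} → a ≈ b → ν a ≡ ν b
 ν-cong {a} {b} e = 𝟙-⇔ (¬? (zero? a)) (¬? (zero? b)) (λ ne z → ne (trans e z)) (λ ne z → ne (trans (sym e) z))

 ζ-scale : ∀ {u a} → ¬ (u ≈ 0#) → ζ (u * a) ≡ ζ a
 ζ-scale {u} {a} u≉0 = 𝟙-⇔ (zero? (u * a)) (zero? a) (cancel-≈0 u u≉0) (λ z → trans (*-congˡ z) (zeroʳ u))

 ∑-affine-root : ∀ {u} → ¬ (u ≈ 0#) → ∀ w → ∑ₑ (λ x → ζ (u * x + w)) ≡ 1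
 ∑-affine-root {u} u≉0 w = ≡.trans (∑-reindex {ζ} ζ-cong (proj₂ (inv u≉0)) w)
  (≡.trans (∑-cong elements λ x → 𝟙-⇔ (zero? x) (x ≟ 0#) (λ z → z) (λ z → z)) (unique-representative 0#))

 count-≉ : ∀ c → suc (∑ₑ (λ x → 𝟙 (¬? (x ≟ c)))) ≡ size
 count-≉ c = begin
  1 N.+ ∑ₑ (λ x → 𝟙 (¬? (x ≟ c))) ≡⟨ ≡.cong (N._+ ∑ₑ (λ x → 𝟙 (¬? (x ≟ c)))) (unique-representative c) ⟨
  ∑ₑ (λ x → 𝟙 (x ≟ c)) N.+ ∑ₑ (λ x → 𝟙 (¬? (x ≟ c))) ≡⟨ ∑-+ elements _ _ ⟨
  ∑ₑ (λ x → 𝟙 (x ≟ c) N.+ 𝟙 (¬? (x ≟ c))) ≡⟨ ∑-cong elements (λ x → complement (x ≟ c)) ⟩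
  ∑ₑ (λ _ → 1) ≡⟨ ∑-const elements 1 ⟩
  size N.* 1 ≡⟨ N.*-identityʳ size ⟩
  size ∎
  where
  open ≡.≡-Reasoning
  complement : ∀ {p} {P : Set p} (d : Dec P) → 𝟙 d N.+ 𝟙 (¬? d) ≡ 1
  complement (yes _) = ≡.refl
  complement (no _) = ≡.refl

 roots : Poly → ℕ
 roots f = ∑ₑ (λ x → ζ (evaluate x f))

 roots-cong : ∀ {f g} → f ≋ g → roots f ≡ roots g
 roots-cong {f} {g} e = ∑-cong elements λ x → ζ-cong (RingHom.⟦⟧-cong (Evaluation.evalHom (identityHom commutativeRing) x) {f} {g} e)

 evaluate-point : ∀ f {x y} → x ≈ y → evaluate x f ≈ evaluate y f
 evaluate-point [] e = refl
 evaluate-point (a ∷ f) e = +-congˡ (*-cong e (evaluate-point f e))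

 rootless : Poly → ℕ
 rootless f = 𝟙 (roots f N.≟ 0)

 rootless-cong : ∀ {f g} → f ≋ g → rootless f ≡ rootless g
 rootless-cong {f} {g} e = ≡.cong (λ n → 𝟙 (n N.≟ 0)) (roots-cong {f} {g} e)

 rootless≤1 : ∀ f → rootless f N.≤ 1
 rootless≤1 f = 𝟙≤1 (roots f N.≟ 0)

 rootless⇒NoRoot : ∀ {f} → rootless f ≢ 0 → NoRoot f
 rootless⇒NoRoot {f} ne κ e = N.<⇒≱ (N.≤-trans (N.≤-reflexive (≡.sym (𝟙-yes (zero? (evaluate κ f)) e)))
  (∑-≥ {λ x → ζ (evaluate x f)} (λ x≈y → ζ-cong (evaluate-point f x≈y)) κ)) (N.≤-reflexive (𝟙≢0 (roots f N.≟ 0) ne))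

 roots≤degree : ∀ n f → f ⊏ suc n → ¬ (f ≋ []) → roots f N.≤ n
 roots≤degree n f f⊏ f≉0 = cases (roots f N.≟ 0)
  where
  module _ (r : Carrier) (fr≈0 : evaluate r f ≈ 0#) where
   open SyntheticDivision commutativeRing r
   fact : f ≋ X-κ ✶ quot f
   fact = factor f fr≈0
   quot≉0 : ¬ (quot f ≋ [])
   quot≉0 z = f≉0 (≋-trans fact (≋-trans (✶-congˡ X-κ z) (✶-zeroʳ X-κ)))
   pointwise : ∀ x → ζ (evaluate x f) N.≤ 𝟙 (x ≟ r) N.+ ζ (evaluate x (quot f))
   pointwise x = bound (zero? (evaluate x f)) (x ≟ r) (zero? (evaluate x (quot f)))
    where
    open RingHom (Evaluation.evalHom (identityHom commutativeRing) x)
    product : evaluate x f ≈ (x - r) * evaluate x (quot f)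
    product = trans (⟦⟧-cong fact) (trans (*-homo X-κ (quot f)) (*-congʳ (eval-X-κ x)))
    bound : (d : Dec (evaluate x f ≈ 0#)) (d′ : Dec (x ≈ r)) (d″ : Dec (evaluate x (quot f) ≈ 0#)) → 𝟙 d N.≤ 𝟙 d′ N.+ 𝟙 d″
    bound (no _) _ _ = z≤n
    bound (yes _) (yes _) _ = s≤s z≤n
    bound (yes _) (no _) (yes _) = s≤s z≤n
    bound (yes e) (no x≉r) (no q≉0) = ⊥-elim (*-≉0 (λ z → x≉r (x∙y⁻¹≈ε⇒x≈y x r z)) q≉0 (trans (sym product) e))
   total : roots f N.≤ 1 N.+ roots (quot f)
   total = N.≤-trans (∑-mono elements pointwise) (N.≤-reflexive (≡.trans (∑-+ elements _ _) (≡.cong (N._+ roots (quot f)) (unique-representative r))))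
   bounded : ∀ n → f ⊏ suc n → roots f N.≤ n
   bounded zero f⊏ = ⊥-elim (quot≉0 (⊏0⇒≋[] (quot-⊏ f 0 f⊏)))
   bounded (suc n) f⊏ = N.≤-trans total (s≤s (roots≤degree n (quot f) (quot-⊏ f (suc n) f⊏) quot≉0))
  cases : Dec (roots f ≡ 0) → roots f N.≤ n
  cases (yes e) = N.≤-trans (N.≤-reflexive e) z≤n
  cases (no ne) = bounded (proj₁ root) (𝟙≢0 (zero? (evaluate (proj₁ root) f)) (proj₂ root)) n f⊏
   where root = ∑≢0 elements (λ x → ζ (evaluate x f)) ne

 -- The values of x for which u x (k1 x + k0) + w x vanishes.

 module Lines (u w : Carrier → Carrier) (u-cong : ∀ {x y} → x ≈ y → u x ≈ u y) (w-cong : ∀ {x y} → x ≈ y → w x ≈ w y)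
  (u≈0⇒w≉0 : ∀ x → u x ≈ 0# → ¬ (w x ≈ 0#)) where

  -- Where u x ≠ 0, it vanishes exactly when the line with slope k1 and intercept k0 passes through
  -- the point (x , - w x / u x). Where u x = 0 it is w x, which the hypothesis keeps away from 0,
  -- so such x belong to no point.
  value : Carrier → Carrier × Carrier → Carrier
  value x (k1 , k0) = u x * (k1 * x + k0) + w x

  open Incidences elements (pairs elements elements) (λ x k → ζ (value x k))

  X : ℕ
  X = ∑ₑ (λ x → ν (u x))

  private
   lines-through : ∀ x (d : Dec (u x ≈ 0#)) → ∑ (pairs elements elements) (λ k → ζ (value x k)) ≡ 𝟙 (¬? d) N.* size
   lines-through x (yes u≈0) = ≡.trans (∑-cong (pairs elements elements) λ k → 𝟙-no (zero? (value x k))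
     (λ z → u≈0⇒w≉0 x u≈0 (trans (sym (trans (+-congʳ (trans (*-congʳ u≈0) (zeroˡ _))) (+-identityˡ _))) z))) (∑-0 (pairs elements elements))
   lines-through x (no u≉0) = begin
    ∑ (pairs elements elements) (λ k → ζ (value x k)) ≡⟨ ∑-pairs elements elements _ ⟩
    ∑ₑ (λ k1 → ∑ₑ (λ k0 → ζ (value x (k1 , k0))))
     ≡⟨ ∑-cong elements (λ k1 → ≡.trans (∑-cong elements λ k0 → ζ-cong
        (solve 5 (λ u k1 x k0 w → u :* (k1 :* x :+ k0) :+ w := u :* k0 :+ (u :* (k1 :* x) :+ w)) (u x) k1 x k0 (w x)))
        (∑-affine-root u≉0 (u x * (k1 * x) + w x))) ⟩
    ∑ₑ (λ _ → 1) ≡⟨ ∑-const elements 1 ⟩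
    size N.* 1 ≡⟨ N.*-comm size 1 ⟩
    1 N.* size ∎
    where open ≡.≡-Reasoning

   joint : Carrier → Carrier → ℕ
   joint x y = ∑ (pairs elements elements) (λ k → ζ (value x k) N.* ζ (value y k))

   value-cong : ∀ {x y} k → x ≈ y → value x k ≈ value y k
   value-cong (k1 , k0) e = +-cong (*-cong (u-cong e) (+-congʳ (*-congˡ e))) (w-cong e)

   joint-≈ : ∀ {x y} → y ≈ x → joint x y ≡ ν (u x) N.* size
   joint-≈ {x} {y} y≈x = ≡.trans (∑-cong (pairs elements elements) λ k → ≡.trans (≡.cong (ζ (value x k) N.*_) (ζ-cong (value-cong k y≈x))) (idempotent (zero? (value x k))))
    (lines-through x (zero? (u x)))
    where
    idempotent : ∀ {p} {P : Set p} (d : Dec P) → 𝟙 d N.* 𝟙 d ≡ 𝟙 d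
    idempotent (yes _) = ≡.refl
    idempotent (no _) = ≡.refl

   joint-≉ : ∀ {x y} → ¬ (y ≈ x) → ¬ (u x ≈ 0#) → ¬ (u y ≈ 0#) → 1 N.≤ joint x y
   joint-≉ {x} {y} y≉x ux≉0 uy≉0 = begin
    1 ≡⟨ ≡.cong₂ N._*_ (𝟙-yes (zero? (value x (k1 , k0))) on-x) (𝟙-yes (zero? (value y (k1 , k0))) on-y) ⟨
    ζ (value x (k1 , k0)) N.* ζ (value y (k1 , k0)) ≤⟨ ∑-≥ {f k1} (resp k1) k0 ⟩
    ∑ₑ (f k1) ≤⟨ ∑-≥ {λ k → ∑ₑ (f k)} (λ e → ∑-cong elements λ k0 → resp2 e refl) k1 ⟩
    ∑ₑ (λ k1 → ∑ₑ (f k1)) ≡⟨ ∑-pairs elements elements _ ⟨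
    joint x y ∎
    where
    open N.≤-Reasoning
    i j d p q k1 k0 : Carrier
    i = proj₁ (inv ux≉0)
    j = proj₁ (inv uy≉0)
    y-x≉0 : ¬ (y - x ≈ 0#)
    y-x≉0 z = y≉x (x∙y⁻¹≈ε⇒x≈y y x z)
    d = proj₁ (inv y-x≉0)
    p = - (i * w x)
    q = - (j * w y)
    -- The line through (x , p) and (y , q), where d inverts y - x.
    k1 = (q - p) * d
    k0 = p - k1 * x
    f : Carrier → Carrier → ℕ
    f k1 k0 = ζ (value x (k1 , k0)) N.* ζ (value y (k1 , k0))
    resp2 : ∀ {a b c d} → a ≈ b → c ≈ d → f a c ≡ f b d
    resp2 e e′ = ≡.cong₂ N._*_ (ζ-cong (+-congʳ (*-congˡ (+-cong (*-congʳ e) e′)))) (ζ-cong (+-congʳ (*-congˡ (+-cong (*-congʳ e) e′))))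
    resp : ∀ k1 {c d} → c ≈ d → f k1 c ≡ f k1 d
    resp k1 = resp2 refl
    on-x : value x (k1 , k0) ≈ 0#
    on-x = ≈R.begin
     u x * (k1 * x + (p - k1 * x)) + w x
      ≈R.≈⟨ solve 5 (λ u k x i w → u :* (k :* x :+ (:- (i :* w) :- k :* x)) :+ w := (:1 :- i :* u) :* w) (u x) k1 x i (w x) ⟩
     (1# - i * u x) * w x ≈R.≈⟨ *-congʳ (trans (+-congˡ (-‿cong (proj₂ (inv ux≉0)))) (-‿inverseʳ 1#)) ⟩
     0# * w x ≈R.≈⟨ zeroˡ _ ⟩
     0# ≈R.∎
    on-y : value y (k1 , k0) ≈ 0#
    on-y = ≈R.begin
     u y * (k1 * y + (p - k1 * x)) + w y
      ≈R.≈⟨ solve 7 (λ u w q p d x y → u :* ((q :- p) :* d :* y :+ (p :- (q :- p) :* d :* x)) :+ w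
          := u :* (p :+ (q :- p) :* (d :* (y :- x))) :+ w) (u y) (w y) q p d x y ⟩
     u y * (p + (q - p) * (d * (y - x))) + w y ≈R.≈⟨ +-congʳ (*-congˡ (+-congˡ (trans (*-congˡ (proj₂ (inv y-x≉0))) (*-identityʳ _)))) ⟩
     u y * (p + (q - p)) + w y ≈R.≈⟨ solve 4 (λ u w j p → u :* (p :+ (:- (j :* w) :- p)) :+ w := (:1 :- j :* u) :* w) (u y) (w y) j p ⟩
     (1# - j * u y) * w y ≈R.≈⟨ *-congʳ (trans (+-congˡ (-‿cong (proj₂ (inv uy≉0)))) (-‿inverseʳ 1#)) ⟩
     0# * w y ≈R.≈⟨ zeroˡ _ ⟩
     0# ≈R.∎

   joint-bound : ∀ x y → ν (u x) N.* (𝟙 (y ≟ x) N.* size N.+ ν (u y)) N.≤ joint x y N.+ ν (u x) N.* 𝟙 (y ≟ x)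
   joint-bound x y = cases (y ≟ x) (zero? (u x)) (zero? (u y))
    where
    cases : (d : Dec (y ≈ x)) (d′ : Dec (u x ≈ 0#)) (d″ : Dec (u y ≈ 0#)) →
        𝟙 (¬? d′) N.* (𝟙 d N.* size N.+ 𝟙 (¬? d″)) N.≤ joint x y N.+ 𝟙 (¬? d′) N.* 𝟙 d
    cases d (yes _) d″ = z≤n
    cases (no y≉x) (no x≉0) (yes _) = z≤n
    cases (no y≉x) (no x≉0) (no y≉0) = N.≤-trans (joint-≉ y≉x x≉0 y≉0) (N.m≤m+n _ _)
    cases (yes y≈x) (no x≉0) d″ = begin
     1 N.* (1 N.* size N.+ 𝟙 (¬? d″)) ≡⟨ ≡.trans (N.*-identityˡ _) (≡.cong (N._+ 𝟙 (¬? d″)) (N.*-identityˡ size)) ⟩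
     size N.+ 𝟙 (¬? d″) ≤⟨ N.+-monoʳ-≤ size (𝟙≤1 (¬? d″)) ⟩
     size N.+ 1 ≡⟨ ≡.cong (N._+ 1) (≡.trans (joint-≈ y≈x) (≡.trans (≡.cong (N._* size) (𝟙-yes (¬? (zero? (u x))) x≉0)) (N.*-identityˡ size))) ⟨
     joint x y N.+ 1 ∎
     where open N.≤-Reasoning

   first : ∑ₑ (λ x → ∑ (pairs elements elements) (λ k → ζ (value x k))) ≡ X N.* size
   first = ≡.trans (∑-cong elements λ x → lines-through x (zero? (u x))) (∑-*ʳ elements size (λ x → ν (u x)))

   second : X N.* (size N.+ X) N.≤ ∑ₑ (λ x → ∑ₑ (joint x)) N.+ X
   second = begin
    X N.* (size N.+ X) ≡⟨ ∑-*ʳ elements (size N.+ X) (λ x → ν (u x)) ⟨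
    ∑ₑ (λ x → ν (u x) N.* (size N.+ X))
     ≡⟨ ∑-cong elements (λ x → ≡.trans (≡.cong (ν (u x) N.*_) (≡.sym (≡.trans (∑-+ elements _ _) (≡.cong (N._+ X)
        (≡.trans (∑-*ʳ elements size (λ y → 𝟙 (y ≟ x))) (≡.trans (≡.cong (N._* size) (unique-representative x)) (N.*-identityˡ size)))))))
        (≡.sym (∑-*ˡ elements (ν (u x)) _))) ⟩
    ∑ₑ (λ x → ∑ₑ (λ y → ν (u x) N.* (𝟙 (y ≟ x) N.* size N.+ ν (u y))))
     ≤⟨ ∑-mono elements (λ x → ∑-mono elements (joint-bound x)) ⟩
    ∑ₑ (λ x → ∑ₑ (λ y → joint x y N.+ ν (u x) N.* 𝟙 (y ≟ x)))
     ≡⟨ ∑-cong elements (λ x → ≡.trans (∑-+ elements _ _) (≡.cong (∑ₑ (joint x) N.+_)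
        (≡.trans (∑-*ˡ elements (ν (u x)) _) (≡.trans (≡.cong (ν (u x) N.*_) (unique-representative x)) (N.*-identityʳ _))))) ⟩
    ∑ₑ (λ x → ∑ₑ (joint x) N.+ ν (u x)) ≡⟨ ∑-+ elements _ _ ⟩
    ∑ₑ (λ x → ∑ₑ (joint x)) N.+ X ∎
    where open N.≤-Reasoning

   X≤size : X N.≤ size
   X≤size = N.≤-trans (∑-mono elements λ x → ν≤1 (u x)) (N.≤-reflexive (≡.trans (∑-const elements 1) (N.*-identityʳ size)))

   lines≡ : length (pairs elements elements) ≡ size N.* size
   lines≡ = ≡.trans (≡.sym (≡.trans (∑-const (pairs elements elements) 1) (N.*-identityʳ _)))
    (≡.trans (∑-pairs elements elements (λ _ → 1)) (≡.trans (∑-cong elements λ _ → ≡.trans (∑-const elements 1) (N.*-identityʳ size)) (∑-const elements size)))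

  -- 20 absorbs the loss from n ≤ 4 and from size - 1 ≤ X.
  many-rootless : ∀ n → n N.≤ 4 → 3 N.≤ size → size N.≤ suc X → (f : Carrier → Carrier → Poly) →
   (∀ k1 k0 x → evaluate x (f k1 k0) ≈ value x (k1 , k0)) → (∀ k1 k0 → roots (f k1 k0) N.≤ n) →
   size N.* size N.≤ 20 N.* ∑ₑ (λ k1 → ∑ₑ (λ k0 → rootless (f k1 k0)))
  many-rootless n n≤4 3≤s s≤X+1 f f≈ roots≤n = begin
   size N.* size ≤⟨ arithmetic X (N.s≤s⁻¹ (N.≤-trans 3≤s s≤X+1)) s≤X+1 ⟩
   5 N.* (X N.* X N.∸ X) ≤⟨ N.*-monoʳ-≤ 5 (N.m≤n+o⇒m∸n≤o (X N.* X) X (≡.subst (X N.* X N.≤_) (N.+-comm _ X)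
                     (many-missed n size X (λ (k1 , k0) → ≡.subst (N._≤ n) (count≡ k1 k0) (roots≤n k1 k0)) X≤size lines≡ first second))) ⟩
   5 N.* (n N.* missed) ≤⟨ N.*-monoʳ-≤ 5 (N.*-monoˡ-≤ missed n≤4) ⟩
   5 N.* (4 N.* missed) ≡⟨ N.*-assoc 5 4 missed ⟨
   20 N.* missed ≡⟨ ≡.cong (20 N.*_) (≡.trans (∑-pairs elements elements _) (∑-cong elements λ k1 → ∑-cong elements λ k0 →
                     ≡.cong (λ m → 𝟙 (m N.≟ 0)) (≡.sym (count≡ k1 k0)))) ⟩
   20 N.* ∑ₑ (λ k1 → ∑ₑ (λ k0 → rootless (f k1 k0))) ∎
   where
   open N.≤-Reasoning
   count≡ : ∀ k1 k0 → roots (f k1 k0) ≡ count (k1 , k0)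
   count≡ k1 k0 = ∑-cong elements λ x → ζ-cong (f≈ k1 k0 x)
   -- The factor 5 is dictated by the smallest case X = 2, s = 3, where the inequality is 9 ≤ 10.
   arithmetic : ∀ X → 2 N.≤ X → ∀ {s} → s N.≤ suc X → s N.* s N.≤ 5 N.* (X N.* X N.∸ X)
   arithmetic (suc zero) (s≤s ())
   arithmetic (suc (suc Y)) _ {s} s≤ = begin
    s N.* s ≤⟨ N.*-mono-≤ s≤ s≤ ⟩
    (3 N.+ Y) N.* (3 N.+ Y)
     ≤⟨ N.m≤m+n _ (4 N.* (Y N.* Y) N.+ 9 N.* Y N.+ 1) ⟩
    (3 N.+ Y) N.* (3 N.+ Y) N.+ (4 N.* (Y N.* Y) N.+ 9 N.* Y N.+ 1)
     ≡⟨ NS.solve 1 (λ Y → (NS.con 3 NS.:+ Y) NS.:* (NS.con 3 NS.:+ Y) NS.:+ (NS.con 4 NS.:* (Y NS.:* Y) NS.:+ NS.con 9 NS.:* Y NS.:+ NS.con 1)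
        NS.:= NS.con 5 NS.:* ((NS.con 1 NS.:+ Y) NS.:* (NS.con 2 NS.:+ Y))) ≡.refl Y ⟩
    5 N.* (suc Y N.* suc (suc Y))
     ≡⟨ ≡.cong (5 N.*_) (≡.sym (N.m+n∸m≡n (suc (suc Y)) (suc Y N.* suc (suc Y)))) ⟩
    5 N.* (suc (suc Y) N.* suc (suc Y) N.∸ suc (suc Y)) ∎

 ∑-large : ∀ {L k} {f : Carrier → ℕ} → (∀ x → L N.≤ k N.* f x) → size N.* L N.≤ k N.* ∑ₑ f
 ∑-large {L} {k} {f} b = ≡.subst₂ N._≤_ (∑-const elements L) (∑-*ˡ elements k f) (∑-mono elements b)

 -- Leaving out one residue costs at most a factor 2, because size - 1 is at least half of size.
 ∑-large-≉ : ∀ {L k} {f : Carrier → ℕ} → 2 N.≤ size → ∀ c → (∀ x → ¬ (x ≈ c) → L N.≤ k N.* f x) → size N.* L N.≤ 2 N.* k N.* ∑ₑ f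
 ∑-large-≉ {L} {k} {f} 2≤s c b = begin
  size N.* L ≤⟨ N.*-monoˡ-≤ L size≤ ⟩
  2 N.* others N.* L ≡⟨ N.*-assoc 2 others L ⟩
  2 N.* (others N.* L) ≡⟨ ≡.cong (2 N.*_) (∑-*ʳ elements L _) ⟨
  2 N.* ∑ₑ (λ x → 𝟙 (¬? (x ≟ c)) N.* L) ≤⟨ N.*-monoʳ-≤ 2 (∑-mono elements λ x → pointwise x (x ≟ c)) ⟩
  2 N.* ∑ₑ (λ x → k N.* f x) ≡⟨ ≡.cong (2 N.*_) (∑-*ˡ elements k f) ⟩
  2 N.* (k N.* ∑ₑ f) ≡⟨ N.*-assoc 2 k (∑ₑ f) ⟨
  2 N.* k N.* ∑ₑ f ∎
  where
  open N.≤-Reasoning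
  others : ℕ
  others = ∑ₑ (λ x → 𝟙 (¬? (x ≟ c)))
  pointwise : ∀ x (d : Dec (x ≈ c)) → 𝟙 (¬? d) N.* L N.≤ k N.* f x
  pointwise x (yes _) = z≤n
  pointwise x (no x≉c) = N.≤-trans (N.≤-reflexive (N.*-identityˡ L)) (b x x≉c)
  double : ∀ {m n} → suc m ≡ n → 2 N.≤ n → n N.≤ 2 N.* m
  double {suc m} ≡.refl _ = s≤s (N.≤-trans (N.≤-reflexive (N.+-comm 1 m)) (N.+-monoʳ-≤ m (s≤s z≤n)))
  double {zero} ≡.refl (s≤s ())
  size≤ : size N.≤ 2 N.* others
  size≤ = double (count-≉ c) 2≤s

-- Certificates modulo a prime and the proportion of residue classes that pass

-- The invariants of Y² = A(X) T² + B(X) T + C(X) with A = a0 + a1 X, B = b0 + b1 X + b2 X²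
-- and C = c0 + c1 X + c2 X² + X³.

module Invariants {c ℓ} (R : CommutativeRing c ℓ) where

 open CommutativeRing R hiding (zero)
 open Polynomials R

 4# : Carrier
 4# = 1# + 1# + 1# + 1#

 2* : Carrier → Carrier
 2* x = x + x

 discriminant : (a0 a1 b0 b1 b2 c0 c1 c2 : Carrier) → Poly
 discriminant a0 a1 b0 b1 b2 c0 c1 c2 =
   b0 * b0 - 4# * (a0 * c0)
  ∷ 2* (b0 * b1) - 4# * (a0 * c1 + a1 * c0)
  ∷ b1 * b1 + 2* (b0 * b2) - 4# * (a0 * c2 + a1 * c1)
  ∷ 2* (b1 * b2) - 4# * (a0 + a1 * c2)
  ∷ b2 * b2 - 4# * a1
  ∷ []

 remainder1 remainder0 resultant : (b0 b1 b2 c0 c1 c2 : Carrier) → Carrier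
 remainder1 b0 b1 b2 c0 c1 c2 = b2 * b2 * c1 - b2 * b1 * c2 + (b1 * b1 - b0 * b2)
 remainder0 b0 b1 b2 c0 c1 c2 = b2 * b2 * c0 - b2 * b0 * c2 + b0 * b1
 resultant b0 b1 b2 c0 c1 c2 = b2 * (b2 * k0 * k0 - b1 * k0 * k1 + b0 * k1 * k1)
  where
  k0 k1 : Carrier
  k0 = remainder0 b0 b1 b2 c0 c1 c2
  k1 = remainder1 b0 b1 b2 c0 c1 c2

 discriminant-cong : ∀ {a0 a1 b0 b1 b2 c0 c1 c2 a0′ a1′ b0′ b1′ b2′ c0′ c1′ c2′} →
  a0 ≈ a0′ → a1 ≈ a1′ → b0 ≈ b0′ → b1 ≈ b1′ → b2 ≈ b2′ → c0 ≈ c0′ → c1 ≈ c1′ → c2 ≈ c2′ →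
  discriminant a0 a1 b0 b1 b2 c0 c1 c2 ≋ discriminant a0′ a1′ b0′ b1′ b2′ c0′ c1′ c2′
 discriminant-cong A0 A1 B0 B1 B2 C0 C1 C2 =
  ∷-cong (+-cong (*-cong B0 B0) (-‿cong (*-congˡ (*-cong A0 C0))))
  (∷-cong (+-cong (+-cong (*-cong B0 B1) (*-cong B0 B1)) (-‿cong (*-congˡ (+-cong (*-cong A0 C1) (*-cong A1 C0)))))
  (∷-cong (+-cong (+-cong (*-cong B1 B1) (+-cong (*-cong B0 B2) (*-cong B0 B2))) (-‿cong (*-congˡ (+-cong (*-cong A0 C2) (*-cong A1 C1)))))
  (∷-cong (+-cong (+-cong (*-cong B1 B2) (*-cong B1 B2)) (-‿cong (*-congˡ (+-cong A0 (*-cong A1 C2)))))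
  (∷-cong (+-cong (*-cong B2 B2) (-‿cong (*-congˡ A1))) ≋-refl))))

 resultant-cong : ∀ {b0 b1 b2 c0 c1 c2 b0′ b1′ b2′ c0′ c1′ c2′} →
  b0 ≈ b0′ → b1 ≈ b1′ → b2 ≈ b2′ → c0 ≈ c0′ → c1 ≈ c1′ → c2 ≈ c2′ →
  resultant b0 b1 b2 c0 c1 c2 ≈ resultant b0′ b1′ b2′ c0′ c1′ c2′
 resultant-cong B0 B1 B2 C0 C1 C2 = *-cong B2 (+-cong (+-cong (*-cong (*-cong B2 K0) K0) (-‿cong (*-cong (*-cong B1 K0) K1))) (*-cong (*-cong B0 K1) K1))
  where
  K1 = +-cong (+-cong (*-cong (*-cong B2 B2) C1) (-‿cong (*-cong (*-cong B2 B1) C2))) (+-cong (*-cong B1 B1) (-‿cong (*-cong B0 B2)))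
  K0 = +-cong (+-cong (*-cong (*-cong B2 B2) C0) (-‿cong (*-cong (*-cong B2 B0) C2))) (*-cong B0 B1)

module Certificates (F : DiscreteField 0ℓ 0ℓ) (elements : List (DiscreteField.Carrier F))
 (unique-representative : ∀ a → ∑ elements (λ x → 𝟙 (DiscreteField._≟_ F x a)) ≡ 1) where

 open DiscreteField F hiding (zero; inverse)
 private
  inv = DiscreteField.inverse F
 open FieldPolynomials F hiding (∣-refl; ∣-trans; divides; quotient)
 open IntegerSolver commutativeRing using (solve)
 open DomainProperties domain using (*-≉0; cancel-≈0; square-≈0)
 open GroupProperties +-group using (x∙y⁻¹≈ε⇒x≈y)
 open FiniteFieldSums F elements unique-representative public
 open Invariants commutativeRing
 private
  module ≈R = SetoidReasoning setoid

 ∑ᵛ : ∀ m → (Vec Carrier m → ℕ) → ℕ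
 ∑ᵛ m = ∑ⱽ (replicate m elements)

 ∑ᵛ-cong : ∀ m {f g} → (∀ v → f v ≡ g v) → ∑ᵛ m f ≡ ∑ᵛ m g
 ∑ᵛ-cong zero e = e []
 ∑ᵛ-cong (suc m) e = ∑-cong elements λ x → ∑ᵛ-cong m λ v → e (x ∷ v)

 ∑ᵛ-swap : ∀ m (f : Carrier → Vec Carrier m → ℕ) → ∑ₑ (λ a → ∑ᵛ m (f a)) ≡ ∑ᵛ m (λ v → ∑ₑ (λ a → f a v))
 ∑ᵛ-swap zero f = ≡.refl
 ∑ᵛ-swap (suc m) f = ≡.trans (∑-swap elements elements (λ a x → ∑ᵛ m (λ v → f a (x ∷ v)))) (∑-cong elements λ x → ∑ᵛ-swap m (λ a v → f a (x ∷ v)))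

 ∑ᵛ-*ˡ : ∀ m k f → ∑ᵛ m (λ v → k N.* f v) ≡ k N.* ∑ᵛ m f
 ∑ᵛ-*ˡ zero k f = ≡.refl
 ∑ᵛ-*ˡ (suc m) k f = ≡.trans (∑-cong elements λ x → ∑ᵛ-*ˡ m k (λ v → f (x ∷ v))) (∑-*ˡ elements k _)

 quotient-by : Carrier → Poly → Poly
 quotient-by r = SyntheticDivision.quot commutativeRing r

 -- f has a root with a rootless cofactor
 simple : Poly → ℕ
 simple f = ∑ₑ (λ r → ζ (evaluate r f) N.* rootless (quotient-by r f))

 quotient-by-cong : ∀ r {f g} → f ≋ g → quotient-by r f ≋ quotient-by r g
 quotient-by-cong r {[]} {[]} e = ≋-refl
 quotient-by-cong r {[]} {b ∷ g} e = ≋-sym (⊏0⇒≋[] (SyntheticDivision.quot-⊏ commutativeRing r (b ∷ g) 0 (⊏-resp e []⊏)))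
 quotient-by-cong r {a ∷ f} {[]} e = ⊏0⇒≋[] (SyntheticDivision.quot-⊏ commutativeRing r (a ∷ f) 0 (⊏-resp (≋-sym e) []⊏))
 quotient-by-cong r {a ∷ f} {b ∷ g} e = ∷-cong (RingHom.⟦⟧-cong (Evaluation.evalHom (identityHom commutativeRing) r) {f} {g} (≋-tail e))
  (quotient-by-cong r {f} {g} (≋-tail e))

 simple-term-cong : ∀ r {f g} → f ≋ g → ζ (evaluate r f) N.* rootless (quotient-by r f) ≡ ζ (evaluate r g) N.* rootless (quotient-by r g)
 simple-term-cong r {f} {g} e = ≡.cong₂ N._*_ (ζ-cong (RingHom.⟦⟧-cong (Evaluation.evalHom (identityHom commutativeRing) r) {f} {g} e))
  (rootless-cong {quotient-by r f} {quotient-by r g} (quotient-by-cong r {f} {g} e))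

 simple-cong : ∀ {f g} → f ≋ g → simple f ≡ simple g
 simple-cong {f} {g} e = ∑-cong elements λ r → simple-term-cong r {f} {g} e

 -- A cofactor without roots leaves r as the only root of f, so the sum has at most one nonzero
 -- term.
 simple≤1 : ∀ f → simple f N.≤ 1
 simple≤1 f = cases (simple f N.≟ 0)
  where
  term : Carrier → ℕ
  term r = ζ (evaluate r f) N.* rootless (quotient-by r f)
  *≢0 : ∀ m n → m N.* n ≢ 0 → m ≢ 0 × n ≢ 0
  *≢0 m n ne = (λ e → ne (≡.cong (N._* n) e)) , (λ e → ne (≡.trans (≡.cong (m N.*_) e) (N.*-zeroʳ m)))
  module _ (r : Carrier) (ne : term r ≢ 0) where
   open SyntheticDivision commutativeRing r using (X-κ; factor; eval-X-κ)
   fr≈0 : evaluate r f ≈ 0#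
   fr≈0 = 𝟙≢0 (zero? (evaluate r f)) (proj₁ (*≢0 _ _ ne))
   only : ∀ x → term x N.≤ 𝟙 (x ≟ r)
   only x = bound (zero? (evaluate x f)) (x ≟ r)
    where
    open RingHom (Evaluation.evalHom (identityHom commutativeRing) x)
    bound : (d : Dec (evaluate x f ≈ 0#)) (d′ : Dec (x ≈ r)) → 𝟙 d N.* rootless (quotient-by x f) N.≤ 𝟙 d′
    bound (no _) d′ = z≤n
    bound (yes _) (yes _) = N.≤-trans (N.≤-reflexive (N.*-identityˡ _)) (rootless≤1 (quotient-by x f))
    bound (yes e) (no x≉r) = ⊥-elim (*-≉0 (λ z → x≉r (x∙y⁻¹≈ε⇒x≈y x r z))
     (rootless⇒NoRoot {quotient-by r f} (proj₂ (*≢0 (ζ (evaluate r f)) _ ne)) x)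
     (trans (*-congʳ (sym (eval-X-κ x))) (trans (sym (*-homo X-κ (quotient-by r f))) (trans (⟦⟧-cong (≋-sym (factor f fr≈0))) e))))
  cases : Dec (simple f ≡ 0) → simple f N.≤ 1
  cases (yes e) = N.≤-trans (N.≤-reflexive e) z≤n
  cases (no ne) = N.≤-trans (∑-mono elements (only (proj₁ root) (proj₂ root))) (N.≤-reflexive (unique-representative (proj₁ root)))
   where root = ∑≢0 elements term ne

 -- The order of the coordinates is the order of summation: those that are fixed first come first.
 -- The factor `ν` keeps the leading coefficient alive modulo the prime, and a nonsquare v is tested
 -- by the absence of roots of X² - v.
 certificate-B certificate-resultant : Vec Carrier 6 → ℕ
 certificate-B (b2 ∷ c2 ∷ b1 ∷ b0 ∷ c1 ∷ c0 ∷ []) = ν b2 N.* rootless (b0 ∷ b1 ∷ b2 ∷ [])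
 certificate-resultant (b2 ∷ c2 ∷ b1 ∷ b0 ∷ c1 ∷ c0 ∷ []) = rootless (- resultant b0 b1 b2 c0 c1 c2 ∷ 0# ∷ 1# ∷ [])

 discriminant□ : Vec Carrier 7 → Poly
 discriminant□ (a ∷ b2 ∷ b1 ∷ b0 ∷ c2 ∷ c1 ∷ c0 ∷ []) = discriminant (a * a) 0# b0 b1 b2 c0 c1 c2

 certificate□-rootless certificate□-simple : Vec Carrier 7 → ℕ
 certificate□-rootless v@(a ∷ b2 ∷ _) = ν b2 N.* rootless (discriminant□ v)
 certificate□-simple v@(a ∷ b2 ∷ _) = ν b2 N.* simple (discriminant□ v)

 discriminantℓ : Vec Carrier 6 → Poly
 discriminantℓ (a1 ∷ a0 ∷ b1 ∷ b0 ∷ c1 ∷ c0 ∷ []) = discriminant a0 a1 b0 b1 0# c0 c1 0#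

 -- The first asks that X² + a1 have no root, so that - a1 is a nonsquare. In the others `ν` of a1
 -- keeps the degree of the discriminant equal to 4.
 certificateℓ-square certificateℓ-rootless certificateℓ-simple : Vec Carrier 6 → ℕ
 certificateℓ-square (a1 ∷ _) = rootless (a1 ∷ 0# ∷ 1# ∷ [])
 certificateℓ-rootless v@(a1 ∷ _) = ν a1 N.* rootless (discriminantℓ v)
 certificateℓ-simple v@(a1 ∷ _) = ν a1 N.* simple (discriminantℓ v)

 module _ (3≤size : 3 N.≤ size) (2≉0 : ¬ (1# + 1# ≈ 0#)) where

  private
   2≤size : 2 N.≤ size
   2≤size = N.≤-trans (N.n≤1+n 2) 3≤size
   4≉0 : ¬ (4# ≈ 0#)
   4≉0 e = *-≉0 2≉0 2≉0 (trans (solve 0 ((:1 :+ :1) :* (:1 :+ :1) := :4)) e)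
   neg≉0 : ∀ {a} → ¬ (a ≈ 0#) → ¬ (- a ≈ 0#)
   neg≉0 {a} a≉0 e = a≉0 (trans (solve 1 (λ a → a := :- (:- a)) a) (trans (-‿cong e) (solve 0 (:- :0 := :0))))
   2*≉0 : ∀ {a} → ¬ (a ≈ 0#) → ¬ (a + a ≈ 0#)
   2*≉0 {a} a≉0 e = *-≉0 2≉0 a≉0 (trans (solve 1 (λ a → (:1 :+ :1) :* a := a :+ a) a) e)
   ν≡1 : ∀ {a} → ¬ (a ≈ 0#) → ν a ≡ 1
   ν≡1 {a} a≉0 = 𝟙-yes (¬? (zero? a)) a≉0
   ν* : ∀ {a} → ¬ (a ≈ 0#) → ∀ n → ν a N.* n ≡ n
   ν* a≉0 n = ≡.trans (≡.cong (N._* n) (ν≡1 a≉0)) (N.*-identityˡ n)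
   unit-lines : ∀ n → n N.≤ 4 → ∀ {u} → ¬ (u ≈ 0#) → (w : Carrier → Carrier) → (∀ {x y} → x ≈ y → w x ≈ w y) →
    (f : Carrier → Carrier → Poly) → (∀ k1 k0 x → evaluate x (f k1 k0) ≈ u * (k1 * x + k0) + w x) → (∀ k1 k0 → roots (f k1 k0) N.≤ n) →
    size N.* size N.≤ 20 N.* ∑ₑ (λ k1 → ∑ₑ (λ k0 → rootless (f k1 k0)))
   unit-lines n n≤4 {u} u≉0 w w-cong = Lines.many-rootless (λ _ → u) w (λ _ → refl) w-cong (λ _ u≈0 → ⊥-elim (u≉0 u≈0)) n n≤4 3≤size
    (N.≤-trans (N.≤-reflexive (≡.sym (≡.trans (∑-cong elements λ _ → ν≡1 u≉0) (≡.trans (∑-const elements 1) (N.*-identityʳ size))))) (N.n≤1+n _))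

  private
   constant-cong : ∀ {v w} → v ≈ w → rootless (v ∷ 0# ∷ 1# ∷ []) ≡ rootless (w ∷ 0# ∷ 1# ∷ [])
   constant-cong {v} {w} e = rootless-cong {v ∷ 0# ∷ 1# ∷ []} {w ∷ 0# ∷ 1# ∷ []} (∷-cong e ≋-refl)

  -- For a fixed leading coefficient a, the lines b x + d are compared with the points of a
  -- parabola: u = 1 and w = a x².
  many-quadratics : ∀ {a} → ¬ (a ≈ 0#) → size N.* size N.≤ 20 N.* ∑ₑ (λ b → ∑ₑ (λ d → rootless (d ∷ b ∷ a ∷ [])))
  many-quadratics {a} a≉0 = unit-lines 2 (s≤s (s≤s z≤n)) 1≉0 (λ x → a * (x * x)) (λ e → *-congˡ (*-cong e e)) (λ b d → d ∷ b ∷ a ∷ [])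
   (λ b d x → solve 4 (λ a b d x → d :+ x :* (b :+ x :* (a :+ x :* :0)) := :1 :* (b :* x :+ d) :+ a :* (x :* x)) a b d x)
   (λ b d → roots≤degree 2 (d ∷ b ∷ a ∷ []) (⊏-length (d ∷ b ∷ a ∷ [])) (λ z → a≉0 (at z 2)))

  -- Completing the square.
  many-nonsquares : size N.≤ 20 N.* ∑ₑ (λ v → rootless (v ∷ 0# ∷ 1# ∷ []))
  many-nonsquares = N.*-cancelˡ-≤ size {{N.>-nonZero (N.≤-trans (s≤s z≤n) 3≤size)}} (begin
   size N.* size ≤⟨ many-quadratics 1≉0 ⟩
   20 N.* ∑ₑ (λ b → ∑ₑ (λ d → rootless (d ∷ b ∷ 1# ∷ [])))
    ≡⟨ ≡.cong (20 N.*_) (≡.trans (∑-cong elements λ b → ≡.trans (∑-cong elements λ d → ≡.cong (λ n → 𝟙 (n N.≟ 0)) (complete b d))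
       (∑-translate {λ v → rootless (v ∷ 0# ∷ 1# ∷ [])} constant-cong (- (h * b * (h * b))))) (∑-const elements _)) ⟩
   20 N.* (size N.* nonsquares) ≡⟨ NS.solve 2 (λ s n → NS.con 20 NS.:* (s NS.:* n) NS.:= s NS.:* (NS.con 20 NS.:* n)) ≡.refl size nonsquares ⟩
   size N.* (20 N.* nonsquares) ∎)
   where
   open N.≤-Reasoning
   nonsquares : ℕ
   nonsquares = ∑ₑ (λ v → rootless (v ∷ 0# ∷ 1# ∷ []))
   h : Carrier
   h = proj₁ (inv 2≉0)
   complete : ∀ b d → roots (d ∷ b ∷ 1# ∷ []) ≡ roots ((d + - (h * b * (h * b))) ∷ 0# ∷ 1# ∷ [])
   complete b d = ≡.trans (∑-cong elements λ x → ζ-cong (shifted x))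
    (∑-translate {λ x → ζ (evaluate x ((d + - (h * b * (h * b))) ∷ 0# ∷ 1# ∷ []))}
     (λ e → ζ-cong (evaluate-point ((d + - (h * b * (h * b))) ∷ 0# ∷ 1# ∷ []) e)) (h * b))
    where
    shifted : ∀ x → evaluate x (d ∷ b ∷ 1# ∷ []) ≈ evaluate (x + h * b) ((d + - (h * b * (h * b))) ∷ 0# ∷ 1# ∷ [])
    shifted x = ≈R.begin
     d + x * (b + x * (1# + x * 0#)) ≈R.≈⟨ +-congˡ (*-congˡ (+-congʳ (trans (sym (*-identityˡ b)) (*-congʳ (sym (proj₂ (inv 2≉0))))))) ⟩
     d + x * (h * (1# + 1#) * b + x * (1# + x * 0#))
      ≈R.≈⟨ solve 4 (λ h b d x → d :+ x :* (h :* (:1 :+ :1) :* b :+ x :* (:1 :+ x :* :0))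
         := (d :+ :- (h :* b :* (h :* b))) :+ (x :+ h :* b) :* (:0 :+ (x :+ h :* b) :* (:1 :+ (x :+ h :* b) :* :0))) h b d x ⟩
     evaluate (x + h * b) ((d + - (h * b * (h * b))) ∷ 0# ∷ 1# ∷ []) ≈R.∎

  -- The final entry 0# matches the list that synthetic division of a quartic returns as its cubic
  -- cofactor.
  many-cubics : ∀ {a} → ¬ (a ≈ 0#) → ∀ b → size N.* size N.≤ 20 N.* ∑ₑ (λ k1 → ∑ₑ (λ k0 → rootless (k0 ∷ k1 ∷ b ∷ a ∷ 0# ∷ [])))
  many-cubics {a} a≉0 b = unit-lines 3 (s≤s (s≤s (s≤s z≤n))) 1≉0 (λ x → b * (x * x) + a * (x * (x * x))) (λ e → +-cong (*-congˡ (*-cong e e)) (*-congˡ (*-cong e (*-cong e e))))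
   (λ k1 k0 → k0 ∷ k1 ∷ b ∷ a ∷ 0# ∷ [])
   (λ k1 k0 x → solve 5 (λ k1 k0 a b x → k0 :+ x :* (k1 :+ x :* (b :+ x :* (a :+ x :* (:0 :+ x :* :0)))) := :1 :* (k1 :* x :+ k0) :+ (b :* (x :* x) :+ a :* (x :* (x :* x)))) k1 k0 a b x)
   (λ k1 k0 → roots≤degree 3 (k0 ∷ k1 ∷ b ∷ a ∷ 0# ∷ [])
    (λ { 4 _ → refl ; (suc (suc (suc (suc (suc m))))) _ → refl
      ; 1 (s≤s ()) ; 2 (s≤s (s≤s ())) ; 3 (s≤s (s≤s (s≤s ()))) }) (λ z → a≉0 (at z 3)))

  many-B : size N.^ 6 N.≤ 80 N.* ∑ᵛ 6 certificate-B
  many-B = N.≤-trans (∑-large-≉ {k = 20} 2≤size 0# λ b2 b2≉0 → ∑-large {k = 20} λ c2 → begin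
   size N.* (size N.* (size N.* (size N.* 1)))
    ≡⟨ NS.solve 1 (λ s → s NS.:* (s NS.:* (s NS.:* (s NS.:* NS.con 1))) NS.:= s NS.:* s NS.:* (s NS.:* s)) ≡.refl size ⟩
   size N.* size N.* (size N.* size) ≤⟨ N.*-monoʳ-≤ (size N.* size) (many-quadratics b2≉0) ⟩
   size N.* size N.* (20 N.* ∑ₑ (λ b1 → ∑ₑ (λ b0 → rootless (b0 ∷ b1 ∷ b2 ∷ []))))
    ≡⟨ NS.solve 2 (λ s r → s NS.:* s NS.:* (NS.con 20 NS.:* r) NS.:= NS.con 20 NS.:* (s NS.:* (s NS.:* r))) ≡.refl size _ ⟩
   20 N.* (size N.* (size N.* ∑ₑ (λ b1 → ∑ₑ (λ b0 → rootless (b0 ∷ b1 ∷ b2 ∷ [])))))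
    ≡⟨ ≡.cong (20 N.*_) (constants b2 b2≉0) ⟨
   20 N.* ∑ₑ (λ b1 → ∑ₑ (λ b0 → ∑ₑ (λ c1 → ∑ₑ (λ c0 → ν b2 N.* rootless (b0 ∷ b1 ∷ b2 ∷ []))))) ∎)
   (N.*-monoˡ-≤ (∑ᵛ 6 certificate-B) (40≤80))
   where
   open N.≤-Reasoning
   40≤80 : 40 N.≤ 80
   40≤80 = N.m≤m+n 40 40
   constants : ∀ b2 → ¬ (b2 ≈ 0#) → ∑ₑ (λ b1 → ∑ₑ (λ b0 → ∑ₑ (λ c1 → ∑ₑ (λ c0 → ν b2 N.* rootless (b0 ∷ b1 ∷ b2 ∷ []))))) ≡
         size N.* (size N.* ∑ₑ (λ b1 → ∑ₑ (λ b0 → rootless (b0 ∷ b1 ∷ b2 ∷ []))))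
   constants b2 b2≉0 = ≡.trans (∑-cong elements λ b1 → ≡.trans (∑-cong elements λ b0 →
     ≡.trans (∑-cong elements λ c1 → ≡.trans (∑-const elements _) (≡.cong (size N.*_) (ν* b2≉0 _))) (∑-const elements _))
     (≡.trans (∑-*ˡ elements size _) (≡.cong (size N.*_) (∑-*ˡ elements size _))))
    (≡.trans (∑-*ˡ elements size _) (≡.cong (size N.*_) (∑-*ˡ elements size _)))

  -- For fixed b2 ≠ 0, c2, b1 and b0, the pair (c1 , c0) corresponds to the coefficients (k1 , k0)
  -- of the remainder by affine maps of slope b2². In these variables the resultant is affine in b0
  -- with slope b2 k1², so for k1 ≠ 0 it runs over all residues and is a nonsquare at least once in
  -- 20. Excluding b2 = 0 and k1 = 0 costs a factor 2 each, and 2 · 2 · 20 = 80.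
  many-resultants : size N.^ 6 N.≤ 80 N.* ∑ᵛ 6 certificate-resultant
  many-resultants = ∑-large-≉ {k = 40} 2≤size 0# λ b2 b2≉0 → ∑-large {k = 40} λ c2 → ∑-large {k = 40} λ b1 → begin
   size N.* (size N.* (size N.* 1))
    ≤⟨ ∑-large-≉ {k = 20} 2≤size 0# (λ k1 k1≉0 → ∑-large {k = 20} λ k0 → ≡.subst (N._≤ 20 N.* ∑ₑ (λ b0 → R b2 b1 b0 k1 k0)) (≡.sym (N.*-identityʳ size))
       (≡.subst (λ n → size N.≤ 20 N.* n) (≡.sym (in-b0 b2 b1 k1 k0 b2≉0 k1≉0)) many-nonsquares)) ⟩
   40 N.* ∑ₑ (λ k1 → ∑ₑ (λ k0 → ∑ₑ (λ b0 → R b2 b1 b0 k1 k0)))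
    ≡⟨ ≡.cong (40 N.*_) (≡.trans (∑-cong elements λ k1 → ∑-swap elements elements (λ k0 b0 → R b2 b1 b0 k1 k0)) (∑-swap elements elements (λ k1 b0 → ∑ₑ (λ k0 → R b2 b1 b0 k1 k0)))) ⟩
   40 N.* ∑ₑ (λ b0 → ∑ₑ (λ k1 → ∑ₑ (λ k0 → R b2 b1 b0 k1 k0)))
    ≡⟨ ≡.cong (40 N.*_) (∑-cong elements λ b0 → ≡.sym (reindexed b2 c2 b1 b0 b2≉0)) ⟩
   40 N.* ∑ₑ (λ b0 → ∑ₑ (λ c1 → ∑ₑ (λ c0 → certificate-resultant (b2 ∷ c2 ∷ b1 ∷ b0 ∷ c1 ∷ c0 ∷ [])))) ∎
   where
   open N.≤-Reasoning
   V : (b2 b1 b0 k1 k0 : Carrier) → Carrier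
   V b2 b1 b0 k1 k0 = b2 * (b2 * k0 * k0 - b1 * k0 * k1 + b0 * k1 * k1)
   R : (b2 b1 b0 k1 k0 : Carrier) → ℕ
   R b2 b1 b0 k1 k0 = rootless (- V b2 b1 b0 k1 k0 ∷ 0# ∷ 1# ∷ [])
   R-cong : ∀ b2 b1 b0 {k1 k1′ k0 k0′} → k1 ≈ k1′ → k0 ≈ k0′ → R b2 b1 b0 k1 k0 ≡ R b2 b1 b0 k1′ k0′
   R-cong b2 b1 b0 e1 e0 = constant-cong (-‿cong (*-congˡ (+-cong (+-cong (*-cong (*-congˡ e0) e0) (-‿cong (*-cong (*-congˡ e0) e1))) (*-cong (*-congˡ e1) e1))))
   in-b0 : ∀ b2 b1 k1 k0 → ¬ (b2 ≈ 0#) → ¬ (k1 ≈ 0#) → ∑ₑ (λ b0 → R b2 b1 b0 k1 k0) ≡ ∑ₑ (λ v → rootless (v ∷ 0# ∷ 1# ∷ []))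
   in-b0 b2 b1 k1 k0 b2≉0 k1≉0 = ≡.trans (∑-cong elements λ b0 → constant-cong
     (solve 5 (λ b2 b1 b0 k1 k0 → :- (b2 :* (b2 :* k0 :* k0 :- b1 :* k0 :* k1 :+ b0 :* k1 :* k1))
       := (:- (b2 :* (k1 :* k1))) :* b0 :+ :- (b2 :* (b2 :* k0 :* k0 :- b1 :* k0 :* k1))) b2 b1 b0 k1 k0))
    (∑-reindex {λ v → rootless (v ∷ 0# ∷ 1# ∷ [])} constant-cong
     (proj₂ (inv (neg≉0 (*-≉0 b2≉0 (*-≉0 k1≉0 k1≉0))))) (- (b2 * (b2 * k0 * k0 - b1 * k0 * k1))))
   reindexed : ∀ b2 c2 b1 b0 → ¬ (b2 ≈ 0#) → ∑ₑ (λ c1 → ∑ₑ (λ c0 → certificate-resultant (b2 ∷ c2 ∷ b1 ∷ b0 ∷ c1 ∷ c0 ∷ []))) ≡ ∑ₑ (λ k1 → ∑ₑ (λ k0 → R b2 b1 b0 k1 k0))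
   reindexed b2 c2 b1 b0 b2≉0 = ≡.trans
    (∑-cong elements λ c1 → ≡.trans
     (∑-cong elements λ c0 → R-cong b2 b1 b0 (solve 5 (λ b2 c2 b1 b0 c → b2 :* b2 :* c :- b2 :* b1 :* c2 :+ (b1 :* b1 :- b0 :* b2) := b2 :* b2 :* c :+ (b1 :* b1 :- b0 :* b2 :- b2 :* b1 :* c2)) b2 c2 b1 b0 c1)
      (solve 5 (λ b2 c2 b1 b0 c → b2 :* b2 :* c :- b2 :* b0 :* c2 :+ b0 :* b1 := b2 :* b2 :* c :+ (b0 :* b1 :- b2 :* b0 :* c2)) b2 c2 b1 b0 c0))
     (∑-reindex {λ k0 → R b2 b1 b0 (b2 * b2 * c1 + (b1 * b1 - b0 * b2 - b2 * b1 * c2)) k0} (λ e → R-cong b2 b1 b0 refl e) (proj₂ (inv (*-≉0 b2≉0 b2≉0))) (b0 * b1 - b2 * b0 * c2)))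
    (∑-reindex {λ k1 → ∑ₑ (λ k0 → R b2 b1 b0 k1 k0)} (λ e → ∑-cong elements λ k0 → R-cong b2 b1 b0 e refl) (proj₂ (inv (*-≉0 b2≉0 b2≉0))) (b1 * b1 - b0 * b2 - b2 * b1 * c2))

  -- As a function of c1 and c0 the discriminant is - 4 a² (c1 X + c0) plus fixed terms, so lines
  -- with a constant u are counted. The restrictions a ≠ 0 and b2 ≠ 0 cost 2 · 2 on top of 20.
  many-rootless□ : size N.^ 7 N.≤ 80 N.* ∑ᵛ 7 certificate□-rootless
  many-rootless□ = ∑-large-≉ {k = 40} 2≤size 0# λ a a≉0 → ∑-large-≉ {k = 20} 2≤size 0# λ b2 b2≉0 →
   ∑-large {k = 20} λ b1 → ∑-large {k = 20} λ b0 → ∑-large {k = 20} λ c2 → begin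
    size N.* (size N.* 1) ≡⟨ ≡.cong (size N.*_) (N.*-identityʳ size) ⟩
    size N.* size
     ≤⟨ unit-lines 4 N.≤-refl (neg≉0 (*-≉0 4≉0 (*-≉0 a≉0 a≉0))) (λ x → w a b2 b1 b0 c2 x)
        (λ e → +-cong (*-cong (value-cong e) (value-cong e)) (-‿cong (*-congˡ (*-congˡ (+-cong (*-congˡ (*-cong e e)) (*-cong e (*-cong e e)))))))
        (λ c1 c0 → discriminant□ (a ∷ b2 ∷ b1 ∷ b0 ∷ c2 ∷ c1 ∷ c0 ∷ []))
        (λ c1 c0 x → solve 8 (λ a b2 b1 b0 c2 c1 c0 x →
          (b0 :* b0 :- :4 :* (a :* a :* c0)) :+ x :* ((b0 :* b1 :+ b0 :* b1 :- :4 :* (a :* a :* c1 :+ :0 :* c0)) :+ x :* ((b1 :* b1 :+ (b0 :* b2 :+ b0 :* b2) :- :4 :* (a :* a :* c2 :+ :0 :* c1))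
           :+ x :* ((b1 :* b2 :+ b1 :* b2 :- :4 :* (a :* a :+ :0 :* c2)) :+ x :* ((b2 :* b2 :- :4 :* :0) :+ x :* :0))))
          := (:- (:4 :* (a :* a))) :* (c1 :* x :+ c0) :+ ((b0 :+ x :* (b1 :+ x :* b2)) :* (b0 :+ x :* (b1 :+ x :* b2)) :- :4 :* (a :* a :* (c2 :* (x :* x) :+ x :* (x :* x))))) a b2 b1 b0 c2 c1 c0 x)
        (λ c1 c0 → roots≤degree 4 (discriminant□ (a ∷ b2 ∷ b1 ∷ b0 ∷ c2 ∷ c1 ∷ c0 ∷ [])) (⊏-length (discriminant□ (a ∷ b2 ∷ b1 ∷ b0 ∷ c2 ∷ c1 ∷ c0 ∷ [])))
         (λ z → *-≉0 b2≉0 b2≉0 (trans (solve 1 (λ b → b :* b := b :* b :- :4 :* :0) b2) (at z 4)))) ⟩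
    20 N.* ∑ₑ (λ c1 → ∑ₑ (λ c0 → rootless (discriminant□ (a ∷ b2 ∷ b1 ∷ b0 ∷ c2 ∷ c1 ∷ c0 ∷ []))))
     ≡⟨ ≡.cong (20 N.*_) (∑-cong elements λ c1 → ∑-cong elements λ c0 → ≡.sym (ν* b2≉0 _)) ⟩
    20 N.* ∑ₑ (λ c1 → ∑ₑ (λ c0 → certificate□-rootless (a ∷ b2 ∷ b1 ∷ b0 ∷ c2 ∷ c1 ∷ c0 ∷ []))) ∎
   where
   open N.≤-Reasoning
   w : (a b2 b1 b0 c2 x : Carrier) → Carrier
   w a b2 b1 b0 c2 x = (b0 + x * (b1 + x * b2)) * (b0 + x * (b1 + x * b2)) - 4# * (a * a * (c2 * (x * x) + x * (x * x)))
   value-cong : ∀ {b2 b1 b0 x y} → x ≈ y → b0 + x * (b1 + x * b2) ≈ b0 + y * (b1 + y * b2)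
   value-cong e = +-congˡ (*-cong e (+-congˡ (*-congʳ e)))

  -- For a given root r, the coefficients of the cofactor and the remainder are
  -- successive affine functions of c2, c1 and c0.
  many-simple□ : size N.^ 7 N.≤ 80 N.* ∑ᵛ 7 certificate□-simple
  many-simple□ = ∑-large-≉ {k = 40} 2≤size 0# λ a a≉0 → ∑-large-≉ {k = 20} 2≤size 0# λ b2 b2≉0 →
   ∑-large {k = 20} λ b1 → ∑-large {k = 20} λ b0 → begin
    size N.* (size N.* (size N.* 1))
     ≤⟨ ∑-large {k = 20} (λ r → N.≤-trans (N.≤-reflexive (≡.cong (size N.*_) (N.*-identityʳ size)))
        (≡.subst (λ n → size N.* size N.≤ 20 N.* n) (≡.sym (for-root a b2 b1 b0 r a≉0))
         (many-cubics (λ z → *-≉0 b2≉0 b2≉0 (trans (solve 2 (λ b r → b :* b := (b :* b :- :4 :* :0) :+ r :* :0) b2 r) z)) (q2 a b2 b1 r)))) ⟩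
    20 N.* ∑ₑ (λ r → ∑ₑ (λ c2 → ∑ₑ (λ c1 → ∑ₑ (λ c0 → term r (a ∷ b2 ∷ b1 ∷ b0 ∷ c2 ∷ c1 ∷ c0 ∷ [])))))
     ≡⟨ ≡.cong (20 N.*_) (∑ᵛ-swap 3 (λ { r (c2 ∷ c1 ∷ c0 ∷ []) → term r (a ∷ b2 ∷ b1 ∷ b0 ∷ c2 ∷ c1 ∷ c0 ∷ []) })) ⟩
    20 N.* ∑ₑ (λ c2 → ∑ₑ (λ c1 → ∑ₑ (λ c0 → simple (discriminant□ (a ∷ b2 ∷ b1 ∷ b0 ∷ c2 ∷ c1 ∷ c0 ∷ [])))))
     ≡⟨ ≡.cong (20 N.*_) (∑-cong elements λ c2 → ∑-cong elements λ c1 → ∑-cong elements λ c0 → ≡.sym (ν* b2≉0 _)) ⟩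
    20 N.* ∑ₑ (λ c2 → ∑ₑ (λ c1 → ∑ₑ (λ c0 → certificate□-simple (a ∷ b2 ∷ b1 ∷ b0 ∷ c2 ∷ c1 ∷ c0 ∷ [])))) ∎
   where
   open N.≤-Reasoning
   term : Carrier → Vec Carrier 7 → ℕ
   term r v = ζ (evaluate r (discriminant□ v)) N.* rootless (quotient-by r (discriminant□ v))
   q3 : (b2 r : Carrier) → Carrier
   q3 b2 r = (b2 * b2 - 4# * 0#) + r * 0#
   q2 : (a b2 b1 r : Carrier) → Carrier
   q2 a b2 b1 r = 2* (b1 * b2) - 4# * (a * a) + r * q3 b2 r
   cubic : (a b2 b1 r k1 k0 : Carrier) → ℕ
   cubic a b2 b1 r k1 k0 = rootless (k0 ∷ k1 ∷ q2 a b2 b1 r ∷ q3 b2 r ∷ 0# ∷ [])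
   cubic-cong : ∀ a b2 b1 r {k1 k1′ k0 k0′} → k1 ≈ k1′ → k0 ≈ k0′ → cubic a b2 b1 r k1 k0 ≡ cubic a b2 b1 r k1′ k0′
   cubic-cong a b2 b1 r {k1} {k1′} {k0} {k0′} e1 e0 = rootless-cong {k0 ∷ k1 ∷ q2 a b2 b1 r ∷ q3 b2 r ∷ 0# ∷ []} {k0′ ∷ k1′ ∷ q2 a b2 b1 r ∷ q3 b2 r ∷ 0# ∷ []}
    (∷-cong e0 (∷-cong e1 ≋-refl))
   for-root : ∀ a b2 b1 b0 r → ¬ (a ≈ 0#) →
    ∑ₑ (λ c2 → ∑ₑ (λ c1 → ∑ₑ (λ c0 → term r (a ∷ b2 ∷ b1 ∷ b0 ∷ c2 ∷ c1 ∷ c0 ∷ [])))) ≡ ∑ₑ (λ k1 → ∑ₑ (λ k0 → cubic a b2 b1 r k1 k0))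
   for-root a b2 b1 b0 r a≉0 = ≡.trans
    (∑-cong elements λ c2 → ≡.trans
     (∑-cong elements λ c1 → ≡.trans
      (∑-cong elements λ c0 → ≡.cong₂ N._*_ (ζ-cong (remainder c2 c1 c0))
       (rootless-cong {quotient-by r (discriminant□ (a ∷ b2 ∷ b1 ∷ b0 ∷ c2 ∷ c1 ∷ c0 ∷ []))} {u * c1 + w0 c2 ∷ u * c2 + w1 ∷ q2 a b2 b1 r ∷ q3 b2 r ∷ 0# ∷ []}
        (∷-cong (entry0 c2 c1 c0) (∷-cong (entry1 c2 c1) (∷-cong (entry2 c2) ≋-refl)))))
      (≡.trans (∑-*ʳ elements (cubic a b2 b1 r (u * c2 + w1) (u * c1 + w0 c2)) _)
       (≡.trans (≡.cong (N._* cubic a b2 b1 r (u * c2 + w1) (u * c1 + w0 c2)) (∑-affine-root u≉0 (w₋ c2 c1))) (N.*-identityˡ _))))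
     (∑-reindex {λ k0 → cubic a b2 b1 r (u * c2 + w1) k0} (λ e → cubic-cong a b2 b1 r refl e) (proj₂ (inv u≉0)) (w0 c2)))
    (∑-reindex {λ k1 → ∑ₑ (λ k0 → cubic a b2 b1 r k1 k0)} (λ e → ∑-cong elements λ k0 → cubic-cong a b2 b1 r e refl) (proj₂ (inv u≉0)) w1)
    where
    u w1 : Carrier
    u = - (4# * (a * a))
    w1 = b1 * b1 + 2* (b0 * b2) + r * q2 a b2 b1 r
    w0 : Carrier → Carrier
    w0 c2 = 2* (b0 * b1) + r * (u * c2 + w1)
    w₋ : Carrier → Carrier → Carrier
    w₋ c2 c1 = b0 * b0 + r * (u * c1 + w0 c2)
    u≉0 : ¬ (u ≈ 0#)
    u≉0 = neg≉0 (*-≉0 4≉0 (*-≉0 a≉0 a≉0))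
    entry2 : ∀ c2 → evaluate r (2* (b1 * b2) - 4# * (a * a + 0# * c2) ∷ b2 * b2 - 4# * 0# ∷ []) ≈ q2 a b2 b1 r
    entry2 c2 = +-congʳ (+-congˡ (-‿cong (*-congˡ (trans (+-congˡ (zeroˡ c2)) (+-identityʳ _)))))
    affine : ∀ {d k z} → evaluate r (d ∷ []) ≈ d → k ≈ z → d + r * k ≈ d + r * z
    affine _ e = +-congˡ (*-congˡ e)
    entry1 : ∀ c2 c1 → evaluate r (b1 * b1 + 2* (b0 * b2) - 4# * (a * a * c2 + 0# * c1) ∷ 2* (b1 * b2) - 4# * (a * a + 0# * c2) ∷ b2 * b2 - 4# * 0# ∷ []) ≈ u * c2 + w1
    entry1 c2 c1 = trans (+-congˡ (*-congˡ (entry2 c2)))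
     (solve 5 (λ s a c2 c1 z → s :- :4 :* (a :* a :* c2 :+ :0 :* c1) :+ z := (:- (:4 :* (a :* a))) :* c2 :+ (s :+ z)) (b1 * b1 + 2* (b0 * b2)) a c2 c1 (r * q2 a b2 b1 r))
    entry0 : ∀ c2 c1 c0 → evaluate r (2* (b0 * b1) - 4# * (a * a * c1 + 0# * c0) ∷ b1 * b1 + 2* (b0 * b2) - 4# * (a * a * c2 + 0# * c1) ∷ 2* (b1 * b2) - 4# * (a * a + 0# * c2) ∷ b2 * b2 - 4# * 0# ∷ [])
          ≈ u * c1 + w0 c2
    entry0 c2 c1 c0 = trans (+-congˡ (*-congˡ (entry1 c2 c1)))
     (solve 5 (λ s a c1 c0 z → s :- :4 :* (a :* a :* c1 :+ :0 :* c0) :+ z := (:- (:4 :* (a :* a))) :* c1 :+ (s :+ z)) (2* (b0 * b1)) a c1 c0 (r * (u * c2 + w1)))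
    remainder : ∀ c2 c1 c0 → evaluate r (discriminant□ (a ∷ b2 ∷ b1 ∷ b0 ∷ c2 ∷ c1 ∷ c0 ∷ [])) ≈ u * c0 + w₋ c2 c1
    remainder c2 c1 c0 = trans (+-congˡ (*-congˡ (entry0 c2 c1 c0)))
     (solve 4 (λ s a c0 z → s :- :4 :* (a :* a :* c0) :+ z := (:- (:4 :* (a :* a))) :* c0 :+ (s :+ z)) (b0 * b0) a c0 (r * (u * c1 + w0 c2)))

  many-squareℓ : size N.^ 6 N.≤ 80 N.* ∑ᵛ 6 certificateℓ-square
  many-squareℓ = begin
   size N.* (size N.^ 5) ≤⟨ N.*-monoˡ-≤ (size N.^ 5) many-nonsquares ⟩
   20 N.* nonsquares N.* (size N.^ 5)
    ≤⟨ N.*-monoˡ-≤ (size N.^ 5) (N.*-monoˡ-≤ nonsquares (N.m≤m+n 20 60)) ⟩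
   80 N.* nonsquares N.* (size N.^ 5) ≡⟨ N.*-assoc 80 nonsquares (size N.^ 5) ⟩
   80 N.* (nonsquares N.* (size N.^ 5)) ≡⟨ ≡.cong (80 N.*_) (∑-*ʳ elements (size N.^ 5) _) ⟨
   80 N.* ∑ₑ (λ a1 → rootless (a1 ∷ 0# ∷ 1# ∷ []) N.* (size N.^ 5))
    ≡⟨ ≡.cong (80 N.*_) (∑-cong elements λ a1 → ≡.trans (N.*-comm _ (size N.^ 5)) (≡.sym (∑ᵛ-const 5 _))) ⟩
   80 N.* ∑ᵛ 6 certificateℓ-square ∎
   where
   open N.≤-Reasoning
   nonsquares : ℕ
   nonsquares = ∑ₑ (λ v → rootless (v ∷ 0# ∷ 1# ∷ []))
   ∑ᵛ-const : ∀ m k → ∑ᵛ m (λ _ → k) ≡ size N.^ m N.* k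
   ∑ᵛ-const zero k = ≡.sym (N.*-identityˡ k)
   ∑ᵛ-const (suc m) k = ≡.trans (∑-const elements _) (≡.trans (≡.cong (size N.*_) (∑ᵛ-const m k)) (≡.sym (N.*-assoc size (size N.^ m) k)))

  -- Here u = - 4 A vanishes at the zero ξ of A, where the discriminant is the square of the value
  -- of B. One b0 is left out to keep that value nonzero, and ξ is the only x lost from the count of
  -- points. Excluding this b0 and a1 = 0 costs 2 · 2 on top of 20.
  many-rootlessℓ : size N.^ 6 N.≤ 80 N.* ∑ᵛ 6 certificateℓ-rootless
  many-rootlessℓ = ∑-large-≉ {k = 40} 2≤size 0# λ a1 a1≉0 → ∑-large {k = 40} λ a0 → ∑-large {k = 40} λ b1 →
   ∑-large-≉ {k = 20} 2≤size (- (b1 * ξ a1 a0 a1≉0)) λ b0 b0≉ → begin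
    size N.* (size N.* 1) ≡⟨ ≡.cong (size N.*_) (N.*-identityʳ size) ⟩
    size N.* size
     ≤⟨ Lines.many-rootless (λ x → - (4# * (a0 + a1 * x))) (λ x → (b0 + b1 * x) * (b0 + b1 * x) - 4# * ((a0 + a1 * x) * (x * (x * x))))
        (λ e → -‿cong (*-congˡ (+-congˡ (*-congˡ e))))
        (λ e → +-cong (*-cong (+-congˡ (*-congˡ e)) (+-congˡ (*-congˡ e))) (-‿cong (*-congˡ (*-cong (+-congˡ (*-congˡ e)) (*-cong e (*-cong e e))))))
        (λ x ux≈0 wx≈0 → b0≉ (nonvanishing a1 a0 b1 b0 a1≉0 x ux≈0 wx≈0))
        4 N.≤-refl 3≤size (few-excluded a1 a0 a1≉0)
        (λ c1 c0 → discriminantℓ (a1 ∷ a0 ∷ b1 ∷ b0 ∷ c1 ∷ c0 ∷ []))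
        (λ c1 c0 x → solve 7 (λ a1 a0 b1 b0 c1 c0 x →
          (b0 :* b0 :- :4 :* (a0 :* c0)) :+ x :* ((b0 :* b1 :+ b0 :* b1 :- :4 :* (a0 :* c1 :+ a1 :* c0)) :+ x :* ((b1 :* b1 :+ (b0 :* :0 :+ b0 :* :0) :- :4 :* (a0 :* :0 :+ a1 :* c1))
           :+ x :* ((b1 :* :0 :+ b1 :* :0 :- :4 :* (a0 :+ a1 :* :0)) :+ x :* ((:0 :* :0 :- :4 :* a1) :+ x :* :0))))
          := (:- (:4 :* (a0 :+ a1 :* x))) :* (c1 :* x :+ c0) :+ ((b0 :+ b1 :* x) :* (b0 :+ b1 :* x) :- :4 :* ((a0 :+ a1 :* x) :* (x :* (x :* x))))) a1 a0 b1 b0 c1 c0 x)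
        (λ c1 c0 → roots≤degree 4 (discriminantℓ (a1 ∷ a0 ∷ b1 ∷ b0 ∷ c1 ∷ c0 ∷ [])) (⊏-length (discriminantℓ (a1 ∷ a0 ∷ b1 ∷ b0 ∷ c1 ∷ c0 ∷ [])))
         (λ z → neg≉0 (*-≉0 4≉0 a1≉0) (trans (solve 1 (λ a → :- (:4 :* a) := :0 :* :0 :- :4 :* a) a1) (at z 4)))) ⟩
    20 N.* ∑ₑ (λ c1 → ∑ₑ (λ c0 → rootless (discriminantℓ (a1 ∷ a0 ∷ b1 ∷ b0 ∷ c1 ∷ c0 ∷ []))))
     ≡⟨ ≡.cong (20 N.*_) (∑-cong elements λ c1 → ∑-cong elements λ c0 → ≡.sym (ν* a1≉0 _)) ⟩
    20 N.* ∑ₑ (λ c1 → ∑ₑ (λ c0 → certificateℓ-rootless (a1 ∷ a0 ∷ b1 ∷ b0 ∷ c1 ∷ c0 ∷ []))) ∎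
   where
   open N.≤-Reasoning
   ξ : ∀ a1 a0 → ¬ (a1 ≈ 0#) → Carrier
   ξ a1 a0 a1≉0 = - (a0 * proj₁ (inv a1≉0))
   root : ∀ a1 a0 (a1≉0 : ¬ (a1 ≈ 0#)) x → - (4# * (a0 + a1 * x)) ≈ 0# → x ≈ ξ a1 a0 a1≉0
   root a1 a0 a1≉0 x e = ≈R.begin
    x ≈R.≈⟨ solve 1 (λ x → x := :1 :* x) x ⟩
    1# * x ≈R.≈⟨ *-congʳ (proj₂ (inv a1≉0)) ⟨
    i * a1 * x ≈R.≈⟨ solve 4 (λ i a1 a0 x → i :* a1 :* x := i :* (a0 :+ a1 :* x) :+ :- (a0 :* i)) i a1 a0 x ⟩
    i * (a0 + a1 * x) + ξ a1 a0 a1≉0 ≈R.≈⟨ trans (+-congʳ (trans (*-congˡ A≈0) (zeroʳ i))) (+-identityˡ _) ⟩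
    ξ a1 a0 a1≉0 ≈R.∎
    where
    i : Carrier
    i = proj₁ (inv a1≉0)
    A≈0 : a0 + a1 * x ≈ 0#
    A≈0 = cancel-≈0 (- 4#) (neg≉0 4≉0) (trans (solve 1 (λ A → (:- :4) :* A := :- (:4 :* A)) (a0 + a1 * x)) e)
   nonvanishing : ∀ a1 a0 b1 b0 (a1≉0 : ¬ (a1 ≈ 0#)) x → - (4# * (a0 + a1 * x)) ≈ 0# →
    (b0 + b1 * x) * (b0 + b1 * x) - 4# * ((a0 + a1 * x) * (x * (x * x))) ≈ 0# → b0 ≈ - (b1 * ξ a1 a0 a1≉0)
   nonvanishing a1 a0 b1 b0 a1≉0 x ux≈0 wx≈0 = trans (solve 2 (λ b z → b := (b :+ z) :+ :- z) b0 (b1 * x))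
    (trans (+-cong (square-≈0 (trans (solve 3 (λ s A z → s := (s :- :4 :* (A :* z)) :+ :- ((:- (:4 :* A)) :* z)) ((b0 + b1 * x) * (b0 + b1 * x)) (a0 + a1 * x) (x * (x * x)))
     (trans (+-cong wx≈0 (-‿cong (trans (*-congʳ ux≈0) (zeroˡ _)))) (-‿inverseʳ 0#)))) (-‿cong (*-congˡ (root a1 a0 a1≉0 x ux≈0)))) (+-identityˡ _))
   few-excluded : ∀ a1 a0 → ¬ (a1 ≈ 0#) → size N.≤ suc (∑ₑ (λ x → ν (- (4# * (a0 + a1 * x)))))
   few-excluded a1 a0 a1≉0 = ≡.subst (N._≤ suc (∑ₑ (λ x → ν (- (4# * (a0 + a1 * x)))))) (count-≉ (ξ a1 a0 a1≉0))
    (s≤s (∑-mono elements λ x → 𝟙-⇒ (¬? (x ≟ ξ a1 a0 a1≉0)) (¬? (zero? (- (4# * (a0 + a1 * x))))) (λ ne z → ne (root a1 a0 a1≉0 x z))))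

  -- Writing A = a1 (X - ξ), B = 2 a1 (β (X - ξ) + σ) and D = - 4 a1 ((X - r) K + ρ), the roots ξ and r,
  -- β, σ and the coefficients of K can be prescribed; then ρ = - a1 σ² - (ξ - r) K(ξ) determines a1.
  many-simpleℓ : size N.^ 6 N.≤ 80 N.* ∑ᵛ 6 certificateℓ-simple
  many-simpleℓ = begin
   size N.^ 6 ≤⟨ ∑-large {k = 80} for-root ⟩
   80 N.* ∑ₑ (λ r → ∑ᵛ 6 (λ v → G r v))
    ≡⟨ ≡.cong (80 N.*_) (∑ᵛ-swap 6 G) ⟩
   80 N.* ∑ᵛ 6 (λ v → ∑ₑ (λ r → G r v))
    ≡⟨ ≡.cong (80 N.*_) (∑ᵛ-cong 6 {λ v → ∑ₑ (λ r → G r v)} {certificateℓ-simple} λ { (a1 ∷ v) → ∑-*ˡ elements (ν a1) (λ r → term r (a1 ∷ v)) }) ⟩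
   80 N.* ∑ᵛ 6 certificateℓ-simple ∎
   where
   open N.≤-Reasoning
   term : Carrier → Vec Carrier 6 → ℕ
   term r v = ζ (evaluate r (discriminantℓ v)) N.* rootless (quotient-by r (discriminantℓ v))
   G : Carrier → Vec Carrier 6 → ℕ
   G r v@(a1 ∷ _) = ν a1 N.* term r v
   t : (r a1 a0 b1 b0 c1 c0 : Carrier) → ℕ
   t r a1 a0 b1 b0 c1 c0 = term r (a1 ∷ a0 ∷ b1 ∷ b0 ∷ c1 ∷ c0 ∷ [])
   t-cong : ∀ r a1 {a0 b1 b0 c1 c0 a0′ b1′ b0′ c1′ c0′} → a0 ≈ a0′ → b1 ≈ b1′ → b0 ≈ b0′ → c1 ≈ c1′ → c0 ≈ c0′ → t r a1 a0 b1 b0 c1 c0 ≡ t r a1 a0′ b1′ b0′ c1′ c0′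
   t-cong r a1 {a0} {b1} {b0} {c1} {c0} {a0′} {b1′} {b0′} {c1′} {c0′} A0 B1 B0 C1 C0 =
    simple-term-cong r {discriminantℓ (a1 ∷ a0 ∷ b1 ∷ b0 ∷ c1 ∷ c0 ∷ [])} {discriminantℓ (a1 ∷ a0′ ∷ b1′ ∷ b0′ ∷ c1′ ∷ c0′ ∷ [])}
     (discriminant-cong A0 refl B0 B1 refl C0 C1 refl)
   module _ (r : Carrier) where
    -- Each coefficient of the curve is an affine function of one new parameter, with a slope that
    -- is invertible for a1 ≠ 0; the summands 0# give it the shape u x + w of `∑-reindex`.
    α0 : (a1 ξ : Carrier) → Carrier
    α0 a1 ξ = - a1 * ξ + 0#
    β1 : (a1 β : Carrier) → Carrier
    β1 a1 β = (a1 + a1) * β + 0#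
    β0 : (a1 ξ β σ : Carrier) → Carrier
    β0 a1 ξ β σ = (a1 + a1) * σ + - (β1 a1 β * ξ)
    γ1 : (a1 ξ β κ1 : Carrier) → Carrier
    γ1 a1 ξ β κ1 = κ1 + (a1 * (β * β) - r * (r - ξ))
    γ0 : (a1 ξ β σ κ1 κ0 : Carrier) → Carrier
    γ0 a1 ξ β σ κ1 κ0 = κ0 + (ξ * γ1 a1 ξ β κ1 + (a1 + a1) * (β * (σ - β * ξ)) - r * κ1)
    K : (ξ κ1 κ0 : Carrier) → Poly
    K ξ κ1 κ0 = κ0 ∷ κ1 ∷ r - ξ ∷ 1# ∷ 0# ∷ []
    ρ : (a1 ξ σ κ1 κ0 : Carrier) → Carrier
    ρ a1 ξ σ κ1 κ0 = (- (σ * σ)) * a1 + - ((ξ - r) * evaluate ξ (K ξ κ1 κ0))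
    T : (a1 ξ β σ κ1 κ0 : Carrier) → ℕ
    T a1 ξ β σ κ1 κ0 = ζ (ρ a1 ξ σ κ1 κ0) N.* rootless (K ξ κ1 κ0)
    T* : Carrier → Vec Carrier 5 → ℕ
    T* a1 (ξ ∷ β ∷ σ ∷ κ1 ∷ κ0 ∷ []) = ν a1 N.* T a1 ξ β σ κ1 κ0
    scaled : ∀ {u} → ¬ (u ≈ 0#) → ∀ k0 k1 k2 → rootless (u * k0 ∷ u * k1 ∷ u * k2 ∷ u ∷ 0# ∷ []) ≡ rootless (k0 ∷ k1 ∷ k2 ∷ 1# ∷ 0# ∷ [])
    scaled {u} u≉0 k0 k1 k2 = ≡.cong (λ n → 𝟙 (n N.≟ 0)) (∑-cong elements λ x → ≡.trans
     (ζ-cong (solve 5 (λ u k0 k1 k2 x → u :* k0 :+ x :* (u :* k1 :+ x :* (u :* k2 :+ x :* (u :+ x :* (:0 :+ x :* :0))))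
      := u :* (k0 :+ x :* (k1 :+ x :* (k2 :+ x :* (:1 :+ x :* (:0 :+ x :* :0)))))) u k0 k1 k2 x)) (ζ-scale u≉0))
    substituted : ∀ {a1} → ¬ (a1 ≈ 0#) → ∀ ξ β σ κ1 κ0 →
     t r a1 (α0 a1 ξ) (β1 a1 β) (β0 a1 ξ β σ) (γ1 a1 ξ β κ1) (γ0 a1 ξ β σ κ1 κ0) ≡ T a1 ξ β σ κ1 κ0
    substituted {a1} a1≉0 ξ β σ κ1 κ0 = ≡.cong₂ N._*_ (≡.trans (ζ-cong remainder) (ζ-scale u≉0)) (≡.trans
     (rootless-cong {quotient-by r (discriminantℓ (a1 ∷ α0 a1 ξ ∷ β1 a1 β ∷ β0 a1 ξ β σ ∷ γ1 a1 ξ β κ1 ∷ γ0 a1 ξ β σ κ1 κ0 ∷ []))}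
      {u * κ0 ∷ u * κ1 ∷ u * (r - ξ) ∷ u ∷ 0# ∷ []} (∷-cong entry0 (∷-cong entry1 (∷-cong entry2 (∷-cong entry3 ≋-refl)))))
     (scaled u≉0 κ0 κ1 (r - ξ)))
     where
     a0 b1 b0 c1 c0 u d0 d1 d2 d3 d4 : Carrier
     a0 = α0 a1 ξ
     b1 = β1 a1 β
     b0 = β0 a1 ξ β σ
     c1 = γ1 a1 ξ β κ1
     c0 = γ0 a1 ξ β σ κ1 κ0
     u = - (4# * a1)
     d0 = b0 * b0 - 4# * (a0 * c0)
     d1 = 2* (b0 * b1) - 4# * (a0 * c1 + a1 * c0)
     d2 = b1 * b1 + 2* (b0 * 0#) - 4# * (a0 * 0# + a1 * c1)
     d3 = 2* (b1 * 0#) - 4# * (a0 + a1 * 0#)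
     d4 = 0# * 0# - 4# * a1
     u≉0 : ¬ (u ≈ 0#)
     u≉0 = neg≉0 (*-≉0 4≉0 a1≉0)
     entry3 : evaluate r (d4 ∷ []) ≈ u
     entry3 = solve 2 (λ a r → (:0 :* :0 :- :4 :* a) :+ r :* :0 := :- (:4 :* a)) a1 r
     entry2 : evaluate r (d3 ∷ d4 ∷ []) ≈ u * (r - ξ)
     entry2 = trans (+-congˡ (*-congˡ entry3)) (solve 4 (λ a b ξ r → ((b :* :0 :+ b :* :0) :- :4 :* ((:- a :* ξ :+ :0) :+ a :* :0)) :+ r :* (:- (:4 :* a)) := (:- (:4 :* a)) :* (r :- ξ)) a1 b1 ξ r)
     entry1 : evaluate r (d2 ∷ d3 ∷ d4 ∷ []) ≈ u * κ1
     entry1 = trans (+-congˡ (*-congˡ entry2)) (solve 7 (λ a a0 b β ξ κ r →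
      let b1 = (a :+ a) :* β :+ :0 ; c1 = κ :+ (a :* (β :* β) :- r :* (r :- ξ)) in
      (b1 :* b1 :+ (b :* :0 :+ b :* :0) :- :4 :* (a0 :* :0 :+ a :* c1)) :+ r :* ((:- (:4 :* a)) :* (r :- ξ)) := (:- (:4 :* a)) :* κ) a1 a0 b0 β ξ κ1 r)
     entry0 : evaluate r (d1 ∷ d2 ∷ d3 ∷ d4 ∷ []) ≈ u * κ0
     entry0 = trans (+-congˡ (*-congˡ entry1)) (solve 8 (λ a c β σ ξ κ1 κ0 r →
      let b1 = (a :+ a) :* β :+ :0 ; a0 = :- a :* ξ :+ :0 ; b0 = (a :+ a) :* σ :+ :- (b1 :* ξ) ; c0 = κ0 :+ (ξ :* c :+ (a :+ a) :* (β :* (σ :- β :* ξ)) :- r :* κ1) in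
      ((b0 :* b1 :+ b0 :* b1) :- :4 :* (a0 :* c :+ a :* c0)) :+ r :* ((:- (:4 :* a)) :* κ1) := (:- (:4 :* a)) :* κ0) a1 c1 β σ ξ κ1 κ0 r)
     remainder : evaluate r (d0 ∷ d1 ∷ d2 ∷ d3 ∷ d4 ∷ []) ≈ u * ρ a1 ξ σ κ1 κ0
     remainder = trans (+-congˡ (*-congˡ entry0)) (solve 7 (λ a β σ ξ κ1 κ0 r →
      let b1 = (a :+ a) :* β :+ :0 ; a0 = :- a :* ξ :+ :0 ; b0 = (a :+ a) :* σ :+ :- (b1 :* ξ) ; c1 = κ1 :+ (a :* (β :* β) :- r :* (r :- ξ)) ; c0 = κ0 :+ (ξ :* c1 :+ (a :+ a) :* (β :* (σ :- β :* ξ)) :- r :* κ1) in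
      (b0 :* b0 :- :4 :* (a0 :* c0)) :+ r :* ((:- (:4 :* a)) :* κ0)
       := (:- (:4 :* a)) :* ((:- (σ :* σ)) :* a :+ :- ((ξ :- r) :* (κ0 :+ ξ :* (κ1 :+ ξ :* ((r :- ξ) :+ ξ :* (:1 :+ ξ :* (:0 :+ ξ :* :0)))))))) a1 β σ ξ κ1 κ0 r)
    reindexed : ∀ {a1} → ¬ (a1 ≈ 0#) → ∑ᵛ 5 (λ v → term r (a1 ∷ v)) ≡ ∑ᵛ 5 (λ { (ξ ∷ β ∷ σ ∷ κ1 ∷ κ0 ∷ []) → T a1 ξ β σ κ1 κ0 })
    reindexed {a1} a1≉0 = ≡.sym (≡.trans
     (∑-cong elements λ ξ → ≡.trans
      (∑-cong elements λ β → ≡.trans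
       (∑-cong elements λ σ → ≡.trans
        (∑-cong elements λ κ1 → ≡.trans
         (∑-cong elements λ κ0 → ≡.sym (substituted a1≉0 ξ β σ κ1 κ0))
         (∑-translate {λ c0 → t r a1 (α0 a1 ξ) (β1 a1 β) (β0 a1 ξ β σ) (γ1 a1 ξ β κ1) c0} (λ e → t-cong r a1 refl refl refl refl e)
          (ξ * γ1 a1 ξ β κ1 + (a1 + a1) * (β * (σ - β * ξ)) - r * κ1)))
        (∑-translate {λ c1 → ∑ₑ (λ c0 → t r a1 (α0 a1 ξ) (β1 a1 β) (β0 a1 ξ β σ) c1 c0)}
         (λ e → ∑-cong elements λ c0 → t-cong r a1 refl refl refl e refl) (a1 * (β * β) - r * (r - ξ))))
       (∑-reindex {λ b0 → ∑ₑ (λ c1 → ∑ₑ (λ c0 → t r a1 (α0 a1 ξ) (β1 a1 β) b0 c1 c0))}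
        (λ e → ∑-cong elements λ c1 → ∑-cong elements λ c0 → t-cong r a1 refl refl e refl refl) (proj₂ (inv (2*≉0 a1≉0))) (- (β1 a1 β * ξ))))
      (∑-reindex {λ b1 → ∑ₑ (λ b0 → ∑ₑ (λ c1 → ∑ₑ (λ c0 → t r a1 (α0 a1 ξ) b1 b0 c1 c0)))}
       (λ e → ∑-cong elements λ b0 → ∑-cong elements λ c1 → ∑-cong elements λ c0 → t-cong r a1 refl e refl refl refl) (proj₂ (inv (2*≉0 a1≉0))) 0#))
     (∑-reindex {λ a0 → ∑ₑ (λ b1 → ∑ₑ (λ b0 → ∑ₑ (λ c1 → ∑ₑ (λ c0 → t r a1 a0 b1 b0 c1 c0))))}
      (λ e → ∑-cong elements λ b1 → ∑-cong elements λ b0 → ∑-cong elements λ c1 → ∑-cong elements λ c0 → t-cong r a1 e refl refl refl refl) (proj₂ (inv (neg≉0 a1≉0))) 0#))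
    restricted : ∀ a1 → Dec (a1 ≈ 0#) → ∑ᵛ 5 (λ v → G r (a1 ∷ v)) ≡ ∑ᵛ 5 (T* a1)
    restricted a1 (yes z) = ∑ᵛ-cong 5 {λ v → G r (a1 ∷ v)} {T* a1} λ { (ξ ∷ β ∷ σ ∷ κ1 ∷ κ0 ∷ []) → ≡.trans (≡.cong (N._* term r (a1 ∷ ξ ∷ β ∷ σ ∷ κ1 ∷ κ0 ∷ [])) (ν≡0 z)) (≡.cong (N._* T a1 ξ β σ κ1 κ0) (≡.sym (ν≡0 z))) }
     where
     ν≡0 : a1 ≈ 0# → ν a1 ≡ 0
     ν≡0 z = 𝟙-no (¬? (zero? a1)) (λ ne → ne z)
    restricted a1 (no a1≉0) = ≡.trans (∑ᵛ-*ˡ 5 (ν a1) (λ v → term r (a1 ∷ v))) (≡.trans (≡.cong (ν a1 N.*_) (reindexed a1≉0))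
     (≡.sym (∑ᵛ-*ˡ 5 (ν a1) (λ { (ξ ∷ β ∷ σ ∷ κ1 ∷ κ0 ∷ []) → T a1 ξ β σ κ1 κ0 }))))
    -- ρ is affine in a1 with slope - σ², so exactly one a1 makes it vanish. This a1 is not 0,
    -- because at a1 = 0 the value is - (ξ - r) K(ξ), which is nonzero for ξ ≠ r when K has no root.
    determined : ∀ {ξ σ} → ¬ (ξ ≈ r) → ¬ (σ ≈ 0#) → ∀ β κ1 κ0 → rootless (K ξ κ1 κ0) N.≤ ∑ₑ (λ a1 → ν a1 N.* T a1 ξ β σ κ1 κ0)
    determined {ξ} {σ} ξ≉r σ≉0 β κ1 κ0 = cases (rootless (K ξ κ1 κ0) N.≟ 0)
     where
     cases : Dec (rootless (K ξ κ1 κ0) ≡ 0) → rootless (K ξ κ1 κ0) N.≤ ∑ₑ (λ a1 → ν a1 N.* T a1 ξ β σ κ1 κ0)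
     cases (yes e) = N.≤-trans (N.≤-reflexive e) z≤n
     cases (no ne) = N.≤-reflexive (≡.sym (≡.trans (∑-cong elements λ a1 → nonzero a1 (zero? a1)) (≡.trans
      (∑-*ʳ elements (rootless (K ξ κ1 κ0)) (λ a1 → ζ (ρ a1 ξ σ κ1 κ0)))
      (≡.trans (≡.cong (N._* rootless (K ξ κ1 κ0)) (∑-affine-root (neg≉0 (*-≉0 σ≉0 σ≉0)) (- ((ξ - r) * evaluate ξ (K ξ κ1 κ0))))) (N.*-identityˡ _)))))
      where
      nonzero : ∀ a1 → Dec (a1 ≈ 0#) → ν a1 N.* T a1 ξ β σ κ1 κ0 ≡ T a1 ξ β σ κ1 κ0
      nonzero a1 (no a1≉0) = ν* a1≉0 _
      nonzero a1 (yes z) = ≡.trans (≡.cong (ν a1 N.*_) T≡0) (≡.trans (N.*-zeroʳ (ν a1)) (≡.sym T≡0))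
       where
       T≡0 : T a1 ξ β σ κ1 κ0 ≡ 0
       T≡0 = ≡.cong (N._* rootless (K ξ κ1 κ0)) (𝟙-no (zero? (ρ a1 ξ σ κ1 κ0)) λ e →
        neg≉0 (*-≉0 (λ z → ξ≉r (x∙y⁻¹≈ε⇒x≈y ξ r z)) (rootless⇒NoRoot {K ξ κ1 κ0} ne ξ))
         (trans (sym (trans (+-congʳ (trans (*-congˡ z) (zeroʳ _))) (+-identityˡ _))) e))
    for-root : size N.^ 5 N.≤ 80 N.* ∑ᵛ 6 (G r)
    for-root = begin
     size N.^ 5
      ≤⟨ ∑-large-≉ {k = 40} 2≤size r (λ ξ ξ≉r → ∑-large {k = 40} λ β → ∑-large-≉ {k = 20} 2≤size 0# λ σ σ≉0 →
         N.≤-trans (N.≤-reflexive (≡.cong (size N.*_) (N.*-identityʳ size))) (N.≤-trans (many-cubics 1≉0 (r - ξ))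
          (N.*-monoʳ-≤ 20 (∑-mono elements λ κ1 → ∑-mono elements λ κ0 → determined ξ≉r σ≉0 β κ1 κ0)))) ⟩
     80 N.* ∑ᵛ 5 (λ { (ξ ∷ β ∷ σ ∷ κ1 ∷ κ0 ∷ []) → ∑ₑ (λ a1 → ν a1 N.* T a1 ξ β σ κ1 κ0) })
      ≡⟨ ≡.cong (80 N.*_) (∑ᵛ-swap 5 T*) ⟨
     80 N.* ∑ₑ (λ a1 → ∑ᵛ 5 (T* a1))
      ≡⟨ ≡.cong (80 N.*_) (∑-cong elements λ a1 → restricted a1 (zero? a1)) ⟨
     80 N.* ∑ᵛ 6 (G r) ∎

-- Intervals of integers, periodic sums and residues modulo a prime

ℤ-ring : CommutativeRing 0ℓ 0ℓ
ℤ-ring = ℤ.+-*-commutativeRing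

open IntegerSolver ℤ-ring public using () renaming (solve to solveℤ)

interval : ℤ → ℕ → List ℤ
interval a zero = []
interval a (suc n) = a ∷ interval (1ℤ ℤ.+ a) n

length-interval : ∀ a n → length (interval a n) ≡ n
length-interval a zero = ≡.refl
length-interval a (suc n) = ≡.cong suc (length-interval _ n)

∑-interval-++ : ∀ a m n g → ∑ (interval a (m N.+ n)) g ≡ ∑ (interval a m) g N.+ ∑ (interval (+ m ℤ.+ a) n) g
∑-interval-++ a zero n g = ≡.cong (λ a → ∑ (interval a n) g) (≡.sym (ℤ.+-identityˡ a))
∑-interval-++ a (suc m) n g = ≡.trans (≡.cong (g a N.+_) (≡.trans (∑-interval-++ (1ℤ ℤ.+ a) m n g)
 (≡.cong (λ b → ∑ (interval (1ℤ ℤ.+ a) m) g N.+ ∑ (interval b n) g) (solveℤ 2 (λ m a → m :+ (:1 :+ a) := (:1 :+ m) :+ a) (+ m) a))))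
 (≡.sym (N.+-assoc (g a) _ _))

∑-interval-translate : ∀ b a n g → ∑ (interval (b ℤ.+ a) n) g ≡ ∑ (interval a n) (λ i → g (b ℤ.+ i))
∑-interval-translate b a zero g = ≡.refl
∑-interval-translate b a (suc n) g = ≡.cong (g (b ℤ.+ a) N.+_) (≡.trans
 (≡.cong (λ c → ∑ (interval c n) g) (solveℤ 2 (λ a b → :1 :+ (b :+ a) := b :+ (:1 :+ a)) a b))
 (∑-interval-translate b (1ℤ ℤ.+ a) n g))

infix 4 _≡_[mod_]
_≡_[mod_] : ℤ → ℤ → ℕ → Set
x ≡ y [mod M ] = Quotient._≈ᵐ_ ℤ-ring (+ M) x y

module ℤ∣ = Divisibility ℤ-ring

multiple : ∀ M q {x y} → x ≡ q ℤ.* + M ℤ.+ y → x ≡ y [mod M ]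
multiple M q {x} {y} e = Quotient.mod (ℤ∣.divides q (≡.trans (≡.cong (ℤ._- y) e) (solveℤ 2 (λ p y → p :+ y :- y := p) (q ℤ.* + M) y)))

signed∣ : ∀ {a b} → a ℤ∣.∣ b → a ℤ.∣ b
signed∣ (ℤ∣.divides q e) = ℤ.divides q e

∣signed : ∀ {a b} → a ℤ.∣ b → a ℤ∣.∣ b
∣signed (ℤ.divides q e) = ℤ∣.divides q e

Periodic : ℕ → (ℤ → ℕ) → Set
Periodic M g = ∀ {x y} → x ≡ y [mod M ] → g x ≡ g y

-- The interval of length M + 1 that starts at a can lose either end, and the two end terms agree by
-- periodicity. This moves the start by one in both directions.
∑-shift : ∀ {M g} → Periodic M g → ∀ a → ∑ (interval a M) g ≡ ∑ (interval 0ℤ M) g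
∑-shift {M} {g} per = from
 where
 step : ∀ a → ∑ (interval a M) g ≡ ∑ (interval (1ℤ ℤ.+ a) M) g
 step a = N.+-cancelˡ-≡ (g a) _ _ (≡.trans (N.+-comm (g a) _) (≡.sym (≡.trans
  (≡.trans (≡.cong (λ n → ∑ (interval a n) g) (N.+-comm 1 M)) (∑-interval-++ a M 1 g))
  (≡.cong (∑ (interval a M) g N.+_) (≡.trans (N.+-identityʳ _) (per (multiple M 1ℤ (≡.cong (ℤ._+ a) (≡.sym (ℤ.*-identityˡ (+ M)))))))))))
 from : ∀ a → ∑ (interval a M) g ≡ ∑ (interval 0ℤ M) g
 from (+ zero) = ≡.refl
 from (+ suc n) = ≡.trans (≡.sym (step (+ n))) (from (+ n))
 from -[1+ zero ] = step -[1+ 0 ]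
 from -[1+ suc n ] = ≡.trans (step -[1+ suc n ]) (from -[1+ n ])

-- By periodicity the interval may be taken to start at c itself; then c + j with 0 < j < M is not
-- congruent to c.
one-representative : ∀ M .{{_ : N.NonZero M}} c (d : ∀ x → Dec (x ≡ c [mod M ])) → ∑ (interval 0ℤ M) (λ x → 𝟙 (d x)) ≡ 1
one-representative M@(suc m) c d = ≡.trans (≡.sym (∑-shift {M} {λ x → 𝟙 (d x)} periodic c)) (≡.cong₂ N._+_
 (𝟙-yes (d c) (≈.refl {c})) (others m 1 (s≤s z≤n) N.≤-refl))
 where
 module ≈ = CommutativeRing (Quotient.quotientRing ℤ-ring (+ M))
 periodic : Periodic M (λ x → 𝟙 (d x))
 periodic {x} {y} e = 𝟙-⇔ (d x) (d y) (λ f → ≈.trans {y} {x} {c} (≈.sym {x} {y} e) f) (≈.trans {x} {y} {c} e)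
 others : ∀ n j → 1 N.≤ j → j N.+ n N.≤ M → ∑ (interval (+ j ℤ.+ c) n) (λ x → 𝟙 (d x)) ≡ 0
 others zero j 1≤j j+n≤M = ≡.refl
 others (suc n) j 1≤j j+n≤M = ≡.cong₂ N._+_ (𝟙-no (d (+ j ℤ.+ c)) excluded)
  (≡.trans (≡.cong (λ a → ∑ (interval a n) (λ x → 𝟙 (d x))) (≡.sym (ℤ.+-assoc 1ℤ (+ j) c)))
   (others n (suc j) (s≤s z≤n) (N.≤-trans (N.≤-reflexive (≡.sym (N.+-suc j n))) j+n≤M)))
  where
  excluded : ¬ (+ j ℤ.+ c ≡ c [mod M ])
  excluded e = N.<⇒≱ (N.≤-trans (N.≤-trans (N.≤-reflexive (N.+-comm 1 j)) (N.+-monoʳ-≤ j (s≤s z≤n))) j+n≤M)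
   (N.∣⇒≤ {{N.>-nonZero 1≤j}} (ℤ.∣⇒∣ᵤ (signed∣ (ℤ∣.∣-respʳ (solveℤ 2 (λ j c → j :+ c :- c := j) (+ j) c) (Quotient.m∣- e)))))

module ModPrime {ℓ : ℕ} (ℓ-prime : Prime ℓ) where

 open Quotient ℤ-ring (+ ℓ) public using (mod; m∣-; ∣⇒≈0; ≈0⇒∣; embed; quotientRing; projection)

 private
  nonZero : N.NonZero ℓ
  nonZero = N.≢-nonZero λ e → ¬prime[0] (≡.subst Prime e ℓ-prime)

  invert-ℕ : ∀ n → ¬ (ℓ N.∣ n) → Σ[ b ∈ ℤ ] b ℤ.* + n ≡ 1ℤ [mod ℓ ]
  invert-ℕ n ∤n with Coprimality.coprime-Bézout {ℓ} {n} coprime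
   where
   coprime : Coprimality.Coprime ℓ n
   coprime (d∣ℓ , d∣n) with prime⇒irreducible ℓ-prime d∣ℓ
   ... | inj₁ d≡1 = d≡1
   ... | inj₂ d≡ℓ = ⊥-elim (∤n (≡.subst (N._∣ n) d≡ℓ d∣n))
  ... | GCD.Bézout.+- x y e = ℤ.- (+ y) , multiple ℓ (ℤ.- (+ x)) (≡.trans
   (solveℤ 2 (λ y n → (:- y) :* n := :- (:1 :+ y :* n) :+ :1) (+ y) (+ n))
   (≡.cong (ℤ._+ 1ℤ) (≡.trans (≡.cong ℤ.-_ (≡.trans (≡.cong (λ n → 1ℤ ℤ.+ n) (≡.sym (ℤ.pos-* y n))) (≡.trans (≡.cong +_ e) (ℤ.pos-* x ℓ))))
    (solveℤ 2 (λ x l → :- (x :* l) := (:- x) :* l) (+ x) (+ ℓ)))))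
  ... | GCD.Bézout.-+ x y e = + y , multiple ℓ (+ x) (≡.trans (≡.sym (ℤ.pos-* y n)) (≡.trans (≡.cong +_ (≡.trans (≡.sym e) (N.+-comm 1 (x N.* ℓ))))
   (≡.cong (ℤ._+ 1ℤ) (ℤ.pos-* x ℓ))))

  invert′ : ∀ a → Dec (+ ℓ ℤ.∣ a) → (a ≡ 0ℤ [mod ℓ ]) ⊎ Σ[ b ∈ ℤ ] b ℤ.* a ≡ 1ℤ [mod ℓ ]
  invert′ a (yes d) = inj₁ (∣⇒≈0 (∣signed d))
  invert′ (+ n) (no ∤n) = inj₂ (invert-ℕ n λ d → ∤n (ℤ.∣ᵤ⇒∣ d))
  invert′ -[1+ n ] (no ∤n) with invert-ℕ (suc n) (λ d → ∤n (ℤ.∣ᵤ⇒∣ d))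
  ... | b , e = inj₂ (ℤ.- b , ≡.subst (_≡ 1ℤ [mod ℓ ]) (solveℤ 2 (λ b n → b :* n := (:- b) :* (:- n)) b (+ suc n)) e)

 𝔽 : DiscreteField 0ℓ 0ℓ
 𝔽 = record
  { commutativeRing = quotientRing
  ; invert = λ a → invert′ a (+ ℓ ℤ.∣? a)
  ; 1≉0 = λ e → ¬prime[1] (≡.subst Prime (N.∣1⇒≡1 (ℤ.∣⇒∣ᵤ (signed∣ (≈0⇒∣ e)))) ℓ-prime)
  }

 residues : List ℤ
 residues = interval 0ℤ ℓ

 unique-residue : ∀ a → ∑ residues (λ x → 𝟙 (DiscreteField._≟_ 𝔽 x a)) ≡ 1
 unique-residue a = one-representative ℓ {{nonZero}} a (λ x → DiscreteField._≟_ 𝔽 x a)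

 -- The Chinese remainder theorem: x = j M + i runs over all pairs (i , x mod ℓ).
 ∑-remainder : ∀ M → ¬ (ℓ N.∣ M) → ∀ {f g} → Periodic M f → Periodic ℓ g →
        ∑ (interval 0ℤ (ℓ N.* M)) (λ x → f x N.* g x) ≡ ∑ (interval 0ℤ M) f N.* ∑ residues g
 ∑-remainder M ℓ∤M {f} {g} f-per g-per = begin
  ∑ (interval 0ℤ (ℓ N.* M)) h ≡⟨ blocks ℓ 0ℤ ⟩
  ∑ residues (λ j → ∑ (interval (j ℤ.* + M) M) h)
   ≡⟨ ∑-cong residues (λ j → ≡.trans (≡.trans (≡.cong (λ a → ∑ (interval a M) h) (≡.sym (ℤ.+-identityʳ _))) (∑-interval-translate (j ℤ.* + M) 0ℤ M h))
      (∑-cong (interval 0ℤ M) λ i → ≡.cong₂ N._*_ (f-per (multiple M j ≡.refl)) (≡.cong (λ n → g (n ℤ.+ i)) (ℤ.*-comm j (+ M))))) ⟩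
  ∑ residues (λ j → ∑ (interval 0ℤ M) (λ i → f i N.* g (+ M ℤ.* j ℤ.+ i))) ≡⟨ ∑-swap residues (interval 0ℤ M) _ ⟩
  ∑ (interval 0ℤ M) (λ i → ∑ residues (λ j → f i N.* g (+ M ℤ.* j ℤ.+ i)))
   ≡⟨ ∑-cong (interval 0ℤ M) (λ i → ≡.trans (∑-*ˡ residues (f i) _) (≡.cong (f i N.*_)
      (FiniteFieldSums.∑-reindex 𝔽 residues unique-residue {g} g-per {+ M} {proj₁ (invert-ℕ M ℓ∤M)} (proj₂ (invert-ℕ M ℓ∤M)) i))) ⟩
  ∑ (interval 0ℤ M) (λ i → f i N.* ∑ residues g) ≡⟨ ∑-*ʳ (interval 0ℤ M) (∑ residues g) f ⟩
  ∑ (interval 0ℤ M) f N.* ∑ residues g ∎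
  where
  open ≡.≡-Reasoning
  h : ℤ → ℕ
  h x = f x N.* g x
  blocks : ∀ q a → ∑ (interval (a ℤ.* + M) (q N.* M)) h ≡ ∑ (interval a q) (λ j → ∑ (interval (j ℤ.* + M) M) h)
  blocks zero a = ≡.refl
  blocks (suc q) a = ≡.trans (∑-interval-++ (a ℤ.* + M) M (q N.* M) h) (≡.cong (∑ (interval (a ℤ.* + M) M) h N.+_)
   (≡.trans (≡.cong (λ b → ∑ (interval b (q N.* M)) h) (solveℤ 2 (λ a m → m :+ a :* m := (:1 :+ a) :* m) a (+ M))) (blocks q (1ℤ ℤ.+ a))))

-- Absence of affine points, from conditions on the coefficients

discriminant≋ : ∀ {c ℓ} (R : CommutativeRing c ℓ) → let open CommutativeRing R ; open Polynomials R in
 ∀ a0 a1 b0 b1 b2 c0 c1 c2 → Invariants.discriminant R a0 a1 b0 b1 b2 c0 c1 c2 ≋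
  (b0 ∷ b1 ∷ b2 ∷ []) ✶ (b0 ∷ b1 ∷ b2 ∷ []) ⊹ ⊟ ((one ⊹ one ⊹ one ⊹ one) ✶ ((a0 ∷ a1 ∷ []) ✶ (c0 ∷ c1 ∷ c2 ∷ 1# ∷ [])))
discriminant≋ R a0 a1 b0 b1 b2 c0 c1 c2 =
 ∷-cong (solve 3 (λ a b c → b :* b :- :4 :* (a :* c) := (b :* b :+ :0) :+ :- (:4 :* (a :* c :+ :0) :+ :0)) a0 b0 c0)
 (∷-cong (solve 6 (λ a0 a1 b0 b1 c0 c1 → (b0 :* b1 :+ b0 :* b1) :- :4 :* (a0 :* c1 :+ a1 :* c0) := (b0 :* b1 :+ (b1 :* b0 :+ :0)) :+ :- (:4 :* (a0 :* c1 :+ (a1 :* c0 :+ :0)))) a0 a1 b0 b1 c0 c1)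
 (∷-cong (solve 7 (λ a0 a1 b0 b1 b2 c1 c2 → (b1 :* b1 :+ (b0 :* b2 :+ b0 :* b2)) :- :4 :* (a0 :* c2 :+ a1 :* c1) := (b0 :* b2 :+ (b1 :* b1 :+ (b2 :* b0 :+ :0))) :+ :- (:4 :* (a0 :* c2 :+ a1 :* c1))) a0 a1 b0 b1 b2 c1 c2)
 (∷-cong (solve 5 (λ a0 a1 b1 b2 c2 → (b1 :* b2 :+ b1 :* b2) :- :4 :* (a0 :+ a1 :* c2) := (b1 :* b2 :+ b2 :* b1) :+ :- (:4 :* (a0 :* :1 :+ a1 :* c2))) a0 a1 b1 b2 c2)
 (∷-cong (solve 2 (λ a1 b2 → b2 :* b2 :- :4 :* a1 := b2 :* b2 :+ :- (:4 :* (a1 :* :1))) a1 b2) ≋-refl))))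
 where
 open CommutativeRing R
 open Polynomials R
 open IntegerSolver R

module AffinePoints (K : DiscreteField 0ℓ 0ℓ) (a0 a1 b0 b1 b2 c0 c1 c2 : DiscreteField.Carrier K) where

 open Bivariate K
 private module K = DiscreteField K
 open Invariants K0 using (discriminant; resultant)

 A B C : P.Poly
 A = a0 ∷ a1 ∷ []
 B = b0 ∷ b1 ∷ b2 ∷ []
 C = c0 ∷ c1 ∷ c2 ∷ K.1# ∷ []

 A⊏3 : A P.⊏ 3
 A⊏3 = P.⊏-weaken {A} (N.n≤1+n 2) (P.⊏-length A)
 B⊏3 : B P.⊏ 3
 B⊏3 = P.⊏-length B
 C-top : P.Top C 3 K.1#
 C-top = P.top (P.⊏-length C) K.refl


 𝒞 : Conic K
 𝒞 = record { A = A ; B = B ; C = C ; A⊏3 = A⊏3 ; B⊏3 = B⊏3 ; C-top = C-top }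
 open Conics.ConicDiscriminant K 𝒞 using (disc; never-square; q; Reduction; NeverSquare)

 private
  D : P.Poly
  D = discriminant a0 a1 b0 b1 b2 c0 c1 c2
  disc≋ : D P.≋ disc
  disc≋ = discriminant≋ K0 a0 a1 b0 b1 b2 c0 c1 c2
  disc-noRoot : P.NoRoot D → P.NoRoot disc
  disc-noRoot noRoot κ e = noRoot κ (K.trans (RingHom.⟦⟧-cong (Evaluation.evalHom (identityHom K0) κ) {D} {disc} disc≋) e)
  irreducible : ∀ {k} → ¬ (k K.≈ K.0#) → P.coeff D 4 K.≈ k → P.NoRoot D → P.NoQuadraticFactors D → ∀ {π} → P.Irreducible π → π P.∣ disc → disc P.∣ π
  irreducible k≉0 lead noRoot noQuadratic irr π∣ = P.∣-respˡ disc≋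
   (P.quartic-irreducible {D} k≉0 (P.top (P.⊏-length D) lead) noRoot (λ {g} {h} → noQuadratic {g} {h}) irr (P.∣-respʳ (P.≋-sym disc≋) π∣))

 module Over (𝓕 : Overdomain K)
  (t : ℕ → 𝕂) (t-injective : ∀ {i j} → t i K.≈ t j → i ≡ j)
  (x y : Overdomain.Element 𝓕) where

  open Overdomain 𝓕
  open CommutativeRing F hiding (zero)
  open AtPoint 𝓕 x
  private
   module ι = RingHom ι
   module S = IntegerSolver F
  open S using (solve)

  point : ∀ {p e r s} → ¬ (e P.≋ []) → ¬ (s P.≋ []) → x * ι.⟦ e ⟧ ≈ ι.⟦ p ⟧ → y * ι.⟦ s ⟧ ≈ ι.⟦ r ⟧ →
      Conics.Descent.PointData K 𝒞 𝓕 x y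
  point {p} {e} {r} {s} = Conics.Descent.lowestTerms K 𝒞 𝓕 x y {p} {e} {r} {s}

  module _ (y²≈ : y * y ≈ x * x * x + ι.⟦ c2 ∷ b2 ∷ K.0# ∷ [] ⟧ * (x * x) + ι.⟦ c1 ∷ b1 ∷ a1 ∷ [] ⟧ * x + ι.⟦ c0 ∷ b0 ∷ a0 ∷ [] ⟧)
   (P : Conics.Descent.PointData K 𝒞 𝓕 x y) where

   private
    ιc : 𝕂 → Carrier
    ιc a = ι.⟦ a ∷ [] ⟧
    τ : Carrier
    τ = ι.⟦ var ⟧
    quadratic : ∀ a b d → ι.⟦ a ∷ b ∷ d ∷ [] ⟧ ≈ ιc a + τ * (ιc b + τ * ιc d)
    quadratic a b d = trans (ι-∷ a (b ∷ d ∷ [])) (+-congˡ (*-congˡ (ι-∷ b (d ∷ []))))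
    ιc0 : ιc K.0# ≈ 0#
    ιc0 = trans (ι.⟦⟧-cong P.shift-0) ι.0-homo
    y²≈q : y * y ≈ ev.⟦ q ⟧
    y²≈q = trans y²≈ (trans (+-cong (+-cong (+-congˡ (*-congʳ (trans (quadratic c2 b2 K.0#) (+-congˡ (*-congˡ (+-congˡ (*-congˡ ιc0)))))))
      (*-congʳ (quadratic c1 b1 a1))) (quadratic c0 b0 a0))
     (trans (solve 10 (λ x t a0 a1 b0 b1 b2 c0 c1 c2 →
      let :0 = :0 in
      x :* x :* x :+ (c2 :+ t :* (b2 :+ t :* :0)) :* (x :* x) :+ (c1 :+ t :* (b1 :+ t :* a1)) :* x :+ (c0 :+ t :* (b0 :+ t :* a0))
      := (c0 :+ x :* (c1 :+ x :* (c2 :+ x :* (:1 :+ x :* :0)))) :+ t :* ((b0 :+ x :* (b1 :+ x :* (b2 :+ x :* :0))) :+ t :* ((a0 :+ x :* (a1 :+ x :* :0)) :+ t :* :0))) x τ (ιc a0) (ιc a1) (ιc b0) (ιc b1) (ιc b2) (ιc c0) (ιc c1) (ιc c2))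
     (+-congʳ (+-congˡ (*-congˡ (+-congˡ (*-congˡ (+-congˡ (*-congˡ (+-congʳ (sym ι.1-homo)))))))))))
    impossible : Reduction → NeverSquare → Conics.Descent.Shape K 𝒞 𝓕 x y y²≈q (Conics.Descent.PointData.n P) → ⊥
    impossible reduction never = Conics.Descent.impossible K 𝒞 𝓕 x y y²≈q
     (λ {π} {U} {V} → reduction {π} {U} {V}) (λ κ Q → never κ Q) t t-injective P
    -- If A is the square of a constant, both parities of n are admissible.
    shape : ∀ {a} → A P.≋ (a K.* a) ∷ [] → Conics.Descent.Shape K 𝒞 𝓕 x y y²≈q (Conics.Descent.PointData.n P)
    shape A≋ = [ (λ (m , e) → ≡.subst (Conics.Descent.Shape K 𝒞 𝓕 x y y²≈q) (≡.sym e) (Conics.Descent.even-shape K 𝒞 𝓕 x y y²≈q m))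
          , (λ (m , e) → ≡.subst (Conics.Descent.Shape K 𝒞 𝓕 x y y²≈q) (≡.sym e) (Conics.Descent.odd-shape K 𝒞 𝓕 x y y²≈q A≋ m)) ]′ (parity (Conics.Descent.PointData.n P))

   no-point-0 : a0 K.≈ K.0# → a1 K.≈ K.0# → ¬ (b2 K.≈ K.0#) → P.NoRoot B → (∀ w → ¬ (w K.* w K.≈ resultant b0 b1 b2 c0 c1 c2)) → ⊥
   no-point-0 a0≈0 a1≈0 b2≉0 noRoot nonSquare = impossible
    (λ {π} {U} {V} → Conics.LinearInT.reduction K 𝒞 A≋0 P.≋-refl P.≋-refl b2≉0 noRoot nonSquare {π} {U} {V})
    (never-square (Conics.LinearInT.disc-noRoot K 𝒞 A≋0 P.≋-refl P.≋-refl b2≉0 noRoot))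
    (shape {K.0#} (P.∷-cong (K.trans a0≈0 (K.sym (K.zeroˡ K.0#))) (P.≋-trans (P.∷-cong a1≈0 P.≋-refl) P.shift-0)))
    where
    A≋0 : A P.≋ []
    A≋0 = P.≋-trans (P.∷-cong a0≈0 (P.≋-trans (P.∷-cong a1≈0 P.≋-refl) P.shift-0)) P.shift-0

   no-point-□ : ∀ a k → a0 K.≈ a K.* a → a1 K.≈ K.0# → ¬ (a K.+ a K.≈ K.0#) → ¬ (k K.≈ K.0#) → P.coeff D 4 K.≈ k →
          P.NoRoot D → P.NoQuadraticFactors D → ⊥
   no-point-□ a k a0≈a² a1≈0 2a≉0 k≉0 lead noRoot noQuadratic = impossible
    (λ {π} {U} {V} → Conics.SquareLeading.reduction K 𝒞 {a} A≋ 2a≉0 (λ z → P.Top-≉0 k≉0 (P.top (P.⊏-length D) lead) (P.≋-trans disc≋ z))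
     (irreducible k≉0 lead noRoot (λ {g} {h} → noQuadratic {g} {h})) {π} {U} {V})
    (never-square (disc-noRoot noRoot)) (shape {a} A≋)
    where
    A≋ : A P.≋ (a K.* a) ∷ []
    A≋ = P.∷-cong a0≈a² (P.≋-trans (P.∷-cong a1≈0 P.≋-refl) P.shift-0)

   -- For linear A only the even shape is available; that n is even comes from `even-degree`,
   -- through the condition that - a1 is not a square.
   no-point-ℓ : ∀ k → b2 K.≈ K.0# → c2 K.≈ K.0# → ¬ (K.1# K.+ K.1# K.≈ K.0#) → ¬ (a1 K.≈ K.0#) →
          (∀ u w → ¬ (w K.≈ K.0#) → ¬ (u K.* u K.≈ (K.- a1) K.* (w K.* w))) → ¬ (k K.≈ K.0#) → P.coeff D 4 K.≈ k →
          P.NoRoot D → P.NoQuadraticFactors D → ⊥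
   no-point-ℓ k b2≈0 c2≈0 2≉0 a1≉0 nonSquare k≉0 lead noRoot noQuadratic = impossible
    (λ {π} {U} {V} → Conics.LinearInX.reduction K 𝒞 P.≋-refl B≋ C≋ 2≉0 a1≉0 nonSquare (disc-noRoot noRoot)
     (irreducible k≉0 lead noRoot (λ {g} {h} → noQuadratic {g} {h})) {π} {U} {V})
    (never-square (disc-noRoot noRoot))
    (≡.subst (Conics.Descent.Shape K 𝒞 𝓕 x y y²≈q) (≡.sym (proj₂ even)) (Conics.Descent.even-shape K 𝒞 𝓕 x y y²≈q (proj₁ even)))
    where
    B≋ : B P.≋ b0 ∷ b1 ∷ []
    B≋ = P.∷-cong K.refl (P.∷-cong K.refl (P.≋-trans (P.∷-cong b2≈0 P.≋-refl) P.shift-0))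
    C≋ : C P.≋ c0 ∷ c1 ∷ K.0# ∷ K.1# ∷ []
    C≋ = P.∷-cong K.refl (P.∷-cong K.refl (P.∷-cong c2≈0 P.≋-refl))
    even : Σ[ m ∈ ℕ ] Conics.Descent.PointData.n P ≡ m N.+ m
    even = Conics.EvenDegree.even-degree K 𝒞 𝓕 x y P.≋-refl B≋ C≋ nonSquare y²≈q P

-- Rational numbers and denominators

ℚ-field : DiscreteField 0ℓ 0ℓ
ℚ-field = record { commutativeRing = ℚ.+-*-commutativeRing ; invert = λ a → invert a (a ℚ.≟ 0ℚ) ; 1≉0 = ℚ.1≢0 }
 where
 invert : ∀ a → Dec (a ≡ 0ℚ) → a ≡ 0ℚ ⊎ Σ[ b ∈ ℚ ] b ℚ.* a ≡ 1ℚ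
 invert a (yes e) = inj₁ e
 invert a (no ne) = inj₂ (ℚ.1/_ a {{ℚ.≢-nonZero ne}} , ℚ.*-inverseˡ a {{ℚ.≢-nonZero ne}})

fromℤ : ℤ → ℚ
fromℤ n = n ℚ./ 1

private
 -- n / 1 is computed by ℚ.fromℚᵘ, which respects _≃_
 normalised : ∀ n {r} → ℚ.toℚᵘ r ℚᵘ.≃ ℚᵘ.mkℚᵘ n 0 → fromℤ n ≡ r
 normalised n {r} e = ≡.trans (ℚ.fromℚᵘ-cong (ℚᵘ.≃-sym e)) (ℚ.fromℚᵘ-toℚᵘ r)

 toℚᵘ-fromℤ : ∀ n → ℚ.toℚᵘ (fromℤ n) ℚᵘ.≃ ℚᵘ.mkℚᵘ n 0
 toℚᵘ-fromℤ n = ℚ.toℚᵘ-fromℚᵘ (ℚᵘ.mkℚᵘ n 0)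

fromℤ-hom : RingHom ℤ-ring ℚ.+-*-commutativeRing
fromℤ-hom = record
 { ⟦_⟧ = fromℤ
 ; ⟦⟧-cong = ≡.cong fromℤ
 ; +-homo = λ x y → normalised (x ℤ.+ y) (ℚᵘ.≃-trans (ℚ.toℚᵘ-homo-+ (fromℤ x) (fromℤ y)) (ℚᵘ.≃-trans
   (ℚᵘ.+-cong (toℚᵘ-fromℤ x) (toℚᵘ-fromℤ y)) (ℚᵘ.*≡* (solveℤ 2 (λ x y → (x :* :1 :+ y :* :1) :* :1 := (x :+ y) :* :1) x y))))
 ; *-homo = λ x y → normalised (x ℤ.* y) (ℚᵘ.≃-trans (ℚ.toℚᵘ-homo-* (fromℤ x) (fromℤ y)) (ℚᵘ.≃-trans
   (ℚᵘ.*-cong (toℚᵘ-fromℤ x) (toℚᵘ-fromℤ y)) (ℚᵘ.*≡* ≡.refl)))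
 ; 1-homo = ≡.refl
 }

fromℤ-injective : ∀ {m n} → fromℤ m ≡ fromℤ n → m ≡ n
fromℤ-injective {m} {n} e with ℚ.fromℚᵘ-injective {ℚᵘ.mkℚᵘ m 0} {ℚᵘ.mkℚᵘ n 0} e
... | ℚᵘ.*≡* f = ≡.trans (≡.sym (ℤ.*-identityʳ m)) (≡.trans f (ℤ.*-identityʳ n))

denominator : ∀ x → Σ[ d ∈ ℤ ] d ≢ 0ℤ × Σ[ n ∈ ℤ ] fromℤ n ≡ fromℤ d ℚ.* x
denominator x@(ℚ.mkℚ n d-1 _) = + suc d-1 , (λ ()) , n , normalised n (ℚᵘ.≃-trans (ℚ.toℚᵘ-homo-* (fromℤ (+ suc d-1)) x) (ℚᵘ.≃-trans
 (ℚᵘ.*-cong (toℚᵘ-fromℤ (+ suc d-1)) (ℚᵘ.≃-refl {ℚ.toℚᵘ x})) (ℚᵘ.*≡* (≡.trans (solveℤ 2 (λ d n → (d :* n) :* :1 := n :* d) (+ suc d-1) n)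
  (≡.cong (λ k → n ℤ.* + k) (≡.sym (N.+-identityʳ (suc d-1))))))))

module PZ where
 open Polynomials ℤ-ring public
 open Degrees ℤ-ring public

module PQ = FieldPolynomials ℚ-field

fromℤ[X] : RingHom (polyRing ℤ-ring) (polyRing ℚ.+-*-commutativeRing)
fromℤ[X] = polyHom fromℤ-hom

private module φ = RingHom fromℤ[X]

fromℤ[X]-injective : ∀ {f g} → φ.⟦ f ⟧ PQ.≋ φ.⟦ g ⟧ → f PZ.≋ g
fromℤ[X]-injective {f} {g} e = PZ.mk≋ λ n → fromℤ-injective (≡.trans (≡.sym (coeff-map fromℤ-hom f n)) (≡.trans (PQ.at e n) (coeff-map fromℤ-hom g n)))

fromℤ[X]-· : ∀ w f → φ.⟦ w PZ.· f ⟧ PQ.≋ fromℤ w PQ.· φ.⟦ f ⟧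
fromℤ[X]-· w [] = PQ.≋-refl
fromℤ[X]-· w (a ∷ f) = PQ.∷-cong (RingHom.*-homo fromℤ-hom w a) (fromℤ[X]-· w f)

clearDenominators : ∀ P → Σ[ w ∈ ℤ ] w ≢ 0ℤ × Σ[ P′ ∈ PZ.Poly ] φ.⟦ P′ ⟧ PQ.≋ fromℤ w PQ.· P
clearDenominators [] = 1ℤ , (λ ()) , [] , PQ.≋-refl
clearDenominators (x ∷ P) with denominator x | clearDenominators P
... | d , d≢0 , n , e | w , w≢0 , P′ , f = d ℤ.* w , (λ z → [ d≢0 , w≢0 ]′ (ℤ.i*j≡0⇒i≡0∨j≡0 d z)) , n ℤ.* w ∷ d PZ.· P′ ,
 PQ.∷-cong (≡.trans (h.*-homo n w) (≡.trans (≡.cong (ℚ._* fromℤ w) e) (≡.trans (ℚ.*-assoc (fromℤ d) x (fromℤ w))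
   (≡.trans (≡.cong (fromℤ d ℚ.*_) (ℚ.*-comm x (fromℤ w))) (≡.trans (≡.sym (ℚ.*-assoc (fromℤ d) (fromℤ w) x)) (≡.cong (ℚ._* x) (≡.sym (h.*-homo d w))))))))
  (PQ.≋-trans (fromℤ[X]-· d P′) (PQ.≋-trans (PQ.·-cong {fromℤ d} ≡.refl f) (PQ.≋-trans (PQ.≋-sym (PQ.·-assoc (fromℤ d) (fromℤ w) P)) (PQ.·-cong (≡.sym (h.*-homo d w)) PQ.≋-refl))))
 where module h = RingHom fromℤ-hom

⊏-cleared : ∀ {P w P′ n} → φ.⟦ P′ ⟧ PQ.≋ fromℤ w PQ.· P → P PQ.⊏ n → P′ PZ.⊏ n
⊏-cleared {P} {w} {P′} e P⊏ m n≤m = fromℤ-injective (≡.trans (≡.sym (coeff-map fromℤ-hom P′ m)) (≡.trans (PQ.at e m)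
 (≡.trans (PQ.coeff-· (fromℤ w) P m) (≡.trans (≡.cong (fromℤ w ℚ.*_) (P⊏ m n≤m)) (ℚ.*-zeroʳ (fromℤ w))))))

-- Factorisations over the rationals, read modulo a prime

module FactorsModPrime {ℓ : ℕ} (ℓ-prime : Prime ℓ) (𝔽 : DiscreteField 0ℓ 0ℓ)
 (π : RingHom ℤ-ring (DiscreteField.commutativeRing 𝔽))
 (kernel : ∀ {a} → DiscreteField._≈_ 𝔽 (RingHom.⟦_⟧ π a) (DiscreteField.0# 𝔽) → + ℓ ℤ.∣ a)
 (ℓ≈0 : DiscreteField._≈_ 𝔽 (RingHom.⟦_⟧ π (+ ℓ)) (DiscreteField.0# 𝔽))
 (residues : List (DiscreteField.Carrier 𝔽)) (unique-residue : ∀ a → ∑ residues (λ x → 𝟙 (DiscreteField._≟_ 𝔽 x a)) ≡ 1) where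

 module PF = FieldPolynomials 𝔽
 private
  module F = DiscreteField 𝔽
  module π = RingHom π
  module ρ = RingHom (polyHom π)
  ρ-coeff : ∀ f n → PF.coeff ρ.⟦ f ⟧ n F.≈ π.⟦ PZ.coeff f n ⟧
  ρ-coeff = coeff-map π

  divide : ∀ f → ρ.⟦ f ⟧ PF.≋ [] → Σ[ g ∈ PZ.Poly ] f PZ.≋ (+ ℓ) PZ.· g
  divide [] e = [] , PZ.≋-refl
  divide (a ∷ f) e with kernel (PF.at e 0) | divide f (PF.mk≋ λ n → PF.at e (suc n))
  ... | ℤ.divides q a≡ | g , f≋ = q ∷ g , PZ.∷-cong (≡.trans a≡ (ℤ.*-comm q (+ ℓ))) f≋

  ℓ≢0 : + ℓ ≢ 0ℤ
  ℓ≢0 e = ¬prime[0] (≡.subst Prime (ℤ.+-injective e) ℓ-prime)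

  cancel-ℓ : ∀ {f g} → (+ ℓ) PZ.· f PZ.≋ (+ ℓ) PZ.· g → f PZ.≋ g
  cancel-ℓ {f} {g} e = PZ.mk≋ λ n → ℤ.*-cancelˡ-≡ (+ ℓ) _ _ {{ℤ.≢-nonZero ℓ≢0}}
   (≡.trans (≡.sym (PZ.coeff-· (+ ℓ) f n)) (≡.trans (PZ.at e n) (PZ.coeff-· (+ ℓ) g n)))

  ⊏-divided : ∀ {f g n} → f PZ.≋ (+ ℓ) PZ.· g → f PZ.⊏ n → g PZ.⊏ n
  ⊏-divided {f} {g} e f⊏ m n≤m = ℤ.*-cancelˡ-≡ (+ ℓ) _ _ {{ℤ.≢-nonZero ℓ≢0}}
   (≡.trans (≡.sym (PZ.coeff-· (+ ℓ) g m)) (≡.trans (≡.sym (PZ.at e m)) (≡.trans (f⊏ m n≤m) (≡.sym (ℤ.*-zeroʳ (+ ℓ))))))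

 -- What remains modulo ℓ of a rational factorisation: it is multiplied by a nonzero constant w, and
 -- only upper bounds on the degrees are kept. The exact degrees are recovered from the product when
 -- ℓ does not divide the leading coefficient of D.
 record Factors (D : PZ.Poly) (m n : ℕ) : Set where
  field
   w : F.Carrier
   P S : PF.Poly
   w≉0 : ¬ (w F.≈ F.0#)
   P⊏ : P PF.⊏ m
   S⊏ : S PF.⊏ n
   wD≋PS : w PF.· ρ.⟦ D ⟧ PF.≋ P PF.✶ S

 private
  -- Gauss's lemma: while ℓ divides w, it divides P or S, and can be cancelled.
  strip : ∀ N {D m n} w P S → ℤ.∣ w ∣ N.≤ N → w ≢ 0ℤ → P PZ.⊏ m → S PZ.⊏ n → w PZ.· D PZ.≋ P PZ.✶ S → Dec (+ ℓ ℤ.∣ w) → Factors D m n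
  strip N {D} {m} {n} w P S ∣w∣≤N w≢0 P⊏ S⊏ e (no ℓ∤w) = record
   { w = π.⟦ w ⟧ ; P = ρ.⟦ P ⟧ ; S = ρ.⟦ S ⟧ ; w≉0 = λ z → ℓ∤w (kernel z)
   ; P⊏ = reduced P P⊏ ; S⊏ = reduced S S⊏
   ; wD≋PS = PF.≋-trans (PF.mk≋ λ i → F.trans (PF.coeff-· π.⟦ w ⟧ ρ.⟦ D ⟧ i) (F.trans (F.*-congˡ (ρ-coeff D i)) (F.trans (F.sym (π.*-homo w (PZ.coeff D i))) (F.trans (π.⟦⟧-cong (≡.sym (PZ.coeff-· w D i))) (F.sym (ρ-coeff (w PZ.· D) i))))))
     (PF.≋-trans (ρ.⟦⟧-cong e) (ρ.*-homo P S)) }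
   where
   reduced : ∀ f {k} → f PZ.⊏ k → ρ.⟦ f ⟧ PF.⊏ k
   reduced f f⊏ i k≤i = F.trans (ρ-coeff f i) (F.trans (π.⟦⟧-cong (f⊏ i k≤i)) π.0-homo)
  strip zero w P S ∣w∣≤N w≢0 _ _ _ (yes _) = ⊥-elim (w≢0 (ℤ.∣i∣≡0⇒i≡0 (N.n≤0⇒n≡0 ∣w∣≤N)))
  strip (suc N) {D} w P S ∣w∣≤N w≢0 P⊏ S⊏ e (yes (ℤ.divides q w≡qℓ)) =
   [ (λ P≋0 → let (P0 , P≋) = divide P P≋0 in
     strip N q P0 S ∣q∣≤N q≢0 (⊏-divided {P} {P0} P≋ P⊏) S⊏
      (cancel-ℓ (PZ.≋-trans ℓqD (PZ.≋-trans (PZ.✶-congʳ P ((+ ℓ) PZ.· P0) P≋) (PZ.·-✶ (+ ℓ) P0 S)))) (+ ℓ ℤ.∣? q))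
   , (λ S≋0 → let (S0 , S≋) = divide S S≋0 in
     strip N q P S0 ∣q∣≤N q≢0 P⊏ (⊏-divided {S} {S0} S≋ S⊏)
      (cancel-ℓ (PZ.≋-trans ℓqD (PZ.≋-trans (PZ.✶-comm P S) (PZ.≋-trans (PZ.✶-congʳ S ((+ ℓ) PZ.· S0) S≋) (PZ.≋-trans (PZ.·-✶ (+ ℓ) S0 P) (PZ.·-cong {+ ℓ} ≡.refl (PZ.✶-comm S0 P)))))))
      (+ ℓ ℤ.∣? q)) ]′
   (DiscreteDomain.noZeroDivisors (polyDomain F.domain) ρ.⟦ P ⟧ ρ.⟦ S ⟧ (PF.≋-trans (PF.≋-sym (ρ.*-homo P S))
    (PF.≋-trans (ρ.⟦⟧-cong (PZ.≋-sym e)) (PF.mk≋ λ i → F.trans (ρ-coeff (w PZ.· D) i) (F.trans (π.⟦⟧-cong (≡.trans (PZ.coeff-· w D i) (≡.trans (≡.cong (ℤ._* PZ.coeff D i) w≡qℓ)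
      (solveℤ 3 (λ q l d → q :* l :* d := q :* d :* l) q (+ ℓ) (PZ.coeff D i)))))
      (F.trans (π.*-homo (q ℤ.* PZ.coeff D i) (+ ℓ)) (F.trans (F.*-congˡ ℓ≈0) (F.zeroʳ _))))))))
   where
   q≢0 : q ≢ 0ℤ
   q≢0 z = w≢0 (≡.trans w≡qℓ (≡.trans (≡.cong (ℤ._* + ℓ) z) (ℤ.*-zeroˡ (+ ℓ))))
   ∣q∣≤N : ℤ.∣ q ∣ N.≤ N
   ∣q∣≤N = N.s≤s⁻¹ (N.≤-trans (N.≤-trans (N.m<m*n ℤ.∣ q ∣ ℓ {{N.≢-nonZero λ z → q≢0 (ℤ.∣i∣≡0⇒i≡0 z)}} 1<ℓ)
    (N.≤-reflexive (≡.trans (≡.sym (ℤ.abs-* q (+ ℓ))) (≡.cong ℤ.∣_∣ (≡.sym w≡qℓ))))) ∣w∣≤N)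
    where
    1<ℓ : 1 N.< ℓ
    1<ℓ = N.≤∧≢⇒< (N.n≢0⇒n>0 λ e → ℓ≢0 (≡.cong +_ e)) (λ e → ¬prime[1] (≡.subst Prime (≡.sym e) ℓ-prime))
   ℓqD : (+ ℓ) PZ.· (q PZ.· D) PZ.≋ P PZ.✶ S
   ℓqD = PZ.≋-trans (PZ.≋-trans (PZ.≋-sym (PZ.·-assoc (+ ℓ) q D)) (PZ.·-cong (≡.trans (ℤ.*-comm (+ ℓ) q) (≡.sym w≡qℓ)) PZ.≋-refl)) e

 -- The integer that clears the denominators may be divisible by ℓ; `strip` then moves these factors
 -- ℓ out of P and S.
 factors : ∀ {D m n P S} → φ.⟦ D ⟧ PQ.≋ P PQ.✶ S → P PQ.⊏ m → S PQ.⊏ n → Factors D m n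
 factors {D} {m} {n} {P} {S} e P⊏ S⊏ with clearDenominators P | clearDenominators S
 ... | w1 , w1≢0 , P′ , P′≋ | w2 , w2≢0 , S′ , S′≋ =
  strip _ (w1 ℤ.* w2) P′ S′ N.≤-refl (λ z → [ w1≢0 , w2≢0 ]′ (ℤ.i*j≡0⇒i≡0∨j≡0 w1 z)) (⊏-cleared {P} {w1} {P′} P′≋ P⊏) (⊏-cleared {S} {w2} {S′} S′≋ S⊏)
   (fromℤ[X]-injective (begin
    φ.⟦ (w1 ℤ.* w2) PZ.· D ⟧ ≈⟨ fromℤ[X]-· (w1 ℤ.* w2) D ⟩
    fromℤ (w1 ℤ.* w2) PQ.· φ.⟦ D ⟧
     ≈⟨ PQ.·-cong (RingHom.*-homo fromℤ-hom w1 w2) e ⟩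
    (fromℤ w1 ℚ.* fromℤ w2) PQ.· (P PQ.✶ S) ≈⟨ PQ.·-assoc (fromℤ w1) (fromℤ w2) (P PQ.✶ S) ⟩
    fromℤ w1 PQ.· (fromℤ w2 PQ.· (P PQ.✶ S))
     ≈⟨ PQ.·-cong {fromℤ w1} ≡.refl (PQ.≋-trans (PQ.·-cong {fromℤ w2} ≡.refl (PQ.✶-comm P S)) (PQ.≋-trans (PQ.≋-sym (PQ.·-✶ (fromℤ w2) S P)) (PQ.✶-comm (fromℤ w2 PQ.· S) P))) ⟩
    fromℤ w1 PQ.· (P PQ.✶ (fromℤ w2 PQ.· S)) ≈⟨ PQ.·-✶ (fromℤ w1) P (fromℤ w2 PQ.· S) ⟨
    (fromℤ w1 PQ.· P) PQ.✶ (fromℤ w2 PQ.· S) ≈⟨ PQ.✶-cong P′≋ S′≋ ⟨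
    φ.⟦ P′ ⟧ PQ.✶ φ.⟦ S′ ⟧ ≈⟨ φ.*-homo P′ S′ ⟨
    φ.⟦ P′ PZ.✶ S′ ⟧ ∎)) (+ ℓ ℤ.∣? (w1 ℤ.* w2))
  where open import Relation.Binary.Reasoning.Setoid PQ.≋-setoid

 private
  module F* = DomainProperties F.domain
  -- the leading coefficients of the factors, at the maximal degrees allowed
  tops≉0 : ∀ {D m n} → ¬ (π.⟦ PZ.coeff D (m N.+ n) ⟧ F.≈ F.0#) → (fs : Factors D (suc m) (suc n)) → let open Factors fs in
   ¬ (PF.coeff P m F.≈ F.0#) × ¬ (PF.coeff S n F.≈ F.0#)
  tops≉0 {D} {m} {n} lead≉0 fs = (λ z → product≉0 (F.trans (F.*-congʳ z) (F.zeroˡ (PF.coeff S n)))) , (λ z → product≉0 (F.trans (F.*-congˡ {PF.coeff P m} z) (F.zeroʳ (PF.coeff P m))))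
   where
   open Factors fs
   product≉0 : ¬ (PF.coeff P m F.* PF.coeff S n F.≈ F.0#)
   product≉0 z = F*.*-≉0 w≉0 (λ z → lead≉0 (F.trans (F.sym (ρ-coeff D (m N.+ n))) z)) (F.trans (F.sym (PF.coeff-· w ρ.⟦ D ⟧ (m N.+ n))) (F.trans (PF.at wD≋PS (m N.+ n)) (F.trans (PF.lead (PF.Top-✶ {P} {S} (PF.top P⊏ F.refl) (PF.top S⊏ F.refl))) z)))

  divides-· : ∀ {w f g} → ¬ (w F.≈ F.0#) → ∀ κ → PF.evaluate κ g F.≈ F.0# → w PF.· f PF.≋ g → PF.evaluate κ f F.≈ F.0#
  divides-· {w} {f} {g} w≉0 κ gκ≈0 e = F*.cancel-≈0 w w≉0 (F.trans (F.sym (scaled f)) (F.trans (RingHom.⟦⟧-cong (Evaluation.evalHom (identityHom F.commutativeRing) κ) {w PF.· f} {g} e) gκ≈0))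
   where
   open IntegerSolver F.commutativeRing
   scaled : ∀ f → PF.evaluate κ (w PF.· f) F.≈ w F.* PF.evaluate κ f
   scaled [] = F.sym (F.zeroʳ w)
   scaled (a ∷ f) = F.trans (F.+-congˡ (F.*-congˡ {κ} (scaled f))) (solve 4 (λ w a k z → w :* a :+ k :* (w :* z) := w :* (a :+ k :* z)) w a κ (PF.evaluate κ f))

 open Certificates 𝔽 residues unique-residue using (rootless; simple; quotient-by; ζ; rootless⇒NoRoot)

 -- A rational root splits off a linear factor, which stays linear modulo ℓ because the leading
 -- coefficient of D does not vanish there, and hence yields a root modulo ℓ.
 rootless⇒noRationalRoot : ∀ D n → D PZ.⊏ suc (suc n) → ¬ (π.⟦ PZ.coeff D (suc n) ⟧ F.≈ F.0#) → rootless ρ.⟦ D ⟧ ≢ 0 → PQ.NoRoot φ.⟦ D ⟧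
 rootless⇒noRationalRoot D n D⊏ lead≉0 ne κ Dκ≡0 = rootless⇒NoRoot {ρ.⟦ D ⟧} ne (proj₁ root) (divides-· {w} {ρ.⟦ D ⟧} w≉0 (proj₁ root) (proj₂ root) wD≋PS)
  where
  open SyntheticDivision ℚ.+-*-commutativeRing κ using (X-κ; quot; factor; quot-⊏)
  fs : Factors D 2 (suc n)
  fs = factors {D} {2} {suc n} {X-κ} {quot φ.⟦ D ⟧} (factor φ.⟦ D ⟧ Dκ≡0) (PQ.⊏-length X-κ) (quot-⊏ φ.⟦ D ⟧ (suc n) λ m ≤m → ≡.trans (coeff-map fromℤ-hom D m) (≡.cong fromℤ (D⊏ m ≤m)))
  open Factors fs
  root : Σ[ κ ∈ F.Carrier ] PF.evaluate κ (P PF.✶ S) F.≈ F.0#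
  root = PF.linear-root {P PF.✶ S} {P} (proj₁ (tops≉0 {D} {1} {n} lead≉0 fs)) (PF.top P⊏ F.refl) (PF.divides S (PF.✶-comm P S))

 -- Modulo ℓ one has D = (X - r) K with K rootless. If D were a product of two quadratics, r would
 -- be a root of one of them; its other factor is linear and, after cancelling X - r, divides K up
 -- to a constant, giving K a root.
 simple⇒noQuadraticFactors : ∀ D → ¬ (π.⟦ PZ.coeff D 4 ⟧ F.≈ F.0#) → simple ρ.⟦ D ⟧ ≢ 0 → PQ.NoQuadraticFactors φ.⟦ D ⟧
 simple⇒noQuadraticFactors D lead≉0 ne {g} {h} _ g-top _ h-top D≋gh with ∑≢0 residues _ ne
 ... | r , ne′ = [ (λ Pr≈0 → contradiction P S P⊏ (proj₁ tops) Pr≈0 wD≋PS)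
         , (λ Sr≈0 → contradiction S P S⊏ (proj₂ tops) Sr≈0 (PF.≋-trans wD≋PS (PF.✶-comm P S))) ]′
         (F.noZeroDivisors (PF.evaluate r P) (PF.evaluate r S) (F.trans (F.sym (r̂.*-homo P S)) (F.trans (r̂.⟦⟧-cong (PF.≋-sym wD≋PS)) (F.trans (r̂.⟦⟧-cong wD≋) (F.trans (r̂.*-homo X-κ (w PF.· K)) (F.trans (F.*-congʳ (F.trans (eval-X-κ r) (F.-‿inverseʳ r))) (F.zeroˡ (PF.evaluate r (w PF.· K)))))))))
  where
  open SyntheticDivision F.commutativeRing r using (X-κ; quot; factor; quot-⊏; eval-X-κ)
  module r̂ = RingHom (Evaluation.evalHom (identityHom F.commutativeRing) r)
  fs : Factors D 3 3
  fs = factors {D} {3} {3} {g} {h} D≋gh (PQ.below g-top) (PQ.below h-top)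
  open Factors fs
  tops : ¬ (PF.coeff P 2 F.≈ F.0#) × ¬ (PF.coeff S 2 F.≈ F.0#)
  tops = tops≉0 {D} {2} {2} lead≉0 fs
  K : PF.Poly
  K = quotient-by r ρ.⟦ D ⟧
  K-noRoot : PF.NoRoot K
  K-noRoot = rootless⇒NoRoot {K} λ z → ne′ (≡.trans (≡.cong (ζ (PF.evaluate r ρ.⟦ D ⟧) N.*_) z) (N.*-zeroʳ (ζ (PF.evaluate r ρ.⟦ D ⟧))))
  Dr≈0 : PF.evaluate r ρ.⟦ D ⟧ F.≈ F.0#
  Dr≈0 = 𝟙≢0 (F.zero? (PF.evaluate r ρ.⟦ D ⟧)) λ z → ne′ (≡.cong (N._* rootless K) z)
  wD≋ : w PF.· ρ.⟦ D ⟧ PF.≋ X-κ PF.✶ (w PF.· K)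
  wD≋ = PF.≋-trans (PF.·-cong {w} F.refl (PF.≋-trans (factor ρ.⟦ D ⟧ Dr≈0) (PF.✶-comm X-κ K))) (PF.≋-trans (PF.≋-sym (PF.·-✶ w K X-κ)) (PF.✶-comm (w PF.· K) X-κ))
  contradiction : ∀ P S → P PF.⊏ 3 → ¬ (PF.coeff P 2 F.≈ F.0#) → PF.evaluate r P F.≈ F.0# → w PF.· ρ.⟦ D ⟧ PF.≋ P PF.✶ S → ⊥
  contradiction P S P⊏ p2≉0 Pr≈0 e = K-noRoot (proj₁ root) (divides-· {w} {K} w≉0 (proj₁ root) (proj₂ root) wK≋)
   where
   Q : PF.Poly
   Q = quot P
   P≋ : P PF.≋ X-κ PF.✶ Q
   P≋ = factor P Pr≈0
   q1≉0 : ¬ (PF.coeff Q 1 F.≈ F.0#)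
   q1≉0 z = p2≉0 (F.trans (PF.at P≋ 2) (F.trans (PF.lead (PF.Top-✶ {X-κ} {Q} (PF.top {X-κ} {1} (PF.⊏-length X-κ) F.refl) (PF.top (quot-⊏ P 2 P⊏) F.refl))) (F.trans (F.*-congˡ {F.1#} z) (F.zeroʳ F.1#))))
   X-κ≉0 : ¬ (X-κ PF.≋ [])
   X-κ≉0 z = F.1≉0 (PF.at z 1)
   wK≋ : w PF.· K PF.≋ Q PF.✶ S
   wK≋ = DomainProperties.*-cancel (polyDomain F.domain) X-κ {w PF.· K} {Q PF.✶ S} X-κ≉0 (PF.≋-trans (PF.≋-sym wD≋) (PF.≋-trans e (PF.≋-trans (PF.✶-congʳ P (X-κ PF.✶ Q) P≋) (PF.✶-assoc X-κ Q S))))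
   root : Σ[ κ ∈ F.Carrier ] PF.evaluate κ (Q PF.✶ S) F.≈ F.0#
   root = PF.linear-root {Q PF.✶ S} {Q} q1≉0 (PF.top (quot-⊏ P 2 P⊏) F.refl) (PF.divides S (PF.✶-comm Q S))

-- Conditions on integer coefficients and the soundness of their certificates

module InvariantsHom {c ℓ c′ ℓ′} {R : CommutativeRing c ℓ} {S : CommutativeRing c′ ℓ′} (φ : RingHom R S) where

 private
  module R = CommutativeRing R
  module IR = Invariants R
  module IS = Invariants S
 open CommutativeRing S
 open RingHom φ
 open Polynomials S using (_≋_; ∷-cong; ≋-refl)

 private
  H+ : ∀ {x y x′ y′} → ⟦ x ⟧ ≈ x′ → ⟦ y ⟧ ≈ y′ → ⟦ x R.+ y ⟧ ≈ x′ + y′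
  H+ e f = trans (+-homo _ _) (+-cong e f)
  H* : ∀ {x y x′ y′} → ⟦ x ⟧ ≈ x′ → ⟦ y ⟧ ≈ y′ → ⟦ x R.* y ⟧ ≈ x′ * y′
  H* e f = trans (*-homo _ _) (*-cong e f)
  H- : ∀ {x y x′ y′} → ⟦ x ⟧ ≈ x′ → ⟦ y ⟧ ≈ y′ → ⟦ x R.- y ⟧ ≈ x′ - y′
  H- e f = trans (sub-homo _ _) (+-cong e (-‿cong f))
  H4 : ⟦ IR.4# ⟧ ≈ IS.4#
  H4 = H+ (H+ (H+ 1-homo 1-homo) 1-homo) 1-homo

 discriminant-homo : ∀ {a0 a1 b0 b1 b2 c0 c1 c2 a0′ a1′ b0′ b1′ b2′ c0′ c1′ c2′} →
  ⟦ a0 ⟧ ≈ a0′ → ⟦ a1 ⟧ ≈ a1′ → ⟦ b0 ⟧ ≈ b0′ → ⟦ b1 ⟧ ≈ b1′ → ⟦ b2 ⟧ ≈ b2′ → ⟦ c0 ⟧ ≈ c0′ → ⟦ c1 ⟧ ≈ c1′ → ⟦ c2 ⟧ ≈ c2′ →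
  RingHom.⟦_⟧ (polyHom φ) (IR.discriminant a0 a1 b0 b1 b2 c0 c1 c2) ≋ IS.discriminant a0′ a1′ b0′ b1′ b2′ c0′ c1′ c2′
 discriminant-homo A0 A1 B0 B1 B2 C0 C1 C2 =
  ∷-cong (H- (H* B0 B0) (H* H4 (H* A0 C0)))
  (∷-cong (H- (H+ (H* B0 B1) (H* B0 B1)) (H* H4 (H+ (H* A0 C1) (H* A1 C0))))
  (∷-cong (H- (H+ (H* B1 B1) (H+ (H* B0 B2) (H* B0 B2))) (H* H4 (H+ (H* A0 C2) (H* A1 C1))))
  (∷-cong (H- (H+ (H* B1 B2) (H* B1 B2)) (H* H4 (H+ A0 (H* A1 C2))))
  (∷-cong (H- (H* B2 B2) (H* H4 A1)) ≋-refl))))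

 resultant-homo : ∀ {b0 b1 b2 c0 c1 c2 b0′ b1′ b2′ c0′ c1′ c2′} →
  ⟦ b0 ⟧ ≈ b0′ → ⟦ b1 ⟧ ≈ b1′ → ⟦ b2 ⟧ ≈ b2′ → ⟦ c0 ⟧ ≈ c0′ → ⟦ c1 ⟧ ≈ c1′ → ⟦ c2 ⟧ ≈ c2′ →
  ⟦ IR.resultant b0 b1 b2 c0 c1 c2 ⟧ ≈ IS.resultant b0′ b1′ b2′ c0′ c1′ c2′
 resultant-homo B0 B1 B2 C0 C1 C2 = H* B2 (H+ (H- (H* (H* B2 K0) K0) (H* (H* B1 K0) K1)) (H* (H* B0 K1) K1))
  where
  K1 = H+ (H- (H* (H* B2 B2) C1) (H* (H* B2 B1) C2)) (H- (H* B1 B1) (H* B0 B2))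
  K0 = H+ (H- (H* (H* B2 B2) C0) (H* (H* B2 B0) C2)) (H* B0 B1)

private
 module Iℤ = Invariants ℤ-ring
 module Iℚ = Invariants ℚ.+-*-commutativeRing
 module Qh = InvariantsHom fromℤ-hom

NoRoot-B NonSquareResultant : Vec ℤ 6 → Set
NoRoot-B (b2 ∷ c2 ∷ b1 ∷ b0 ∷ c1 ∷ c0 ∷ []) = b2 ≢ 0ℤ × PQ.NoRoot (fromℤ b0 ∷ fromℤ b1 ∷ fromℤ b2 ∷ [])
NonSquareResultant (b2 ∷ c2 ∷ b1 ∷ b0 ∷ c1 ∷ c0 ∷ []) =
 ∀ w → w ℚ.* w ≢ Iℚ.resultant (fromℤ b0) (fromℤ b1) (fromℤ b2) (fromℤ c0) (fromℤ c1) (fromℤ c2)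

ℚ-discriminant□ : Vec ℤ 7 → PQ.Poly
ℚ-discriminant□ (a ∷ b2 ∷ b1 ∷ b0 ∷ c2 ∷ c1 ∷ c0 ∷ []) =
 Iℚ.discriminant (fromℤ (a ℤ.* a)) 0ℚ (fromℤ b0) (fromℤ b1) (fromℤ b2) (fromℤ c0) (fromℤ c1) (fromℤ c2)

NoRoot-□ NoQuadraticFactors-□ : Vec ℤ 7 → Set
NoRoot-□ v@(_ ∷ b2 ∷ _) = b2 ≢ 0ℤ × PQ.NoRoot (ℚ-discriminant□ v)
NoQuadraticFactors-□ v = PQ.NoQuadraticFactors (ℚ-discriminant□ v)

ℚ-discriminantℓ : Vec ℤ 6 → PQ.Poly
ℚ-discriminantℓ (a1 ∷ a0 ∷ b1 ∷ b0 ∷ c1 ∷ c0 ∷ []) =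
 Iℚ.discriminant (fromℤ a0) (fromℤ a1) (fromℤ b0) (fromℤ b1) 0ℚ (fromℤ c0) (fromℤ c1) 0ℚ

NonSquare-ℓ NoRoot-ℓ NoQuadraticFactors-ℓ : Vec ℤ 6 → Set
NonSquare-ℓ (a1 ∷ _) = ∀ u w → w ≢ 0ℚ → u ℚ.* u ≢ (ℚ.- fromℤ a1) ℚ.* (w ℚ.* w)
NoRoot-ℓ v@(a1 ∷ _) = a1 ≢ 0ℤ × PQ.NoRoot (ℚ-discriminantℓ v)
NoQuadraticFactors-ℓ v = PQ.NoQuadraticFactors (ℚ-discriminantℓ v)

pointwise6 : ∀ {A : Set} {_~_ : A → A → Set} (P : Vec A 6 → Vec A 6 → Set) →
 (∀ {a b c d e f a′ b′ c′ d′ e′ f′} → a ~ a′ → b ~ b′ → c ~ c′ → d ~ d′ → e ~ e′ → f ~ f′ →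
  P (a ∷ b ∷ c ∷ d ∷ e ∷ f ∷ []) (a′ ∷ b′ ∷ c′ ∷ d′ ∷ e′ ∷ f′ ∷ [])) →
 ∀ {u v} → Pointwise _~_ u v → P u v
pointwise6 P k (A ∷ B ∷ C ∷ D ∷ E ∷ F ∷ []) = k A B C D E F

module Soundness {ℓ : ℕ} (ℓ-prime : Prime ℓ) (𝔽 : DiscreteField 0ℓ 0ℓ)
 (π : RingHom ℤ-ring (DiscreteField.commutativeRing 𝔽))
 (kernel : ∀ {a} → DiscreteField._≈_ 𝔽 (RingHom.⟦_⟧ π a) (DiscreteField.0# 𝔽) → + ℓ ℤ.∣ a)
 (ℓ≈0 : DiscreteField._≈_ 𝔽 (RingHom.⟦_⟧ π (+ ℓ)) (DiscreteField.0# 𝔽))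
 (residues : List (DiscreteField.Carrier 𝔽)) (unique-residue : ∀ a → ∑ residues (λ x → 𝟙 (DiscreteField._≟_ 𝔽 x a)) ≡ 1)
 (2≉0 : ¬ (DiscreteField._≈_ 𝔽 (DiscreteField._+_ 𝔽 (DiscreteField.1# 𝔽) (DiscreteField.1# 𝔽)) (DiscreteField.0# 𝔽))) where

 open FactorsModPrime ℓ-prime 𝔽 π kernel ℓ≈0 residues unique-residue
 open Certificates 𝔽 residues unique-residue
 private
  module F = DiscreteField 𝔽
  module π = RingHom π
  module Fh = InvariantsHom π
  module F* = DomainProperties F.domain
  module Q = RingHom fromℤ-hom
  reduceₚ : PZ.Poly → PF.Poly
  reduceₚ = RingHom.⟦_⟧ (polyHom π)
  ℤ→ℚ : PZ.Poly → PQ.Poly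
  ℤ→ℚ = RingHom.⟦_⟧ fromℤ[X]
  factors≢0 : ∀ m n → m N.* n ≢ 0 → m ≢ 0 × n ≢ 0
  factors≢0 m n ne = (λ e → ne (≡.cong (N._* n) e)) , (λ e → ne (≡.trans (≡.cong (m N.*_) e) (N.*-zeroʳ m)))
  unit : ∀ {a} → ν a ≢ 0 → ¬ (a F.≈ F.0#)
  unit {a} = 𝟙≢0 (¬? (F.zero? a))
  nonzero : ∀ {a} → ¬ (π.⟦ a ⟧ F.≈ F.0#) → a ≢ 0ℤ
  nonzero a≉0 e = a≉0 (F.trans (π.⟦⟧-cong e) π.0-homo)
  product≤1 : ∀ {m n} → m N.≤ 1 → n N.≤ 1 → m N.* n N.≤ 1
  product≤1 = N.*-mono-≤

  noRoot : ∀ {D n D′ D″} → D PZ.⊏ suc (suc n) → ¬ (π.⟦ PZ.coeff D (suc n) ⟧ F.≈ F.0#) → reduceₚ D PF.≋ D′ → ℤ→ℚ D PQ.≋ D″ → rootless D′ ≢ 0 → PQ.NoRoot D″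
  noRoot {D} {n} {D′} {D″} D⊏ lead e f ne κ z = rootless⇒noRationalRoot D n D⊏ lead (λ r → ne (≡.trans (≡.sym (rootless-cong {reduceₚ D} {D′} e)) r)) κ
   (≡.trans (RingHom.⟦⟧-cong (Evaluation.evalHom (identityHom ℚ.+-*-commutativeRing) κ) {ℤ→ℚ D} {D″} f) z)

  noQuadraticFactors : ∀ {D D′ D″} → ¬ (π.⟦ PZ.coeff D 4 ⟧ F.≈ F.0#) → reduceₚ D PF.≋ D′ → ℤ→ℚ D PQ.≋ D″ → simple D′ ≢ 0 → PQ.NoQuadraticFactors D″
  noQuadraticFactors {D} {D′} {D″} lead e f ne {g} {h} a≢0 t b≢0 u D≋ = simple⇒noQuadraticFactors D lead (λ r → ne (≡.trans (≡.sym (simple-cong {reduceₚ D} {D′} e)) r))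
   {g} {h} a≢0 t b≢0 u (PQ.≋-trans f D≋)

  square-free : ∀ {v v′ v″} → π.⟦ v ⟧ F.≈ v′ → fromℤ v ≡ v″ → rootless (v′ ∷ F.0# ∷ F.1# ∷ []) ≢ 0 → PQ.NoRoot (v″ ∷ 0ℚ ∷ 1ℚ ∷ [])
  square-free {v} e f = noRoot {v ∷ 0ℤ ∷ 1ℤ ∷ []} {1} (PZ.⊏-length (v ∷ 0ℤ ∷ 1ℤ ∷ [])) (λ z → F.1≉0 (F.trans (F.sym π.1-homo) z))
   (PF.∷-cong e (PF.∷-cong π.0-homo (PF.∷-cong π.1-homo PF.≋-refl))) (PQ.∷-cong f PQ.≋-refl)

  lead-□ : ∀ {b} → ¬ (π.⟦ b ⟧ F.≈ F.0#) → ¬ (π.⟦ b ℤ.* b ℤ.- + 4 ℤ.* 0ℤ ⟧ F.≈ F.0#)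
  lead-□ {b} b≉0 z = F*.*-≉0 b≉0 b≉0 (F.trans (F.sym (π.*-homo b b)) (F.trans (π.⟦⟧-cong (≡.sym (ℤ.+-identityʳ (b ℤ.* b)))) z))

  lead-ℓ : ∀ {a} → ¬ (π.⟦ a ⟧ F.≈ F.0#) → ¬ (π.⟦ 0ℤ ℤ.- + 4 ℤ.* a ⟧ F.≈ F.0#)
  lead-ℓ {a} a≉0 z = F*.*-≉0 2≉0 (F*.*-≉0 2≉0 a≉0) (F.trans (F.trans (F.*-cong h2 (F.*-congʳ h2)) (F.trans (F.*-congˡ (F.sym (π.*-homo (+ 2) a))) (F.sym (π.*-homo (+ 2) (+ 2 ℤ.* a)))))
   (F.trans (π.⟦⟧-cong (IntegerSolver.solve ℤ-ring 1 (λ a → (:1 :+ :1) :* ((:1 :+ :1) :* a) := :- (:0 :- (:1 :+ :1 :+ :1 :+ :1) :* a)) a)) (F.trans (π.-‿homo (0ℤ ℤ.- + 4 ℤ.* a)) (F.trans (F.-‿cong z) (F.trans (F.sym (F.+-identityˡ _)) (F.-‿inverseʳ F.0#))))))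
   where
   h2 : F.1# F.+ F.1# F.≈ π.⟦ + 2 ⟧
   h2 = F.sym (F.trans (π.+-homo 1ℤ 1ℤ) (F.+-cong π.1-homo π.1-homo))

 sound-B : ∀ v → certificate-B (Vec.map π.⟦_⟧ v) ≢ 0 → NoRoot-B v
 sound-B (b2 ∷ c2 ∷ b1 ∷ b0 ∷ c1 ∷ c0 ∷ []) ne with factors≢0 (ν π.⟦ b2 ⟧) _ ne
 ... | ν≢0 , r≢0 = nonzero (unit ν≢0) , noRoot {b0 ∷ b1 ∷ b2 ∷ []} {1} (PZ.⊏-length (b0 ∷ b1 ∷ b2 ∷ [])) (unit ν≢0) PF.≋-refl PQ.≋-refl r≢0

 sound-resultant : ∀ v → certificate-resultant (Vec.map π.⟦_⟧ v) ≢ 0 → NonSquareResultant v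
 sound-resultant (b2 ∷ c2 ∷ b1 ∷ b0 ∷ c1 ∷ c0 ∷ []) ne w e = square-free {ℤ.- Iℤ.resultant b0 b1 b2 c0 c1 c2} {_} {ℚ.- V}
  (F.trans (π.-‿homo (Iℤ.resultant b0 b1 b2 c0 c1 c2)) (F.-‿cong (Fh.resultant-homo F.refl F.refl F.refl F.refl F.refl F.refl)))
  (≡.trans (Q.-‿homo (Iℤ.resultant b0 b1 b2 c0 c1 c2)) (≡.cong ℚ.-_ (Qh.resultant-homo {b0} {b1} {b2} {c0} {c1} {c2} ≡.refl ≡.refl ≡.refl ≡.refl ≡.refl ≡.refl)))
  ne w (root (≡.sym e))
  where
  V : ℚ
  V = Iℚ.resultant (fromℤ b0) (fromℤ b1) (fromℤ b2) (fromℤ c0) (fromℤ c1) (fromℤ c2)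
  root : ∀ {V} → V ≡ w ℚ.* w → ℚ.- V ℚ.+ w ℚ.* (0ℚ ℚ.+ w ℚ.* (1ℚ ℚ.+ w ℚ.* 0ℚ)) ≡ 0ℚ
  root ≡.refl = IntegerSolver.solve ℚ.+-*-commutativeRing 1 (λ w → :- (w :* w) :+ w :* (:0 :+ w :* (:1 :+ w :* :0)) := :0) w
   where open IntegerSolver ℚ.+-*-commutativeRing

 module _ {a b2 b1 b0 c2 c1 c0 : ℤ} where
  private
   v : Vec ℤ 7
   v = a ∷ b2 ∷ b1 ∷ b0 ∷ c2 ∷ c1 ∷ c0 ∷ []
   D : PZ.Poly
   D = Iℤ.discriminant (a ℤ.* a) 0ℤ b0 b1 b2 c0 c1 c2
   mod-ℓ : reduceₚ D PF.≋ discriminant□ (Vec.map π.⟦_⟧ v)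
   mod-ℓ = Fh.discriminant-homo (π.*-homo a a) π.0-homo F.refl F.refl F.refl F.refl F.refl F.refl
   in-ℚ : ℤ→ℚ D PQ.≋ ℚ-discriminant□ v
   in-ℚ = Qh.discriminant-homo {a ℤ.* a} {0ℤ} {b0} {b1} {b2} {c0} {c1} {c2} ≡.refl ≡.refl ≡.refl ≡.refl ≡.refl ≡.refl ≡.refl ≡.refl

  sound-□-rootless : certificate□-rootless (Vec.map π.⟦_⟧ v) ≢ 0 → NoRoot-□ v
  sound-□-rootless ne with factors≢0 (ν π.⟦ b2 ⟧) _ ne
  ... | ν≢0 , r≢0 = nonzero (unit ν≢0) , noRoot {D} {3} (PZ.⊏-length D) (lead-□ (unit ν≢0)) mod-ℓ in-ℚ r≢0

  sound-□-simple : certificate□-simple (Vec.map π.⟦_⟧ v) ≢ 0 → NoQuadraticFactors-□ v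
  sound-□-simple ne {g} {h} with factors≢0 (ν π.⟦ b2 ⟧) _ ne
  ... | ν≢0 , r≢0 = noQuadraticFactors {D} (lead-□ (unit ν≢0)) mod-ℓ in-ℚ r≢0 {g} {h}

 module _ {a1 a0 b1 b0 c1 c0 : ℤ} where
  private
   v : Vec ℤ 6
   v = a1 ∷ a0 ∷ b1 ∷ b0 ∷ c1 ∷ c0 ∷ []
   D : PZ.Poly
   D = Iℤ.discriminant a0 a1 b0 b1 0ℤ c0 c1 0ℤ
   mod-ℓ : reduceₚ D PF.≋ discriminantℓ (Vec.map π.⟦_⟧ v)
   mod-ℓ = Fh.discriminant-homo F.refl F.refl F.refl F.refl π.0-homo F.refl F.refl π.0-homo
   in-ℚ : ℤ→ℚ D PQ.≋ ℚ-discriminantℓ v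
   in-ℚ = Qh.discriminant-homo {a0} {a1} {b0} {b1} {0ℤ} {c0} {c1} {0ℤ} ≡.refl ≡.refl ≡.refl ≡.refl ≡.refl ≡.refl ≡.refl ≡.refl

  -- A solution of u² = - a1 w² with w ≠ 0 makes u / w a rational root of X² + a1.
  sound-ℓ-square : certificateℓ-square (Vec.map π.⟦_⟧ v) ≢ 0 → NonSquare-ℓ v
  sound-ℓ-square ne u w w≢0 e = square-free {a1} F.refl ≡.refl ne (u ℚ.* i) (≡.trans (≡.sym (≡.trans
    (solve 4 (λ a u w i → a :* (i :* w) :* (i :* w) :+ (u :* u) :* (i :* i) := a :* (i :* w) :* (i :* w) :+ (u :* i) :* (:0 :+ (u :* i) :* (:1 :+ (u :* i) :* :0))) (fromℤ a1) u w i)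
    (≡.cong (ℚ._+ (u ℚ.* i) ℚ.* (0ℚ ℚ.+ (u ℚ.* i) ℚ.* (1ℚ ℚ.+ (u ℚ.* i) ℚ.* 0ℚ))) (≡.trans (≡.cong₂ (λ p q → fromℤ a1 ℚ.* p ℚ.* q) iw≡1 iw≡1) (≡.trans (ℚ.*-identityʳ (fromℤ a1 ℚ.* 1ℚ)) (ℚ.*-identityʳ (fromℤ a1)))))))
   (≡.trans (≡.cong (λ s → fromℤ a1 ℚ.* (i ℚ.* w) ℚ.* (i ℚ.* w) ℚ.+ s ℚ.* (i ℚ.* i)) e)
    (solve 3 (λ a w i → a :* (i :* w) :* (i :* w) :+ ((:- a) :* (w :* w)) :* (i :* i) := :0) (fromℤ a1) w i)))
   where
   open IntegerSolver ℚ.+-*-commutativeRing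
   i : ℚ
   i = proj₁ (DiscreteField.inverse ℚ-field w≢0)
   iw≡1 : i ℚ.* w ≡ 1ℚ
   iw≡1 = proj₂ (DiscreteField.inverse ℚ-field w≢0)

  sound-ℓ-rootless : certificateℓ-rootless (Vec.map π.⟦_⟧ v) ≢ 0 → NoRoot-ℓ v
  sound-ℓ-rootless ne with factors≢0 (ν π.⟦ a1 ⟧) _ ne
  ... | ν≢0 , r≢0 = nonzero (unit ν≢0) , noRoot {D} {3} (PZ.⊏-length D) (lead-ℓ {a1} (unit ν≢0)) mod-ℓ in-ℚ r≢0

  sound-ℓ-simple : certificateℓ-simple (Vec.map π.⟦_⟧ v) ≢ 0 → NoQuadraticFactors-ℓ v
  sound-ℓ-simple ne {g} {h} with factors≢0 (ν π.⟦ a1 ⟧) _ ne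
  ... | ν≢0 , r≢0 = noQuadraticFactors {D} (lead-ℓ {a1} (unit ν≢0)) mod-ℓ in-ℚ r≢0 {g} {h}

 certificate-B-cong : ∀ {u v} → Pointwise F._≈_ u v → certificate-B u ≡ certificate-B v
 certificate-B-cong = pointwise6 (λ u v → certificate-B u ≡ certificate-B v) λ B2 C2 B1 B0 C1 C0 → ≡.cong₂ N._*_ (ν-cong B2) (rootless-cong {_ ∷ _ ∷ _ ∷ []} {_ ∷ _ ∷ _ ∷ []} (PF.∷-cong B0 (PF.∷-cong B1 (PF.∷-cong B2 PF.≋-refl))))

 certificate-resultant-cong : ∀ {u v} → Pointwise F._≈_ u v → certificate-resultant u ≡ certificate-resultant v
 certificate-resultant-cong = pointwise6 (λ u v → certificate-resultant u ≡ certificate-resultant v) λ B2 C2 B1 B0 C1 C0 → rootless-cong {_ ∷ _ ∷ _ ∷ []} {_ ∷ _ ∷ _ ∷ []}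
  (PF.∷-cong (F.-‿cong (Invariants.resultant-cong F.commutativeRing B0 B1 B2 C0 C1 C2)) PF.≋-refl)

 private
  discriminant□-cong : ∀ {u v} → Pointwise F._≈_ u v → discriminant□ u PF.≋ discriminant□ v
  discriminant□-cong {a ∷ _} {a′ ∷ _} (A ∷ es) = pointwise6 (λ u v → discriminant□ (a ∷ u) PF.≋ discriminant□ (a′ ∷ v)) (λ B2 B1 B0 C2 C1 C0 → Invariants.discriminant-cong F.commutativeRing (F.*-cong A A) F.refl B0 B1 B2 C0 C1 C2) es
  discriminantℓ-cong : ∀ {u v} → Pointwise F._≈_ u v → discriminantℓ u PF.≋ discriminantℓ v
  discriminantℓ-cong = pointwise6 (λ u v → discriminantℓ u PF.≋ discriminantℓ v) λ A1 A0 B1 B0 C1 C0 → Invariants.discriminant-cong F.commutativeRing A0 A1 B0 B1 F.refl C0 C1 F.refl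

 certificate□-rootless-cong : ∀ {u v} → Pointwise F._≈_ u v → certificate□-rootless u ≡ certificate□-rootless v
 certificate□-rootless-cong {u} {v} e@(_ ∷ B2 ∷ _) = ≡.cong₂ N._*_ (ν-cong B2) (rootless-cong {discriminant□ u} {discriminant□ v} (discriminant□-cong e))
 certificate□-simple-cong : ∀ {u v} → Pointwise F._≈_ u v → certificate□-simple u ≡ certificate□-simple v
 certificate□-simple-cong {u} {v} e@(_ ∷ B2 ∷ _) = ≡.cong₂ N._*_ (ν-cong B2) (simple-cong {discriminant□ u} {discriminant□ v} (discriminant□-cong e))
 certificateℓ-square-cong : ∀ {u v} → Pointwise F._≈_ u v → certificateℓ-square u ≡ certificateℓ-square v
 certificateℓ-square-cong (A1 ∷ _) = rootless-cong {_ ∷ _ ∷ _ ∷ []} {_ ∷ _ ∷ _ ∷ []} (PF.∷-cong A1 PF.≋-refl)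
 certificateℓ-rootless-cong : ∀ {u v} → Pointwise F._≈_ u v → certificateℓ-rootless u ≡ certificateℓ-rootless v
 certificateℓ-rootless-cong {u} {v} e@(A1 ∷ _) = ≡.cong₂ N._*_ (ν-cong A1) (rootless-cong {discriminantℓ u} {discriminantℓ v} (discriminantℓ-cong e))
 certificateℓ-simple-cong : ∀ {u v} → Pointwise F._≈_ u v → certificateℓ-simple u ≡ certificateℓ-simple v
 certificateℓ-simple-cong {u} {v} e@(A1 ∷ _) = ≡.cong₂ N._*_ (ν-cong A1) (simple-cong {discriminantℓ u} {discriminantℓ v} (discriminantℓ-cong e))

 certificate-B≤1 : ∀ v → certificate-B v N.≤ 1
 certificate-B≤1 (b2 ∷ c2 ∷ b1 ∷ b0 ∷ c1 ∷ c0 ∷ []) = product≤1 (ν≤1 b2) (rootless≤1 (b0 ∷ b1 ∷ b2 ∷ []))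
 certificate-resultant≤1 : ∀ v → certificate-resultant v N.≤ 1
 certificate-resultant≤1 (b2 ∷ c2 ∷ b1 ∷ b0 ∷ c1 ∷ c0 ∷ []) = rootless≤1 (F.- Invariants.resultant F.commutativeRing b0 b1 b2 c0 c1 c2 ∷ F.0# ∷ F.1# ∷ [])
 certificate□-rootless≤1 : ∀ v → certificate□-rootless v N.≤ 1
 certificate□-rootless≤1 v@(_ ∷ b2 ∷ _) = product≤1 (ν≤1 b2) (rootless≤1 (discriminant□ v))
 certificate□-simple≤1 : ∀ v → certificate□-simple v N.≤ 1
 certificate□-simple≤1 v@(_ ∷ b2 ∷ _) = product≤1 (ν≤1 b2) (simple≤1 (discriminant□ v))
 certificateℓ-square≤1 : ∀ v → certificateℓ-square v N.≤ 1
 certificateℓ-square≤1 (a1 ∷ _) = rootless≤1 (a1 ∷ F.0# ∷ F.1# ∷ [])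
 certificateℓ-rootless≤1 : ∀ v → certificateℓ-rootless v N.≤ 1
 certificateℓ-rootless≤1 v@(a1 ∷ _) = product≤1 (ν≤1 a1) (rootless≤1 (discriminantℓ v))
 certificateℓ-simple≤1 : ∀ v → certificateℓ-simple v N.≤ 1
 certificateℓ-simple≤1 v@(a1 ∷ _) = product≤1 (ν≤1 a1) (simple≤1 (discriminantℓ v))

-- The sieve

record ResidueField (ℓ : ℕ) : Set1 where
 field
  ℓ-prime : Prime ℓ
  3≤ℓ : 3 N.≤ ℓ
  𝔽 : DiscreteField 0ℓ 0ℓ
  π : RingHom ℤ-ring (DiscreteField.commutativeRing 𝔽)
 module F = DiscreteField 𝔽
 module π = RingHom π
 field
  kernel : ∀ {a} → π.⟦ a ⟧ F.≈ F.0# → + ℓ ℤ.∣ a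
  respects : ∀ {a b} → a ≡ b [mod ℓ ] → π.⟦ a ⟧ F.≈ π.⟦ b ⟧
  unique-residue : ∀ a → ∑ (map π.⟦_⟧ (interval 0ℤ ℓ)) (λ x → 𝟙 (x F.≟ a)) ≡ 1

residueField : ∀ {ℓ} → Prime ℓ → 3 N.≤ ℓ → ResidueField ℓ
residueField {ℓ} ℓ-prime 3≤ℓ = record
 { ℓ-prime = ℓ-prime ; 3≤ℓ = 3≤ℓ ; 𝔽 = 𝔽 ; π = projection ; kernel = λ e → signed∣ (≈0⇒∣ e) ; respects = λ e → e
 ; unique-residue = λ a → ≡.trans (∑-map (λ x → x) residues (λ x → 𝟙 (DiscreteField._≟_ 𝔽 x a))) (unique-residue a) }
 where open ModPrime ℓ-prime

_≡ⱽ_[mod_] : ∀ {m} → Vec ℤ m → Vec ℤ m → ℕ → Set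
u ≡ⱽ v [mod M ] = Pointwise (λ x y → x ≡ y [mod M ]) u v

Periodicⱽ : ∀ {m} → ℕ → (Vec ℤ m → ℕ) → Set
Periodicⱽ M f = ∀ {u v} → u ≡ⱽ v [mod M ] → f u ≡ f v

box : ∀ m → ℕ → Vec (List ℤ) m
box m M = replicate m (interval 0ℤ M)

-- A property of integer vectors implied by a test modulo any odd prime, which at least one residue class in 80 passes.

record Criterion (m : ℕ) : Set1 where
 field
  Holds : Vec ℤ m → Set
  test : ∀ {ℓ} → ResidueField ℓ → Vec ℤ m → ℕ
  test≤1 : ∀ {ℓ} (R : ResidueField ℓ) v → test R v N.≤ 1
  periodic : ∀ {ℓ} (R : ResidueField ℓ) → Periodicⱽ ℓ (test R)
  many : ∀ {ℓ} (R : ResidueField ℓ) → ℓ N.^ m N.≤ 80 N.* ∑ⱽ (box m ℓ) (test R)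
  sound : ∀ {ℓ} (R : ResidueField ℓ) v → test R v ≢ 0 → Holds v

module _ {a b} {A : Set a} {B : Set b} where
 ∑ⱽ-map : ∀ m (h : A → B) xs f → ∑ⱽ (replicate m (map h xs)) f ≡ ∑ⱽ (replicate m xs) (λ v → f (Vec.map h v))
 ∑ⱽ-map zero h xs f = ≡.refl
 ∑ⱽ-map (suc m) h xs f = ≡.trans (∑-map h xs _) (∑-cong xs λ x → ∑ⱽ-map m h xs (λ v → f (h x ∷ v)))

module _ {a} {A : Set a} where
 ∑ⱽ-cong : ∀ {m} (xss : Vec (List A) m) {f g} → (∀ v → f v ≡ g v) → ∑ⱽ xss f ≡ ∑ⱽ xss g
 ∑ⱽ-cong [] e = e []
 ∑ⱽ-cong (xs ∷ xss) e = ∑-cong xs λ x → ∑ⱽ-cong xss λ v → e (x ∷ v)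

 ∑ⱽ-+ : ∀ {m} (xss : Vec (List A) m) f g → ∑ⱽ xss (λ v → f v N.+ g v) ≡ ∑ⱽ xss f N.+ ∑ⱽ xss g
 ∑ⱽ-+ [] f g = ≡.refl
 ∑ⱽ-+ (xs ∷ xss) f g = ≡.trans (∑-cong xs λ x → ∑ⱽ-+ xss (λ v → f (x ∷ v)) (λ v → g (x ∷ v))) (∑-+ xs _ _)

 ∑ⱽ-1 : ∀ m (xs : List A) → ∑ⱽ (replicate m xs) (λ _ → 1) ≡ length xs N.^ m
 ∑ⱽ-1 zero xs = ≡.refl
 ∑ⱽ-1 (suc m) xs = ≡.trans (∑-cong xs λ _ → ∑ⱽ-1 m xs) (∑-const xs _)

module AtPrime {ℓ} (R : ResidueField ℓ) where
 open ResidueField R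
 private
  residues = map π.⟦_⟧ (interval 0ℤ ℓ)

  length-residues : length residues ≡ ℓ
  length-residues = ≡.trans (List.length-map π.⟦_⟧ (interval 0ℤ ℓ)) (length-interval 0ℤ ℓ)

  2≉0 : ¬ (F.1# F.+ F.1# F.≈ F.0#)
  2≉0 e = N.<⇒≱ 3≤ℓ (N.∣⇒≤ (ℤ.∣⇒∣ᵤ (kernel (F.trans (π.+-homo 1ℤ 1ℤ) (F.trans (F.+-cong π.1-homo π.1-homo) e)))))

  3≤size : 3 N.≤ length residues
  3≤size = ≡.subst (3 N.≤_) (≡.sym length-residues) 3≤ℓ

  ℓ≈0 : π.⟦ + ℓ ⟧ F.≈ F.0#
  ℓ≈0 = F.trans (respects (multiple ℓ 1ℤ (≡.sym (≡.trans (ℤ.+-identityʳ (1ℤ ℤ.* + ℓ)) (ℤ.*-identityˡ (+ ℓ)))))) π.0-homo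

 open Soundness ℓ-prime 𝔽 π kernel ℓ≈0 residues unique-residue 2≉0 public
 open Certificates 𝔽 residues unique-residue public
 module Many where
  B = many-B 3≤size 2≉0
  resultants = many-resultants 3≤size 2≉0
  rootless□ = many-rootless□ 3≤size 2≉0
  simple□ = many-simple□ 3≤size 2≉0
  squareℓ = many-squareℓ 3≤size 2≉0
  rootlessℓ = many-rootlessℓ 3≤size 2≉0
  simpleℓ = many-simpleℓ 3≤size 2≉0

 over-ℤ : ∀ m (f : Vec F.Carrier m → ℕ) → length residues N.^ m N.≤ 80 N.* ∑ⱽ (replicate m residues) f →
      ℓ N.^ m N.≤ 80 N.* ∑ⱽ (box m ℓ) (λ v → f (Vec.map π.⟦_⟧ v))
 over-ℤ m f = ≡.subst₂ (λ n k → n N.^ m N.≤ 80 N.* k) length-residues (∑ⱽ-map m π.⟦_⟧ (interval 0ℤ ℓ) f)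

 reduced : ∀ {m} {u v : Vec ℤ m} → u ≡ⱽ v [mod ℓ ] → Pointwise F._≈_ (Vec.map π.⟦_⟧ u) (Vec.map π.⟦_⟧ v)
 reduced [] = []
 reduced (e ∷ es) = respects e ∷ reduced es

mkCriterion : ∀ {m} (Holds : Vec ℤ m → Set) (certificate : ∀ {ℓ} (R : ResidueField ℓ) → Vec (ResidueField.F.Carrier R) m → ℕ) →
 (∀ {ℓ} (R : ResidueField ℓ) v → certificate R v N.≤ 1) →
 (∀ {ℓ} (R : ResidueField ℓ) {u v} → Pointwise (ResidueField.F._≈_ R) u v → certificate R u ≡ certificate R v) →
 (∀ {ℓ} (R : ResidueField ℓ) → let residues = map (ResidueField.π.⟦_⟧ R) (interval 0ℤ ℓ) in
   length residues N.^ m N.≤ 80 N.* ∑ⱽ (replicate m residues) (certificate R)) →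
 (∀ {ℓ} (R : ResidueField ℓ) v → certificate R (Vec.map (ResidueField.π.⟦_⟧ R) v) ≢ 0 → Holds v) → Criterion m
mkCriterion {m} Holds certificate ≤1 cong many sound = record
 { Holds = Holds ; test = λ R v → certificate R (Vec.map (ResidueField.π.⟦_⟧ R) v) ; test≤1 = λ R v → ≤1 R _
 ; periodic = λ R {u} {v} e → cong R (AtPrime.reduced R {m} {u} {v} e) ; many = λ R → AtPrime.over-ℤ R m (certificate R) (many R) ; sound = sound }

criterion-B criterion-resultant criterionℓ-square criterionℓ-rootless criterionℓ-simple : Criterion 6
criterion-B = mkCriterion NoRoot-B AtPrime.certificate-B AtPrime.certificate-B≤1 (λ R → AtPrime.certificate-B-cong R) AtPrime.Many.B AtPrime.sound-B
criterion-resultant = mkCriterion NonSquareResultant AtPrime.certificate-resultant AtPrime.certificate-resultant≤1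
 (λ R → AtPrime.certificate-resultant-cong R) AtPrime.Many.resultants AtPrime.sound-resultant
criterionℓ-square = mkCriterion NonSquare-ℓ AtPrime.certificateℓ-square AtPrime.certificateℓ-square≤1
 (λ R → AtPrime.certificateℓ-square-cong R) AtPrime.Many.squareℓ (λ { R (a1 ∷ a0 ∷ b1 ∷ b0 ∷ c1 ∷ c0 ∷ []) → AtPrime.sound-ℓ-square R {a1} {a0} {b1} {b0} {c1} {c0} })
criterionℓ-rootless = mkCriterion NoRoot-ℓ AtPrime.certificateℓ-rootless AtPrime.certificateℓ-rootless≤1
 (λ R → AtPrime.certificateℓ-rootless-cong R) AtPrime.Many.rootlessℓ (λ { R (_ ∷ _ ∷ _ ∷ _ ∷ _ ∷ _ ∷ []) → AtPrime.sound-ℓ-rootless R })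
criterionℓ-simple = mkCriterion NoQuadraticFactors-ℓ AtPrime.certificateℓ-simple AtPrime.certificateℓ-simple≤1
 (λ R → AtPrime.certificateℓ-simple-cong R) AtPrime.Many.simpleℓ (λ { R (_ ∷ _ ∷ _ ∷ _ ∷ _ ∷ _ ∷ []) ne {g} {h} → AtPrime.sound-ℓ-simple R ne {g} {h} })

criterion□-rootless criterion□-simple : Criterion 7
criterion□-rootless = mkCriterion NoRoot-□ AtPrime.certificate□-rootless AtPrime.certificate□-rootless≤1
 (λ R → AtPrime.certificate□-rootless-cong R) AtPrime.Many.rootless□ (λ { R (_ ∷ _ ∷ _ ∷ _ ∷ _ ∷ _ ∷ _ ∷ []) → AtPrime.sound-□-rootless R })
criterion□-simple = mkCriterion NoQuadraticFactors-□ AtPrime.certificate□-simple AtPrime.certificate□-simple≤1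
 (λ R → AtPrime.certificate□-simple-cong R) AtPrime.Many.simple□ (λ { R (_ ∷ _ ∷ _ ∷ _ ∷ _ ∷ _ ∷ _ ∷ []) ne {g} {h} → AtPrime.sound-□-simple R ne {g} {h} })

prime-divisor : ∀ n → 2 N.≤ n → Σ[ p ∈ ℕ ] Prime p × p N.∣ n
prime-divisor n 2≤n = head (PrimeFactorisation.factors f) (PrimeFactorisation.isFactorisation f) (PrimeFactorisation.factorsPrime f)
 where
 f : PrimeFactorisation n
 f = factorise n {{N.>-nonZero (N.≤-trans (s≤s z≤n) 2≤n)}}
 head : ∀ ps → n ≡ List.product ps → All.All Prime ps → Σ[ p ∈ ℕ ] Prime p × p N.∣ n
 head [] e _ = ⊥-elim (N.<⇒≱ 2≤n (N.≤-reflexive e))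
 head (p ∷ ps) e (pr ∷ _) = p , pr , N.divides (List.product ps) (≡.trans e (N.*-comm p (List.product ps)))

-- a prime factor of 2 M + 1
coprime-prime : ∀ M .{{_ : N.NonZero M}} → Σ[ ℓ ∈ ℕ ] Prime ℓ × 3 N.≤ ℓ × ¬ (ℓ N.∣ M)
coprime-prime M with prime-divisor (2 N.* M N.+ 1) (N.≤-trans (N.*-monoʳ-≤ 2 (N.>-nonZero⁻¹ M)) (N.m≤m+n (2 N.* M) 1))
... | ℓ , pr , ℓ∣ = ℓ , pr , 3≤ ℓ pr ℓ∣ , λ ℓ∣M → ¬∣1 pr (N.∣m+n∣m⇒∣n ℓ∣ (N.∣n⇒∣m*n 2 ℓ∣M))
 where
 ¬∣1 : ∀ {p} → Prime p → ¬ (p N.∣ 1)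
 ¬∣1 pr d = ¬prime[1] (≡.subst Prime (N.∣1⇒≡1 d) pr)
 3≤ : ∀ p → Prime p → p N.∣ 2 N.* M N.+ 1 → 3 N.≤ p
 3≤ 0 pr d = ⊥-elim (¬prime[0] pr)
 3≤ 1 pr d = ⊥-elim (¬prime[1] pr)
 3≤ 2 pr d = ⊥-elim (¬∣1 pr (N.∣m+n∣m⇒∣n d (N.m∣m*n M)))
 3≤ (suc (suc (suc p))) pr d = s≤s (s≤s (s≤s z≤n))

≡ⱽ-refl : ∀ {M m} (v : Vec ℤ m) → v ≡ⱽ v [mod M ]
≡ⱽ-refl [] = []
≡ⱽ-refl {M} (x ∷ v) = multiple M 0ℤ (≡.trans (≡.sym (ℤ.+-identityˡ x)) (≡.cong (ℤ._+ x) (≡.sym (ℤ.*-zeroˡ (+ M))))) ∷ ≡ⱽ-refl v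

≡-refl[mod] : ∀ {M} x → x ≡ x [mod M ]
≡-refl[mod] {M} x with ≡ⱽ-refl {M} (x ∷ [])
... | e ∷ [] = e

∑ⱽ-periodic : ∀ {M m} (xss : Vec (List ℤ) m) {f : Vec ℤ (suc m) → ℕ} → Periodicⱽ M f → Periodic M (λ x → ∑ⱽ xss (λ v → f (x ∷ v)))
∑ⱽ-periodic xss per e = ∑ⱽ-cong xss λ v → per (e ∷ ≡ⱽ-refl v)

-- One coordinate is treated at a time: once the other coordinates are summed over, what remains is
-- again periodic in the first.
∑ⱽ-remainder : ∀ m {ℓ} (ℓ-prime : Prime ℓ) M → ¬ (ℓ N.∣ M) → ∀ {f g} → Periodicⱽ M f → Periodicⱽ ℓ g →
        ∑ⱽ (box m (ℓ N.* M)) (λ v → f v N.* g v) ≡ ∑ⱽ (box m M) f N.* ∑ⱽ (box m ℓ) g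
∑ⱽ-remainder zero pr M ∤M f-per g-per = ≡.refl
∑ⱽ-remainder (suc m) {ℓ} pr M ∤M {f} {g} f-per g-per = ≡.trans
 (∑-cong (interval 0ℤ (ℓ N.* M)) λ x → ∑ⱽ-remainder m pr M ∤M {λ v → f (x ∷ v)} {λ v → g (x ∷ v)} (λ e → f-per (≡-refl[mod] x ∷ e)) (λ e → g-per (≡-refl[mod] x ∷ e)))
 (ModPrime.∑-remainder pr M ∤M (∑ⱽ-periodic (box m M) {f} f-per) (∑ⱽ-periodic (box m ℓ) {g} g-per))

^-distribʳ : ∀ m a b → (a N.* b) N.^ m ≡ a N.^ m N.* b N.^ m
^-distribʳ zero a b = ≡.refl
^-distribʳ (suc m) a b = ≡.trans (≡.cong (a N.* b N.*_) (^-distribʳ m a b))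
 (NS.solve 4 (λ a b c d → a NS.:* b NS.:* (c NS.:* d) NS.:= a NS.:* c NS.:* (b NS.:* d)) ≡.refl a b (a N.^ m) (b N.^ m))

-- The state after k primes: M is their product, and `bad` marks the vectors that fail the test at
-- every one of them. The mean of `bad` over a period is at most (79/80)^k.
record Sieved {m} (C : Criterion m) (k : ℕ) : Set where
 open Criterion C
 field
  M : ℕ
  {{M≢0}} : N.NonZero M
  bad : Vec ℤ m → ℕ
  bad-periodic : Periodicⱽ M bad
  few : 80 N.^ k N.* ∑ⱽ (box m M) bad N.≤ 79 N.^ k N.* M N.^ m
  good : ∀ v → bad v ≡ 0 → Holds v

-- A new prime ℓ coprime to M multiplies `bad` by the indicator of failure at ℓ. By the Chinese
-- remainder theorem the two conditions are independent, so the mean is multiplied by at most 79/80.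
sieved : ∀ {m} (C : Criterion m) k → Sieved C k
sieved {m} C zero = record { M = 1 ; bad = λ _ → 1 ; bad-periodic = λ _ → ≡.refl ; good = λ _ ()
 ; few = N.≤-reflexive (≡.cong (1 N.*_) (∑ⱽ-1 m (0ℤ ∷ []))) }
sieved {m} C (suc k) with sieved C k
... | S with coprime-prime (Sieved.M S) {{Sieved.M≢0 S}}
... | ℓ , ℓ-prime , 3≤ℓ , ℓ∤M = record
 { M = ℓ N.* M ; M≢0 = N.m*n≢0 ℓ M {{N.>-nonZero (N.≤-trans (s≤s z≤n) 3≤ℓ)}} ; bad = λ v → bad v N.* (1 N.∸ test R v)
 ; bad-periodic = λ e → ≡.cong₂ N._*_ (bad-periodic (weaken e ℓ)) (≡.cong (1 N.∸_) (periodic R (weaken′ e)))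
 ; few = few′
 ; good = λ v e → [ good v , (λ z → sound R v λ t≡0 → N.1+n≢0 (≡.trans (≡.sym (≡.cong (1 N.∸_) t≡0)) z)) ]′ (N.m*n≡0⇒m≡0∨n≡0 (bad v) e) }
 where
 open Criterion C
 open Sieved S
 R : ResidueField ℓ
 R = residueField ℓ-prime 3≤ℓ
 weaken1 : ∀ N d {x y} → x ≡ y [mod d N.* N ] → x ≡ y [mod N ]
 weaken1 N d (Quotient.mod (ℤ∣.divides q e)) = Quotient.mod (ℤ∣.divides (q ℤ.* + d) (≡.trans e (≡.trans (≡.cong (q ℤ.*_) (ℤ.pos-* d N)) (≡.sym (ℤ.*-assoc q (+ d) (+ N))))))
 weaken : ∀ {n} {u v : Vec ℤ n} → u ≡ⱽ v [mod ℓ N.* M ] → ∀ d → u ≡ⱽ v [mod M ]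
 weaken [] d = []
 weaken (e ∷ es) d = weaken1 M ℓ e ∷ weaken es d
 weaken′ : ∀ {n} {u v : Vec ℤ n} → u ≡ⱽ v [mod ℓ N.* M ] → u ≡ⱽ v [mod ℓ ]
 weaken′ [] = []
 weaken′ {u = x ∷ _} {y ∷ _} (e ∷ es) = weaken1 ℓ M (≡.subst (λ n → x ≡ y [mod n ]) (N.*-comm ℓ M) e) ∷ weaken′ es
 failing : 80 N.* ∑ⱽ (box m ℓ) (λ v → 1 N.∸ test R v) N.≤ 79 N.* ℓ N.^ m
 failing = N.+-cancelʳ-≤ (80 N.* ∑ⱽ (box m ℓ) (test R)) (80 N.* ∑ⱽ (box m ℓ) (λ v → 1 N.∸ test R v)) (79 N.* ℓ N.^ m) (begin
  80 N.* ∑ⱽ (box m ℓ) (λ v → 1 N.∸ test R v) N.+ 80 N.* ∑ⱽ (box m ℓ) (test R) ≡⟨ N.*-distribˡ-+ 80 (∑ⱽ (box m ℓ) (λ v → 1 N.∸ test R v)) (∑ⱽ (box m ℓ) (test R)) ⟨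
  80 N.* (∑ⱽ (box m ℓ) (λ v → 1 N.∸ test R v) N.+ ∑ⱽ (box m ℓ) (test R))
   ≡⟨ ≡.cong (80 N.*_) (≡.trans (≡.sym (∑ⱽ-+ (box m ℓ) (λ v → 1 N.∸ test R v) (test R))) (≡.trans (∑ⱽ-cong (box m ℓ) λ v → N.m∸n+n≡m (test≤1 R v))
      (≡.trans (∑ⱽ-1 m (interval 0ℤ ℓ)) (≡.cong (N._^ m) (length-interval 0ℤ ℓ))))) ⟩
  80 N.* ℓ N.^ m ≡⟨ N.+-comm (ℓ N.^ m) (79 N.* ℓ N.^ m) ⟩
  79 N.* ℓ N.^ m N.+ ℓ N.^ m ≤⟨ N.+-monoʳ-≤ (79 N.* ℓ N.^ m) (many R) ⟩
  79 N.* ℓ N.^ m N.+ 80 N.* ∑ⱽ (box m ℓ) (test R) ∎)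
  where open N.≤-Reasoning
 few′ : 80 N.^ suc k N.* ∑ⱽ (box m (ℓ N.* M)) (λ v → bad v N.* (1 N.∸ test R v)) N.≤ 79 N.^ suc k N.* (ℓ N.* M) N.^ m
 few′ = begin
  80 N.* 80 N.^ k N.* ∑ⱽ (box m (ℓ N.* M)) (λ v → bad v N.* (1 N.∸ test R v))
   ≡⟨ ≡.cong (80 N.* 80 N.^ k N.*_) (∑ⱽ-remainder m ℓ-prime M ℓ∤M bad-periodic (λ e → ≡.cong (1 N.∸_) (periodic R e))) ⟩
  80 N.* 80 N.^ k N.* (∑ⱽ (box m M) bad N.* ∑ⱽ (box m ℓ) (λ v → 1 N.∸ test R v)) ≡⟨ swap 80 (80 N.^ k) (∑ⱽ (box m M) bad) (∑ⱽ (box m ℓ) (λ v → 1 N.∸ test R v)) ⟩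
  80 N.* ∑ⱽ (box m ℓ) (λ v → 1 N.∸ test R v) N.* (80 N.^ k N.* ∑ⱽ (box m M) bad) ≤⟨ N.*-mono-≤ failing few ⟩
  79 N.* ℓ N.^ m N.* (79 N.^ k N.* M N.^ m) ≡⟨ ≡.trans (≡.sym (swap 79 (79 N.^ k) (M N.^ m) (ℓ N.^ m)))
                           (≡.cong (79 N.* 79 N.^ k N.*_) (≡.trans (N.*-comm (M N.^ m) (ℓ N.^ m)) (≡.sym (^-distribʳ m ℓ M)))) ⟩
  79 N.* 79 N.^ k N.* (ℓ N.* M) N.^ m ∎
  where
  open N.≤-Reasoning
  swap : ∀ a b c d → a N.* b N.* (c N.* d) ≡ a N.* d N.* (b N.* c)
  swap = NS.solve 4 (λ a b c d → a NS.:* b NS.:* (c NS.:* d) NS.:= a NS.:* d NS.:* (b NS.:* c)) ≡.refl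

-- With q the integer part of L / M, the interval is covered by q + 1 periods, and (q + 1) M ≤ 2 L
-- because M ≤ L.
∑-period : ∀ {M g} .{{_ : N.NonZero M}} → Periodic M g → ∀ a L → M N.≤ L → M N.* ∑ (interval a L) g N.≤ 2 N.* L N.* ∑ (interval 0ℤ M) g
∑-period {M} {g} per a L M≤L = begin
 M N.* ∑ (interval a L) g ≤⟨ N.*-monoʳ-≤ M (≡.subst (λ n → ∑ (interval a L) g N.≤ ∑ (interval a n) g) (N.m+[n∸m]≡n L≤) (≡.subst (∑ (interval a L) g N.≤_)
                        (≡.sym (∑-interval-++ a L (suc q N.* M N.∸ L) g)) (N.m≤m+n _ _))) ⟩
 M N.* ∑ (interval a (suc q N.* M)) g ≡⟨ ≡.cong (M N.*_) (blocks (suc q) a) ⟩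
 M N.* (suc q N.* S) ≡⟨ NS.solve 3 (λ m q s → m NS.:* ((NS.con 1 NS.:+ q) NS.:* s) NS.:= (m NS.:+ q NS.:* m) NS.:* s) ≡.refl M q S ⟩
 (M N.+ q N.* M) N.* S ≤⟨ N.*-monoˡ-≤ S (N.+-mono-≤ M≤L (≡.subst (q N.* M N.≤_) (≡.sym (N.m≡m%n+[m/n]*n L M)) (N.m≤n+m (q N.* M) (L N.% M)))) ⟩
 (L N.+ L) N.* S ≡⟨ ≡.cong (λ n → (L N.+ n) N.* S) (N.+-identityʳ L) ⟨
 2 N.* L N.* S ∎
 where
 open N.≤-Reasoning
 q S : ℕ
 q = L N./ M
 S = ∑ (interval 0ℤ M) g
 L≤ : L N.≤ suc q N.* M
 L≤ = ≡.subst (N._≤ suc q N.* M) (≡.sym (N.m≡m%n+[m/n]*n L M)) (N.+-monoˡ-≤ (q N.* M) (N.<⇒≤ (N.m%n<n L M)))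
 blocks : ∀ n a → ∑ (interval a (n N.* M)) g ≡ n N.* S
 blocks zero a = ≡.refl
 blocks (suc n) a = ≡.trans (∑-interval-++ a M (n N.* M) g) (≡.cong₂ N._+_ (∑-shift {M} {g} per a) (blocks n (+ M ℤ.+ a)))

Box : ℕ → Set
Box m = Vec (ℤ × ℕ) m

sides : ∀ {m} → Box m → Vec (List ℤ) m
sides = Vec.map (λ (a , L) → interval a L)

volume : ∀ {m} → Box m → ℕ
volume [] = 1
volume ((_ , L) ∷ b) = L N.* volume b

-- Every coordinate contributes one factor 2 for the incomplete period at the end of its side.
∑ⱽ-period : ∀ {m M f} .{{_ : N.NonZero M}} → Periodicⱽ M f → (b : Box m) → VecAll.All (λ (_ , L) → M N.≤ L) b →
      M N.^ m N.* ∑ⱽ (sides b) f N.≤ 2 N.^ m N.* volume b N.* ∑ⱽ (box m M) f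
∑ⱽ-period per [] [] = N.≤-refl
∑ⱽ-period {suc m} {M} {f} per ((a , L) ∷ b) (M≤L ∷ M≤b) = begin
 M N.* M N.^ m N.* ∑ (interval a L) (λ x → ∑ⱽ (sides b) (λ v → f (x ∷ v))) ≡⟨ N.*-assoc M (M N.^ m) _ ⟩
 M N.* (M N.^ m N.* ∑ (interval a L) (λ x → ∑ⱽ (sides b) (λ v → f (x ∷ v))))
  ≡⟨ ≡.cong (M N.*_) (∑-*ˡ (interval a L) (M N.^ m) _) ⟨
 M N.* ∑ (interval a L) (λ x → M N.^ m N.* ∑ⱽ (sides b) (λ v → f (x ∷ v)))
  ≤⟨ N.*-monoʳ-≤ M (∑-mono (interval a L) λ x → ∑ⱽ-period {f = λ v → f (x ∷ v)} (λ e → per (≡-refl[mod] x ∷ e)) b M≤b) ⟩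
 M N.* ∑ (interval a L) (λ x → V N.* G x) ≡⟨ ≡.cong (M N.*_) (∑-*ˡ (interval a L) V G) ⟩
 M N.* (V N.* ∑ (interval a L) G) ≡⟨ swap M V _ ⟩
 V N.* (M N.* ∑ (interval a L) G) ≤⟨ N.*-monoʳ-≤ V (∑-period {M} {G} (∑ⱽ-periodic (box m M) {f} per) a L M≤L) ⟩
 V N.* (2 N.* L N.* ∑ (interval 0ℤ M) G)
  ≡⟨ NS.solve 4 (λ p v l s → p NS.:* v NS.:* (NS.con 2 NS.:* l NS.:* s) NS.:= NS.con 2 NS.:* p NS.:* (l NS.:* v) NS.:* s) ≡.refl (2 N.^ m) (volume b) L (∑ (interval 0ℤ M) G) ⟩
 2 N.* 2 N.^ m N.* (L N.* volume b) N.* ∑ (interval 0ℤ M) G ∎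
 where
 open N.≤-Reasoning
 V : ℕ
 V = 2 N.^ m N.* volume b
 G : ℤ → ℕ
 G x = ∑ⱽ (box m M) (λ v → f (x ∷ v))
 swap : ∀ a b c → a N.* (b N.* c) ≡ b N.* (a N.* c)
 swap = NS.solve 3 (λ a b c → a NS.:* (b NS.:* c) NS.:= b NS.:* (a NS.:* c)) ≡.refl

-- Bernoulli's inequality for (1 + 1/d)^k, with k = d Q.
power-large : ∀ d Q .{{_ : N.NonZero d}} → Σ[ k ∈ ℕ ] Q N.* d N.^ k N.≤ suc d N.^ k
power-large d Q = d N.* Q , N.*-cancelˡ-≤ d (begin
 d N.* (Q N.* X) ≡⟨ NS.solve 3 (λ d q x → d NS.:* (q NS.:* x) NS.:= x NS.:* (d NS.:* q)) ≡.refl d Q X ⟩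
 X N.* (d N.* Q) ≤⟨ N.*-monoʳ-≤ X (N.m≤n+m (d N.* Q) d) ⟩
 X N.* (d N.+ d N.* Q) ≤⟨ bernoulli (d N.* Q) ⟩
 d N.* suc d N.^ (d N.* Q) ∎)
 where
 open N.≤-Reasoning
 X : ℕ
 X = d N.^ (d N.* Q)
 bernoulli : ∀ k → d N.^ k N.* (d N.+ k) N.≤ d N.* suc d N.^ k
 bernoulli zero = N.≤-reflexive (NS.solve 1 (λ d → NS.con 1 NS.:* (d NS.:+ NS.con 0) NS.:= d NS.:* NS.con 1) ≡.refl d)
 bernoulli (suc k) = begin
  d N.* d N.^ k N.* (d N.+ suc k) ≤⟨ N.m≤m+n _ (d N.^ k N.* k) ⟩
  d N.* d N.^ k N.* (d N.+ suc k) N.+ d N.^ k N.* k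
   ≡⟨ NS.solve 3 (λ d p k → d NS.:* p NS.:* (d NS.:+ (NS.con 1 NS.:+ k)) NS.:+ p NS.:* k NS.:= (NS.con 1 NS.:+ d) NS.:* (p NS.:* (d NS.:+ k))) ≡.refl d (d N.^ k) k ⟩
  suc d N.* (d N.^ k N.* (d N.+ k)) ≤⟨ N.*-monoʳ-≤ (suc d) (bernoulli k) ⟩
  suc d N.* (d N.* suc d N.^ k) ≡⟨ NS.solve 2 (λ d p → (NS.con 1 NS.:+ d) NS.:* (d NS.:* p) NS.:= d NS.:* ((NS.con 1 NS.:+ d) NS.:* p)) ≡.refl d (suc d N.^ k) ⟩
  d N.* (suc d N.* suc d N.^ k) ∎

-- Only the lengths of the sides are bounded, not the position of the box: in one family the range
-- of a coordinate is not symmetric about 0.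
record Sparse {m} (Holds : Vec ℤ m → Set) (q : ℕ) : Set where
 field
  N : ℕ
  bad : Vec ℤ m → ℕ
  few : ∀ (b : Box m) → VecAll.All (λ (_ , L) → N N.≤ L) b → q N.* ∑ⱽ (sides b) bad N.≤ volume b
  good : ∀ v → bad v ≡ 0 → Holds v

-- The number k of primes is chosen with q 2^m 79^k ≤ 80^k; the factor 2^m makes up for covering the
-- box by whole periods.
sparse : ∀ {m} (C : Criterion m) q → Sparse (Criterion.Holds C) q
sparse {m} C q = from (proj₁ (power-large 79 (q N.* 2 N.^ m))) (proj₂ (power-large 79 (q N.* 2 N.^ m)))
 where
 bound : ∀ X Y Z t v S s .{{_ : N.NonZero X}} .{{_ : N.NonZero Z}} → Z N.* S N.≤ t N.* v N.* s → X N.* s N.≤ Y N.* Z → q N.* t N.* Y N.≤ X → q N.* S N.≤ v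
 bound X Y Z t v S s inBox few large = N.*-cancelˡ-≤ (Z N.* X) {{N.m*n≢0 Z X}} (begin
  Z N.* X N.* (q N.* S)
   ≡⟨ NS.solve 4 (λ M e q s → M NS.:* e NS.:* (q NS.:* s) NS.:= e NS.:* q NS.:* (M NS.:* s)) ≡.refl Z X q S ⟩
  X N.* q N.* (Z N.* S) ≤⟨ N.*-monoʳ-≤ (X N.* q) inBox ⟩
  X N.* q N.* (t N.* v N.* s)
   ≡⟨ NS.solve 5 (λ e q t v s → e NS.:* q NS.:* (t NS.:* v NS.:* s) NS.:= q NS.:* t NS.:* v NS.:* (e NS.:* s)) ≡.refl X q t v s ⟩
  q N.* t N.* v N.* (X N.* s) ≤⟨ N.*-monoʳ-≤ (q N.* t N.* v) few ⟩
  q N.* t N.* v N.* (Y N.* Z)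
   ≡⟨ NS.solve 4 (λ q v e M → q NS.:* v NS.:* (e NS.:* M) NS.:= q NS.:* e NS.:* (M NS.:* v)) ≡.refl (q N.* t) v Y Z ⟩
  q N.* t N.* Y N.* (Z N.* v) ≤⟨ N.*-monoˡ-≤ (Z N.* v) large ⟩
  X N.* (Z N.* v) ≡⟨ NS.solve 3 (λ e M v → e NS.:* (M NS.:* v) NS.:= M NS.:* e NS.:* v) ≡.refl X Z v ⟩
  Z N.* X N.* v ∎)
  where open N.≤-Reasoning
 from : ∀ k → q N.* 2 N.^ m N.* 79 N.^ k N.≤ 80 N.^ k → Sparse (Criterion.Holds C) q
 from k large = record { N = M ; bad = bad ; good = good ; few = λ b M≤b →
  bound (80 N.^ k) (79 N.^ k) (M N.^ m) (2 N.^ m) (volume b) (∑ⱽ (sides b) bad) (∑ⱽ (box m M) bad) {{N.m^n≢0 80 k}} {{N.m^n≢0 M m {{M≢0}}}}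
   (∑ⱽ-period {f = bad} {{M≢0}} bad-periodic b M≤b) few large }
  where open Sieved (sieved C k)

-- Curves over the rational function field

module FractionField {c ℓ} (D : DiscreteDomain c ℓ) where

 open DiscreteDomain D
 open Fractions D
 open IntegerSolver commutativeRing

 fromD-hom : RingHom commutativeRing fractionRing
 fromD-hom = record
  { ⟦_⟧ = fromD
  ; ⟦⟧-cong = λ e → mk≃ (*-congʳ e)
  ; +-homo = λ x y → mk≃ (solve 2 (λ x y → (x :+ y) :* (:1 :* :1) := (x :* :1 :+ y :* :1) :* :1) x y)
  ; *-homo = λ x y → mk≃ (solve 2 (λ x y → (x :* y) :* (:1 :* :1) := (x :* y) :* :1) x y)
  ; 1-homo = ≃-refl
  }

 fraction-noZeroDivisors : ∀ x y → x ⊗ y ≃ 0F → x ≃ 0F ⊎ y ≃ 0F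
 fraction-noZeroDivisors x y e = [ (λ z → inj₁ (num≈0⇒≃0 {x} z)) , (λ z → inj₂ (num≈0⇒≃0 {y} z)) ]′ (noZeroDivisors (num x) (num y) (≃0⇒num≈0 e))

 ⊗-den : ∀ x → x ⊗ fromD (den x) ≃ fromD (num x)
 ⊗-den x = mk≃ (solve 2 (λ n d → (n :* d) :* :1 := n :* (d :* :1)) (num x) (den x))

open FractionField ℚ[T]-domain

mkCurve : (a0 a1 b0 b1 b2 c0 c1 c2 : ℤ) → Curve
mkCurve a0 a1 b0 b1 b2 c0 c1 c2 = record
 { A-coeffs = a0 ∷ a1 ∷ 0ℤ ∷ [] ; B-coeffs = b0 ∷ b1 ∷ b2 ∷ [] ; C-X³-coeffs = c0 ∷ c1 ∷ c2 ∷ [] }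

curve0 curveℓ : Vec ℤ 6 → Curve
curve0 (b2 ∷ c2 ∷ b1 ∷ b0 ∷ c1 ∷ c0 ∷ []) = mkCurve 0ℤ 0ℤ b0 b1 b2 c0 c1 c2
curveℓ (a1 ∷ a0 ∷ b1 ∷ b0 ∷ c1 ∷ c0 ∷ []) = mkCurve a0 a1 b0 b1 0ℤ c0 c1 0ℤ

curve□ : Vec ℤ 7 → Curve
curve□ (a ∷ b2 ∷ b1 ∷ b0 ∷ c2 ∷ c1 ∷ c0 ∷ []) = mkCurve (a ℤ.* a) 0ℤ b0 b1 b2 c0 c1 c2

module CurvePoints (E : Curve) where
 open Curve E
 open Points ℚ⟨T⟩.fractionField ℚ⟨T⟩._≄?_ ⟨ ℤ[T]→ℚ⟨T⟩ α₂ , ℤ[T]→ℚ⟨T⟩ α₄ , ℤ[T]→ℚ⟨T⟩ α₆ ⟩ public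

NoAffinePoint : Curve → Set
NoAffinePoint E = ∀ x y → ¬ CurvePoints.OnCurve E x y

-- Without affine points every point is ∞, so the relation with all coefficients equal to 1 holds
-- and contradicts independence.
no-rank : ∀ E → NoAffinePoint E → ∀ {r} → Rank.HasRank (Curve.group E) r → ¬ (1 N.≤ r)
no-rank E noAffine {suc r} ((P , independent) , _) _ = 1≢0 (independent (λ _ → 1ℤ) (trivial-sum (λ i → 1ℤ ×ᶻ P i)) zero)
 where
 open CurvePoints E
 open Rank (Curve.group E)
 open RawMonoidDefinitions (RawGroup.rawMonoid (Curve.group E)) using (sum)
 1≢0 : 1ℤ ≢ 0ℤ
 1≢0 ()
 only-∞ : ∀ Q → Q ≡ ∞
 only-∞ ∞ = ≡.refl
 only-∞ (affine x y p) = ⊥-elim (noAffine x y p)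
 trivial-sum : ∀ {n} (Q : Vector Point n) → sum Q ≈ₚ ∞
 trivial-sum Q = ≡.subst (_≈ₚ ∞) (≡.sym (only-∞ (sum Q))) ∞≈

private
 point-injective : ∀ {i j} → fromℤ (+ i) ≡ fromℤ (+ j) → i ≡ j
 point-injective e = ℤ.+-injective (fromℤ-injective e)
 fromℤ≢0 : ∀ {a} → a ≢ 0ℤ → fromℤ a ≢ 0ℚ
 fromℤ≢0 a≢0 e = a≢0 (fromℤ-injective e)
 module ℚ* = DomainProperties (DiscreteField.domain ℚ-field)
 open IntegerSolver ℚ.+-*-commutativeRing
 2≢0 : 1ℚ ℚ.+ 1ℚ ≢ 0ℚ
 2≢0 ()
 2*≢0 : ∀ {a} → a ≢ 0ℚ → a ℚ.+ a ≢ 0ℚ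
 2*≢0 {a} a≢0 e = ℚ*.*-≉0 2≢0 a≢0 (≡.trans (solve 1 (λ a → (:1 :+ :1) :* a := a :+ a) a) e)

 fractions : Overdomain ℚ-field
 fractions = record
  { F = ℚ⟨T⟩.fractionRing
  ; F-noZeroDivisors = fraction-noZeroDivisors
  ; ι = fromD-hom
  ; ι-injective = λ _ e → ℚ⟨T⟩.≃0⇒num≈0 e
  }

 module At (a0 a1 b0 b1 b2 c0 c1 c2 : ℚ) (x y : ℚ⟨T⟩.Frac) where
  open AffinePoints.Over ℚ-field a0 a1 b0 b1 b2 c0 c1 c2 fractions
   (λ i → fromℤ (+ i)) point-injective x y public
  P = point (ℚ⟨T⟩.den≉0 x) (ℚ⟨T⟩.den≉0 y) (⊗-den x) (⊗-den y)

no-affine0 : ∀ v → NoRoot-B v → NonSquareResultant v → NoAffinePoint (curve0 v)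
no-affine0 (b2 ∷ c2 ∷ b1 ∷ b0 ∷ c1 ∷ c0 ∷ []) (b2≢0 , noRoot) nonSquare x y on =
 no-point-0 on P ≡.refl ≡.refl (fromℤ≢0 b2≢0) noRoot nonSquare
 where open At 0ℚ 0ℚ (fromℤ b0) (fromℤ b1) (fromℤ b2) (fromℤ c0) (fromℤ c1) (fromℤ c2) x y

no-affine□ : ∀ {a b2 b1 b0 c2 c1 c0} → let v = a ∷ b2 ∷ b1 ∷ b0 ∷ c2 ∷ c1 ∷ c0 ∷ [] in
 a ≢ 0ℤ → NoRoot-□ v → NoQuadraticFactors-□ v → NoAffinePoint (curve□ v)
no-affine□ {a} {b2} {b1} {b0} {c2} {c1} {c0} a≢0 (b2≢0 , noRoot) noQuadratic x y on =
 no-point-□ on P (fromℤ a) _ (RingHom.*-homo fromℤ-hom a a) ≡.refl (2*≢0 (fromℤ≢0 a≢0)) lead ≡.refl noRoot (λ {g} {h} → noQuadratic {g} {h})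
 where
 open At (fromℤ (a ℤ.* a)) 0ℚ (fromℤ b0) (fromℤ b1) (fromℤ b2) (fromℤ c0) (fromℤ c1) (fromℤ c2) x y
 lead : fromℤ b2 ℚ.* fromℤ b2 ℚ.- Invariants.4# ℚ.+-*-commutativeRing ℚ.* 0ℚ ≢ 0ℚ
 lead e = ℚ*.*-≉0 (fromℤ≢0 b2≢0) (fromℤ≢0 b2≢0) (≡.trans (solve 1 (λ b → b :* b := b :* b :- :4 :* :0) (fromℤ b2)) e)

no-affineℓ : ∀ {a1 a0 b1 b0 c1 c0} → let v = a1 ∷ a0 ∷ b1 ∷ b0 ∷ c1 ∷ c0 ∷ [] in
 NonSquare-ℓ v → NoRoot-ℓ v → NoQuadraticFactors-ℓ v → NoAffinePoint (curveℓ v)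
no-affineℓ {a1} {a0} {b1} {b0} {c1} {c0} nonSquare (a1≢0 , noRoot) noQuadratic x y on =
 no-point-ℓ on P _ ≡.refl ≡.refl 2≢0 (fromℤ≢0 a1≢0) nonSquare lead ≡.refl noRoot (λ {g} {h} → noQuadratic {g} {h})
 where
 open At (fromℤ a0) (fromℤ a1) (fromℤ b0) (fromℤ b1) 0ℚ (fromℤ c0) (fromℤ c1) 0ℚ x y
 lead : 0ℚ ℚ.* 0ℚ ℚ.- Invariants.4# ℚ.+-*-commutativeRing ℚ.* fromℤ a1 ≢ 0ℚ
 lead e = 2*≢0 (2*≢0 (fromℤ≢0 a1≢0)) (≡.trans (solve 1 (λ a → a :+ a :+ (a :+ a) := :- (:0 :* :0 :- :4 :* a)) (fromℤ a1)) (≡.cong ℚ.-_ e))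

-- Nonsingularity of the good curves

-- The discriminant in T is nonzero because its coefficient of the largest possible degree is.

module _ where
 open PZ
 open RawMonoidDefinitions (CommutativeRing.+-rawMonoid polynomialRing) using () renaming (_×_ to _×ₚ_)
 open RawMonoidDefinitions (CommutativeRing.+-rawMonoid ℤ-ring) using () renaming (_×_ to _×ₙ_)

 private
  Top-× : ∀ k {p n a} → Top p n a → Top (k ×ₚ p) n (k ×ₙ a)
  Top-× zero t = Top-0 {[]} _ z≤n []⊏
  Top-× (suc k) {p} t = Top-⊹ {p} t (Top-× k t)

  module _ {α₂ α₄ α₆ : Poly} where
   b2 b4 b6 b8 Δ : Poly
   b2 = 4 ×ₚ α₂
   b4 = 2 ×ₚ α₄
   b6 = 4 ×ₚ α₆
   b8 = 4 ×ₚ (α₂ ✶ α₆) ⊹ ⊟ (α₄ ✶ α₄)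
   Δ = Discriminant.Δ polynomialRing ⟨ α₂ , α₄ , α₆ ⟩

   Δ-lead : ∀ {n e1 e2 e3 e4} → Top (b2 ✶ b2 ✶ b8) n e1 → Top (b4 ✶ b4 ✶ b4) n e2 → Top (b6 ✶ b6) n e3 → Top (b2 ✶ b4 ✶ b6) n e4 →
        Δ ≋ [] → ℤ.- e1 ℤ.- 8 ×ₙ e2 ℤ.- 27 ×ₙ e3 ℤ.+ 9 ×ₙ e4 ≡ 0ℤ
   Δ-lead {n} t1 t2 t3 t4 e = ≡.trans (≡.sym (lead (Top-⊹ {⊟ (b2 ✶ b2 ✶ b8) ⊹ ⊟ (8 ×ₚ (b4 ✶ b4 ✶ b4)) ⊹ ⊟ (27 ×ₚ (b6 ✶ b6))} {9 ×ₚ (b2 ✶ b4 ✶ b6)}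
    (Top-⊹ {⊟ (b2 ✶ b2 ✶ b8) ⊹ ⊟ (8 ×ₚ (b4 ✶ b4 ✶ b4))} {⊟ (27 ×ₚ (b6 ✶ b6))} (Top-⊹ {⊟ (b2 ✶ b2 ✶ b8)} {⊟ (8 ×ₚ (b4 ✶ b4 ✶ b4))}
     (Top-⊟ {b2 ✶ b2 ✶ b8} t1) (Top-⊟ {8 ×ₚ (b4 ✶ b4 ✶ b4)} (Top-× 8 {b4 ✶ b4 ✶ b4} t2))) (Top-⊟ {27 ×ₚ (b6 ✶ b6)} (Top-× 27 {b6 ✶ b6} t3)))
    (Top-× 9 {b2 ✶ b4 ✶ b6} t4)))) (at e n)

   module _ {n2 n4 n6 x2 x4 x6} (t2 : Top α₂ n2 x2) (t4 : Top α₄ n4 x4) (t6 : Top α₆ n6 x6) where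
    b4³ : Top (b4 ✶ b4 ✶ b4) (n4 N.+ n4 N.+ n4) _
    b4³ = Top-✶ {b4 ✶ b4} {b4} (Top-✶ {b4} {b4} (Top-× 2 {α₄} t4) (Top-× 2 {α₄} t4)) (Top-× 2 {α₄} t4)
    b6² : Top (b6 ✶ b6) (n6 N.+ n6) _
    b6² = Top-✶ {b6} {b6} (Top-× 4 {α₆} t6) (Top-× 4 {α₆} t6)
    b2b4b6 : Top (b2 ✶ b4 ✶ b6) (n2 N.+ n4 N.+ n6) _
    b2b4b6 = Top-✶ {b2 ✶ b4} {b6} (Top-✶ {b2} {b4} (Top-× 4 {α₂} t2) (Top-× 2 {α₄} t4)) (Top-× 4 {α₆} t6)
    b2²b8 : ∀ {n x} → Top b8 n x → Top (b2 ✶ b2 ✶ b8) (n2 N.+ n2 N.+ n) _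
    b2²b8 t8 = Top-✶ {b2 ✶ b2} {b8} (Top-✶ {b2} {b2} (Top-× 4 {α₂} t2) (Top-× 4 {α₂} t2)) t8
    α2α6 : Top (4 ×ₚ (α₂ ✶ α₆)) (n2 N.+ n6) _
    α2α6 = Top-× 4 {α₂ ✶ α₆} (Top-✶ {α₂} {α₆} t2 t6)
    α4² : Top (⊟ (α₄ ✶ α₄)) (n4 N.+ n4) _
    α4² = Top-⊟ {α₄ ✶ α₄} (Top-✶ {α₄} {α₄} t4 t4)

  linear : ∀ c b → Top (c ∷ b ∷ 0ℤ ∷ []) 1 b
  linear c b = top (λ { (suc zero) (s≤s ()) ; (suc (suc zero)) _ → ≡.refl ; (suc (suc (suc n))) _ → ≡.refl }) ≡.refl
  quadratic : ∀ c b a → Top (c ∷ b ∷ a ∷ []) 2 a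
  quadratic c b a = top (⊏-length (c ∷ b ∷ a ∷ [])) ≡.refl

  *≢0 : ∀ {a b} → a ≢ 0ℤ → b ≢ 0ℤ → a ℤ.* b ≢ 0ℤ
  *≢0 {a} a≢0 b≢0 e = [ a≢0 , b≢0 ]′ (ℤ.i*j≡0⇒i≡0∨j≡0 a e)

 -- Degree 4 is reached by b2² b8 alone, and the coefficient of T⁴ is - 16 β2² (4 β2 β0 - β1²). The
 -- bracket is minus the discriminant of B, which has no rational root.
 nonSingular0 : ∀ v → NoRoot-B v → Curve.NonSingular (curve0 v)
 nonSingular0 (β2 ∷ γ2 ∷ β1 ∷ β0 ∷ γ1 ∷ γ0 ∷ []) (β2≢0 , noRoot) e = *≢0 (*≢0 β2≢0 β2≢0) d≢0 (ℤ.*-cancelˡ-≡ (+ 16) _ 0ℤ (≡.trans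
   (solveℤ 3 (λ b d e → ⟨16⟩ :* (b :* b :* d) := :- (((:- ((b :+ (b :+ (b :+ (b :+ :0)))) :* (b :+ (b :+ (b :+ (b :+ :0)))) :* d) :- :0) :- :0) :+ :0)) β2 d 0ℤ) (≡.cong ℤ.-_ lead≡0)))
  where
  ⟨16⟩ : ∀ {n} → Expression n
  ⟨16⟩ = con (16 , 0)
  α₂ α₄ α₆ : Poly
  α₂ = γ2 ∷ β2 ∷ 0ℤ ∷ []
  α₄ = γ1 ∷ β1 ∷ 0ℤ ∷ []
  α₆ = γ0 ∷ β0 ∷ 0ℤ ∷ []
  t2 = linear γ2 β2
  t4 = linear γ1 β1
  t6 = linear γ0 β0
  d : ℤ
  d = 4 ×ₙ (β2 ℤ.* β0) ℤ.+ ℤ.- (β1 ℤ.* β1)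
  lead≡0 = Δ-lead {α₂} {α₄} {α₆} {4} (b2²b8 t2 t4 t6 (Top-⊹ {4 ×ₚ (α₂ ✶ α₆)} {⊟ (α₄ ✶ α₄)} (α2α6 t2 t4 t6) (α4² t2 t4 t6)))
   (Top-weaken 4 N.≤-refl (b4³ t2 t4 t6)) (Top-weaken 4 (N.n≤1+n 3) (b6² t2 t4 t6)) (Top-weaken 4 N.≤-refl (b2b4b6 t2 t4 t6)) e
  -- otherwise - β1 / 2 β2 is a double root of B
  d≢0 : d ≢ 0ℤ
  d≢0 d≡0 = noRoot (ℚ.- (q1 ℚ.* i)) (ℚ*.cancel-≈0 (q2 ℚ.+ q2 ℚ.+ (q2 ℚ.+ q2)) (2*≢0 (2*≢0 (fromℤ≢0 β2≢0))) (≡.trans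
   (solve 4 (λ b0 b1 b2 i → (b2 :+ b2 :+ (b2 :+ b2)) :* (b0 :+ (:- (b1 :* i)) :* (b1 :+ (:- (b1 :* i)) :* (b2 :+ (:- (b1 :* i)) :* :0)))
    := (b1 :- b1 :* (i :* (b2 :+ b2))) :* (b1 :- b1 :* (i :* (b2 :+ b2))) :+ ((b2 :* b0 :+ (b2 :* b0 :+ (b2 :* b0 :+ (b2 :* b0 :+ :0)))) :+ :- (b1 :* b1))) q0 q1 q2 i)
   (≡.trans (≡.cong₂ (λ u w → (q1 ℚ.- q1 ℚ.* u) ℚ.* (q1 ℚ.- q1 ℚ.* u) ℚ.+ w) (proj₂ inv) (≡.trans (≡.sym d-homo) (≡.cong fromℤ d≡0)))
    (solve 1 (λ b → (b :- b :* :1) :* (b :- b :* :1) :+ :0 := :0) q1))))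
   where
   q0 q1 q2 i : ℚ
   q0 = fromℤ β0
   q1 = fromℤ β1
   q2 = fromℤ β2
   inv = DiscreteField.inverse ℚ-field (2*≢0 (fromℤ≢0 β2≢0))
   i = proj₁ inv
   module h = RingHom fromℤ-hom
   s : fromℤ (β2 ℤ.* β0) ≡ q2 ℚ.* q0
   s = h.*-homo β2 β0
   4×-homo : ∀ k → fromℤ (k ×ₙ (β2 ℤ.* β0)) ≡ RawMonoidDefinitions._×_ (CommutativeRing.+-rawMonoid ℚ.+-*-commutativeRing) k (q2 ℚ.* q0)
   4×-homo zero = ≡.refl
   4×-homo (suc k) = ≡.trans (h.+-homo (β2 ℤ.* β0) (k ×ₙ (β2 ℤ.* β0))) (≡.cong₂ ℚ._+_ s (4×-homo k))
   d-homo : fromℤ d ≡ q2 ℚ.* q0 ℚ.+ (q2 ℚ.* q0 ℚ.+ (q2 ℚ.* q0 ℚ.+ (q2 ℚ.* q0 ℚ.+ 0ℚ))) ℚ.+ ℚ.- (q1 ℚ.* q1)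
   d-homo = ≡.trans (h.sub-homo (4 ×ₙ (β2 ℤ.* β0)) (β1 ℤ.* β1)) (≡.cong₂ (λ u w → u ℚ.+ ℚ.- w) (4×-homo 4) (h.*-homo β1 β1))

 -- Degree 5 is reached by b2² b8 alone, and the coefficient of T⁵ is - 64 β2³ a².
 nonSingular□ : ∀ {a β2 β1 β0 γ2 γ1 γ0} → a ≢ 0ℤ → β2 ≢ 0ℤ → Curve.NonSingular (curve□ (a ∷ β2 ∷ β1 ∷ β0 ∷ γ2 ∷ γ1 ∷ γ0 ∷ []))
 nonSingular□ {a} {β2} {β1} {β0} {γ2} {γ1} {γ0} a≢0 β2≢0 e = *≢0 (*≢0 β2≢0 β2≢0) (*≢0 β2≢0 (*≢0 a≢0 a≢0)) (ℤ.*-cancelˡ-≡ (+ 64) _ 0ℤ (≡.trans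
   (solveℤ 3 (λ b d e → ⟨64⟩ :* (b :* b :* d) := :- (((:- ((b :+ (b :+ (b :+ (b :+ :0)))) :* (b :+ (b :+ (b :+ (b :+ :0)))) :* ((d :+ (d :+ (d :+ (d :+ :0)))) :+ :0)) :- :0) :- :0) :+ :0)) β2 (β2 ℤ.* (a ℤ.* a)) 0ℤ) (≡.cong ℤ.-_ lead≡0)))
  where
  ⟨64⟩ : ∀ {n} → Expression n
  ⟨64⟩ = con (64 , 0)
  α₂ α₄ α₆ : Poly
  α₂ = γ2 ∷ β2 ∷ 0ℤ ∷ []
  α₄ = γ1 ∷ β1 ∷ 0ℤ ∷ []
  α₆ = γ0 ∷ β0 ∷ a ℤ.* a ∷ []
  t2 = linear γ2 β2
  t4 = linear γ1 β1
  t6 = quadratic γ0 β0 (a ℤ.* a)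
  lead≡0 = Δ-lead {α₂} {α₄} {α₆} {5} (b2²b8 t2 t4 t6 (Top-⊹ {4 ×ₚ (α₂ ✶ α₆)} {⊟ (α₄ ✶ α₄)} (α2α6 t2 t4 t6) (Top-weaken 3 N.≤-refl (α4² t2 t4 t6))))
   (Top-weaken 5 (N.n≤1+n 4) (b4³ t2 t4 t6)) (Top-weaken 5 N.≤-refl (b6² t2 t4 t6)) (Top-weaken 5 N.≤-refl (b2b4b6 t2 t4 t6)) e

 -- Here α₂ = 0, and degree 6 is reached by - 8 b4³ alone, with leading coefficient - 64 a1³.
 nonSingularℓ : ∀ {a1 a0 β1 β0 γ1 γ0} → a1 ≢ 0ℤ → Curve.NonSingular (curveℓ (a1 ∷ a0 ∷ β1 ∷ β0 ∷ γ1 ∷ γ0 ∷ []))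
 nonSingularℓ {a1} {a0} {β1} {β0} {γ1} {γ0} a1≢0 e = *≢0 (*≢0 a1≢0 a1≢0) a1≢0 (ℤ.*-cancelˡ-≡ (+ 64) _ 0ℤ (≡.trans
   (solveℤ 1 (λ a → let b = a :+ (a :+ :0) ; c = b :* b :* b in
    ⟨64⟩ :* (a :* a :* a) := :- (((:0 :- (c :+ (c :+ (c :+ (c :+ (c :+ (c :+ (c :+ (c :+ :0))))))))) :- :0) :+ :0)) a1) (≡.cong ℤ.-_ lead≡0)))
  where
  ⟨64⟩ : ∀ {n} → Expression n
  ⟨64⟩ = con (64 , 0)
  α₂ α₄ α₆ : Poly
  α₂ = 0ℤ ∷ 0ℤ ∷ 0ℤ ∷ []
  α₄ = γ1 ∷ β1 ∷ a1 ∷ []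
  α₆ = γ0 ∷ β0 ∷ a0 ∷ []
  t2 : Top α₂ 0 0ℤ
  t2 = Top-0 {α₂} 0 z≤n (λ { zero _ → ≡.refl ; (suc zero) _ → ≡.refl ; (suc (suc zero)) _ → ≡.refl ; (suc (suc (suc n))) _ → ≡.refl })
  t4 = quadratic γ1 β1 a1
  t6 = quadratic γ0 β0 a0
  lead≡0 = Δ-lead {α₂} {α₄} {α₆} {6} (Top-weaken 6 (N.n≤1+n 5) (b2²b8 t2 t4 t6 (Top-⊹ {4 ×ₚ (α₂ ✶ α₆)} {⊟ (α₄ ✶ α₄)} (Top-weaken 4 (N.n≤1+n 3) (α2α6 t2 t4 t6)) (α4² t2 t4 t6))))
   (b4³ t2 t4 t6) (Top-weaken 6 (N.n≤1+n 5) (b6² t2 t4 t6)) (Top-weaken 6 (N.n≤1+n 5) (b2b4b6 t2 t4 t6)) e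

-- Counting curves by counting coefficient vectors

module _ {A : Set} where

 unique-⊆-length : ∀ {xs ys : List A} → Unique xs → (∀ {x} → x ∈ xs → x ∈ ys) → length xs N.≤ length ys
 unique-⊆-length {[]} _ sub = z≤n
 unique-⊆-length {x ∷ xs} (x∉ ∷ u) sub with ∈-∃++ (sub (here ≡.refl))
 ... | as , bs , ≡.refl = ≡.subst (suc (length xs) N.≤_) (≡.sym (≡.trans (List.length-++ as) (≡.trans (N.+-suc (length as) (length bs)) (≡.cong suc (≡.sym (List.length-++ as))))))
  (s≤s (unique-⊆-length u λ z∈ → [ ∈-++⁺ˡ , (λ { (here e) → ⊥-elim (All.lookup x∉ z∈ (≡.sym e)) ; (there z∈bs) → ∈-++⁺ʳ as z∈bs }) ]′ (∈-++⁻ as (sub (there z∈)))))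

 length-filter-∑ : ∀ {P : Pred A 0ℓ} (P? : Unary.Decidable P) xs → length (filter P? xs) ≡ ∑ xs (λ x → 𝟙 (P? x))
 length-filter-∑ P? [] = ≡.refl
 length-filter-∑ P? (x ∷ xs) with P? x
 ... | yes _ = ≡.cong suc (length-filter-∑ P? xs)
 ... | no _ = length-filter-∑ P? xs

 -- Each instance of excluded middle for P holds up to a double negation, and finitely many of them,
 -- one for every element of the list, can be combined under a single double negation.
 ¬¬-sublist : ∀ (P : Pred A 0ℓ) {xs : List A} → Unique xs → ¬ ¬ (Σ[ ys ∈ List A ] Unique ys × (∀ x → x ∈ ys ⇔ (x ∈ xs × P x)))
 ¬¬-sublist P {[]} _ k = k ([] , [] , λ x → mk⇔ (λ ()) (λ { (() , _) }))
 ¬¬-sublist P {x ∷ xs} (x∉ ∷ u) k = ¬¬-sublist P u λ (ys , uys , mem) → (λ em → em (inj₂ λ p → em (inj₁ p)))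
  [ (λ p → k (x ∷ ys , All.tabulate (λ z∈ → All.lookup x∉ (proj₁ (Equivalence.to (mem _) z∈))) ∷ uys , λ z → mk⇔
    (λ { (here ≡.refl) → here ≡.refl , p ; (there z∈) → there (proj₁ (Equivalence.to (mem z) z∈)) , proj₂ (Equivalence.to (mem z) z∈) })
    (λ { (here ≡.refl , _) → here ≡.refl ; (there z∈ , q) → there (Equivalence.from (mem z) (z∈ , q)) })))
  , (λ ¬p → k (ys , uys , λ z → mk⇔
    (λ z∈ → there (proj₁ (Equivalence.to (mem z) z∈)) , proj₂ (Equivalence.to (mem z) z∈))
    (λ { (here ≡.refl , q) → ⊥-elim (¬p q) ; (there z∈ , q) → Equivalence.from (mem z) (z∈ , q) }))) ]′

unique-map : ∀ {A B : Set} {f : A → B} {xs} → (∀ {x y} → x ∈ xs → y ∈ xs → f x ≡ f y → x ≡ y) → Unique xs → Unique (map f xs)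
unique-map inj [] = []
unique-map inj (x∉ ∷ u) = All.map⁺ (All.tabulate λ y∈ e → All.lookup x∉ y∈ (inj (here ≡.refl) (there y∈) e)) ∷ unique-map (λ x∈ y∈ → inj (there x∈) (there y∈)) u

vectors : ∀ {A : Set} {m} → Vec (List A) m → List (Vec A m)
vectors [] = [] ∷ []
vectors (xs ∷ xss) = cartesianProductWith _∷_ xs (vectors xss)

∑-vectors : ∀ {A : Set} {m} (xss : Vec (List A) m) f → ∑ (vectors xss) f ≡ ∑ⱽ xss f
∑-vectors [] f = N.+-identityʳ (f [])
∑-vectors (xs ∷ xss) f = ≡.trans (product xs) (∑-cong xs λ x → ∑-vectors xss (λ v → f (x ∷ v)))
 where
 product : ∀ xs → ∑ (cartesianProductWith _∷_ xs (vectors xss)) f ≡ ∑ xs (λ x → ∑ (vectors xss) (λ v → f (x ∷ v)))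
 product [] = ≡.refl
 product (x ∷ xs) = ≡.trans (∑-++ (map (x ∷_) (vectors xss)) _ f) (≡.cong₂ N._+_ (∑-map (x ∷_) (vectors xss) f) (product xs))

∈-vectors⁺ : ∀ {A : Set} {m} {v : Vec A m} {xss} → Pointwise _∈_ v xss → v ∈ vectors xss
∈-vectors⁺ [] = here ≡.refl
∈-vectors⁺ (x ∷ xs) = ∈-cartesianProductWith⁺ _∷_ x (∈-vectors⁺ xs)

∈-vectors⁻ : ∀ {A : Set} {m} {v : Vec A m} xss → v ∈ vectors xss → Pointwise _∈_ v xss
∈-vectors⁻ [] (here ≡.refl) = []
∈-vectors⁻ (xs ∷ xss) v∈ with ∈-cartesianProductWith⁻ _∷_ xs (vectors xss) v∈
... | x , w , x∈ , w∈ , ≡.refl = x∈ ∷ ∈-vectors⁻ xss w∈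

unique-vectors : ∀ {A : Set} {m} {xss : Vec (List A) m} → VecAll.All Unique xss → Unique (vectors xss)
unique-vectors [] = [] ∷ []
unique-vectors (u ∷ us) = Unique.cartesianProductWith⁺ _∷_ Vec.∷-injective u (unique-vectors us)

∈-interval⁻ : ∀ {x} a n → x ∈ interval a n → Σ[ j ∈ ℕ ] j N.< n × x ≡ + j ℤ.+ a
∈-interval⁻ a (suc n) (here e) = 0 , s≤s z≤n , ≡.trans e (≡.sym (ℤ.+-identityˡ a))
∈-interval⁻ a (suc n) (there x∈) with ∈-interval⁻ (1ℤ ℤ.+ a) n x∈
... | j , j<n , e = suc j , s≤s j<n , ≡.trans e (solveℤ 2 (λ j a → j :+ (:1 :+ a) := (:1 :+ j) :+ a) (+ j) a)

∈-interval⁺ : ∀ {x} a n j → j N.< n → x ≡ + j ℤ.+ a → x ∈ interval a n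
∈-interval⁺ a (suc n) zero _ e = here (≡.trans e (ℤ.+-identityˡ a))
∈-interval⁺ a (suc n) (suc j) (s≤s j<n) e = there (∈-interval⁺ (1ℤ ℤ.+ a) n j j<n
 (≡.trans e (solveℤ 2 (λ j a → (:1 :+ j) :+ a := j :+ (:1 :+ a)) (+ j) a)))

unique-interval : ∀ a n → Unique (interval a n)
unique-interval a zero = []
unique-interval a (suc n) = All.tabulate (λ x∈ e → a∉ (≡.subst (_∈ interval (1ℤ ℤ.+ a) n) (≡.sym e) x∈)) ∷ unique-interval (1ℤ ℤ.+ a) n
 where
 a∉ : ¬ (a ∈ interval (1ℤ ℤ.+ a) n)
 a∉ a∈ with ∈-interval⁻ (1ℤ ℤ.+ a) n a∈
 ... | j , _ , e = impossible (≡.trans (solveℤ 2 (λ j a → :1 :+ j := j :+ (:1 :+ a) :- a) (+ j) a) (≡.trans (≡.cong (ℤ._- a) (≡.sym e)) (ℤ.+-inverseʳ a)))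
  where
  impossible : + suc j ≢ 0ℤ
  impossible ()

symmetric : ℕ → ℤ × ℕ
symmetric H = ℤ.- + H , suc (H N.+ H)

∈-symmetric⁻ : ∀ {H x} → x ∈ interval (ℤ.- + H) (suc (H N.+ H)) → ℤ.∣ x ∣ N.≤ H
∈-symmetric⁻ {H} {x} x∈ with ∈-interval⁻ (ℤ.- + H) (suc (H N.+ H)) x∈
... | j , s≤s j≤2H , e = bound x (≡.trans (≡.cong (ℤ._+ + H) e) (solveℤ 2 (λ j h → (j :+ :- h) :+ h := j) (+ j) (+ H)))
 where
 bound : ∀ x → x ℤ.+ + H ≡ + j → ℤ.∣ x ∣ N.≤ H
 bound (+ n) f = N.+-cancelʳ-≤ H n H (≡.subst (N._≤ H N.+ H) (≡.sym (ℤ.+-injective f)) j≤2H)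
 bound -[1+ n ] f = ≡.subst (suc n N.≤_) (ℤ.+-injective (≡.trans (≡.cong (λ k → + suc n ℤ.+ k) (≡.sym f))
  (solveℤ 2 (λ n h → n :+ (:- n :+ h) := h) (+ suc n) (+ H)))) (N.m≤m+n (suc n) j)

∈-symmetric⁺ : ∀ {H x} → ℤ.∣ x ∣ N.≤ H → x ∈ interval (ℤ.- + H) (suc (H N.+ H))
∈-symmetric⁺ {H} {+ n} n≤H = ∈-interval⁺ _ _ (n N.+ H) (s≤s (N.+-monoˡ-≤ H n≤H)) (solveℤ 2 (λ n h → n := (n :+ h) :+ :- h) (+ n) (+ H))
∈-symmetric⁺ {H} { -[1+ n ]} n<H = ∈-interval⁺ _ _ (H N.∸ suc n) (s≤s (N.≤-trans (N.m∸n≤m H (suc n)) (N.m≤m+n H H)))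
 (≡.trans (solveℤ 2 (λ n k → :- n := k :+ :- (n :+ k)) (+ suc n) (+ (H N.∸ suc n))) (≡.cong (λ h → + (H N.∸ suc n) ℤ.+ ℤ.- + h) (N.m+[n∸m]≡n n<H)))

-- The vectors that are bad for a conjunction form the union of two bad sets, each of which is
-- allowed half of the density.
Sparse-× : ∀ {m q} {P Q : Vec ℤ m → Set} → Sparse P (2 N.* q) → Sparse Q (2 N.* q) → Sparse (λ v → P v × Q v) q
Sparse-× {m} {q} S T = record
 { N = S.N N.⊔ T.N ; bad = λ v → S.bad v N.+ T.bad v
 ; good = λ v e → S.good v (N.m+n≡0⇒m≡0 (S.bad v) e) , T.good v (N.m+n≡0⇒n≡0 (S.bad v) e)
 ; few = λ b N≤b → N.*-cancelˡ-≤ 2 (begin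
   2 N.* (q N.* ∑ⱽ (sides b) (λ v → S.bad v N.+ T.bad v))
    ≡⟨ ≡.cong (λ n → 2 N.* (q N.* n)) (∑ⱽ-+ (sides b) S.bad T.bad) ⟩
   2 N.* (q N.* (∑ⱽ (sides b) S.bad N.+ ∑ⱽ (sides b) T.bad))
    ≡⟨ NS.solve 3 (λ q x y → NS.con 2 NS.:* (q NS.:* (x NS.:+ y)) NS.:= NS.con 2 NS.:* q NS.:* x NS.:+ NS.con 2 NS.:* q NS.:* y) ≡.refl q (∑ⱽ (sides b) S.bad) (∑ⱽ (sides b) T.bad) ⟩
   2 N.* q N.* ∑ⱽ (sides b) S.bad N.+ 2 N.* q N.* ∑ⱽ (sides b) T.bad
    ≤⟨ N.+-mono-≤ (S.few b (VecAll.map (N.≤-trans (N.m≤m⊔n S.N T.N)) N≤b)) (T.few b (VecAll.map (N.≤-trans (N.m≤n⊔m S.N T.N)) N≤b)) ⟩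
   volume b N.+ volume b ≡⟨ ≡.cong (volume b N.+_) (N.+-identityʳ (volume b)) ⟨
   2 N.* volume b ∎) }
 where
 open N.≤-Reasoning
 module S = Sparse S
 module T = Sparse T

volume-∑ : ∀ {m} (b : Box m) → ∑ⱽ (sides b) (λ _ → 1) ≡ volume b
volume-∑ [] = ≡.refl
volume-∑ ((a , L) ∷ b) = ≡.trans (∑-cong (interval a L) λ _ → volume-∑ b) (≡.trans (∑-const (interval a L) (volume b)) (≡.cong (N._* volume b) (length-interval a L)))

volume≥1 : ∀ {m} {b : Box m} → VecAll.All (λ (_ , L) → 1 N.≤ L) b → 1 N.≤ volume b
volume≥1 [] = N.≤-refl
volume≥1 (p ∷ ps) = N.*-mono-≤ p (volume≥1 ps)

-- NonSingular is kept abstract because the discriminant has a huge normal form.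

record Parametrisation (∗ : Family) : Set1 where
 field
  NonSingular : Curve → Set
  nonSingular? : ∀ E → Dec (NonSingular E)
  {m} : ℕ
  curve : Vec ℤ m → Curve
  range : ℕ → Box m
  large : ∀ H → VecAll.All (λ (_ , L) → H N.≤ L) (range H)
  curve-injective : ∀ {H u v} → u ∈ vectors (sides (range H)) → v ∈ vectors (sides (range H)) → curve u ≡ curve v → u ≡ v
  to : ∀ {H v} → 1 N.≤ H → v ∈ vectors (sides (range H)) → NonSingular (curve v) → 𝒮 ∗ H (curve v)
  from : ∀ {H E} → 𝒮 ∗ H E → NonSingular E × Σ[ v ∈ Vec ℤ m ] v ∈ vectors (sides (range H)) × curve v ≡ E
  Good : Vec ℤ m → Set
  sparse-bad : ∀ q → Sparse Good q
  good-curve : ∀ {H v} → v ∈ vectors (sides (range H)) → Good v → NonSingular (curve v) × NoAffinePoint (curve v)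

module _ {∗ : Family} (Π : Parametrisation ∗) where
 open Parametrisation Π

 module Counting (q : ℕ) (H : ℕ) (1≤H : 1 N.≤ H) (N≤H : Sparse.N (sparse-bad (2 N.* suc q)) N.≤ H) where
  open Sparse (sparse-bad (2 N.* suc q))

  vs : List (Vec ℤ m)
  vs = vectors (sides (range H))

  unique-vs : Unique vs
  unique-vs = unique-vectors (unique (range H))
   where
   unique : ∀ {n} (b : Box n) → VecAll.All Unique (sides b)
   unique [] = []
   unique ((a , L) ∷ b) = unique-interval a L ∷ unique b

  curves : List Curve
  curves = filter nonSingular? (map curve vs)

  unique-curves : Unique curves
  unique-curves = Unique.filter⁺ nonSingular? (unique-map curve-injective unique-vs)

  ∈-curves : ∀ E → E ∈ curves ⇔ 𝒮 ∗ H E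
  ∈-curves E = mk⇔ (λ E∈ → to′ (∈-filter⁻ nonSingular? E∈)) (λ s → from′ (from s))
   where
   to′ : E ∈ map curve vs × NonSingular E → 𝒮 ∗ H E
   to′ (E∈ , ns) with ∈-map⁻ curve E∈
   ... | v , v∈ , ≡.refl = to 1≤H v∈ ns
   from′ : NonSingular E × Σ[ v ∈ Vec ℤ m ] v ∈ vs × curve v ≡ E → E ∈ curves
   from′ (ns , v , v∈ , ≡.refl) = ∈-filter⁺ nonSingular? (∈-map⁺ curve v∈) ns

  B s : ℕ
  B = ∑ vs bad
  s = length curves

  -- A vector that is not bad gives a nonsingular curve, so every vector of the box is accounted for
  -- by s or by B.
  volume≤ : volume (range H) N.≤ s N.+ B
  volume≤ = begin
   volume (range H) ≡⟨ volume-∑ (range H) ⟨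
   ∑ⱽ (sides (range H)) (λ _ → 1) ≡⟨ ∑-vectors (sides (range H)) (λ _ → 1) ⟨
   ∑ vs (λ _ → 1) ≤⟨ bounded vs (λ v∈ → v∈) ⟩
   ∑ vs (λ v → 𝟙 (nonSingular? (curve v)) N.+ bad v) ≡⟨ ∑-+ vs _ bad ⟩
   ∑ vs (λ v → 𝟙 (nonSingular? (curve v))) N.+ B ≡⟨ ≡.cong (N._+ B) (≡.trans (length-filter-∑ nonSingular? (map curve vs)) (∑-map curve vs _)) ⟨
   s N.+ B ∎
   where
   open N.≤-Reasoning
   pointwise : ∀ {v} → v ∈ vs → (d : Dec (NonSingular (curve v))) (e : Dec (bad v ≡ 0)) → 1 N.≤ 𝟙 d N.+ bad v
   pointwise v∈ (yes _) _ = s≤s z≤n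
   pointwise v∈ (no ¬n) (yes e) = ⊥-elim (¬n (proj₁ (good-curve v∈ (good _ e))))
   pointwise v∈ (no _) (no ne) = N.n≢0⇒n>0 ne
   bounded : ∀ us → (∀ {v} → v ∈ us → v ∈ vs) → ∑ us (λ _ → 1) N.≤ ∑ us (λ v → 𝟙 (nonSingular? (curve v)) N.+ bad v)
   bounded [] sub = z≤n
   bounded (v ∷ us) sub = N.+-mono-≤ (pointwise (sub (here ≡.refl)) (nonSingular? (curve v)) (bad v N.≟ 0)) (bounded us λ v∈ → sub (there v∈))

  few-bad : 2 N.* suc q N.* B N.≤ volume (range H)
  few-bad = ≡.subst (λ n → 2 N.* suc q N.* n N.≤ volume (range H)) (≡.sym (∑-vectors (sides (range H)) bad)) (few (range H) (VecAll.map (N.≤-trans N≤H) (large H)))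

  ℛ-bound : ∀ {r} → HasCardinality (ℛ ∗ H) r → r N.≤ B
  ℛ-bound (xs , unique-xs , ∈-xs , ≡.refl) = begin
   length xs ≤⟨ unique-⊆-length unique-xs (λ x∈ → included (Equivalence.to (∈-xs _) x∈)) ⟩
   length (map curve bads) ≡⟨ List.length-map curve bads ⟩
   length bads ≡⟨ length-filter-∑ bad? vs ⟩
   ∑ vs (λ v → 𝟙 (bad? v)) ≤⟨ ∑-mono vs (λ v → 𝟙≤bad v (bad v N.≟ 0)) ⟩
   B ∎
   where
   open N.≤-Reasoning
   bad? : ∀ v → Dec (bad v ≢ 0)
   bad? v = ¬? (bad v N.≟ 0)
   bads : List (Vec ℤ m)
   bads = filter bad? vs
   𝟙≤bad : ∀ v (d : Dec (bad v ≡ 0)) → 𝟙 (¬? d) N.≤ bad v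
   𝟙≤bad v (yes _) = z≤n
   𝟙≤bad v (no ne) = N.n≢0⇒n>0 ne
   excluded : ∀ {v} → v ∈ vs → (Σ[ r ∈ ℕ ] Rank.HasRank (Curve.group (curve v)) r × 1 N.≤ r) → bad v ≢ 0
   excluded {v} v∈ (r , rank , 1≤r) e = no-rank (curve v) (proj₂ (good-curve v∈ (good v e))) {r} rank 1≤r
   included : ∀ {E} → ℛ ∗ H E → E ∈ map curve bads
   included {E} (s , ranked) = ≡.subst (_∈ map curve bads) (proj₂ (proj₂ (proj₂ (from s)))) (∈-map⁺ curve (∈-filter⁺ bad? (proj₁ (proj₂ (proj₂ (from s))))
    (excluded (proj₁ (proj₂ (proj₂ (from s)))) (≡.subst (λ E → Σ[ r ∈ ℕ ] Rank.HasRank (Curve.group E) r × 1 N.≤ r) (≡.sym (proj₂ (proj₂ (proj₂ (from s))))) ranked))))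

  -- If s ≤ q r, then r ≤ B yields volume ≤ s + B ≤ (q + 1) B. Since 2 (q + 1) B ≤ volume, the
  -- volume would be 0.
  ratio : ∀ {r} → HasCardinality (ℛ ∗ H) r → q N.* r N.< s
  ratio {r} card = N.≰⇒> λ s≤qr → N.<⇒≱ (volume≥1 {b = range H} (VecAll.map (N.≤-trans 1≤H) (large H))) (N.+-cancelʳ-≤ (volume (range H)) _ 0 (begin
   volume (range H) N.+ volume (range H) ≤⟨ N.+-mono-≤ (volume≤qB s≤qr) (volume≤qB s≤qr) ⟩
   suc q N.* B N.+ suc q N.* B ≡⟨ NS.solve 2 (λ q b → q NS.:* b NS.:+ q NS.:* b NS.:= NS.con 2 NS.:* q NS.:* b) ≡.refl (suc q) B ⟩
   2 N.* suc q N.* B ≤⟨ few-bad ⟩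
   volume (range H) ∎))
   where
   open N.≤-Reasoning
   volume≤qB : s N.≤ q N.* r → volume (range H) N.≤ suc q N.* B
   volume≤qB s≤qr = N.≤-trans volume≤ (N.≤-trans (N.+-monoˡ-≤ B (N.≤-trans s≤qr (N.*-monoʳ-≤ q (ℛ-bound card)))) (N.≤-reflexive (N.+-comm (q N.* B) B)))

  ℛ-exists : ¬ ¬ (Σ[ r ∈ ℕ ] HasCardinality (ℛ ∗ H) r)
  ℛ-exists k = ¬¬-sublist (ℛ ∗ H) unique-curves λ (ys , u , mem) → k (length ys , ys , u ,
   (λ E → mk⇔ (λ E∈ → proj₂ (Equivalence.to (mem E) E∈)) (λ r → Equivalence.from (mem E) (Equivalence.from (∈-curves E) (proj₁ r) , r))) , ≡.refl)

  -- The strict inequality q r < s forces s > 0. The number r exists only up to a double negation,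
  -- which is enough to refute s = 0.
  s≢0 : N.NonZero s
  s≢0 = N.≢-nonZero λ e → ℛ-exists λ (r , card) → N.<⇒≱ (ratio card) (N.≤-trans (N.≤-reflexive e) z≤n)

 -- The denominator of ε serves as q: then r / s < 1 / q ≤ ε, because the numerator of ε is at least
 -- 1.
 tendsToZero : RatioTendsToZero (ℛ ∗) (𝒮 ∗)
 tendsToZero ε@(ℚ.mkℚ n d-1 _) 0<ε = N , λ H N≤H → let open Counting (suc d-1) H (N.≤-trans (N.m≤m⊔n 1 N0) N≤H) (N.≤-trans (N.m≤n⊔m 1 N0) N≤H) in
  s , (curves , unique-curves , ∈-curves , ≡.refl) , s≢0 , ℛ-exists , λ r card → below r s s≢0 (ratio card)
  where
  N0 N : ℕ
  N0 = Sparse.N (sparse-bad (2 N.* suc (suc d-1)))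
  -- The leading coefficient 1 of C makes the norm of C at least 1, so H ≥ 1 is required for the box
  -- to describe the family.
  N = 1 N.⊔ N0
  1≤n : ℤ.Positive n
  1≤n = ℚ.positive 0<ε
  below : ∀ r s (s≢0 : N.NonZero s) → suc d-1 N.* r N.< s → ℚ._/_ (+ r) s {{s≢0}} ℚ.< ε
  below r (suc s) _ qr<s = ℚ.toℚᵘ-cancel-< (ℚᵘ.<-respˡ-≃ (ℚᵘ.≃-sym (ℚ.toℚᵘ-fromℚᵘ (ℚᵘ.mkℚᵘ (+ r) s))) (ℚᵘ.*<* (numerators n 1≤n)))
   where
   numerators : ∀ n → ℤ.Positive n → + r ℤ.* + suc d-1 ℤ.< n ℤ.* + suc s
   numerators (+ suc n) _ = ≡.subst₂ ℤ._<_ (ℤ.pos-* r (suc d-1)) (ℤ.pos-* (suc n) (suc s)) (ℤ.+<+ (N.≤-trans (≡.subst (N._< suc s) (N.*-comm (suc d-1) r) qr<s) (N.m≤m+n (suc s) (n N.* suc s))))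

-- Parametrisations of the three families

private
 singular? : ∀ E → Dec (Curve.NonSingular E)
 singular? E = ¬? (ℤ[·].≋-dec ℤ._≟_ _ [])

 H≤2H+1 : ∀ H → H N.≤ suc (H N.+ H)
 H≤2H+1 H = N.m≤n⇒m≤1+n (N.m≤m+n H H)

 bounded3 : ∀ {H} a b c {p} → a ∈ interval (ℤ.- + H) (suc (H N.+ H)) → b ∈ interval (ℤ.- + H) (suc (H N.+ H)) → c ∈ interval (ℤ.- + H) (suc (H N.+ H)) →
       ‖ p ‖ N.≤ H → ‖ a ∷ b ∷ c ∷ p ‖ N.≤ H
 bounded3 a b c x y z n = N.⊔-lub (∈-symmetric⁻ {x = a} x) (N.⊔-lub (∈-symmetric⁻ {x = b} y) (N.⊔-lub (∈-symmetric⁻ {x = c} z) n))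

 zero-bounded : ∀ {H} → 0ℤ ∈ interval (ℤ.- + H) (suc (H N.+ H))
 zero-bounded = ∈-symmetric⁺ {x = 0ℤ} z≤n

 entries3 : ∀ {H a b c p} → ‖ a ∷ b ∷ c ∷ p ‖ N.≤ H →
       a ∈ interval (ℤ.- + H) (suc (H N.+ H)) × b ∈ interval (ℤ.- + H) (suc (H N.+ H)) × c ∈ interval (ℤ.- + H) (suc (H N.+ H))
 entries3 {H} {a} {b} {c} {p} n = ∈-symmetric⁺ (N.m⊔n≤o⇒m≤o ℤ.∣ a ∣ _ n) , ∈-symmetric⁺ (N.m⊔n≤o⇒m≤o ℤ.∣ b ∣ _ n′) ,
  ∈-symmetric⁺ (N.m⊔n≤o⇒m≤o ℤ.∣ c ∣ _ (N.m⊔n≤o⇒n≤o ℤ.∣ b ∣ _ n′))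
  where n′ = N.m⊔n≤o⇒n≤o ℤ.∣ a ∣ _ n

 square-injective : ∀ m n → + suc m ℤ.* + suc m ≡ + suc n ℤ.* + suc n → + suc m ≡ + suc n
 square-injective m n e = [ (λ d → ℤ.i-j≡0⇒i≡j (+ suc m) (+ suc n) d) , (λ ()) ]′
  (ℤ.i*j≡0⇒i≡0∨j≡0 (+ suc m ℤ.- + suc n) {+ suc m ℤ.+ + suc n} (≡.trans (solveℤ 2 (λ a b → (a :- b) :* (a :+ b) := a :* a :- b :* b) (+ suc m) (+ suc n))
   (≡.trans (≡.cong (ℤ._- + suc n ℤ.* + suc n) e) (ℤ.+-inverseʳ (+ suc n ℤ.* + suc n)))))

 ∈-positive⁻ : ∀ {H a} → a ∈ interval 1ℤ H → Σ[ j ∈ ℕ ] j N.< H × a ≡ + suc j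
 ∈-positive⁻ {H} a∈ with ∈-interval⁻ 1ℤ H a∈
 ... | j , j<H , e = j , j<H , ≡.trans e (≡.cong +_ (N.+-comm j 1))

 ∈-positive⁺ : ∀ {H j} → j N.< H → + suc j ∈ interval 1ℤ H
 ∈-positive⁺ {H} {j} j<H = ∈-interval⁺ 1ℤ H j j<H (≡.cong +_ (N.+-comm 1 j))

 symmetric6-large : ∀ H → VecAll.All (λ (_ , L) → H N.≤ L) (replicate 6 (symmetric H))
 symmetric6-large H = h ∷ h ∷ h ∷ h ∷ h ∷ h ∷ [] where h = H≤2H+1 H

parametrisation0 : Parametrisation ∗0
parametrisation0 = record
 { NonSingular = Curve.NonSingular ; nonSingular? = singular? ; curve = curve0 ; range = λ H → replicate 6 (symmetric H) ; large = symmetric6-large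
 ; curve-injective = λ {H} {u} {v} _ _ → injective u v
 ; to = λ {H} {v} 1≤H v∈ → to v 1≤H (∈-vectors⁻ (sides (replicate 6 (symmetric H))) v∈)
 ; from = λ {H} {E} → from {H} E
 ; Good = λ v → NoRoot-B v × NonSquareResultant v
 ; sparse-bad = λ q → Sparse-× (sparse criterion-B (2 N.* q)) (sparse criterion-resultant (2 N.* q))
 ; good-curve = λ {H} {v} _ (noRoot , nonSquare) → nonSingular0 v noRoot , no-affine0 v noRoot nonSquare }
 where
 injective : ∀ u v → curve0 u ≡ curve0 v → u ≡ v
 injective (_ ∷ _ ∷ _ ∷ _ ∷ _ ∷ _ ∷ []) (_ ∷ _ ∷ _ ∷ _ ∷ _ ∷ _ ∷ []) ≡.refl = ≡.refl
 to : ∀ {H} v → 1 N.≤ H → Pointwise _∈_ v (sides (replicate 6 (symmetric H))) → Curve.NonSingular (curve0 v) → 𝒮 ∗0 H (curve0 v)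
 to (b2 ∷ c2 ∷ b1 ∷ b0 ∷ c1 ∷ c0 ∷ []) 1≤H (B2 ∷ C2 ∷ B1 ∷ B0 ∷ C1 ∷ C0 ∷ []) ns =
  ns , ≡.refl , N.⊔-lub (bounded3 b0 b1 b2 {[]} B0 B1 B2 z≤n) (bounded3 c0 c1 c2 {1ℤ ∷ []} C0 C1 C2 1≤H)
 from : ∀ {H} E → 𝒮 ∗0 H E → Curve.NonSingular E × Σ[ v ∈ Vec ℤ 6 ] v ∈ vectors (sides (replicate 6 (symmetric H))) × curve0 v ≡ E
 from {H} record { A-coeffs = _ ; B-coeffs = b0 ∷ b1 ∷ b2 ∷ [] ; C-X³-coeffs = c0 ∷ c1 ∷ c2 ∷ [] } (ns , ≡.refl , n) =
  ns , b2 ∷ c2 ∷ b1 ∷ b0 ∷ c1 ∷ c0 ∷ [] , ∈-vectors⁺ (proj₂ (proj₂ B) ∷ proj₂ (proj₂ C) ∷ proj₁ (proj₂ B) ∷ proj₁ B ∷ proj₁ (proj₂ C) ∷ proj₁ C ∷ []) , ≡.refl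
  where
  B = entries3 {p = []} (N.m⊔n≤o⇒m≤o ‖ b0 ∷ b1 ∷ b2 ∷ [] ‖ _ n)
  C = entries3 {p = 1ℤ ∷ []} (N.m⊔n≤o⇒n≤o ‖ b0 ∷ b1 ∷ b2 ∷ [] ‖ _ n)

-- Since a and - a give the same curve, a runs over 1, ..., H only; this makes the parametrisation
-- injective.
parametrisation□ : Parametrisation ∗□
parametrisation□ = record
 { NonSingular = Curve.NonSingular ; nonSingular? = singular? ; curve = curve□ ; range = λ H → (1ℤ , H) ∷ replicate 6 (symmetric H) ; large = λ H → N.≤-refl ∷ symmetric6-large H
 ; curve-injective = λ {H} {u} {v} u∈ v∈ → injective u v (∈-vectors⁻ (sides ((1ℤ , H) ∷ replicate 6 (symmetric H))) u∈) (∈-vectors⁻ (sides ((1ℤ , H) ∷ replicate 6 (symmetric H))) v∈)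
 ; to = λ {H} {v} 1≤H v∈ → to v 1≤H (∈-vectors⁻ (sides ((1ℤ , H) ∷ replicate 6 (symmetric H))) v∈)
 ; from = λ {H} {E} → from {H} E
 ; Good = λ v → NoRoot-□ v × NoQuadraticFactors-□ v
 ; sparse-bad = λ q → Sparse-× (sparse criterion□-rootless (2 N.* q)) (sparse criterion□-simple (2 N.* q))
 ; good-curve = λ {H} {v} v∈ good → good-curve {H} v (∈-vectors⁻ (sides ((1ℤ , H) ∷ replicate 6 (symmetric H))) v∈) good }
 where
 Range : ∀ {H} → Vec ℤ 7 → Set
 Range {H} v = Pointwise _∈_ v (sides ((1ℤ , H) ∷ replicate 6 (symmetric H)))
 nonzero : ∀ {H a} → a ∈ interval 1ℤ H → a ≢ 0ℤ
 nonzero {H} a∈ e with ∈-positive⁻ {H} a∈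
 nonzero a∈ () | j , j<H , ≡.refl
 leading-injective : ∀ {H a b} → a ∈ interval 1ℤ H → b ∈ interval 1ℤ H → a ℤ.* a ≡ b ℤ.* b → a ≡ b
 leading-injective {H} a∈ b∈ with ∈-positive⁻ {H} a∈ | ∈-positive⁻ {H} b∈
 ... | j , _ , ≡.refl | k , _ , ≡.refl = square-injective j k
 injective : ∀ {H} u v → Range {H} u → Range {H} v → curve□ u ≡ curve□ v → u ≡ v
 injective (a ∷ _ ∷ _ ∷ _ ∷ _ ∷ _ ∷ _ ∷ []) (b ∷ _ ∷ _ ∷ _ ∷ _ ∷ _ ∷ _ ∷ []) (a∈ ∷ _) (b∈ ∷ _) e
  with ≡.cong Curve.B-coeffs e | ≡.cong Curve.C-X³-coeffs e | leading-injective a∈ b∈ (≡.cong Vec.head (≡.cong Curve.A-coeffs e))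
 ... | ≡.refl | ≡.refl | ≡.refl = ≡.refl
 to : ∀ {H} v → 1 N.≤ H → Range {H} v → Curve.NonSingular (curve□ v) → 𝒮 ∗□ H (curve□ v)
 to {H} (a ∷ b2 ∷ b1 ∷ b0 ∷ c2 ∷ c1 ∷ c0 ∷ []) 1≤H (a∈ ∷ B2 ∷ B1 ∷ B0 ∷ C2 ∷ C1 ∷ C0 ∷ []) ns =
  ns , a , nonzero {H} a∈ , ≡.refl , N.⊔-lub (N.⊔-lub (N.⊔-lub (∣a∣≤H a∈) z≤n) (bounded3 b0 b1 b2 {[]} B0 B1 B2 z≤n)) (bounded3 c0 c1 c2 {1ℤ ∷ []} C0 C1 C2 1≤H)
  where
  ∣a∣≤H : ∀ {a} → a ∈ interval 1ℤ H → ℤ.∣ a ∣ N.≤ H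
  ∣a∣≤H a∈ with ∈-positive⁻ {H} a∈
  ... | j , j<H , ≡.refl = j<H
 from : ∀ {H} E → 𝒮 ∗□ H E → Curve.NonSingular E × Σ[ v ∈ Vec ℤ 7 ] v ∈ vectors (sides ((1ℤ , H) ∷ replicate 6 (symmetric H))) × curve□ v ≡ E
 from {H} record { A-coeffs = _ ; B-coeffs = b0 ∷ b1 ∷ b2 ∷ [] ; C-X³-coeffs = c0 ∷ c1 ∷ c2 ∷ [] } (ns , a , a≢0 , ≡.refl , n) =
  ns , proj₁ ∣a∣ ∷ b2 ∷ b1 ∷ b0 ∷ c2 ∷ c1 ∷ c0 ∷ [] ,
  ∈-vectors⁺ (proj₁ (proj₂ ∣a∣) ∷ proj₂ (proj₂ B) ∷ proj₁ (proj₂ B) ∷ proj₁ B ∷ proj₂ (proj₂ C) ∷ proj₁ (proj₂ C) ∷ proj₁ C ∷ []) ,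
  ≡.cong (λ s → mkCurve s 0ℤ b0 b1 b2 c0 c1 c2) (proj₂ (proj₂ ∣a∣))
  where
  n′ = N.m⊔n≤o⇒m≤o (‖ a ∷ [] ‖ N.⊔ ‖ b0 ∷ b1 ∷ b2 ∷ [] ‖) _ n
  B = entries3 {p = []} (N.m⊔n≤o⇒n≤o ‖ a ∷ [] ‖ _ n′)
  C = entries3 {p = 1ℤ ∷ []} (N.m⊔n≤o⇒n≤o (‖ a ∷ [] ‖ N.⊔ ‖ b0 ∷ b1 ∷ b2 ∷ [] ‖) _ n)
  absolute : ∀ a → a ≢ 0ℤ → ℤ.∣ a ∣ N.≤ H → Σ[ b ∈ ℤ ] b ∈ interval 1ℤ H × b ℤ.* b ≡ a ℤ.* a
  absolute (+ zero) a≢0 _ = ⊥-elim (a≢0 ≡.refl)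
  absolute (+ suc j) _ j<H = + suc j , ∈-positive⁺ j<H , ≡.refl
  absolute -[1+ j ] _ j<H = + suc j , ∈-positive⁺ j<H , ≡.refl
  ∣a∣ = absolute a a≢0 (N.m⊔n≤o⇒m≤o ℤ.∣ a ∣ 0 (N.m⊔n≤o⇒m≤o ‖ a ∷ [] ‖ _ n′))
 good-curve : ∀ {H} v → Range {H} v → NoRoot-□ v × NoQuadraticFactors-□ v → Curve.NonSingular (curve□ v) × NoAffinePoint (curve□ v)
 good-curve {H} (a ∷ b2 ∷ b1 ∷ b0 ∷ c2 ∷ c1 ∷ c0 ∷ []) (a∈ ∷ _) (noRoot , noQuadratic) =
  nonSingular□ {a} {b2} {b1} {b0} {c2} {c1} {c0} (nonzero {H} a∈) (proj₁ noRoot) ,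
  no-affine□ {a} {b2} {b1} {b0} {c2} {c1} {c0} (nonzero {H} a∈) noRoot (λ {g} {h} → noQuadratic {g} {h})

parametrisationℓ : Parametrisation ∗ℓ
parametrisationℓ = record
 { NonSingular = Curve.NonSingular ; nonSingular? = singular? ; curve = curveℓ ; range = λ H → replicate 6 (symmetric H) ; large = symmetric6-large
 ; curve-injective = λ {H} {u} {v} _ _ → injective u v
 ; to = λ {H} {v} 1≤H v∈ → to v 1≤H (∈-vectors⁻ (sides (replicate 6 (symmetric H))) v∈)
 ; from = λ {H} {E} → from {H} E
 ; Good = λ v → NonSquare-ℓ v × NoRoot-ℓ v × NoQuadraticFactors-ℓ v
 -- Three conditions share the allowed density in the parts 1/2, 1/4 and 1/4.
 ; sparse-bad = λ q → Sparse-× (sparse criterionℓ-square (2 N.* q))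
   (Sparse-× (sparse criterionℓ-rootless (2 N.* (2 N.* q))) (sparse criterionℓ-simple (2 N.* (2 N.* q))))
 ; good-curve = λ {H} {v} _ good → good-curve v good }
 where
 injective : ∀ u v → curveℓ u ≡ curveℓ v → u ≡ v
 injective (_ ∷ _ ∷ _ ∷ _ ∷ _ ∷ _ ∷ []) (_ ∷ _ ∷ _ ∷ _ ∷ _ ∷ _ ∷ []) ≡.refl = ≡.refl
 linear : ∀ a b → Deg≤ 1 (a ∷ b ∷ 0ℤ ∷ [])
 linear a b (suc zero) (s≤s ())
 linear a b (suc (suc zero)) _ = ≡.refl
 linear a b (suc (suc (suc n))) _ = ≡.refl
 to : ∀ {H} v → 1 N.≤ H → Pointwise _∈_ v (sides (replicate 6 (symmetric H))) → Curve.NonSingular (curveℓ v) → 𝒮 ∗ℓ H (curveℓ v)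
 to {H} (a1 ∷ a0 ∷ b1 ∷ b0 ∷ c1 ∷ c0 ∷ []) 1≤H (A1 ∷ A0 ∷ B1 ∷ B0 ∷ C1 ∷ C0 ∷ []) ns =
  ns , linear a0 a1 , linear b0 b1 , linear c0 c1 , N.⊔-lub (N.⊔-lub (bounded3 a0 a1 0ℤ {[]} A0 A1 (zero-bounded {H}) z≤n) (bounded3 b0 b1 0ℤ {[]} B0 B1 (zero-bounded {H}) z≤n))
   (bounded3 c0 c1 0ℤ {1ℤ ∷ []} C0 C1 (zero-bounded {H}) 1≤H)
 from : ∀ {H} E → 𝒮 ∗ℓ H E → Curve.NonSingular E × Σ[ v ∈ Vec ℤ 6 ] v ∈ vectors (sides (replicate 6 (symmetric H))) × curveℓ v ≡ E
 from {H} record { A-coeffs = a0 ∷ a1 ∷ a2 ∷ [] ; B-coeffs = b0 ∷ b1 ∷ b2 ∷ [] ; C-X³-coeffs = c0 ∷ c1 ∷ c2 ∷ [] } (ns , dA , dB , dC , n) =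
  ns , a1 ∷ a0 ∷ b1 ∷ b0 ∷ c1 ∷ c0 ∷ [] , ∈-vectors⁺ (proj₁ (proj₂ A) ∷ proj₁ A ∷ proj₁ (proj₂ B) ∷ proj₁ B ∷ proj₁ (proj₂ C) ∷ proj₁ C ∷ []) ,
  same (≡.sym (dA 2 (s≤s (s≤s z≤n)))) (≡.sym (dB 2 (s≤s (s≤s z≤n)))) (≡.sym (dC 2 (s≤s (s≤s z≤n))))
  where
  n′ = N.m⊔n≤o⇒m≤o (‖ a0 ∷ a1 ∷ a2 ∷ [] ‖ N.⊔ ‖ b0 ∷ b1 ∷ b2 ∷ [] ‖) _ n
  A = entries3 {a = a0} {a1} {a2} {p = []} (N.m⊔n≤o⇒m≤o ‖ a0 ∷ a1 ∷ a2 ∷ [] ‖ _ n′)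
  B = entries3 {a = b0} {b1} {b2} {p = []} (N.m⊔n≤o⇒n≤o ‖ a0 ∷ a1 ∷ a2 ∷ [] ‖ _ n′)
  C = entries3 {a = c0} {c1} {c2} {p = 1ℤ ∷ []} (N.m⊔n≤o⇒n≤o (‖ a0 ∷ a1 ∷ a2 ∷ [] ‖ N.⊔ ‖ b0 ∷ b1 ∷ b2 ∷ [] ‖) _ n)
  same : ∀ {x y z} → 0ℤ ≡ x → 0ℤ ≡ y → 0ℤ ≡ z → mkCurve a0 a1 b0 b1 0ℤ c0 c1 0ℤ ≡
   record { A-coeffs = a0 ∷ a1 ∷ x ∷ [] ; B-coeffs = b0 ∷ b1 ∷ y ∷ [] ; C-X³-coeffs = c0 ∷ c1 ∷ z ∷ [] }
  same ≡.refl ≡.refl ≡.refl = ≡.refl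
 good-curve : ∀ v → NonSquare-ℓ v × NoRoot-ℓ v × NoQuadraticFactors-ℓ v → Curve.NonSingular (curveℓ v) × NoAffinePoint (curveℓ v)
 good-curve (a1 ∷ a0 ∷ b1 ∷ b0 ∷ c1 ∷ c0 ∷ []) (nonSquare , noRoot , noQuadratic) =
  nonSingularℓ {a1} {a0} {b1} {b0} {c1} {c0} (proj₁ noRoot) , no-affineℓ {a1} {a0} {b1} {b0} {c1} {c0} nonSquare noRoot (λ {g} {h} → noQuadratic {g} {h})

theorem2 : (∗ : Family) → RatioTendsToZero (ℛ ∗) (𝒮 ∗)
theorem2 ∗0 = tendsToZero parametrisation0
theorem2 ∗□ = tendsToZero parametrisation□
theorem2 ∗ℓ = tendsToZero parametrisationℓ
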